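{- Let $n>1$ be a positive odd integer and let $m$ be either $n-1$ or $(n+1)/2$. Then \[ \sum_{k=0}^{m}(-1)^k [4k-1]\frac{(q^{ -1};q^2)_k^5}{(q^2;q^2)_k^5}\, q^{k^2+5k} \equiv [n](-q)^{(n+1)(n-3)/4}\sum_{k=0}^{(n+1)/2} \frac{(q^{ -1};q^2)_k^2\, (q^3;q^2)_k}{(q^2;q^2)_k^3 }\, q^{3k} \pmod{[n]\Phi_n(q)^2}. \]
   Context: Here $q$ is an indeterminate. For $x$ and a base $p$ (a power of $q$), $(x;p)_k=\prod_{j=0}^{k-1}(1-xp^j)$ for integers $k\ge0$. The $q$-integer is $[j]=1+q+\cdots+q^{j-1}$ for $j\ge1$, with $[j]=(1-q^j)/(1-q)$ in general (so $[-1]=-q^{ -1}$), and $\Phi_n(q)$ is the $n$-th cyclotomic polynomial. For rational functions $A(q),B(q)$ and a polynomial $P(q)$, $A\equiv B\pmod{P}$ means that the numerator of the reduced form of $A-B$ is divisible by $P$ in $\mathbb{Z}[q]$. -}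

module Defs where

open import Data.Nat as ℕ using (ℕ; zero; suc; _<?_)
open import Data.Nat.Divisibility using (_∣?_)
open import Data.Integer as ℤ using (ℤ; +_; -[1+_])
import Data.Integer.Properties as ℤP
open import Data.List using (List; []; _∷_; map; replicate; _++_; reverse; length; filter; upTo; dropWhile; foldr)
open import Data.Product using (Σ; _×_)
open import Relation.Nullary using (¬_; yes; no)
open import Relation.Binary.PropositionalEquality using (_≡_)

-- Polynomials in ℤ[q], as coefficient lists (lowest degree first).

Poly : Set
Poly = List ℤ

infixl 6 _⊕_ _⊖_
infixl 7 _⊗_

_⊕_ : Poly → Poly → Poly
[] ⊕ g = g
(a ∷ f) ⊕ [] = a ∷ f
(a ∷ f) ⊕ (b ∷ g) = (a ℤ.+ b) ∷ (f ⊕ g)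

scale : ℤ → Poly → Poly
scale c = map (c ℤ.*_)

_⊗_ : Poly → Poly → Poly
[] ⊗ g = []
(a ∷ f) ⊗ g = scale a g ⊕ (+ 0 ∷ (f ⊗ g))

pneg : Poly → Poly
pneg = map (λ x → ℤ.- x)

_⊖_ : Poly → Poly → Poly
f ⊖ g = f ⊕ pneg g

pconst : ℤ → Poly
pconst c = c ∷ []

pone : Poly
pone = pconst (+ 1)

pmon : ℕ → Poly
pmon k = replicate k (+ 0) ++ (+ 1 ∷ [])

ppow : Poly → ℕ → Poly
ppow f zero = pone
ppow f (suc k) = f ⊗ ppow f k

coeff : Poly → ℕ → ℤ
coeff [] _ = + 0
coeff (a ∷ f) zero = a
coeff (a ∷ f) (suc i) = coeff f i

infix 4 _≈P_ _∣P_
_≈P_ : Poly → Poly → Set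
f ≈P g = ∀ i → coeff f i ≡ coeff g i

_∣P_ : Poly → Poly → Set
f ∣P g = Σ Poly λ c → f ⊗ c ≈P g

CoprimeP : Poly → Poly → Set
CoprimeP f g = ∀ h → h ∣P f → h ∣P g → h ∣P pone

qnat : ℕ → Poly
qnat n = replicate n (+ 1)

-- Cyclotomic polynomials: Φ_n = (q^n - 1) / ∏_{d ∣ n, d < n} Φ_d
-- (exact division by a monic polynomial via long division).

private
  subPrefix : List ℤ → List ℤ → List ℤ
  subPrefix xs [] = xs
  subPrefix [] (y ∷ ys) = []
  subPrefix (x ∷ xs) (y ∷ ys) = (x ℤ.- y) ∷ subPrefix xs ys

  -- dividend and divisor given highest coefficient first; the divisor is
  -- monic and given by its coefficients after the leading 1.
  longDiv : ℕ → List ℤ → List ℤ → List ℤ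
  longDiv zero _ _ = []
  longDiv (suc f) [] bs = []
  longDiv (suc f) (a ∷ as) bs with length as <? length bs
  ... | yes _ = []
  ... | no _ = a ∷ longDiv f (subPrefix as (scale a bs)) bs

  highFirst : Poly → List ℤ
  highFirst f = dropWhile (λ x → x ℤP.≟ + 0) (reverse f)

monicQuot : Poly → Poly → Poly
monicQuot f g with highFirst g
... | [] = []
... | (_ ∷ bs) = reverse (longDiv (length (highFirst f)) (highFirst f) bs)

pprod : List Poly → Poly
pprod = foldr _⊗_ pone

properDivisors : ℕ → List ℕ
properDivisors n = filter (_∣? n) (map suc (upTo (n ℕ.∸ 1)))

private
  cycF : ℕ → ℕ → Poly
  cycF zero n = pone
  cycF (suc f) n = monicQuot (pmon n ⊖ pone) (pprod (map (cycF f) (properDivisors n)))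

Φ : ℕ → Poly
Φ n = cycF n n

record Frac : Set where
  constructor frac
  field
    num : Poly
    den : Poly
open Frac public

fromPoly : Poly → Frac
fromPoly f = frac f pone

fone : Frac
fone = fromPoly pone

fadd : Frac → Frac → Frac
fadd (frac a b) (frac c d) = frac (a ⊗ d ⊕ c ⊗ b) (b ⊗ d)

fneg : Frac → Frac
fneg (frac a b) = frac (pneg a) b

fsub : Frac → Frac → Frac
fsub x y = fadd x (fneg y)

fmul : Frac → Frac → Frac
fmul (frac a b) (frac c d) = frac (a ⊗ c) (b ⊗ d)

finv : Frac → Frac
finv (frac a b) = frac b a

fdiv : Frac → Frac → Frac
fdiv x y = fmul x (finv y)

fpow : Frac → ℕ → Frac
fpow x zero = fone
fpow x (suc k) = fmul x (fpow x k)

fsum : ℕ → (ℕ → Frac) → Frac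
fsum zero f = f 0
fsum (suc m) f = fadd (fsum m f) (f (suc m))

fprod : ℕ → (ℕ → Frac) → Frac
fprod zero f = fone
fprod (suc k) f = fmul (fprod k f) (f k)

pq : Poly
pq = pmon 1

qinv : Frac
qinv = frac pone pq

poch : Frac → Poly → ℕ → Frac
poch x p k = fprod k (λ j → fsub fone (fmul x (fromPoly (ppow p j))))

-- q-integer [j] = (1 - q^j)/(1 - q) for j ∈ ℤ:
-- [m] = 1 + ... + q^(m-1) for m ≥ 0, and [-m] = -[m]/q^m.
qint : ℤ → Frac
qint (+ m) = fromPoly (qnat m)
qint -[1+ m ] = fneg (frac (qnat (suc m)) (pmon (suc m)))

-- A ≡ B (mod P): the numerator of the reduced form of A - B is divisible
-- by P. A reduced form of A - B is N/D with D ≠ 0 and N, D coprime in ℤ[q]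
-- (unique up to a sign).

Cong : Frac → Frac → Poly → Set
Cong A B P =
  Σ Poly λ N → Σ Poly λ D →
    ¬ (D ≈P []) ×
    CoprimeP N D ×
    (N ⊗ (den A ⊗ den B) ≈P (num A ⊗ den B ⊖ num B ⊗ den A) ⊗ D) ×
    (P ∣P N)

q² : Poly
q² = pmon 2

lhsTerm : ℕ → Frac
lhsTerm k =
  fmul (fromPoly (ppow (pconst (ℤ.- (+ 1))) k))
  (fmul (qint (+ (4 ℕ.* k) ℤ.- + 1))
  (fmul (fdiv (fpow (poch qinv q² k) 5) (fpow (poch (fromPoly q²) q² k) 5))
        (fromPoly (pmon (k ℕ.* k ℕ.+ 5 ℕ.* k)))))

LHS : ℕ → Frac
LHS m = fsum m lhsTerm

rhsTerm : ℕ → Frac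
rhsTerm k =
  fmul (fdiv (fmul (fpow (poch qinv q² k) 2) (poch (fromPoly (pmon 3)) q² k))
             (fpow (poch (fromPoly q²) q² k) 3))
       (fromPoly (pmon (3 ℕ.* k)))

RHS : ℕ → Frac
RHS n =
  fmul (fromPoly (qnat n ⊗ ppow (pneg pq) (((n ℕ.+ 1) ℕ.* (n ℕ.∸ 3)) ℕ./ 4)))
       (fsum ((n ℕ.+ 1) ℕ./ 2) rhsTerm)

modulus : ℕ → Poly
modulus n = qnat n ⊗ Φ n ⊗ Φ n

-- In both sums replace (q⁻¹;q²)ₖ²/(q²;q²)ₖ² by (aq⁻¹,q⁻¹/a;q²)ₖ/(q²/a,aq²;q²)ₖ.  The sums
-- then depend on a only through x = a + 1/a - 2, and at a = qⁿ the two sides agree exactly, by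
-- a limiting case of Watson's ₈φ₇ transformation (the terminating ₆φ₅ sum inserted into
-- q-Chu–Vandermonde).  There x = q⁻ⁿ(1-qⁿ)² is divisible by Φₙ².  Modulo Φₙ the left side
-- vanishes to first order in x, because the terms k and (n+1)/2-k cancel, and the right side
-- carries the factor [n]; hence the two sides at x = 0 differ by a multiple of Φₙ³.
--
-- For a divisor d > 1 of n the same cancellation, in blocks of d terms, makes the left side
-- divisible by Φ_d, while [n] does so on the right.  No term has a pole at a root of Φ_d, since
-- (q⁻¹;q²)ₖ/(q²;q²)ₖ is a q-Catalan number up to units modulo Φ_d.
module Submission where

open import Defs
open import Algebra using (CommutativeRing)
import Data.Bool as Bool
open import Data.Empty using (⊥-elim)
open import Data.Integer as ℤ using (ℤ; +_; -[1+_])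
import Data.Integer.Properties as ℤP
import Data.Integer.Tactic.RingSolver as ℤS
open import Data.List using (List; []; _∷_; _++_; length; map; reverse; filter; applyUpTo; dropWhile)
import Data.List.Properties as ListP
open import Data.List.Relation.Unary.All as All using (All; []; _∷_)
import Data.List.Relation.Unary.All.Properties as AllP
open import Data.Maybe using (nothing)
open import Data.Nat as ℕ using (ℕ; zero; suc; _<?_)
import Data.Nat.DivMod as DivMod
import Data.Nat.Divisibility as ℕD
open import Data.Nat.Divisibility using (_∣?_)
import Data.Nat.GCD as GCD
open import Data.Nat.ListAction using (product)
open import Data.Nat.Primality using (Prime; euclidsLemma; prime⇒nonZero)
open import Data.Nat.Primality.Factorisation using (factorise; PrimeFactorisation)
import Data.Nat.Properties as ℕP
open import Data.Nat.Tactic.RingSolver using (solve-∀)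
open import Data.Product using (_,_; _×_; Σ; proj₁; proj₂)
open import Data.Sum using (_⊎_; inj₁; inj₂; [_,_]′; map₁; map₂)
open import Level using (0ℓ)
open import Relation.Binary using (Setoid)
open import Relation.Binary.Definitions using (tri<; tri≈; tri>)
import Relation.Binary.PropositionalEquality as ≡
open ≡ using (_≡_; _≢_)
import Relation.Binary.Reasoning.Setoid
open import Relation.Nullary using (¬_; yes; no; Dec; contradiction)
open import Relation.Nullary.Decidable using (⌊_⌋)
import Tactic.RingSolver.Core.AlmostCommutativeRing as ACR
open import Tactic.RingSolver.Core.Expression as E using (Expr; Κ; Ι; _⊛_; ⊝_)
open import Tactic.RingSolver.Core.Polynomial.Parameters using (Homomorphism)

-- The obstacle is division. The argument runs in ℤ[q]/Φ_d and in dual numbers over such a quotient,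
-- where (q²;q²)ₖ may be a zero divisor. A sum is therefore handled through a recurrence f(k+1)γ(k)
-- = f(k)α(k), with the denominators multiplied out. The result is polynomial in q, l and x, so one
-- definition can be read at x = 0, at a = qⁿ, and at x = ε with ε² = 0.
--
-- For Φₙ all indices stay below n, and the γ(k) are coprime to Φₙ. For a proper divisor d the range
-- passes zeros of γ modulo Φ_d, so the terms are first rewritten as polynomials; this is where the
-- q-Catalan numbers enter.
--
-- Coprimality in ℤ[q] yields Bézout relations only up to a non-zero integer c. The divisors in
-- question have constant term ±1, and such a polynomial divides g as soon as it divides cg, which
-- removes the integer. The congruence also asks for a reduced form over ℤ[q]; its existence rests
-- on Gauss's lemma.
--
-- The power of -q has exponent M² - 1 for n = 2M + 1. It arises from turning factors 1 -
-- q^(-(2i+1)) into 1 - q^(2i+1).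

infixl 6 _:+_ _:-_
infixl 7 _:*_
infix 4 _:=_
infix 8 :-_

_:+_ _:*_ _:-_ : ∀ {n} → Expr ℤ n → Expr ℤ n → Expr ℤ n
_:+_ = E._⊕_
_:*_ = E._⊗_
x :- y = x E.⊕ (⊝ y)
:-_ : ∀ {n} → Expr ℤ n → Expr ℤ n
:-_ = ⊝_
one : ∀ {n} → Expr ℤ n
one = Κ (+ 1)
zeroᵉ : ∀ {n} → Expr ℤ n
zeroᵉ = Κ (+ 0)
infixr 9 _:^_
_:^_ : ∀ {n} → Expr ℤ n → ℕ → Expr ℤ n
x :^ zero = one
x :^ suc n = x :* x :^ n
_:=_ : ∀ {n} → Expr ℤ n → Expr ℤ n → Expr ℤ n × Expr ℤ n
_:=_ = _,_

-- The library's ring solver takes its coefficients in the ring itself and so cannot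
-- cancel x - x over an abstract ring; here they are taken in ℤ.
module IntegerCoefficients {c ℓ} (R : CommutativeRing c ℓ) where
  open CommutativeRing R
  open import Algebra.Properties.Ring ring
  open import Algebra.Properties.Semiring.Mult.TCOptimised semiring renaming (_×_ to _·_)
  open import Relation.Binary.Reasoning.Setoid setoid

  fromℤ : ℤ → Carrier
  fromℤ (+ n) = n · 1#
  fromℤ -[1+ n ] = - (suc n · 1#)

  fromℤ-neg : ∀ i → fromℤ (ℤ.- i) ≈ - fromℤ i
  fromℤ-neg (+ zero) = sym -0#≈0#
  fromℤ-neg (+ suc n) = refl
  fromℤ-neg -[1+ n ] = sym (-‿involutive _)

  fromℤ-⊖ : ∀ m n → fromℤ (m ℤ.⊖ n) ≈ m · 1# + - (n · 1#)
  fromℤ-⊖ m zero = sym (trans (+-congˡ -0#≈0#) (+-identityʳ _))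
  fromℤ-⊖ zero (suc n) = sym (+-identityˡ _)
  fromℤ-⊖ (suc m) (suc n) = begin
    fromℤ (suc m ℤ.⊖ suc n) ≡⟨ ≡.cong fromℤ (ℤP.[1+m]⊖[1+n]≡m⊖n m n) ⟩
    fromℤ (m ℤ.⊖ n) ≈⟨ fromℤ-⊖ m n ⟩
    m · 1# + - (n · 1#) ≈⟨ +-congʳ (sym (+-identityˡ _)) ⟩
    (0# + m · 1#) + - (n · 1#) ≈⟨ +-congʳ (+-congʳ (sym (-‿inverseʳ 1#))) ⟩
    ((1# + - 1#) + m · 1#) + - (n · 1#) ≈⟨ +-congʳ (trans (+-assoc _ _ _) (trans (+-congˡ (+-comm _ _)) (sym (+-assoc _ _ _)))) ⟩
    ((1# + m · 1#) + - 1#) + - (n · 1#) ≈⟨ +-assoc _ _ _ ⟩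
    (1# + m · 1#) + (- 1# + - (n · 1#)) ≈⟨ +-cong (sym (1+× m 1#)) (-‿+-comm 1# (n · 1#)) ⟩
    suc m · 1# + - (1# + n · 1#) ≈⟨ +-congˡ (-‿cong (sym (1+× n 1#))) ⟩
    suc m · 1# + - (suc n · 1#) ∎

  fromℤ-+ : ∀ i j → fromℤ (i ℤ.+ j) ≈ fromℤ i + fromℤ j
  fromℤ-+ (+ m) (+ n) = ×-homo-+ 1# m n
  fromℤ-+ (+ m) -[1+ n ] = fromℤ-⊖ m (suc n)
  fromℤ-+ -[1+ m ] (+ n) = trans (fromℤ-⊖ n (suc m)) (+-comm _ _)
  fromℤ-+ -[1+ m ] -[1+ n ] = begin
    - (suc (suc (m ℕ.+ n)) · 1#) ≡⟨ ≡.cong (λ k → - (suc k · 1#)) (≡.sym (ℕP.+-suc m n)) ⟩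
    - ((suc m ℕ.+ suc n) · 1#) ≈⟨ -‿cong (×-homo-+ 1# (suc m) (suc n)) ⟩
    - (suc m · 1# + suc n · 1#) ≈⟨ sym (-‿+-comm _ _) ⟩
    - (suc m · 1#) + - (suc n · 1#) ∎

  fromℤ-pos-* : ∀ m n → fromℤ ((+ m) ℤ.* (+ n)) ≈ m · 1# * n · 1#
  fromℤ-pos-* m n = trans (reflexive (≡.cong fromℤ (≡.sym (ℤP.pos-* m n)))) (×1-homo-* m n)

  fromℤ-+* : ∀ m j → fromℤ ((+ m) ℤ.* j) ≈ m · 1# * fromℤ j
  fromℤ-+* m (+ n) = fromℤ-pos-* m n
  fromℤ-+* m -[1+ n ] = begin
    fromℤ ((+ m) ℤ.* (ℤ.- (+ suc n))) ≡⟨ ≡.cong fromℤ (≡.sym (ℤP.neg-distribʳ-* (+ m) (+ suc n))) ⟩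
    fromℤ (ℤ.- ((+ m) ℤ.* (+ suc n))) ≈⟨ fromℤ-neg ((+ m) ℤ.* (+ suc n)) ⟩
    - fromℤ ((+ m) ℤ.* (+ suc n)) ≈⟨ -‿cong (fromℤ-pos-* m (suc n)) ⟩
    - (m · 1# * suc n · 1#) ≈⟨ -‿distribʳ-* _ _ ⟩
    m · 1# * - (suc n · 1#) ∎

  fromℤ-* : ∀ i j → fromℤ (i ℤ.* j) ≈ fromℤ i * fromℤ j
  fromℤ-* (+ m) j = fromℤ-+* m j
  fromℤ-* -[1+ m ] j = begin
    fromℤ ((ℤ.- (+ suc m)) ℤ.* j) ≡⟨ ≡.cong fromℤ (≡.sym (ℤP.neg-distribˡ-* (+ suc m) j)) ⟩
    fromℤ (ℤ.- ((+ suc m) ℤ.* j)) ≈⟨ fromℤ-neg ((+ suc m) ℤ.* j) ⟩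
    - fromℤ ((+ suc m) ℤ.* j) ≈⟨ -‿cong (fromℤ-+* (suc m) j) ⟩
    - (suc m · 1# * fromℤ j) ≈⟨ -‿distribˡ-* _ _ ⟩
    - (suc m · 1#) * fromℤ j ∎

  homo : Homomorphism 0ℓ 0ℓ c ℓ
  homo = record
    { from = record { rawRing = ℤ.+-*-rawRing ; isZero = λ i → ⌊ i ℤP.≟ + 0 ⌋ }
    ; to = ACR.fromCommutativeRing R (λ _ → nothing)
    ; morphism = record
        { ⟦_⟧ = fromℤ
        ; +-homo = fromℤ-+
        ; *-homo = fromℤ-*
        ; -‿homo = fromℤ-neg
        ; 0-homo = refl
        ; 1-homo = refl }
    ; Zero-C⟶Zero-R = isZero⇒≈0
    }
    where
    isZero⇒≈0 : ∀ i → Bool.T ⌊ i ℤP.≟ + 0 ⌋ → 0# ≈ fromℤ i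
    isZero⇒≈0 i t with i ℤP.≟ + 0
    ... | yes ≡.refl = refl

  open import Tactic.RingSolver.Core.Polynomial.Base (Homomorphism.from homo) renaming (Poly to NormalForm)
  open import Tactic.RingSolver.Core.Polynomial.Semantics homo renaming (⟦_⟧ to ⟦_⟧ₚ)
  open import Tactic.RingSolver.Core.Polynomial.Homomorphism homo
  open import Algebra.Properties.Semiring.Exp.TCOptimised semiring using (^-congˡ)
  open E.Eval rawRing fromℤ

  normal : ∀ {n} → Expr ℤ n → NormalForm n
  normal (Κ x) = κ x
  normal (Ι x) = ι x
  normal (x E.⊕ y) = normal x ⊞ normal y
  normal (x E.⊗ y) = normal x ⊠ normal y
  normal (⊝ x) = ⊟ normal x
  normal (x ⊛ i) = normal x ⊡ i

  normal-correct : ∀ {n} (e : Expr ℤ n) ρ → ⟦ normal e ⟧ₚ ρ ≈ ⟦ e ⟧ ρ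
  normal-correct (Κ x) ρ = κ-hom x ρ
  normal-correct (Ι x) ρ = ι-hom x ρ
  normal-correct (x E.⊕ y) ρ = trans (⊞-hom (normal x) (normal y) ρ) (+-cong (normal-correct x ρ) (normal-correct y ρ))
  normal-correct (x E.⊗ y) ρ = trans (⊠-hom (normal x) (normal y) ρ) (*-cong (normal-correct x ρ) (normal-correct y ρ))
  normal-correct (⊝ x) ρ = trans (⊟-hom (normal x) ρ) (-‿cong (normal-correct x ρ))
  normal-correct (x ⊛ i) ρ = trans (⊡-hom (normal x) i ρ) (^-congˡ i (normal-correct x ρ))

  open import Relation.Binary.Reflection setoid Ι ⟦_⟧ (λ e → ⟦ normal e ⟧ₚ) normal-correct public
    using (solve)

  -- Rearranging a long product is much cheaper in the multiplicative monoid.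
  open import Algebra.Solver.CommutativeMonoid *-commutativeMonoid public
    using () renaming (solve to solve*; _⊕_ to infixl 7 _•_; _⊜_ to infix 4 _≐_)

-- The equality of the ring is not a parameter here, so that over two rings that differ
-- only in their equality (ℤ[q] and ℤ[q]/Φ) these are the same functions.
module Operations {C : Set} (_+_ _*_ : C → C → C) (1# : C) where

  pow : C → ℕ → C
  pow x zero = 1#
  pow x (suc n) = x * pow x n

  prod : (ℕ → C) → ℕ → C
  prod f zero = 1#
  prod f (suc n) = prod f n * f n

  sum : (ℕ → C) → ℕ → C
  sum f zero = f 0
  sum f (suc n) = sum f n + f (suc n)

  -- The sum over the antidiagonal r + s = n. Passing both indices keeps truncated subtraction out
  -- of the convolutions.
  sumAD : (ℕ → ℕ → C) → ℕ → C
  sumAD f zero = f 0 0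
  sumAD f (suc n) = f 0 (suc n) + sumAD (λ r s → f (suc r) s) n

-- Finite sums and products in a commutative ring

module RingOps (R : CommutativeRing 0ℓ 0ℓ) where
  open CommutativeRing R public
  open IntegerCoefficients R public
  open Operations _+_ _*_ 1# public
  open import Relation.Binary.Reasoning.Setoid setoid public
  open import Algebra.Properties.Ring ring public

  pow-cong : ∀ {x y} n → x ≈ y → pow x n ≈ pow y n
  pow-cong zero p = refl
  pow-cong (suc n) p = *-cong p (pow-cong n p)

  pow-+ : ∀ x m n → pow x (m ℕ.+ n) ≈ pow x m * pow x n
  pow-+ x zero n = sym (*-identityˡ _)
  pow-+ x (suc m) n = trans (*-congˡ (pow-+ x m n)) (sym (*-assoc _ _ _))

  pow-* : ∀ x y n → pow (x * y) n ≈ pow x n * pow y n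
  pow-* x y zero = sym (*-identityˡ _)
  pow-* x y (suc n) = trans (*-congˡ (pow-* x y n))
    (solve 4 (λ x y a b → x :* y :* (a :* b) := x :* a :* (y :* b)) refl _ _ _ _)

  pow-pow : ∀ x m n → pow (pow x m) n ≈ pow x (n ℕ.* m)
  pow-pow x m zero = refl
  pow-pow x m (suc n) = trans (*-congˡ (pow-pow x m n)) (sym (pow-+ x m (n ℕ.* m)))

  pow-1# : ∀ n → pow 1# n ≈ 1#
  pow-1# zero = refl
  pow-1# (suc n) = trans (*-identityˡ _) (pow-1# n)

  pow≡ : ∀ x {m n} → m ≡ n → pow x m ≈ pow x n
  pow≡ x p = reflexive (≡.cong (pow x) p)

  prod-cong : ∀ {f g} n → (∀ j → j ℕ.< n → f j ≈ g j) → prod f n ≈ prod g n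
  prod-cong zero p = refl
  prod-cong (suc n) p = *-cong (prod-cong n (λ j j<n → p j (ℕP.m<n⇒m<1+n j<n))) (p n ℕP.≤-refl)

  prod-* : ∀ f g n → prod (λ j → f j * g j) n ≈ prod f n * prod g n
  prod-* f g zero = sym (*-identityˡ _)
  prod-* f g (suc n) = trans (*-congʳ (prod-* f g n))
    (solve 4 (λ a b c d → a :* b :* (c :* d) := a :* c :* (b :* d)) refl _ _ _ _)

  prod-const : ∀ x n → prod (λ _ → x) n ≈ pow x n
  prod-const x zero = refl
  prod-const x (suc n) = trans (*-congʳ (prod-const x n)) (*-comm _ _)

  prod-+ : ∀ f m n → prod f (m ℕ.+ n) ≈ prod f m * prod (λ j → f (m ℕ.+ j)) n
  prod-+ f m zero = trans (reflexive (≡.cong (prod f) (ℕP.+-identityʳ m))) (sym (*-identityʳ _))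
  prod-+ f m (suc n) = begin
    prod f (m ℕ.+ suc n) ≡⟨ ≡.cong (prod f) (ℕP.+-suc m n) ⟩
    prod f (m ℕ.+ n) * f (m ℕ.+ n) ≈⟨ *-congʳ (prod-+ f m n) ⟩
    (prod f m * prod (λ j → f (m ℕ.+ j)) n) * f (m ℕ.+ n) ≈⟨ *-assoc _ _ _ ⟩
    prod f m * (prod (λ j → f (m ℕ.+ j)) n * f (m ℕ.+ n)) ∎

  prod-head : ∀ f n → prod f (suc n) ≈ f 0 * prod (λ j → f (suc j)) n
  prod-head f n = trans (prod-+ f 1 n) (*-congʳ (*-identityˡ _))

  sum-cong : ∀ {f g} n → (∀ k → k ℕ.≤ n → f k ≈ g k) → sum f n ≈ sum g n
  sum-cong zero p = p 0 ℕ.z≤n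
  sum-cong (suc n) p = +-cong (sum-cong n (λ k k≤n → p k (ℕP.m≤n⇒m≤1+n k≤n))) (p (suc n) ℕP.≤-refl)

  sum-*ˡ : ∀ x f n → sum (λ k → x * f k) n ≈ x * sum f n
  sum-*ˡ x f zero = refl
  sum-*ˡ x f (suc n) = trans (+-congʳ (sum-*ˡ x f n)) (sym (distribˡ x _ _))

  sum-head : ∀ f n → sum f (suc n) ≈ f 0 + sum (λ k → f (suc k)) n
  sum-head f zero = refl
  sum-head f (suc n) = trans (+-congʳ (sum-head f n)) (+-assoc _ _ _)

  sum-+ : ∀ f m n → sum f (m ℕ.+ suc n) ≈ sum f m + sum (λ k → f (suc (m ℕ.+ k))) n
  sum-+ f m zero = trans (reflexive (≡.cong (sum f) (ℕP.+-suc m 0))) (+-congʳ (reflexive (≡.cong (sum f) (ℕP.+-identityʳ m))))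
  sum-+ f m (suc n) = begin
    sum f (m ℕ.+ suc (suc n)) ≡⟨ ≡.cong (sum f) (ℕP.+-suc m (suc n)) ⟩
    sum f (m ℕ.+ suc n) + f (suc (m ℕ.+ suc n)) ≈⟨ +-congʳ (sum-+ f m n) ⟩
    (sum f m + sum (λ k → f (suc (m ℕ.+ k))) n) + f (suc (m ℕ.+ suc n)) ≈⟨ +-assoc _ _ _ ⟩
    sum f m + (sum (λ k → f (suc (m ℕ.+ k))) n + f (suc (m ℕ.+ suc n))) ∎

  sumAD-cong : ∀ {f g} n → (∀ r s → r ℕ.+ s ≡ n → f r s ≈ g r s) → sumAD f n ≈ sumAD g n
  sumAD-cong zero p = p 0 0 ≡.refl
  sumAD-cong (suc n) p = +-cong (p 0 (suc n) ≡.refl) (sumAD-cong n (λ r s e → p (suc r) s (≡.cong suc e)))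

  sumAD-+ : ∀ f g n → sumAD (λ r s → f r s + g r s) n ≈ sumAD f n + sumAD g n
  sumAD-+ f g zero = refl
  sumAD-+ f g (suc n) = trans (+-congˡ (sumAD-+ _ _ n))
    (solve 4 (λ a b c d → a :+ b :+ (c :+ d) := a :+ c :+ (b :+ d)) refl _ _ _ _)

  sumAD-*ˡ : ∀ x f n → sumAD (λ r s → x * f r s) n ≈ x * sumAD f n
  sumAD-*ˡ x f zero = refl
  sumAD-*ˡ x f (suc n) = trans (+-congˡ (sumAD-*ˡ x _ n)) (sym (distribˡ x _ _))

  sumAD-last : ∀ f n → sumAD f (suc n) ≈ sumAD (λ r s → f r (suc s)) n + f (suc n) 0
  sumAD-last f zero = refl
  sumAD-last f (suc n) = trans (+-congˡ (sumAD-last (λ r s → f (suc r) s) n)) (sym (+-assoc _ _ _))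

  sumAD-flip : ∀ f n → sumAD f n ≈ sumAD (λ r s → f s r) n
  sumAD-flip f zero = refl
  sumAD-flip f (suc n) = begin
    f 0 (suc n) + sumAD (λ r s → f (suc r) s) n ≈⟨ +-congˡ (sumAD-flip (λ r s → f (suc r) s) n) ⟩
    f 0 (suc n) + sumAD (λ r s → f (suc s) r) n ≈⟨ +-comm _ _ ⟩
    sumAD (λ r s → f (suc s) r) n + f 0 (suc n) ≈⟨ sumAD-last (λ r s → f s r) n ⟨
    sumAD (λ r s → f s r) (suc n) ∎

  -- Both sides run over the triples r + s + t = n. This is the interchange of summations in
  -- Bailey's lemma.
  sumAD-assoc : ∀ (f : ℕ → ℕ → ℕ → Carrier) n →
    sumAD (λ k t → sumAD (λ r s → f r s t) k) n ≈ sumAD (λ r m → sumAD (λ s t → f r s t) m) n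
  sumAD-assoc f zero = refl
  sumAD-assoc f (suc n) = begin
    f 0 0 (suc n) + sumAD (λ k t → f 0 (suc k) t + sumAD (λ r s → f (suc r) s t) k) n
      ≈⟨ +-congˡ (sumAD-+ _ _ n) ⟩
    f 0 0 (suc n) + (sumAD (λ k t → f 0 (suc k) t) n + sumAD (λ k t → sumAD (λ r s → f (suc r) s t) k) n)
      ≈⟨ +-congˡ (+-congˡ (sumAD-assoc (λ r → f (suc r)) n)) ⟩
    f 0 0 (suc n) + (sumAD (λ k t → f 0 (suc k) t) n + sumAD (λ r m → sumAD (λ s t → f (suc r) s t) m) n)
      ≈⟨ +-assoc _ _ _ ⟨
    sumAD (λ s t → f 0 s t) (suc n) + sumAD (λ r m → sumAD (λ s t → f (suc r) s t) m) n ∎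

  -- The shape of a q-Pascal induction: u vanishes at the end s = 0 and v at the end r = 0, so both
  -- halves reindex to the antidiagonal n, where they can be recombined.
  sumAD-pascal : ∀ {f} u v n → (∀ r s → r ℕ.+ s ≡ suc n → f r s ≈ u r s + v r s) →
    u (suc n) 0 ≈ 0# → v 0 (suc n) ≈ 0# →
    sumAD f (suc n) ≈ sumAD (λ r s → u r (suc s) + v (suc r) s) n
  sumAD-pascal {f} u v n split u≈0 v≈0 = begin
    sumAD f (suc n) ≈⟨ sumAD-cong (suc n) split ⟩
    sumAD (λ r s → u r s + v r s) (suc n) ≈⟨ sumAD-+ u v (suc n) ⟩
    sumAD u (suc n) + sumAD v (suc n) ≈⟨ +-cong (trans (sumAD-last u n) (trans (+-congˡ u≈0) (+-identityʳ _))) (trans (+-congʳ v≈0) (+-identityˡ _)) ⟩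
    sumAD (λ r s → u r (suc s)) n + sumAD (λ r s → v (suc r) s) n ≈⟨ sumAD-+ _ _ n ⟨
    sumAD (λ r s → u r (suc s) + v (suc r) s) n ∎

  sum≈sumAD : ∀ f n → sum f n ≈ sumAD (λ r s → f r) n
  sum≈sumAD f zero = refl
  sum≈sumAD f (suc n) = trans (sum-head f n) (+-congˡ (sum≈sumAD (λ k → f (suc k)) n))

-- Terminating basic hypergeometric sums in base p

module QSeries (R : CommutativeRing 0ℓ 0ℓ) (p : CommutativeRing.Carrier R) where
  open RingOps R

  -- The shifted factorial (x;p)ₖ.
  P : Carrier → ℕ → Carrier
  P x = prod (λ j → 1# + - (x * pow p j))

  P-cong : ∀ {x y} k → x ≈ y → P x k ≈ P y k
  P-cong k e = prod-cong k (λ j _ → +-congˡ (-‿cong (*-congʳ e)))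

  P-+ : ∀ x m n → P x (m ℕ.+ n) ≈ P x m * P (x * pow p m) n
  P-+ x m n = trans (prod-+ _ m n) (*-congˡ (prod-cong n (λ j _ → +-congˡ (-‿cong (trans (*-congˡ (pow-+ p m j)) (sym (*-assoc _ _ _)))))))

  P-head : ∀ x k → P x (suc k) ≈ (1# + - x) * P (x * p) k
  P-head x k = begin
    P x (suc k) ≈⟨ P-+ x 1 k ⟩
    (1# * (1# + - (x * 1#))) * P (x * (p * 1#)) k ≈⟨ *-cong (trans (*-identityˡ _) (+-congˡ (-‿cong (*-identityʳ x)))) (P-cong k (*-congˡ (*-identityʳ p))) ⟩
    (1# + - x) * P (x * p) k ∎

  P-step : ∀ x m k → P (x * pow p m) (suc k) ≈ (1# + - (x * pow p m)) * P (x * pow p (suc m)) k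
  P-step x m k = trans (P-head _ k) (*-congˡ (P-cong k (trans (*-assoc _ _ _) (*-congˡ (*-comm _ _)))))

  -- (-1)ʳ p^(r(r-1)/2)
  sg : ℕ → Carrier
  sg zero = 1#
  sg (suc r) = - (pow p r) * sg r

  module Inverses (ι : ℕ → Carrier) (ι-inv : ∀ k → ι k * (1# + - pow p (suc k)) ≈ 1#) where

    -- This is 1/(p;p)ₖ.
    i : ℕ → Carrier
    i = prod ι

    i-suc : ∀ k → i (suc k) * (1# + - pow p (suc k)) ≈ i k
    i-suc k = trans (*-assoc _ _ _) (trans (*-congˡ (ι-inv k)) (*-identityʳ _))

    ι-cancel : ∀ k {x y} → (1# + - pow p (suc k)) * x ≈ i k * y → x ≈ i (suc k) * y
    ι-cancel k {x} {y} e = begin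
      x ≈⟨ *-identityˡ x ⟨
      1# * x ≈⟨ *-congʳ (ι-inv k) ⟨
      (ι k * (1# + - pow p (suc k))) * x ≈⟨ *-assoc _ _ _ ⟩
      ι k * ((1# + - pow p (suc k)) * x) ≈⟨ *-congˡ e ⟩
      ι k * (i k * y) ≈⟨ solve 3 (λ a b c → a :* (b :* c) := b :* a :* c) refl _ _ _ ⟩
      i (suc k) * y ∎

    module _ (B C : Carrier) where

      sixφfive-X sixφfive-F : Carrier → Carrier → ℕ → ℕ → Carrier
      sixφfive-X A w r s = i r * i s * sg r * P A r * P (A * pow p (suc (r ℕ.+ r ℕ.+ s))) s * (P B r * P C r)
        * (P (w * C * pow p r) s * P (w * B * pow p r) s) * pow w r
      sixφfive-F A w r s = (1# + - (A * pow p (r ℕ.+ r))) * sixφfive-X A w r s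

      private
        common : Carrier → Carrier → ℕ → ℕ → Carrier
        common A w r s = pow p r * i r * i s * sg r * P (A * p) r * P (A * pow p (suc (suc (r ℕ.+ r ℕ.+ s)))) s
          * (P B r * P C r) * (P (w * C * pow p (suc r)) s * P (w * B * pow p (suc r)) s) * pow w r

        u v : Carrier → Carrier → ℕ → ℕ → Carrier
        u A w r s = pow p r * (1# + - pow p s) * (1# + - (A * pow p r)) * sixφfive-X A w r s
        v A w r s = (1# + - pow p r) * (1# + - (A * pow p (r ℕ.+ r ℕ.+ s))) * sixφfive-X A w r s

        -- With x = pʳ and y = pˢ this is (1 - xy)(1 - Ax²) = x(1 - y)(1 - Ax) + (1 - x)(1 - Ax²y).
        -- The factors 1 - y and 1 - x lower the index of `i s` and `i r` and kill the boundary
        -- terms.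
        split : ∀ A w n r s → r ℕ.+ s ≡ n → (1# + - pow p n) * sixφfive-F A w r s ≈ u A w r s + v A w r s
        split A w n r s ≡.refl = begin
          (1# + - pow p (r ℕ.+ s)) * ((1# + - (A * pow p (r ℕ.+ r))) * X)
            ≈⟨ *-cong (+-congˡ (-‿cong (pow-+ p r s))) (*-congʳ (+-congˡ (-‿cong (*-congˡ (pow-+ p r r))))) ⟩
          (1# + - (pow p r * pow p s)) * ((1# + - (A * (pow p r * pow p r))) * X)
            ≈⟨ solve 4 (λ x y a X → (one :- x :* y) :* ((one :- a :* (x :* x)) :* X) :=
                 x :* (one :- y) :* (one :- a :* x) :* X :+ (one :- x) :* (one :- a :* (x :* x :* y)) :* X) refl _ _ _ _ ⟩
          u A w r s + (1# + - pow p r) * (1# + - (A * (pow p r * pow p r * pow p s))) * X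
            ≈⟨ +-congˡ (*-congʳ (*-congˡ (+-congˡ (-‿cong (*-congˡ (sym (trans (pow-+ p (r ℕ.+ r) s) (*-congʳ (pow-+ p r r)))))))) ) ⟩
          u A w r s + v A w r s ∎
          where X = sixφfive-X A w r s

        ls : ∀ A r s → Carrier
        ls A r s = 1# + - (A * pow p (suc (suc (r ℕ.+ s ℕ.+ (r ℕ.+ s)))))

        P-A-last : ∀ A r s → P (A * pow p (suc (suc (r ℕ.+ r ℕ.+ s)))) (suc s) ≈ P (A * pow p (suc (suc (r ℕ.+ r ℕ.+ s)))) s * ls A r s
        P-A-last A r s = *-congˡ (+-congˡ (-‿cong (begin
          A * pow p (suc (suc (r ℕ.+ r ℕ.+ s))) * pow p s ≈⟨ *-assoc _ _ _ ⟩
          A * (pow p (suc (suc (r ℕ.+ r ℕ.+ s))) * pow p s) ≈⟨ *-congˡ (pow-+ p (suc (suc (r ℕ.+ r ℕ.+ s))) s) ⟨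
          A * pow p (suc (suc (r ℕ.+ r ℕ.+ s)) ℕ.+ s) ≈⟨ *-congˡ (pow≡ p (exps r s)) ⟩
          A * pow p (suc (suc (r ℕ.+ s ℕ.+ (r ℕ.+ s)))) ∎)))
          where
          exps : ∀ r s → suc (suc (r ℕ.+ r ℕ.+ s)) ℕ.+ s ≡ suc (suc (r ℕ.+ s ℕ.+ (r ℕ.+ s)))
          exps = solve-∀

        P-A-head : ∀ A r → (1# + - (A * pow p r)) * P A r ≈ (1# + - A) * P (A * p) r
        P-A-head A r = trans (*-comm _ _) (P-head A r)

        u-suc : ∀ A w r s → u A w r (suc s) ≈
          (1# + - A) * ls A r s * common A w r s * ((1# + - (w * C * pow p r)) * (1# + - (w * B * pow p r)))
        u-suc A w r s = begin
          u A w r (suc s)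
            ≈⟨ solve* 13 (λ x y z ir is sr pa pA b c d e f →
                 x • y • z • (ir • is • sr • pa • pA • (b • c) • (d • e) • f) ≐
                 x • ir • (is • y) • sr • (z • pa) • pA • (b • c) • (d • e) • f) refl _ _ _ _ _ _ _ _ _ _ _ _ _ ⟩
          pow p r * i r * (i (suc s) * (1# + - pow p (suc s))) * sg r * ((1# + - (A * pow p r)) * P A r)
            * P (A * pow p (suc (r ℕ.+ r ℕ.+ suc s))) (suc s) * (P B r * P C r)
            * (P (w * C * pow p r) (suc s) * P (w * B * pow p r) (suc s)) * pow w r
            ≈⟨ *-congʳ (*-cong (*-congʳ (*-cong (*-cong (*-congʳ (*-congˡ (i-suc s))) (P-A-head A r))
                 (trans (P-cong (suc s) (*-congˡ (pow≡ p (≡.cong suc (ℕP.+-suc (r ℕ.+ r) s))))) (P-A-last A r s))))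
                 (*-cong (P-step (w * C) r s) (P-step (w * B) r s))) ⟩
          pow p r * i r * i s * sg r * ((1# + - A) * P (A * p) r) * (P (A * pow p (suc (suc (r ℕ.+ r ℕ.+ s)))) s * ls A r s)
            * (P B r * P C r) * ((1# + - (w * C * pow p r)) * P (w * C * pow p (suc r)) s
            * ((1# + - (w * B * pow p r)) * P (w * B * pow p (suc r)) s)) * pow w r
            ≈⟨ solve* 14 (λ x ir is sr a pa pA l bc d d2 e e2 f →
                 x • ir • is • sr • (a • pa) • (pA • l) • bc • (d • d2 • (e • e2)) • f ≐
                 a • l • (x • ir • is • sr • pa • pA • bc • (d2 • e2) • f) • (d • e)) refl _ _ _ _ _ _ _ _ _ _ _ _ _ _ ⟩
          _ ∎

        v-suc : ∀ A w r s → v A w (suc r) s ≈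
          - ((1# + - A) * ls A r s * common A w r s * (w * (1# + - (B * pow p r)) * (1# + - (C * pow p r))))
        v-suc A w r s = begin
          v A w (suc r) s
            ≈⟨ solve* 14 (λ y z ir is x sr pa pA b b2 c c2 de wf →
                 y • z • (ir • is • (x • sr) • pa • pA • (b • b2 • (c • c2)) • de • wf) ≐
                 x • ((ir • y) • is • sr • pa • (z • pA) • (b • b2 • (c • c2)) • de • wf)) refl _ _ _ _ _ _ _ _ _ _ _ _ _ _ ⟩
          - pow p r * (i (suc r) * (1# + - pow p (suc r)) * i s * sg r * P A (suc r)
            * ((1# + - (A * pow p (suc r ℕ.+ suc r ℕ.+ s))) * P (A * pow p (suc (suc r ℕ.+ suc r ℕ.+ s))) s)
            * (P B r * (1# + - (B * pow p r)) * (P C r * (1# + - (C * pow p r))))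
            * (P (w * C * pow p (suc r)) s * P (w * B * pow p (suc r)) s) * (w * pow w r))
            ≈⟨ trans (sym (-‿distribˡ-* _ _)) (-‿cong (solve* 9 (λ x i is sr pa pA bc de wf →
                 x • (i • is • sr • pa • pA • bc • de • wf) ≐ x • i • is • sr • pa • pA • bc • de • wf) refl _ _ _ _ _ _ _ _ _)) ⟩
          - (pow p r * (i (suc r) * (1# + - pow p (suc r))) * i s * sg r * P A (suc r)
            * ((1# + - (A * pow p (suc r ℕ.+ suc r ℕ.+ s))) * P (A * pow p (suc (suc r ℕ.+ suc r ℕ.+ s))) s)
            * (P B r * (1# + - (B * pow p r)) * (P C r * (1# + - (C * pow p r))))
            * (P (w * C * pow p (suc r)) s * P (w * B * pow p (suc r)) s) * (w * pow w r))
            ≈⟨ -‿cong (*-congʳ (*-congʳ (*-congʳ (*-cong (*-cong (*-congʳ (*-congʳ (*-congˡ (i-suc r)))) (P-head A r))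
                 (trans (sym (P-step A (suc r ℕ.+ suc r ℕ.+ s) s))
                   (trans (P-cong (suc s) (*-congˡ (pow≡ p (exps r s)))) (P-A-last A r s))))))) ⟩
          - (pow p r * i r * i s * sg r * ((1# + - A) * P (A * p) r)
            * (P (A * pow p (suc (suc (r ℕ.+ r ℕ.+ s)))) s * ls A r s)
            * (P B r * (1# + - (B * pow p r)) * (P C r * (1# + - (C * pow p r))))
            * (P (w * C * pow p (suc r)) s * P (w * B * pow p (suc r)) s) * (w * pow w r))
            ≈⟨ -‿cong (solve* 15 (λ x ir is sr a pa pA l b b2 c c2 de w f →
                 x • ir • is • sr • (a • pa) • (pA • l) • (b • b2 • (c • c2)) • de • (w • f) ≐
                 a • l • (x • ir • is • sr • pa • pA • (b • c) • de • f) • (w • b2 • c2)) refl _ _ _ _ _ _ _ _ _ _ _ _ _ _ _) ⟩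
          _ ∎
          where
          exps : ∀ r s → suc r ℕ.+ suc r ℕ.+ s ≡ suc (suc (r ℕ.+ r ℕ.+ s))
          exps = solve-∀

        common-F : ∀ A w r s → A * p ≈ w * B * C → 
          common A w r s * ((1# + - w) * (1# + - (w * B * C * (pow p r * pow p r)))) ≈ (1# + - w) * sixφfive-F (A * p) (w * p) r s
        common-F A w r s h = sym (begin
          (1# + - w) * ((1# + - (A * p * pow p (r ℕ.+ r))) * (i r * i s * sg r * P (A * p) r * P (A * p * pow p (suc (r ℕ.+ r ℕ.+ s))) s * (P B r * P C r)
            * (P (w * p * C * pow p r) s * P (w * p * B * pow p r) s) * pow (w * p) r))
            ≈⟨ *-congˡ (*-cong (+-congˡ (-‿cong (*-cong h (pow-+ p r r))))
                 (*-cong (*-cong (*-congʳ (*-congˡ (P-cong s (*-assoc _ _ _))))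
                   (*-cong (P-cong s (shift C)) (P-cong s (shift B)))) (pow-* w p r))) ⟩
          (1# + - w) * ((1# + - (w * B * C * (pow p r * pow p r))) * (i r * i s * sg r * P (A * p) r * P (A * pow p (suc (suc (r ℕ.+ r ℕ.+ s)))) s * (P B r * P C r)
            * (P (w * C * pow p (suc r)) s * P (w * B * pow p (suc r)) s) * (pow w r * pow p r)))
            ≈⟨ solve* 11 (λ w m x ir is sr pa pA bc de f →
                 w • (m • (ir • is • sr • pa • pA • bc • de • (f • x))) ≐
                 (x • ir • is • sr • pa • pA • bc • de • f) • (w • m)) refl _ _ _ _ _ _ _ _ _ _ _ ⟩
          _ ∎)
          where
          shift : ∀ c → w * p * c * pow p r ≈ w * c * pow p (suc r)
          shift c = solve 4 (λ w p c x → w :* p :* c :* x := w :* c :* (p :* x)) refl _ _ _ _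

        -- The two halves share `common`, and (1 - wCx)(1 - wBx) - w(1 - Bx)(1 - Cx) = (1 - w)(1 -
        -- wBCx²) for x = pʳ. Since wBC = Ap, the last factor is the very-well-poised one for the
        -- parameter Ap.
        step : ∀ A w n r s → r ℕ.+ s ≡ n → A * p ≈ w * B * C →
          u A w r (suc s) + v A w (suc r) s ≈
          (1# + - A) * (1# + - (A * pow p (suc (suc (n ℕ.+ n))))) * (1# + - w) * sixφfive-F (A * p) (w * p) r s
        step A w n r s ≡.refl h = begin
          u A w r (suc s) + v A w (suc r) s ≈⟨ +-cong (u-suc A w r s) (v-suc A w r s) ⟩
          _ ≈⟨ solve 7 (λ a l k w b c x →
               a :* l :* k :* ((one :- w :* c :* x) :* (one :- w :* b :* x)) :- a :* l :* k :* (w :* (one :- b :* x) :* (one :- c :* x)) :=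
               a :* l :* (k :* ((one :- w) :* (one :- w :* b :* c :* (x :* x))))) refl _ _ _ _ _ _ _ ⟩
          (1# + - A) * ls A r s * (common A w r s * ((1# + - w) * (1# + - (w * B * C * (pow p r * pow p r))))) ≈⟨ *-congˡ (common-F A w r s h) ⟩
          (1# + - A) * ls A r s * ((1# + - w) * sixφfive-F (A * p) (w * p) r s) ≈⟨ *-assoc _ _ _ ⟨
          _ ∎

      -- The terminating very-well-poised ₆φ₅ sum with b = Ap/B, c = Ap/C, w = Ap/BC, multiplied by
      -- (b;p)ₙ (c;p)ₙ (A;p)₂ₙ₊₁.  A step of the recursion replaces A by Ap and n by n - 1.
      sixφfive : ∀ n A w → A * p ≈ w * B * C → sumAD (sixφfive-F A w) n ≈ i n * (P w n * P A (suc (n ℕ.+ n)))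
      sixφfive zero A w h = begin
        (1# + - (A * 1#)) * (1# * 1# * 1# * 1# * 1# * (1# * 1#) * (1# * 1#) * 1#)
          ≈⟨ solve 1 (λ a → (one :- a :* one) :* (one :* one :* one :* one :* one :* (one :* one) :* (one :* one) :* one) :=
               one :* (one :* (one :* (one :- a :* one)))) refl _ ⟩
        1# * (1# * (1# * (1# + - (A * 1#)))) ∎
      sixφfive (suc n) A w h = ι-cancel n (begin
        (1# + - pow p (suc n)) * sumAD (sixφfive-F A w) (suc n) ≈⟨ sumAD-*ˡ _ (sixφfive-F A w) (suc n) ⟨
        sumAD (λ r s → (1# + - pow p (suc n)) * sixφfive-F A w r s) (suc n)
          ≈⟨ sumAD-pascal (u A w) (v A w) n (split A w (suc n))
               (solve 3 (λ a b c → a :* (one :- one) :* b :* c := zeroᵉ) refl _ _ _)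
               (solve 2 (λ b c → (one :- one) :* b :* c := zeroᵉ) refl _ _) ⟩
        sumAD (λ r s → u A w r (suc s) + v A w (suc r) s) n ≈⟨ sumAD-cong n (λ r s e → step A w n r s e h) ⟩
        sumAD (λ r s → K * sixφfive-F (A * p) (w * p) r s) n ≈⟨ sumAD-*ˡ K (sixφfive-F (A * p) (w * p)) n ⟩
        K * sumAD (sixφfive-F (A * p) (w * p)) n ≈⟨ *-congˡ (sixφfive n (A * p) (w * p) h′) ⟩
        K * (i n * (P (w * p) n * P (A * p) (suc (n ℕ.+ n))))
          ≈⟨ solve 6 (λ a l w i pw pa → a :* l :* w :* (i :* (pw :* pa)) := i :* (w :* pw :* (a :* pa :* l))) refl _ _ _ _ _ _ ⟩
        i n * ((1# + - w) * P (w * p) n * ((1# + - A) * P (A * p) (suc (n ℕ.+ n)) * (1# + - (A * pow p (suc (suc (n ℕ.+ n)))))))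
          ≈⟨ *-congˡ (*-cong (P-head w n) (trans (reflexive (≡.cong (λ k → P A (suc (suc k))) (ℕP.+-suc n n))) (*-congʳ (P-head A (suc (n ℕ.+ n)))))) ⟨
        i n * (P w (suc n) * P A (suc (suc n ℕ.+ suc n))) ∎)
        where

        K = (1# + - A) * (1# + - (A * pow p (suc (suc (n ℕ.+ n))))) * (1# + - w)
        h′ : A * p * p ≈ w * p * B * C
        h′ = trans (*-congʳ h) (solve 4 (λ w b c p → w :* b :* c :* p := w :* p :* b :* c) refl _ _ _ _)

    private
      vandermonde-F vandermonde-u vandermonde-v : Carrier → Carrier → ℕ → ℕ → Carrier
      vandermonde-F a z s t = i s * i t * sg s * pow z s * P a s * P (a * z * pow p s) t
      vandermonde-u a z s t = pow p s * (1# + - pow p t) * vandermonde-F a z s t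
      vandermonde-v a z s t = (1# + - pow p s) * vandermonde-F a z s t

      vandermonde-step : ∀ a z s t →
        vandermonde-u a z s (suc t) + vandermonde-v a z (suc s) t ≈ (1# + - z) * vandermonde-F a (z * p) s t
      vandermonde-step a z s t = begin
        pow p s * (1# + - pow p (suc t)) * (i s * i (suc t) * sg s * pow z s * P a s * P (a * z * pow p s) (suc t))
          + (1# + - pow p (suc s)) * (i (suc s) * i t * (- (pow p s) * sg s) * (z * pow z s) * (P a s * (1# + - (a * pow p s))) * P (a * z * pow p (suc s)) t)
          ≈⟨ +-cong
               (solve* 8 (λ x yt is it sr f pa pz → x • yt • (is • it • sr • f • pa • pz) ≐ x • is • (it • yt) • sr • f • pa • pz) refl _ _ _ _ _ _ _ _)
               (trans (solve* 10 (λ ys is it x sr z f pa a pz → ys • (is • it • (x • sr) • (z • f) • (pa • a) • pz) ≐ x • ((is • ys) • it • sr • (z • f) • (pa • a) • pz)) refl _ _ _ _ _ _ _ _ _ _)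
                 (trans (sym (-‿distribˡ-* _ _)) (-‿cong (solve* 7 (λ x is it sr zf pa pz → x • (is • it • sr • zf • pa • pz) ≐ x • is • it • sr • zf • pa • pz) refl _ _ _ _ _ _ _)))) ⟩
        pow p s * i s * (i (suc t) * (1# + - pow p (suc t))) * sg s * pow z s * P a s * P (a * z * pow p s) (suc t)
          + - (pow p s * (i (suc s) * (1# + - pow p (suc s))) * i t * sg s * (z * pow z s) * (P a s * (1# + - (a * pow p s))) * P (a * z * pow p (suc s)) t)
          ≈⟨ +-cong (*-cong (*-congʳ (*-congʳ (*-congʳ (*-congˡ (i-suc t))))) (P-step (a * z) s t))
               (-‿cong (*-congʳ (*-congʳ (*-congʳ (*-congʳ (*-congʳ (*-congˡ (i-suc s)))))))) ⟩
        pow p s * i s * i t * sg s * pow z s * P a s * ((1# + - (a * z * pow p s)) * P (a * z * pow p (suc s)) t)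
          + - (pow p s * i s * i t * sg s * (z * pow z s) * (P a s * (1# + - (a * pow p s))) * P (a * z * pow p (suc s)) t)
          ≈⟨ solve 9 (λ x is it sr f pa pz z a →
               x :* is :* it :* sr :* f :* pa :* ((one :- a :* z :* x) :* pz) :- x :* is :* it :* sr :* (z :* f) :* (pa :* (one :- a :* x)) :* pz :=
               (one :- z) :* (is :* it :* sr :* (f :* x) :* pa :* pz)) refl _ _ _ _ _ _ _ _ _ ⟩
        (1# + - z) * (i s * i t * sg s * (pow z s * pow p s) * P a s * P (a * z * pow p (suc s)) t)
          ≈⟨ *-congˡ (*-cong (*-congʳ (*-congˡ (pow-* z p s))) (P-cong t (solve 4 (λ a z p x → a :* (z :* p) :* x := a :* z :* (p :* x)) refl _ _ _ _))) ⟨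
        (1# + - z) * vandermonde-F a (z * p) s t ∎

    -- The q-Chu-Vandermonde sum with lower parameter az, multiplied by (az;p)ₙ/(p;p)ₙ. The factor
    -- (p⁻ⁿ;p)ₛ is hidden in `sg s` and `i t`. The induction replaces z by zp.
    vandermonde : ∀ n a z → sumAD (vandermonde-F a z) n ≈ i n * P z n
    vandermonde zero a z = solve 0 (one :* one :* one :* one :* one :* one := one :* one) refl
    vandermonde (suc n) a z = ι-cancel n (begin
      (1# + - pow p (suc n)) * sumAD (vandermonde-F a z) (suc n) ≈⟨ sumAD-*ˡ _ (vandermonde-F a z) (suc n) ⟨
      sumAD (λ s t → (1# + - pow p (suc n)) * vandermonde-F a z s t) (suc n)
        ≈⟨ sumAD-pascal (vandermonde-u a z) (vandermonde-v a z) n split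
             (solve 2 (λ a b → a :* (one :- one) :* b := zeroᵉ) refl _ _)
             (solve 1 (λ b → (one :- one) :* b := zeroᵉ) refl _) ⟩
      sumAD (λ s t → vandermonde-u a z s (suc t) + vandermonde-v a z (suc s) t) n ≈⟨ sumAD-cong n (λ s t _ → vandermonde-step a z s t) ⟩
      sumAD (λ s t → (1# + - z) * vandermonde-F a (z * p) s t) n ≈⟨ sumAD-*ˡ (1# + - z) (vandermonde-F a (z * p)) n ⟩
      (1# + - z) * sumAD (vandermonde-F a (z * p)) n ≈⟨ *-congˡ (vandermonde n a (z * p)) ⟩
      (1# + - z) * (i n * P (z * p) n) ≈⟨ solve 3 (λ a b c → a :* (b :* c) := b :* (a :* c)) refl _ _ _ ⟩
      i n * ((1# + - z) * P (z * p) n) ≈⟨ *-congˡ (P-head z n) ⟨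
      i n * P z (suc n) ∎)
      where
      split : ∀ s t → s ℕ.+ t ≡ suc n → (1# + - pow p (suc n)) * vandermonde-F a z s t ≈ vandermonde-u a z s t + vandermonde-v a z s t
      split s t e = trans (*-congʳ (+-congˡ (-‿cong (trans (pow≡ p (≡.sym e)) (pow-+ p s t)))))
        (solve 3 (λ x y f → (one :- x :* y) :* f := x :* (one :- y) :* f :+ (one :- x) :* f) refl _ _ _)

    i-inv : ∀ k → i k * P p k ≈ 1#
    i-inv zero = *-identityˡ _
    i-inv (suc k) = begin
      i k * ι k * (P p k * (1# + - pow p (suc k))) ≈⟨ solve 4 (λ a b c d → a :* b :* (c :* d) := (a :* c) :* (b :* d)) refl _ _ _ _ ⟩
      (i k * P p k) * (ι k * (1# + - pow p (suc k))) ≈⟨ *-cong (i-inv k) (ι-inv k) ⟩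
      1# * 1# ≈⟨ *-identityˡ _ ⟩
      1# ∎

    module _ (π : Carrier) (πp≈1 : π * p ≈ 1#) where

      pow-π-p : ∀ k → pow π k * pow p k ≈ 1#
      pow-π-p k = trans (sym (pow-* π p k)) (trans (pow-cong k πp≈1) (pow-1# k))

      -- Reversal of a terminating factorial: with n = s + t, (p⁻ⁿ;p)ₛ is (-1)ˢ p^(s(s-1)/2 - ns)
      -- (p;p)ₙ/(p;p)ₜ. Removing the first factor 1 - p⁻ⁿ lowers n and s and keeps t.
      P-π : ∀ s t → P (pow π (s ℕ.+ t)) s ≈ sg s * pow (pow π (s ℕ.+ t)) s * P p (s ℕ.+ t) * i t
      P-π zero t = sym (trans (*-congʳ (trans (*-congʳ (*-identityˡ _)) (*-identityˡ _))) (trans (*-comm _ _) (i-inv t)))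
      P-π (suc s) t = begin
        P (pow π (suc m)) (suc s) ≈⟨ P-head _ s ⟩
        (1# + - pow π (suc m)) * P (pow π (suc m) * p) s
          ≈⟨ *-cong (+-congʳ (sym (pow-π-p (suc m)))) (P-cong s (trans (solve 3 (λ a b c → a :* b :* c := a :* c :* b) refl _ _ _) (trans (*-congʳ πp≈1) (*-identityˡ _)))) ⟩
        (pow π (suc m) * pow p (suc m) + - pow π (suc m)) * P (pow π m) s ≈⟨ *-congˡ (P-π s t) ⟩
        (pow π (suc m) * pow p (suc m) + - pow π (suc m)) * (sg s * pow (pow π m) s * P p m * i t)
          ≈⟨ solve 6 (λ x y f g h it → (x :* y :- x) :* (f :* g :* h :* it) := :- (one :* (f :* (x :* g) :* (h :* (one :- y)) :* it))) refl _ _ _ _ _ _ ⟩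
        - (1# * (sg s * (pow π (suc m) * pow (pow π m) s) * P p (suc m) * i t)) ≈⟨ -‿cong (*-congʳ (sym (pow-π-p s))) ⟩
        - (pow π s * pow p s * (sg s * (pow π (suc m) * pow (pow π m) s) * P p (suc m) * i t))
          ≈⟨ solve 7 (λ a x f y g h it → :- (a :* x :* (f :* (y :* g) :* h :* it)) := (:- x :* f) :* (y :* (a :* g)) :* h :* it) refl _ _ _ _ _ _ _ ⟩
        sg (suc s) * (pow π (suc m) * (pow π s * pow (pow π m) s)) * P p (suc m) * i t ≈⟨ *-congʳ (*-congʳ (*-congˡ (*-congˡ (pow-* π (pow π m) s)))) ⟨
        sg (suc s) * pow (pow π (suc m)) (suc s) * P p (suc m) * i t ∎
        where m = s ℕ.+ t

      vandermonde′ : ∀ n a w c → c ≈ a * (w * pow π n) →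
        sumAD (λ s t → i s * pow w s * P a s * P (pow π n) s * P (c * pow p s) t) n ≈ P (w * pow π n) n
      vandermonde′ n a w c h = begin
        sumAD (λ s t → i s * pow w s * P a s * P (pow π n) s * P (c * pow p s) t) n ≈⟨ sumAD-cong n term ⟩
        sumAD (λ s t → P p n * vandermonde-F a (w * pow π n) s t) n ≈⟨ sumAD-*ˡ (P p n) (vandermonde-F a (w * pow π n)) n ⟩
        P p n * sumAD (vandermonde-F a (w * pow π n)) n ≈⟨ *-congˡ (vandermonde n a _) ⟩
        P p n * (i n * P (w * pow π n) n) ≈⟨ *-assoc _ _ _ ⟨
        P p n * i n * P (w * pow π n) n ≈⟨ *-congʳ (trans (*-comm _ _) (i-inv n)) ⟩
        1# * P (w * pow π n) n ≈⟨ *-identityˡ _ ⟩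
        P (w * pow π n) n ∎
        where
        term : ∀ s t → s ℕ.+ t ≡ n → i s * pow w s * P a s * P (pow π n) s * P (c * pow p s) t ≈ P p n * vandermonde-F a (w * pow π n) s t
        term s t ≡.refl = begin
          i s * pow w s * P a s * P (pow π n) s * P (c * pow p s) t ≈⟨ *-cong (*-congˡ (P-π s t)) (P-cong t (*-congʳ h)) ⟩
          i s * pow w s * P a s * (sg s * pow (pow π n) s * P p n * i t) * P (a * (w * pow π n) * pow p s) t
            ≈⟨ solve 8 (λ is f pa sr g pp it pz → is :* f :* pa :* (sr :* g :* pp :* it) :* pz := pp :* (is :* it :* sr :* (f :* g) :* pa :* pz)) refl _ _ _ _ _ _ _ _ ⟩
          P p n * (i s * i t * sg s * (pow w s * pow (pow π n) s) * P a s * P (a * (w * pow π n) * pow p s) t)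
            ≈⟨ *-congˡ (*-congʳ (*-congʳ (*-congˡ (pow-* w (pow π n) s)))) ⟨
          P p n * vandermonde-F a (w * pow π n) s t ∎

    module _ (A : Carrier) (AAp≈1 : A * A * p ≈ 1#) (J : ℕ → Carrier) (J-inv : ∀ k → J k * P A k ≈ 1#) where

      -- A is a square root of p⁻¹, namely q⁻¹ in the application, and π is p⁻¹. As 1/A = Ap, w
      -- equals p/A, the value of Ap/BC at B = C = A; it becomes q³.
      w π : Carrier
      w = A * p * p
      π = A * A

      private
        wA≈p : w * A ≈ p
        wA≈p = trans (solve 2 (λ a p → a :* p :* p :* a := (a :* a :* p) :* p) refl _ _) (trans (*-congʳ AAp≈1) (*-identityˡ p))

        P-p-step : ∀ r s → P (w * A * pow p r) s ≈ i r * P p (r ℕ.+ s)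
        P-p-step r s = sym (begin
          i r * P p (r ℕ.+ s) ≈⟨ *-congˡ (P-+ p r s) ⟩
          i r * (P p r * P (p * pow p r) s) ≈⟨ *-assoc _ _ _ ⟨
          (i r * P p r) * P (p * pow p r) s ≈⟨ *-cong (i-inv r) (P-cong s (*-congʳ (sym wA≈p))) ⟩
          1# * P (w * A * pow p r) s ≈⟨ *-identityˡ _ ⟩
          P (w * A * pow p r) s ∎)

        P-A-ratio : ∀ {m n k} → m ℕ.+ k ≡ n → P (A * pow p m) k * J n ≈ J m
        P-A-ratio {m} {k = k} ≡.refl = begin
          P (A * pow p m) k * J (m ℕ.+ k) ≈⟨ *-identityˡ _ ⟨
          1# * (P (A * pow p m) k * J (m ℕ.+ k)) ≈⟨ *-congʳ (J-inv m) ⟨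
          J m * P A m * (P (A * pow p m) k * J (m ℕ.+ k)) ≈⟨ solve 4 (λ a b c d → a :* b :* (c :* d) := a :* (d :* (b :* c))) refl _ _ _ _ ⟩
          J m * (J (m ℕ.+ k) * (P A m * P (A * pow p m) k)) ≈⟨ *-congˡ (trans (*-congˡ (sym (P-+ A m k))) (J-inv (m ℕ.+ k))) ⟩
          J m * 1# ≈⟨ *-identityʳ _ ⟩
          J m ∎

      β G : ℕ → Carrier
      β k = i k * i k * i k * P w k
      G r = i r * i r * i r * sg r * (P A r * P A r * P A r) * pow w r * (1# + - (A * pow p (r ℕ.+ r)))

      -- A Bailey pair relative to A, read off from `sixφfive` at B = C = A. There Ap/B = Ap/C = p,
      -- so the two factors (p^(r+1);p)ₛ are quotients of (p;p)'s and supply two of the three powers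
      -- of `i r`.
      baileyPair : ∀ k → β k ≈ sumAD (λ r s → G r * i s * J (suc (r ℕ.+ r ℕ.+ s))) k
      baileyPair k = begin
        i k * i k * i k * P w k ≈⟨ *-identityʳ _ ⟨
        i k * i k * i k * P w k * 1# ≈⟨ *-congˡ (J-inv (suc (k ℕ.+ k))) ⟨
        i k * i k * i k * P w k * (J (suc (k ℕ.+ k)) * P A (suc (k ℕ.+ k)))
          ≈⟨ solve 4 (λ i w j a → i :* i :* i :* w :* (j :* a) := i :* i :* j :* (i :* (w :* a))) refl _ _ _ _ ⟩
        X * (i k * (P w k * P A (suc (k ℕ.+ k)))) ≈⟨ *-congˡ (sixφfive A A k A w h) ⟨
        X * sumAD (sixφfive-F A A A w) k ≈⟨ sumAD-*ˡ X (sixφfive-F A A A w) k ⟨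
        sumAD (λ r s → X * sixφfive-F A A A w r s) k ≈⟨ sumAD-cong k term ⟩
        sumAD (λ r s → G r * i s * J (suc (r ℕ.+ r ℕ.+ s))) k ∎
        where
        X = i k * i k * J (suc (k ℕ.+ k))
        h : A * p ≈ w * A * A
        h = sym (trans (*-congʳ wA≈p) (*-comm p A))
        exps : ∀ r s → suc (r ℕ.+ r ℕ.+ s) ℕ.+ s ≡ suc (r ℕ.+ s ℕ.+ (r ℕ.+ s))
        exps = solve-∀
        term : ∀ r s → r ℕ.+ s ≡ k → X * sixφfive-F A A A w r s ≈ G r * i s * J (suc (r ℕ.+ r ℕ.+ s))
        term r s ≡.refl = begin
          X * ((1# + - (A * pow p (r ℕ.+ r))) * (i r * i s * sg r * P A r * P (A * pow p (suc (r ℕ.+ r ℕ.+ s))) s * (P A r * P A r)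
            * (P (w * A * pow p r) s * P (w * A * pow p r) s) * pow w r))
            ≈⟨ *-congˡ (*-congˡ (*-congʳ (*-congˡ (*-cong (P-p-step r s) (P-p-step r s))))) ⟩
          X * ((1# + - (A * pow p (r ℕ.+ r))) * (i r * i s * sg r * P A r * P (A * pow p (suc (r ℕ.+ r ℕ.+ s))) s * (P A r * P A r)
            * (i r * P p k * (i r * P p k)) * pow w r))
            ≈⟨ solve* 10 (λ ik jk l ir is sr pa pA pp f →
                 ik • ik • jk • (l • (ir • is • sr • pa • pA • (pa • pa) • (ir • pp • (ir • pp)) • f)) ≐
                 (ik • pp) • (ik • pp) • (ir • ir • ir • sr • (pa • pa • pa) • f • l • is • (pA • jk))) refl _ _ _ _ _ _ _ _ _ _ ⟩
          (i k * P p k) * (i k * P p k) * (G r * i s * (P (A * pow p (suc (r ℕ.+ r ℕ.+ s))) s * J (suc (k ℕ.+ k))))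
            ≈⟨ *-cong (*-cong (i-inv k) (i-inv k)) (*-congˡ (P-A-ratio (exps r s))) ⟩
          (1# * 1#) * (G r * i s * J (suc (r ℕ.+ r ℕ.+ s))) ≈⟨ trans (*-congʳ (*-identityˡ 1#)) (*-identityˡ _) ⟩
          G r * i s * J (suc (r ℕ.+ r ℕ.+ s)) ∎

      -- Bailey's lemma for this pair: expand `β`, interchange the sums, evaluate the inner one by
      -- q-Chu-Vandermonde. In the application E and πⁿ are aq⁻¹ and q⁻¹/a at a = q^(2m+1).
      watson : ∀ m → let n = suc m ; E = pow p m in
        sumAD (λ k t → pow w k * P E k * P (pow π n) k * β k) n ≈
        sumAD (λ r t → pow w r * P E r * P (pow π n) r * G r * J (suc (n ℕ.+ r)) * P (w * pow π t) t) n
      watson m = begin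
        sumAD (λ k t → pow w k * P E k * P (pow π n) k * β k) n
          ≈⟨ sumAD-cong n (λ k t _ → trans (*-congˡ (baileyPair k)) (sym (sumAD-*ˡ (pow w k * P E k * P (pow π n) k) (λ r s → G r * i s * J (suc (r ℕ.+ r ℕ.+ s))) k))) ⟩
        sumAD (λ k t → sumAD (λ r s → pow w k * P E k * P (pow π n) k * (G r * i s * J (suc (r ℕ.+ r ℕ.+ s)))) k) n
          ≈⟨ sumAD-cong n (λ k t e → sumAD-cong k (λ r s e′ → term r s t (≡.trans (≡.cong (ℕ._+ t) e′) e) e′)) ⟩
        sumAD (λ k t → sumAD (λ r s → H r s t) k) n ≈⟨ sumAD-assoc H n ⟩
        sumAD (λ r l → sumAD (λ s t → H r s t) l) n ≈⟨ sumAD-cong n inner ⟩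
        sumAD (λ r l → K r * P (w * pow π l) l) n ∎
        where
        n = suc m
        E = pow p m
        K : ℕ → Carrier
        K r = pow w r * P E r * P (pow π n) r * G r * J (suc (n ℕ.+ r))
        V H : ℕ → ℕ → ℕ → Carrier
        V r s t = i s * pow w s * P (E * pow p r) s * P (pow π (s ℕ.+ t)) s * P (A * pow p (suc (r ℕ.+ r)) * pow p s) t
        H r s t = K r * V r s t

        term : ∀ {k} r s t → r ℕ.+ s ℕ.+ t ≡ n → r ℕ.+ s ≡ k →
          pow w k * P E k * P (pow π n) k * (G r * i s * J (suc (r ℕ.+ r ℕ.+ s))) ≈ H r s t
        term r s t e ≡.refl = begin
          pow w (r ℕ.+ s) * P E (r ℕ.+ s) * P (pow π n) (r ℕ.+ s) * (G r * i s * J (suc (r ℕ.+ r ℕ.+ s)))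
            ≈⟨ *-cong (*-cong (*-cong (pow-+ w r s) (P-+ E r s)) (P-+ (pow π n) r s))
                 (*-congˡ (trans (sym (P-A-ratio (≡.trans (exps r s t) (≡.cong (λ k → suc (k ℕ.+ r)) e))))
                   (*-congʳ (P-cong t (trans (*-congˡ (pow-+ p (suc (r ℕ.+ r)) s)) (sym (*-assoc _ _ _))))))) ⟩
          pow w r * pow w s * (P E r * P (E * pow p r) s) * (P (pow π n) r * P (pow π n * pow p r) s)
            * (G r * i s * (P (A * pow p (suc (r ℕ.+ r)) * pow p s) t * J (suc (n ℕ.+ r))))
            ≈⟨ *-congʳ (*-congˡ (*-congˡ (P-cong s (begin
                 pow π n * pow p r ≡⟨ ≡.cong (λ k → pow π k * pow p r) (≡.trans (≡.sym e) (≡.trans (ℕP.+-assoc r s t) (ℕP.+-comm r (s ℕ.+ t)))) ⟩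
                 pow π (s ℕ.+ t ℕ.+ r) * pow p r ≈⟨ *-congʳ (pow-+ π (s ℕ.+ t) r) ⟩
                 pow π (s ℕ.+ t) * pow π r * pow p r ≈⟨ *-assoc _ _ _ ⟩
                 pow π (s ℕ.+ t) * (pow π r * pow p r) ≈⟨ trans (*-congˡ (pow-π-p π AAp≈1 r)) (*-identityʳ _) ⟩
                 pow π (s ℕ.+ t) ∎)))) ⟩
          pow w r * pow w s * (P E r * P (E * pow p r) s) * (P (pow π n) r * P (pow π (s ℕ.+ t)) s)
            * (G r * i s * (P (A * pow p (suc (r ℕ.+ r)) * pow p s) t * J (suc (n ℕ.+ r))))
            ≈⟨ solve* 10 (λ a b c d e f g h x y → a • b • (c • d) • (e • f) • (g • h • (x • y)) ≐
                 a • c • e • g • y • (h • b • d • f • x)) refl _ _ _ _ _ _ _ _ _ _ ⟩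
          H r s t ∎
          where
          exps : ∀ r s t → suc (r ℕ.+ r ℕ.+ s) ℕ.+ t ≡ suc (r ℕ.+ s ℕ.+ t ℕ.+ r)
          exps = solve-∀

        inner : ∀ r l → r ℕ.+ l ≡ n → sumAD (λ s t → H r s t) l ≈ K r * P (w * pow π l) l
        inner r l e = begin
          sumAD (λ s t → H r s t) l ≈⟨ sumAD-*ˡ (K r) (V r) l ⟩
          K r * sumAD (V r) l ≈⟨ *-congˡ (sumAD-cong l (λ s t e′ → *-congʳ (*-congˡ (P-cong s (pow≡ π e′))))) ⟩
          K r * sumAD (λ s t → i s * pow w s * P (E * pow p r) s * P (pow π l) s * P (A * pow p (suc (r ℕ.+ r)) * pow p s) t) l
            ≈⟨ *-congˡ (vandermonde′ π AAp≈1 l (E * pow p r) w (A * pow p (suc (r ℕ.+ r))) balance) ⟩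
          K r * P (w * pow π l) l ∎
          where
          -- The condition on the lower parameter in q-Chu-Vandermonde. It holds because E = pᵐ with
          -- m = n - 1, so that pʳpˡ = pE.
          balance : A * pow p (suc (r ℕ.+ r)) ≈ E * pow p r * (w * pow π l)
          balance = begin
            A * (p * pow p (r ℕ.+ r)) ≈⟨ *-congˡ (*-congˡ (pow-+ p r r)) ⟩
            A * (p * (pow p r * pow p r)) ≈⟨ *-identityʳ _ ⟨
            A * (p * (pow p r * pow p r)) * 1# ≈⟨ *-congˡ (pow-π-p π AAp≈1 l) ⟨
            A * (p * (pow p r * pow p r)) * (pow π l * pow p l)
              ≈⟨ solve 5 (λ a p x y z → a :* (p :* (x :* x)) :* (y :* z) := x :* z :* (x :* (a :* p :* y))) refl _ _ _ _ _ ⟩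
            pow p r * pow p l * (pow p r * (A * p * pow π l)) ≈⟨ *-congʳ (trans (sym (pow-+ p r l)) (pow≡ p e)) ⟩
            p * pow p m * (pow p r * (A * p * pow π l))
              ≈⟨ solve 5 (λ p e x a z → p :* e :* (x :* (a :* p :* z)) := e :* x :* (a :* p :* p :* z)) refl _ _ _ _ _ ⟩
            E * pow p r * (w * pow π l) ∎

-- Cancellation of sums at a root of unity

module RootOfUnity (R : CommutativeRing 0ℓ 0ℓ) (q : CommutativeRing.Carrier R) where
  open RingOps R

  -- Non-zero-divisors take the place of invertible elements, because dual numbers do not form a
  -- domain.
  Cancellable : Carrier → Set
  Cancellable x = ∀ y → x * y ≈ 0# → y ≈ 0#

  Cancellable-* : ∀ {x y} → Cancellable x → Cancellable y → Cancellable (x * y)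
  Cancellable-* cx cy z e = cy z (cx _ (trans (sym (*-assoc _ _ _)) e))

  Cancellable-unit : ∀ {x} x′ → x * x′ ≈ 1# → Cancellable x
  Cancellable-unit {x} x′ e y h = begin
    y ≈⟨ *-identityˡ y ⟨
    1# * y ≈⟨ *-congʳ e ⟨
    x * x′ * y ≈⟨ solve 3 (λ a b c → a :* b :* c := b :* (a :* c)) refl _ _ _ ⟩
    x′ * (x * y) ≈⟨ trans (*-congˡ h) (zeroʳ x′) ⟩
    0# ∎

  Cancellable-prod : ∀ f n → (∀ k → k ℕ.< n → Cancellable (f k)) → Cancellable (prod f n)
  Cancellable-prod f zero c = Cancellable-unit 1# (*-identityˡ 1#)
  Cancellable-prod f (suc n) c = Cancellable-* (Cancellable-prod f n (λ k k<n → c k (ℕP.m<n⇒m<1+n k<n))) (c n ℕP.≤-refl)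

  cancel : ∀ {x} → Cancellable x → ∀ {y z} → x * y ≈ x * z → y ≈ z
  cancel {x} c {y} {z} e = x-y≈0⇒ (c (y + - z) (begin
    x * (y + - z) ≈⟨ solve 3 (λ x y z → x :* (y :- z) := x :* y :- x :* z) refl _ _ _ ⟩
    x * y + - (x * z) ≈⟨ +-congʳ e ⟩
    x * z + - (x * z) ≈⟨ -‿inverseʳ _ ⟩
    0# ∎))
    where
    x-y≈0⇒ : y + - z ≈ 0# → y ≈ z
    x-y≈0⇒ h = trans (solve 2 (λ y z → y := (y :- z) :+ z) refl _ _) (trans (+-congʳ h) (+-identityˡ z))

  root-cancellable : ∀ {m d} → m ℕ.< d → pow q d ≈ 1# → Cancellable q
  root-cancellable {d = suc d} _ e = Cancellable-unit (pow q d) e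

  -- `c k` is q(1 - q) times (-1)ᵏ[4k-1]q^(k²); this clears the denominators of [4k-1] as a quotient
  -- and of [-1].
  ε c : ℕ → Carrier
  ε = pow (- 1#)
  c k = ε k * (q + - pow q (4 ℕ.* k)) * pow q (k ℕ.* k)

  Recurrent : (α γ f : ℕ → Carrier) → ℕ → Set
  Recurrent α γ f m = ∀ k → k ℕ.< m → f (suc k) * γ k ≈ f k * α k

  -- Stated for abstract α and γ, so that it covers both ℤ[q]/Φ_d and the dual numbers over ℤ[q]/Φₙ.
  -- The pairing is a ↔ M - a with M = (d+1)/2.
  module Vanishing
    (d M : ℕ) (d+1≡2M : suc d ≡ M ℕ.+ M) (M<d : M ℕ.< d)
    (qᵈ≈1 : pow q d ≈ 1#) (two : ∀ y → y + y ≈ 0# → y ≈ 0#)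
    (α γ : ℕ → Carrier)
    (α-periodic : ∀ k → α (d ℕ.+ k) ≈ α k) (γ-periodic : ∀ k → γ (d ℕ.+ k) ≈ γ k)
    (γ-cancellable : ∀ k → suc k ℕ.< d → Cancellable (γ k))
    (α-reflect : ∀ a b → a ℕ.+ suc b ≡ M → α a ≈ - (pow q (10 ℕ.* a) * γ b))
    (α-M : α M ≈ 0#)
    where

    q-cancellable : Cancellable q
    q-cancellable = root-cancellable M<d qᵈ≈1

    pow-cancellable : ∀ k → Cancellable (pow q k)
    pow-cancellable zero = Cancellable-unit 1# (*-identityˡ 1#)
    pow-cancellable (suc k) = Cancellable-* q-cancellable (pow-cancellable k)

    q²ᴹ≈q : pow q (M ℕ.+ M) ≈ q
    q²ᴹ≈q = trans (pow≡ q (≡.sym d+1≡2M)) (trans (*-congˡ qᵈ≈1) (*-identityʳ q))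

    q²ᴹᵏ≈qᵏ : ∀ k → pow q (k ℕ.* (M ℕ.+ M)) ≈ pow q k
    q²ᴹᵏ≈qᵏ k = trans (sym (pow-pow q (M ℕ.+ M) k)) (pow-cong k q²ᴹ≈q)

    -- In closed form τ(a) = q^(5a(a-1)), μ(a) = q^(6a²-5a) and κ(a) = (-1)ᵃτ(a). κ collects the
    -- factors that `α-reflect` produces.
    τ μ κ : ℕ → Carrier
    τ = prod (λ j → pow q (10 ℕ.* j))
    μ a = pow q (a ℕ.* a) * τ a
    κ = prod (λ j → - pow q (10 ℕ.* j))

    εκ≈τ : ∀ a → ε a * κ a ≈ τ a
    εκ≈τ zero = *-identityˡ _
    εκ≈τ (suc a) = trans (solve 3 (λ e k x → :- one :* e :* (k :* (:- x)) := e :* k :* x) refl _ _ _) (*-congʳ (εκ≈τ a))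

    τ-closed : ∀ a → τ a * pow q (5 ℕ.* a) ≈ pow q (5 ℕ.* (a ℕ.* a))
    τ-closed zero = *-identityˡ _
    τ-closed (suc a) = begin
      τ a * pow q (10 ℕ.* a) * pow q (5 ℕ.* suc a) ≈⟨ *-congˡ (trans (pow≡ q (e₁ a)) (pow-+ q (5 ℕ.* a) 5)) ⟩
      τ a * pow q (10 ℕ.* a) * (pow q (5 ℕ.* a) * pow q 5) ≈⟨ solve 4 (λ t x y z → t :* x :* (y :* z) := t :* y :* (x :* z)) refl _ _ _ _ ⟩
      τ a * pow q (5 ℕ.* a) * (pow q (10 ℕ.* a) * pow q 5) ≈⟨ *-cong (τ-closed a) (sym (pow-+ q (10 ℕ.* a) 5)) ⟩
      pow q (5 ℕ.* (a ℕ.* a)) * pow q (10 ℕ.* a ℕ.+ 5) ≈⟨ pow-+ q (5 ℕ.* (a ℕ.* a)) (10 ℕ.* a ℕ.+ 5) ⟨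
      pow q (5 ℕ.* (a ℕ.* a) ℕ.+ (10 ℕ.* a ℕ.+ 5)) ≈⟨ pow≡ q (e₂ a) ⟩
      pow q (5 ℕ.* (suc a ℕ.* suc a)) ∎
      where
      e₁ : ∀ a → 5 ℕ.* suc a ≡ 5 ℕ.* a ℕ.+ 5
      e₁ = solve-∀
      e₂ : ∀ a → 5 ℕ.* (a ℕ.* a) ℕ.+ (10 ℕ.* a ℕ.+ 5) ≡ 5 ℕ.* (suc a ℕ.* suc a)
      e₂ = solve-∀

    μ-closed : ∀ a → μ a * pow q (5 ℕ.* a) ≈ pow q (6 ℕ.* (a ℕ.* a))
    μ-closed a = begin
      pow q (a ℕ.* a) * τ a * pow q (5 ℕ.* a) ≈⟨ *-assoc _ _ _ ⟩
      pow q (a ℕ.* a) * (τ a * pow q (5 ℕ.* a)) ≈⟨ *-congˡ (τ-closed a) ⟩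
      pow q (a ℕ.* a) * pow q (5 ℕ.* (a ℕ.* a)) ≈⟨ pow-+ q (a ℕ.* a) _ ⟨
      pow q (a ℕ.* a ℕ.+ 5 ℕ.* (a ℕ.* a)) ≡⟨⟩
      pow q (6 ℕ.* (a ℕ.* a)) ∎

    -- The multiplier is symmetric in a and b, so it serves both sides of `μ-reflect`. It completes
    -- the exponent 6a² - 5a to 6a(a + b) + 5b, and 6a(a + b) = 3a·2M reduces to 3a because q^(2M) =
    -- q.
    μ-scaled : ∀ a b e → a ℕ.+ b ≡ M →
      pow q (5 ℕ.* a ℕ.+ 5 ℕ.* b ℕ.+ 6 ℕ.* (a ℕ.* b)) * (μ a * pow q e) ≈ pow q (3 ℕ.* a ℕ.+ 5 ℕ.* b ℕ.+ e)
    μ-scaled a b e ≡.refl = begin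
      pow q (5 ℕ.* a ℕ.+ 5 ℕ.* b ℕ.+ 6 ℕ.* (a ℕ.* b)) * (μ a * pow q e)
        ≈⟨ *-congʳ (trans (pow≡ q (ℕP.+-assoc (5 ℕ.* a) _ _)) (pow-+ q (5 ℕ.* a) _)) ⟩
      pow q (5 ℕ.* a) * pow q (5 ℕ.* b ℕ.+ 6 ℕ.* (a ℕ.* b)) * (μ a * pow q e)
        ≈⟨ solve 4 (λ x y m z → x :* y :* (m :* z) := (m :* x) :* (y :* z)) refl _ _ _ _ ⟩
      μ a * pow q (5 ℕ.* a) * (pow q (5 ℕ.* b ℕ.+ 6 ℕ.* (a ℕ.* b)) * pow q e)
        ≈⟨ *-cong (μ-closed a) (sym (pow-+ q (5 ℕ.* b ℕ.+ 6 ℕ.* (a ℕ.* b)) e)) ⟩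
      pow q (6 ℕ.* (a ℕ.* a)) * pow q (5 ℕ.* b ℕ.+ 6 ℕ.* (a ℕ.* b) ℕ.+ e) ≈⟨ pow-+ q (6 ℕ.* (a ℕ.* a)) _ ⟨
      pow q (6 ℕ.* (a ℕ.* a) ℕ.+ (5 ℕ.* b ℕ.+ 6 ℕ.* (a ℕ.* b) ℕ.+ e)) ≈⟨ pow≡ q (e₁ a b e) ⟩
      pow q (3 ℕ.* a ℕ.* (a ℕ.+ b ℕ.+ (a ℕ.+ b)) ℕ.+ (5 ℕ.* b ℕ.+ e)) ≈⟨ pow-+ q (3 ℕ.* a ℕ.* (a ℕ.+ b ℕ.+ (a ℕ.+ b))) _ ⟩
      pow q (3 ℕ.* a ℕ.* (a ℕ.+ b ℕ.+ (a ℕ.+ b))) * pow q (5 ℕ.* b ℕ.+ e) ≈⟨ *-congʳ (q²ᴹᵏ≈qᵏ (3 ℕ.* a)) ⟩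
      pow q (3 ℕ.* a) * pow q (5 ℕ.* b ℕ.+ e) ≈⟨ pow-+ q (3 ℕ.* a) _ ⟨
      pow q (3 ℕ.* a ℕ.+ (5 ℕ.* b ℕ.+ e)) ≈⟨ pow≡ q (≡.sym (ℕP.+-assoc (3 ℕ.* a) _ _)) ⟩
      pow q (3 ℕ.* a ℕ.+ 5 ℕ.* b ℕ.+ e) ∎
      where
      e₁ : ∀ a b e → 6 ℕ.* (a ℕ.* a) ℕ.+ (5 ℕ.* b ℕ.+ 6 ℕ.* (a ℕ.* b) ℕ.+ e) ≡ 3 ℕ.* a ℕ.* (a ℕ.+ b ℕ.+ (a ℕ.+ b)) ℕ.+ (5 ℕ.* b ℕ.+ e)
      e₁ = solve-∀

    μ-reflect : ∀ a b → a ℕ.+ b ≡ M → μ b * q ≈ μ a * pow q (4 ℕ.* a)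
    μ-reflect a b e = cancel (pow-cancellable (5 ℕ.* b ℕ.+ 5 ℕ.* a ℕ.+ 6 ℕ.* (b ℕ.* a))) (begin
      Z * (μ b * q) ≈⟨ *-congˡ (*-congˡ (*-identityʳ q)) ⟨
      Z * (μ b * pow q 1) ≈⟨ μ-scaled b a 1 (≡.trans (ℕP.+-comm b a) e) ⟩
      pow q (3 ℕ.* b ℕ.+ 5 ℕ.* a ℕ.+ 1) ≈⟨ pow-+ q (3 ℕ.* b ℕ.+ 5 ℕ.* a) 1 ⟩
      pow q (3 ℕ.* b ℕ.+ 5 ℕ.* a) * (q * 1#) ≈⟨ *-congˡ (trans (*-identityʳ q) (sym (trans (pow≡ q (≡.cong₂ ℕ._+_ e e)) q²ᴹ≈q))) ⟩
      pow q (3 ℕ.* b ℕ.+ 5 ℕ.* a) * pow q (a ℕ.+ b ℕ.+ (a ℕ.+ b)) ≈⟨ pow-+ q (3 ℕ.* b ℕ.+ 5 ℕ.* a) _ ⟨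
      pow q (3 ℕ.* b ℕ.+ 5 ℕ.* a ℕ.+ (a ℕ.+ b ℕ.+ (a ℕ.+ b))) ≈⟨ pow≡ q (e₁ a b) ⟩
      pow q (3 ℕ.* a ℕ.+ 5 ℕ.* b ℕ.+ 4 ℕ.* a) ≈⟨ μ-scaled a b (4 ℕ.* a) e ⟨
      pow q (5 ℕ.* a ℕ.+ 5 ℕ.* b ℕ.+ 6 ℕ.* (a ℕ.* b)) * (μ a * pow q (4 ℕ.* a)) ≈⟨ *-congʳ (pow≡ q (e₂ a b)) ⟩
      Z * (μ a * pow q (4 ℕ.* a)) ∎)
      where
      Z = pow q (5 ℕ.* b ℕ.+ 5 ℕ.* a ℕ.+ 6 ℕ.* (b ℕ.* a))
      e₁ : ∀ a b → 3 ℕ.* b ℕ.+ 5 ℕ.* a ℕ.+ (a ℕ.+ b ℕ.+ (a ℕ.+ b)) ≡ 3 ℕ.* a ℕ.+ 5 ℕ.* b ℕ.+ 4 ℕ.* a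
      e₁ = solve-∀
      e₂ : ∀ a b → 5 ℕ.* a ℕ.+ 5 ℕ.* b ℕ.+ 6 ℕ.* (a ℕ.* b) ≡ 5 ℕ.* b ℕ.+ 5 ℕ.* a ℕ.+ 6 ℕ.* (b ℕ.* a)
      e₂ = solve-∀

    -- Times q, the left side is μ(a)(q² - q^(4a+4b)) by `μ-reflect`, and q^(4M) = q².
    cκ-antisymmetric : ∀ a b → a ℕ.+ b ≡ M → c a * κ a + c b * κ b ≈ 0#
    cκ-antisymmetric a b e = q-cancellable _ (begin
      q * (c a * κ a + c b * κ b)
        ≈⟨ solve 9 (λ q ea xa ya ka eb xb yb kb →
             q :* (ea :* (q :- xa) :* ya :* ka :+ eb :* (q :- xb) :* yb :* kb) :=
             (q :- xa) :* (ya :* (ea :* ka)) :* q :+ (q :- xb) :* (yb :* (eb :* kb) :* q)) refl _ _ _ _ _ _ _ _ _ ⟩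
      (q + - pow q (4 ℕ.* a)) * (pow q (a ℕ.* a) * (ε a * κ a)) * q + (q + - pow q (4 ℕ.* b)) * (pow q (b ℕ.* b) * (ε b * κ b) * q)
        ≈⟨ +-cong (*-congʳ (*-congˡ (*-congˡ (εκ≈τ a)))) (*-congˡ (trans (*-congʳ (*-congˡ (εκ≈τ b))) (μ-reflect a b e))) ⟩
      (q + - pow q (4 ℕ.* a)) * μ a * q + (q + - pow q (4 ℕ.* b)) * (μ a * pow q (4 ℕ.* a))
        ≈⟨ solve 4 (λ q m x y → (q :- x) :* m :* q :+ (q :- y) :* (m :* x) := m :* (q :* q :- x :* y)) refl _ _ _ _ ⟩
      μ a * (q * q + - (pow q (4 ℕ.* a) * pow q (4 ℕ.* b)))
        ≈⟨ *-congˡ (+-congˡ (-‿cong (trans (sym (pow-+ q (4 ℕ.* a) (4 ℕ.* b))) (trans (pow≡ q e₁) (trans (q²ᴹᵏ≈qᵏ 2) (*-congˡ (*-identityʳ q))))))) ⟩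
      μ a * (q * q + - (q * q)) ≈⟨ trans (*-congˡ (-‿inverseʳ _)) (zeroʳ _) ⟩
      0# ∎)
      where
      e₂ : ∀ a b → 4 ℕ.* a ℕ.+ 4 ℕ.* b ≡ 2 ℕ.* (a ℕ.+ b ℕ.+ (a ℕ.+ b))
      e₂ = solve-∀
      e₁ : 4 ℕ.* a ℕ.+ 4 ℕ.* b ≡ 2 ℕ.* (M ℕ.+ M)
      e₁ = ≡.trans (e₂ a b) (≡.cong (λ k → 2 ℕ.* (k ℕ.+ k)) e)

    Γ : ℕ → Carrier
    Γ = prod γ

    Γ-cancellable : ∀ a → a ℕ.≤ M → Cancellable (Γ a)
    Γ-cancellable a a≤M = Cancellable-prod γ a (λ k k<a → γ-cancellable k (ℕP.≤-<-trans (ℕP.≤-trans k<a a≤M) M<d))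

    -- Reflecting every α gives g(a) = κ(a)g(0)Γ(M)/(Γ(a)Γ(b)), here cleared of division. Apart from
    -- κ(a) this is symmetric in a and b.
    recurrent-closed : ∀ g → Recurrent α γ g M → ∀ a b → a ℕ.+ b ≡ M → g a * (Γ a * Γ b) ≈ κ a * (Γ M * g 0)
    recurrent-closed g rec zero b ≡.refl = solve 2 (λ g x → g :* (one :* x) := one :* (x :* g)) refl _ _
    recurrent-closed g rec (suc a) b e = begin
      g (suc a) * (Γ a * γ a * Γ b) ≈⟨ solve 4 (λ g x y z → g :* (x :* y :* z) := (g :* y) :* (x :* z)) refl _ _ _ _ ⟩
      (g (suc a) * γ a) * (Γ a * Γ b) ≈⟨ *-congʳ (rec a (≡.subst (suc a ℕ.≤_) e (ℕP.m≤m+n (suc a) b))) ⟩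
      (g a * α a) * (Γ a * Γ b) ≈⟨ *-congʳ (*-congˡ (α-reflect a b e′)) ⟩
      (g a * - (pow q (10 ℕ.* a) * γ b)) * (Γ a * Γ b)
        ≈⟨ solve 5 (λ g x y u v → g :* (:- (x :* y)) :* (u :* v) := :- x :* (g :* (u :* (v :* y)))) refl _ _ _ _ _ ⟩
      - pow q (10 ℕ.* a) * (g a * (Γ a * Γ (suc b))) ≈⟨ *-congˡ (recurrent-closed g rec a (suc b) e′) ⟩
      - pow q (10 ℕ.* a) * (κ a * (Γ M * g 0)) ≈⟨ solve 3 (λ x k y → x :* (k :* y) := k :* x :* y) refl _ _ _ ⟩
      κ (suc a) * (Γ M * g 0) ∎
      where
      e′ : a ℕ.+ suc b ≡ M
      e′ = ≡.trans (ℕP.+-suc a b) e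

    -- The sum is added to its own reversal, because for even M the middle term is its own partner;
    -- `two` then halves the result.
    half-block : ∀ g → Recurrent α γ g M → sum (λ k → c k * g k) M ≈ 0#
    half-block g rec = trans (sum≈sumAD _ M) (two _ (begin
      sumAD (λ a _ → c a * g a) M + sumAD (λ a _ → c a * g a) M ≈⟨ +-congˡ (sumAD-flip (λ a _ → c a * g a) M) ⟩
      sumAD (λ a _ → c a * g a) M + sumAD (λ _ b → c b * g b) M ≈⟨ sumAD-+ (λ a _ → c a * g a) (λ _ b → c b * g b) M ⟨
      sumAD (λ a b → c a * g a + c b * g b) M ≈⟨ sumAD-cong M pair ⟩
      sumAD (λ a b → 0# * 0#) M ≈⟨ sumAD-*ˡ 0# (λ a b → 0#) M ⟩
      0# * sumAD (λ a b → 0#) M ≈⟨ zeroˡ _ ⟩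
      0# ∎))
      where
      pair : ∀ a b → a ℕ.+ b ≡ M → c a * g a + c b * g b ≈ 0# * 0#
      pair a b e = trans (Cancellable-* (Γ-cancellable a (≡.subst (a ℕ.≤_) e (ℕP.m≤m+n a b))) (Γ-cancellable b (≡.subst (b ℕ.≤_) e (ℕP.m≤n+m b a))) _ (begin
        Γ a * Γ b * (c a * g a + c b * g b)
          ≈⟨ solve 6 (λ x y c g d h → x :* y :* (c :* g :+ d :* h) := c :* (g :* (x :* y)) :+ d :* (h :* (y :* x))) refl _ _ _ _ _ _ ⟩
        c a * (g a * (Γ a * Γ b)) + c b * (g b * (Γ b * Γ a))
          ≈⟨ +-cong (*-congˡ (recurrent-closed g rec a b e)) (*-congˡ (recurrent-closed g rec b a (≡.trans (ℕP.+-comm b a) e))) ⟩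
        c a * (κ a * (Γ M * g 0)) + c b * (κ b * (Γ M * g 0))
          ≈⟨ solve 5 (λ c k d l x → c :* (k :* x) :+ d :* (l :* x) := (c :* k :+ d :* l) :* x) refl _ _ _ _ _ ⟩
        (c a * κ a + c b * κ b) * (Γ M * g 0) ≈⟨ trans (*-congʳ (cκ-antisymmetric a b e)) (zeroˡ _) ⟩
        0# ∎)) (sym (zeroˡ 0#))

    -- `α M` = 0 kills the term M + 1, and the recurrence carries the zero to the end of the block.
    second-half : ∀ g l → M ℕ.+ suc l ℕ.< d → Recurrent α γ g (M ℕ.+ suc l) → g (M ℕ.+ suc l) ≈ 0#
    second-half g l M+l<d rec = γ-cancellable (M ℕ.+ l) (≡.subst (ℕ._< d) (ℕP.+-suc M l) M+l<d) _ (begin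
      γ (M ℕ.+ l) * g (M ℕ.+ suc l) ≈⟨ trans (*-comm _ _) (*-congʳ (reflexive (≡.cong g (ℕP.+-suc M l)))) ⟩
      g (suc (M ℕ.+ l)) * γ (M ℕ.+ l) ≈⟨ rec (M ℕ.+ l) (ℕP.+-monoʳ-< M (ℕP.n<1+n l)) ⟩
      g (M ℕ.+ l) * α (M ℕ.+ l) ≈⟨ gα≈0 l M+l<d rec ⟩
      0# ∎)
      where
      gα≈0 : ∀ l → M ℕ.+ suc l ℕ.< d → Recurrent α γ g (M ℕ.+ suc l) → g (M ℕ.+ l) * α (M ℕ.+ l) ≈ 0#
      gα≈0 zero _ _ = trans (*-congˡ (trans (reflexive (≡.cong α (ℕP.+-identityʳ M))) α-M)) (zeroʳ _)
      gα≈0 (suc l) lt rec = trans (*-congʳ (second-half g l (ℕP.<-trans (ℕP.+-monoʳ-< M (ℕP.n<1+n (suc l))) lt)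
        (λ k k< → rec k (ℕP.<-trans k< (ℕP.+-monoʳ-< M (ℕP.n<1+n (suc l))))))) (zeroˡ _)

    block : ∀ g l → M ℕ.+ l ℕ.< d → Recurrent α γ g (M ℕ.+ l) → sum (λ k → c k * g k) (M ℕ.+ l) ≈ 0#
    block g zero lt rec = trans (reflexive (≡.cong (sum _) (ℕP.+-identityʳ M))) (half-block g (λ k k< → rec k (≡.subst (k ℕ.<_) (≡.sym (ℕP.+-identityʳ M)) k<)))
    block g (suc l) lt rec = begin
      sum (λ k → c k * g k) (M ℕ.+ suc l) ≡⟨ ≡.cong (sum _) (ℕP.+-suc M l) ⟩
      sum (λ k → c k * g k) (M ℕ.+ l) + c (suc (M ℕ.+ l)) * g (suc (M ℕ.+ l))
        ≈⟨ +-cong (block g l (ℕP.<-trans l< lt) (λ k k< → rec k (ℕP.<-trans k< l<)))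
             (*-congˡ (trans (reflexive (≡.cong g (≡.sym (ℕP.+-suc M l)))) (second-half g l lt rec))) ⟩
      0# + c (suc (M ℕ.+ l)) * 0# ≈⟨ trans (+-identityˡ _) (zeroʳ _) ⟩
      0# ∎
      where
      l< : M ℕ.+ l ℕ.< M ℕ.+ suc l
      l< = ℕP.+-monoʳ-< M (ℕP.n<1+n l)

    pow-periodic : ∀ x k → pow q (x ℕ.* d ℕ.+ k) ≈ pow q k
    pow-periodic x k = trans (pow-+ q (x ℕ.* d) k) (trans (*-congʳ (trans (sym (pow-pow q d x)) (trans (pow-cong x qᵈ≈1) (pow-1# x)))) (*-identityˡ _))

    c-periodic : ∀ k → c (d ℕ.+ k) ≈ ε d * c k
    c-periodic k = begin
      ε (d ℕ.+ k) * (q + - pow q (4 ℕ.* (d ℕ.+ k))) * pow q ((d ℕ.+ k) ℕ.* (d ℕ.+ k))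
        ≈⟨ *-cong (*-cong (pow-+ (- 1#) d k) (+-congˡ (-‿cong (trans (pow≡ q (ℕP.*-distribˡ-+ 4 d k)) (pow-periodic 4 (4 ℕ.* k))))))
             (trans (pow≡ q (e₁ d k)) (pow-periodic (d ℕ.+ 2 ℕ.* k) (k ℕ.* k))) ⟩
      ε d * ε k * (q + - pow q (4 ℕ.* k)) * pow q (k ℕ.* k) ≈⟨ trans (*-congʳ (*-assoc _ _ _)) (*-assoc _ _ _) ⟩
      ε d * c k ∎
      where
      e₁ : ∀ d k → (d ℕ.+ k) ℕ.* (d ℕ.+ k) ≡ (d ℕ.+ 2 ℕ.* k) ℕ.* d ℕ.+ k ℕ.* k
      e₁ = solve-∀

    -- γ is cancellable only before the index d - 1, so the recurrence does not determine f(d) from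
    -- f(d-1): every block is a solution with an initial value of its own. Hence f is arbitrary, and
    -- the induction shifts it by d.
    blocks : ∀ t l f → M ℕ.+ l ℕ.< d → Recurrent α γ f (t ℕ.* d ℕ.+ (M ℕ.+ l)) → sum (λ k → c k * f k) (t ℕ.* d ℕ.+ (M ℕ.+ l)) ≈ 0#
    blocks zero l f lt rec = block f l lt rec
    blocks (suc t) l f lt rec with ℕP.m≤n⇒∃[o]m+o≡n M<d
    ... | o , 1+M+o≡d = begin
      sum (λ k → c k * f k) (d ℕ.+ t ℕ.* d ℕ.+ (M ℕ.+ l)) ≡⟨ ≡.cong (sum _) e₁ ⟩
      sum (λ k → c k * f k) (M ℕ.+ o ℕ.+ suc n) ≈⟨ sum-+ _ (M ℕ.+ o) n ⟩
      sum (λ k → c k * f k) (M ℕ.+ o) + sum (λ k → c (suc (M ℕ.+ o ℕ.+ k)) * f (suc (M ℕ.+ o ℕ.+ k))) n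
        ≈⟨ +-cong (block f o o< (λ k k< → rec k (ℕP.<-≤-trans (ℕP.<-trans k< o<) d≤)))
             (sum-cong n (λ k _ → trans (reflexive (≡.cong (λ j → c (j ℕ.+ k) * f (j ℕ.+ k)) 1+M+o≡d))
               (trans (*-congʳ (c-periodic k)) (*-assoc _ _ _)))) ⟩
      0# + sum (λ k → ε d * (c k * f (d ℕ.+ k))) n ≈⟨ trans (+-identityˡ _) (sum-*ˡ (ε d) _ n) ⟩
      ε d * sum (λ k → c k * f (d ℕ.+ k)) n ≈⟨ *-congˡ (blocks t l (λ k → f (d ℕ.+ k)) lt shifted) ⟩
      ε d * 0# ≈⟨ zeroʳ _ ⟩
      0# ∎
      where
      n = t ℕ.* d ℕ.+ (M ℕ.+ l)
      o< : M ℕ.+ o ℕ.< d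
      o< = ℕP.≤-reflexive 1+M+o≡d
      d≤ : d ℕ.≤ d ℕ.+ t ℕ.* d ℕ.+ (M ℕ.+ l)
      d≤ = ℕP.≤-trans (ℕP.m≤m+n d (t ℕ.* d)) (ℕP.m≤m+n _ _)
      e₁ : d ℕ.+ t ℕ.* d ℕ.+ (M ℕ.+ l) ≡ M ℕ.+ o ℕ.+ suc n
      e₁ = ≡.trans (ℕP.+-assoc d (t ℕ.* d) (M ℕ.+ l)) (≡.trans (≡.cong (ℕ._+ n) (≡.sym 1+M+o≡d)) (≡.sym (ℕP.+-suc (M ℕ.+ o) n)))
      shifted : Recurrent α γ (λ k → f (d ℕ.+ k)) n
      shifted k k<n = begin
        f (d ℕ.+ suc k) * γ k ≈⟨ *-cong (reflexive (≡.cong f (ℕP.+-suc d k))) (sym (γ-periodic k)) ⟩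
        f (suc (d ℕ.+ k)) * γ (d ℕ.+ k) ≈⟨ rec (d ℕ.+ k) (≡.subst (d ℕ.+ k ℕ.<_) (≡.sym (ℕP.+-assoc d (t ℕ.* d) (M ℕ.+ l))) (ℕP.+-monoʳ-< d k<n)) ⟩
        f (d ℕ.+ k) * α (d ℕ.+ k) ≈⟨ *-congˡ (α-periodic k) ⟩
        f (d ℕ.+ k) * α k ∎

-- After multiplication by q(1-q) the two sides of the congruence are Σ c f and κ Σ c′ f′ where
-- f(k+1)/f(k) = α/γ and f′(k+1)/f′(k) = α′/γ′ at (l,x) = (1,0).  The parameter a of the
-- classical proof enters only through x/l = a + 1/a - 2; homogeneity in (l,x) avoids q⁻¹.
module Series {C : Set} (_+_ _*_ : C → C → C) (-_ : C → C) (1# q l x : C) where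
  open Operations _+_ _*_ 1#

  p : C
  p = pow q 2

  -- With x/l = a + 1/a - 2, θ(j) is lq²(1 - aq⁻¹pʲ)(1 - q⁻¹pʲ/a), and the last factor of γ(j) is
  -- l(1 - apʲ⁺¹)(1 - pʲ⁺¹/a). The q's that clear q⁻¹ make up q^(5k) on the left and q^(2k) on the
  -- right, so `c` keeps q^(k²) and `c′` keeps qᵏ. The l in γ′ balances the one in θ.
  θ α γ c α′ γ′ c′ : ℕ → C
  θ j = (l * ((q + (- pow p j)) * (q + (- pow p j)))) + (- (x * (q * pow p j)))
  α j = pow (q + (- pow p j)) 3 * θ j
  γ j = pow (1# + (- pow p (suc j))) 3 *
    ((l * ((1# + (- pow p (suc j))) * (1# + (- pow p (suc j))))) + (- (x * pow p (suc j))))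
  c k = (pow (- 1#) k * (q + (- pow q (4 ℕ.* k)))) * pow q (k ℕ.* k)
  α′ j = θ j * (1# + (- (pow q 3 * pow p j)))
  γ′ j = pow (1# + (- pow p (suc j))) 3 * l
  c′ = pow q

  -- The sum of c(k) times the product of α/γ below k, multiplied by all γ's below m. The Horner
  -- form is free of division.
  clearedSum : (c α γ : ℕ → C) → ℕ → C
  clearedSum c α γ zero = c 0
  clearedSum c α γ (suc m) = (clearedSum c α γ m * γ m) + (c (suc m) * prod α (suc m))

  difference : C → ℕ → ℕ → C
  difference κ m N = (prod γ′ N * clearedSum c α γ m) + (- (κ * (prod γ m * clearedSum c′ α′ γ′ N)))

-- Cleared sums and solutions of their recurrences

module SeriesOver (R : CommutativeRing 0ℓ 0ℓ) (q l x : CommutativeRing.Carrier R) where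
  open RingOps R
  open RootOfUnity R q hiding (c; cancel)
  open Series _+_ _*_ -_ 1# q l x public

  -- `f 0` stays as a factor because the solutions used later are normalised differently.
  clearedSum-recurrent : ∀ c α γ f m → Recurrent α γ f m → f 0 * clearedSum c α γ m ≈ sum (λ k → c k * f k) m * prod γ m
  clearedSum-recurrent c α γ f zero rec = solve 2 (λ f c → f :* c := c :* f :* one) refl _ _
  clearedSum-recurrent c α γ f (suc m) rec = begin
    f 0 * (clearedSum c α γ m * γ m + c (suc m) * (prod α m * α m))
      ≈⟨ solve 6 (λ f s g c a b → f :* (s :* g :+ c :* (a :* b)) := f :* s :* g :+ c :* (f :* (a :* b))) refl _ _ _ _ _ _ ⟩
    f 0 * clearedSum c α γ m * γ m + c (suc m) * (f 0 * prod α (suc m))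
      ≈⟨ +-cong (*-congʳ (clearedSum-recurrent c α γ f m (λ k k< → rec k (ℕP.m<n⇒m<1+n k<)))) (*-congˡ (closed (suc m) rec)) ⟩
    sum (λ k → c k * f k) m * prod γ m * γ m + c (suc m) * (f (suc m) * prod γ (suc m))
      ≈⟨ solve 5 (λ s g h c f → s :* g :* h :+ c :* (f :* (g :* h)) := (s :+ c :* f) :* (g :* h)) refl _ _ _ _ _ ⟩
    sum (λ k → c k * f k) (suc m) * prod γ (suc m) ∎
    where
    closed : ∀ m → Recurrent α γ f m → f 0 * prod α m ≈ f m * prod γ m
    closed zero rec = refl
    closed (suc m) rec = begin
      f 0 * (prod α m * α m) ≈⟨ *-assoc _ _ _ ⟨
      f 0 * prod α m * α m ≈⟨ *-congʳ (closed m (λ k k< → rec k (ℕP.m<n⇒m<1+n k<))) ⟩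
      f m * prod γ m * α m ≈⟨ solve 3 (λ f g a → f :* g :* a := (f :* a) :* g) refl _ _ _ ⟩
      (f m * α m) * prod γ m ≈⟨ *-congʳ (rec m ℕP.≤-refl) ⟨
      (f (suc m) * γ m) * prod γ m ≈⟨ solve 3 (λ f a g → f :* a :* g := f :* (g :* a)) refl _ _ _ ⟩
      f (suc m) * prod γ (suc m) ∎

  -- Every product of α's beyond N contains `α N`, so a longer sum only gains factors γ. One
  -- identity thus serves every upper limit from (n+1)/2 on.
  clearedSum-stop : ∀ c α γ N k → α N ≈ 0# → clearedSum c α γ (N ℕ.+ k) ≈ clearedSum c α γ N * prod (λ j → γ (N ℕ.+ j)) k
  clearedSum-stop c α γ N zero αN rewrite ℕP.+-identityʳ N = sym (*-identityʳ _)
  clearedSum-stop c α γ N (suc k) αN rewrite ℕP.+-suc N k = begin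
    clearedSum c α γ (N ℕ.+ k) * γ (N ℕ.+ k) + c (suc (N ℕ.+ k)) * prod α (suc (N ℕ.+ k))
      ≈⟨ trans (+-congˡ (trans (*-congˡ (prodα≈0 k)) (zeroʳ _))) (+-identityʳ _) ⟩
    clearedSum c α γ (N ℕ.+ k) * γ (N ℕ.+ k) ≈⟨ *-congʳ (clearedSum-stop c α γ N k αN) ⟩
    clearedSum c α γ N * prod (λ j → γ (N ℕ.+ j)) k * γ (N ℕ.+ k) ≈⟨ *-assoc _ _ _ ⟩
    clearedSum c α γ N * prod (λ j → γ (N ℕ.+ j)) (suc k) ∎
    where
    prodα≈0 : ∀ k → prod α (suc (N ℕ.+ k)) ≈ 0#
    prodα≈0 zero rewrite ℕP.+-identityʳ N = trans (*-congˡ αN) (zeroʳ _)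
    prodα≈0 (suc k) rewrite ℕP.+-suc N k = trans (*-congʳ (prodα≈0 k)) (zeroˡ _)

-- The exact identity at a = qⁿ

module ExactIdentity (R : CommutativeRing 0ℓ 0ℓ) (q q⁻¹ : CommutativeRing.Carrier R) where
  open RingOps R
  open RootOfUnity R q using (Recurrent)

  module _ (qq⁻¹≈1 : q * q⁻¹ ≈ 1#) (ν : ℕ → Carrier) (ν-inv : ∀ k → ν k * (1# + - pow q (suc k)) ≈ 1#) (M : ℕ) where

    private
      N n : ℕ
      N = suc M
      n = suc (M ℕ.+ M)
      -- This is a = qⁿ, since (1 - qⁿ)²/qⁿ = a + 1/a - 2.
      l x : Carrier
      l = pow q n
      x = (1# + - l) * (1# + - l)

    open SeriesOver R q l x
    open QSeries R p

    private
      A : Carrier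
      A = q⁻¹

      pow-p : ∀ j → pow p j ≈ pow q (j ℕ.+ j)
      pow-p j = trans (pow-pow q 2 j) (pow≡ q (e j))
        where
        e : ∀ j → j ℕ.* 2 ≡ j ℕ.+ j
        e = solve-∀

      ι : ℕ → Carrier
      ι k = ν (suc (k ℕ.+ k))

      ι-inv : ∀ k → ι k * (1# + - pow p (suc k)) ≈ 1#
      ι-inv k = trans (*-congˡ (+-congˡ (-‿cong (trans (pow-p (suc k)) (pow≡ q (≡.cong suc (ℕP.+-suc k k))))))) (ν-inv (suc (k ℕ.+ k)))

      AAp≈1 : A * A * p ≈ 1#
      AAp≈1 = trans (solve 2 (λ a q → a :* a :* (q :* (q :* one)) := (q :* a) :* (q :* a)) refl _ _) (trans (*-cong qq⁻¹≈1 qq⁻¹≈1) (*-identityˡ 1#))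

      Ap≈q : A * p ≈ q
      Ap≈q = trans (solve 2 (λ a q → a :* (q :* (q :* one)) := (q :* a) :* q) refl _ _) (trans (*-congʳ qq⁻¹≈1) (*-identityˡ q))

      Ap^ : ∀ j → A * pow p (suc j) ≈ pow q (suc (j ℕ.+ j))
      Ap^ j = trans (sym (*-assoc _ _ _)) (*-cong Ap≈q (pow-p j))

      j⁻¹ : ℕ → Carrier
      -- 1/(1 - q⁻¹) = -q/(1 - q); the later factors have positive exponents.
      j⁻¹ zero = - (q * ν 0)
      j⁻¹ (suc k) = ν (k ℕ.+ k)

      j-inv : ∀ k → j⁻¹ k * (1# + - (A * pow p k)) ≈ 1#
      j-inv zero = begin
        - (q * ν 0) * (1# + - (A * 1#)) ≈⟨ solve 3 (λ q v a → :- (q :* v) :* (one :- a :* one) := v :* (q :* a :- q :* one)) refl _ _ _ ⟩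
        ν 0 * (q * A + - (q * 1#)) ≈⟨ *-congˡ (+-congʳ qq⁻¹≈1) ⟩
        ν 0 * (1# + - (q * 1#)) ≈⟨ ν-inv 0 ⟩
        1# ∎
      j-inv (suc k) = trans (*-congˡ (+-congˡ (-‿cong (Ap^ k)))) (ν-inv (k ℕ.+ k))

      J : ℕ → Carrier
      J = prod j⁻¹

      J-inv : ∀ k → J k * P A k ≈ 1#
      J-inv k = trans (sym (prod-* j⁻¹ _ k)) (trans (prod-cong k (λ j _ → j-inv j)) (trans (prod-const 1# k) (pow-1# k)))

    open Inverses ι ι-inv hiding (w; π)

    private
      w π E : Carrier
      w = A * p * p
      π = A * A
      E = pow p M

      w≈q³ : w ≈ pow q 3
      w≈q³ = trans (*-congʳ Ap≈q) refl

      -- l = q²ᴺ⁻¹ seen through the parameters E = pᴺ⁻¹ and pᴺ⁻ᴺ = πᴺ of Watson's formula.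
      lq≈pᴺ : l * q ≈ pow p N
      lq≈pᴺ = trans (*-comm _ _) (trans (pow≡ q (≡.cong suc (≡.sym (ℕP.+-suc M M)))) (sym (pow-p N)))

      l≈qE : l ≈ q * E
      l≈qE = *-congˡ (sym (pow-p M))

      lwπ : ∀ r t → r ℕ.+ t ≡ N → l * (w * pow π t) ≈ pow p (suc r)
      lwπ r t e = begin
        l * (w * pow π t) ≈⟨ *-congˡ (*-congʳ (*-congʳ Ap≈q)) ⟩
        l * (q * p * pow π t) ≈⟨ solve 4 (λ l q p x → l :* (q :* p :* x) := l :* q :* (p :* x)) refl _ _ _ _ ⟩
        l * q * (p * pow π t) ≈⟨ *-congʳ (trans lq≈pᴺ (trans (pow≡ p (≡.sym e)) (pow-+ p r t))) ⟩
        pow p r * pow p t * (p * pow π t) ≈⟨ solve 4 (λ x y p z → x :* y :* (p :* z) := p :* x :* (z :* y)) refl _ _ _ _ ⟩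
        pow p (suc r) * (pow π t * pow p t) ≈⟨ trans (*-congˡ (pow-π-p π AAp≈1 t)) (*-identityʳ _) ⟩
        pow p (suc r) ∎

      u : ℕ → Carrier
      u r = (1# + - (E * pow p r)) * (1# + - (pow π N * pow p r))

      -- At x = (1 - l)² the quadratic splits as (lq - y)(q - ly) with y = pʳ. As l = q^(2N-1),
      -- these become the factors of (p⁻ᴺ;p) and (pᴺ⁻¹;p); one vanishes at r = N and ends the sum.
      θ-factored : ∀ r → θ r ≈ l * pow q 2 * u r
      θ-factored r = begin
        l * ((q + - pow p r) * (q + - pow p r)) + - ((1# + - l) * (1# + - l) * (q * pow p r))
          ≈⟨ solve 3 (λ l q y → l :* ((q :- y) :* (q :- y)) :- (one :- l) :* (one :- l) :* (q :* y) := (l :* q :- y) :* (q :- l :* y)) refl _ _ _ ⟩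
        (l * q + - pow p r) * (q + - (l * pow p r))
          ≈⟨ *-cong (+-congˡ (-‿cong (sym y≈))) (+-congˡ (-‿cong (*-congʳ l≈qE))) ⟩
        (l * q + - (l * q * (pow π N * pow p r))) * (q + - (q * E * pow p r))
          ≈⟨ solve 5 (λ l q z e y → (l :* q :- l :* q :* (z :* y)) :* (q :- q :* e :* y) := l :* (q :* (q :* one)) :* ((one :- e :* y) :* (one :- z :* y))) refl _ _ _ _ _ ⟩
        l * pow q 2 * u r ∎
        where
        y≈ : l * q * (pow π N * pow p r) ≈ pow p r
        y≈ = begin
          l * q * (pow π N * pow p r) ≈⟨ *-congʳ lq≈pᴺ ⟩
          pow p N * (pow π N * pow p r) ≈⟨ solve 3 (λ a b c → a :* (b :* c) := (b :* a) :* c) refl _ _ _ ⟩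
          pow π N * pow p N * pow p r ≈⟨ trans (*-congʳ (pow-π-p π AAp≈1 N)) (*-identityˡ _) ⟩
          pow p r ∎

      ι³γ : ∀ r → ι r * ι r * ι r * pow (1# + - pow p (suc r)) 3 ≈ 1#
      ι³γ r = begin
        ι r * ι r * ι r * pow (1# + - pow p (suc r)) 3
          ≈⟨ solve 2 (λ i y → i :* i :* i :* (y :* (y :* (y :* one))) := i :* y :* (i :* y) :* (i :* y)) refl _ _ ⟩
        ι r * (1# + - pow p (suc r)) * (ι r * (1# + - pow p (suc r))) * (ι r * (1# + - pow p (suc r)))
          ≈⟨ *-cong (*-cong (ι-inv r) (ι-inv r)) (ι-inv r) ⟩
        1# * 1# * 1# ≈⟨ trans (*-congʳ (*-identityˡ 1#)) (*-identityˡ 1#) ⟩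
        1# ∎

      -- Here the splitting is (1 - ly)(l - y) with y = p^(r+1). The two factors match the change of
      -- J and of P (w πᵗ) t in `f`.
      γ-factored : ∀ r t → r ℕ.+ t ≡ N →
        γ r ≈ pow (1# + - pow p (suc r)) 3 * (l * ((1# + - (A * pow p (suc (N ℕ.+ r)))) * (1# + - (w * pow π t))))
      γ-factored r t e = *-congˡ (begin
        l * ((1# + - pow p (suc r)) * (1# + - pow p (suc r))) + - ((1# + - l) * (1# + - l) * pow p (suc r))
          ≈⟨ solve 2 (λ l y → l :* ((one :- y) :* (one :- y)) :- (one :- l) :* (one :- l) :* y := (one :- l :* y) :* (l :- y)) refl _ _ ⟩
        (1# + - (l * pow p (suc r))) * (l + - pow p (suc r))
          ≈⟨ *-cong (+-congˡ (-‿cong ly)) (+-congˡ (-‿cong (sym (lwπ r t e)))) ⟩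
        (1# + - (A * pow p (suc (N ℕ.+ r)))) * (l + - (l * (w * pow π t)))
          ≈⟨ solve 3 (λ a l z → a :* (l :- l :* z) := l :* (a :* (one :- z))) refl _ _ _ ⟩
        l * ((1# + - (A * pow p (suc (N ℕ.+ r)))) * (1# + - (w * pow π t))) ∎)
        where
        ly : l * pow p (suc r) ≈ A * pow p (suc (N ℕ.+ r))
        ly = trans (*-cong l≈qE refl) (trans (*-congʳ (*-congʳ (sym Ap≈q)))
          (trans (solve 4 (λ a p e y → a :* p :* e :* (p :* y) := a :* (p :* (p :* (e :* y)))) refl _ _ _ _)
            (*-congˡ (*-congˡ (*-congˡ (sym (pow-+ p M r)))))))

      -- The summands of the two sides of `watson` with the weights `c` and `c′` taken out, on the
      -- side of `f` up to a factor q. f′(0) is 1, whereas f(0) is a product evaluated in `κf₀≈q`.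
      f f′ : ℕ → Carrier
      f r = pow q⁻¹ r * pow w r * pow w r * P E r * P (pow π N) r * (i r * i r * i r) * (P A r * P A r * P A r)
        * J (suc (N ℕ.+ r)) * P (w * pow π (N ℕ.∸ r)) (N ℕ.∸ r)
      f′ k = pow q⁻¹ k * pow w k * P E k * P (pow π N) k * (i k * i k * i k) * P w k

      f-recurrent : Recurrent α γ f N
      f-recurrent r r<N with N ℕ.∸ r | ℕP.m+[n∸m]≡n (ℕP.<⇒≤ r<N) | N ℕ.∸ suc r | ℕP.m+[n∸m]≡n r<N
      ... | t | r+t≡N | s | r+s≡N with ℕP.+-cancelˡ-≡ r t (suc s) (≡.trans r+t≡N (≡.trans (≡.sym r+s≡N) (≡.sym (ℕP.+-suc r s))))
      ... | ≡.refl = begin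
        q⁻¹ * pow q⁻¹ r * (w * pow w r) * (w * pow w r) * (P E r * (1# + - (E * pow p r))) * (P (pow π N) r * (1# + - (pow π N * pow p r)))
          * (i r * ι r * (i r * ι r) * (i r * ι r)) * (P A r * a * (P A r * a) * (P A r * a)) * J (suc (N ℕ.+ suc r)) * P (w * pow π s) s * γ r
          ≈⟨ *-cong (*-congʳ (*-congˡ (reflexive (≡.cong (λ k → J (suc k)) (ℕP.+-suc N r))))) (γ-factored r (suc s) r+t≡N) ⟩
        q⁻¹ * pow q⁻¹ r * (w * pow w r) * (w * pow w r) * (P E r * (1# + - (E * pow p r))) * (P (pow π N) r * (1# + - (pow π N * pow p r)))
          * (i r * ι r * (i r * ι r) * (i r * ι r)) * (P A r * a * (P A r * a) * (P A r * a)) * (J (suc (N ℕ.+ r)) * j⁻¹ (suc (N ℕ.+ r))) * P (w * pow π s) s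
          * (pow (1# + - pow p (suc r)) 3 * (l * ((1# + - (A * pow p (suc (N ℕ.+ r)))) * (1# + - (w * pow π (suc s))))))
          ≈⟨ solve* 19 (λ q′ qr w wr pe e pπ z ir ιr pa a j j′ pw g l ja wl →
               q′ • qr • (w • wr) • (w • wr) • (pe • e) • (pπ • z) • (ir • ιr • (ir • ιr) • (ir • ιr)) • (pa • a • (pa • a) • (pa • a)) • (j • j′) • pw • (g • (l • (ja • wl))) ≐
               (ιr • ιr • ιr • g) • (j′ • ja) • (q′ • w • w) • (qr • wr • wr • pe • pπ • (ir • ir • ir) • (pa • pa • pa) • j • (wl • pw) • (a • a • a • (l • (e • z))))) refl
               _ _ _ _ _ _ _ _ _ _ _ _ _ _ _ _ _ _ _ ⟩
        (ι r * ι r * ι r * pow (1# + - pow p (suc r)) 3) * (j⁻¹ (suc (N ℕ.+ r)) * (1# + - (A * pow p (suc (N ℕ.+ r))))) * (q⁻¹ * w * w)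
          * (pow q⁻¹ r * pow w r * pow w r * P E r * P (pow π N) r * (i r * i r * i r) * (P A r * P A r * P A r) * J (suc (N ℕ.+ r))
            * ((1# + - (w * pow π (suc s))) * P (w * pow π s) s) * (a * a * a * (l * u r)))
          ≈⟨ *-cong (*-cong (trans (*-cong (ι³γ r) (j-inv (suc (N ℕ.+ r)))) (*-identityˡ 1#)) qww) (*-congʳ (*-congˡ (sym P-w))) ⟩
        1# * pow q 5 * (pow q⁻¹ r * pow w r * pow w r * P E r * P (pow π N) r * (i r * i r * i r) * (P A r * P A r * P A r) * J (suc (N ℕ.+ r))
            * P (w * pow π (suc s)) (suc s) * (a * a * a * (l * u r)))
          ≈⟨ solve 5 (λ q f a l u → one :* (q :* (q :* (q :* (q :* (q :* one))))) :* (f :* (a :* a :* a :* (l :* u))) :=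
               f :* ((q :* a) :* ((q :* a) :* ((q :* a) :* one)) :* (l :* (q :* (q :* one)) :* u))) refl _ _ _ _ _ ⟩
        pow q⁻¹ r * pow w r * pow w r * P E r * P (pow π N) r * (i r * i r * i r) * (P A r * P A r * P A r) * J (suc (N ℕ.+ r))
            * P (w * pow π (suc s)) (suc s) * (pow (q * a) 3 * (l * pow q 2 * u r))
          ≈⟨ *-congˡ (*-cong (pow-cong 3 qa) (sym (θ-factored r))) ⟩
        pow q⁻¹ r * pow w r * pow w r * P E r * P (pow π N) r * (i r * i r * i r) * (P A r * P A r * P A r) * J (suc (N ℕ.+ r))
            * P (w * pow π (suc s)) (suc s) * α r ∎
        where
        a = 1# + - (A * pow p r)
        qa : q * a ≈ q + - pow p r
        qa = trans (solve 3 (λ q a y → q :* (one :- a :* y) := q :- (q :* a) :* y) refl _ _ _) (+-congˡ (-‿cong (trans (*-congʳ qq⁻¹≈1) (*-identityˡ _))))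
        qww : q⁻¹ * w * w ≈ pow q 5
        qww = trans (*-cong (*-congˡ w≈q³) w≈q³)
          (trans (solve 2 (λ a q → a :* (q :* (q :* (q :* one))) :* (q :* (q :* (q :* one))) := (q :* a) :* (q :* (q :* (q :* (q :* (q :* one)))))) refl _ _) (trans (*-congʳ qq⁻¹≈1) (*-identityˡ _)))
        P-w : P (w * pow π (suc s)) (suc s) ≈ (1# + - (w * pow π (suc s))) * P (w * pow π s) s
        P-w = trans (P-head _ s) (*-congˡ (P-cong s (trans (solve 4 (λ w π x p → w :* (π :* x) :* p := w :* x :* (π :* p)) refl _ _ _ _)
          (trans (*-congˡ AAp≈1) (*-identityʳ _)))))

      f′-recurrent : Recurrent α′ γ′ f′ N
      f′-recurrent k _ = begin
        q⁻¹ * pow q⁻¹ k * (w * pow w k) * (P E k * (1# + - (E * pow p k))) * (P (pow π N) k * (1# + - (pow π N * pow p k)))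
          * (i k * ι k * (i k * ι k) * (i k * ι k)) * (P w k * (1# + - (w * pow p k))) * (pow (1# + - pow p (suc k)) 3 * l)
          ≈⟨ solve* 13 (λ q′ qr w wr pe e pπ z ir ιr pw g l →
               q′ • qr • (w • wr) • (pe • e) • (pπ • z) • (ir • ιr • (ir • ιr) • (ir • ιr)) • pw • (g • l) ≐
               (ιr • ιr • ιr • g) • (q′ • w) • (qr • wr • pe • pπ • (ir • ir • ir) • pw • (l • (e • z)))) refl
               _ _ _ _ _ _ _ _ _ _ _ _ _ ⟩
        (ι k * ι k * ι k * pow (1# + - pow p (suc k)) 3) * (q⁻¹ * w)
          * (pow q⁻¹ k * pow w k * P E k * P (pow π N) k * (i k * i k * i k) * (P w k * (1# + - (w * pow p k))) * (l * u k))
          ≈⟨ *-cong (*-cong (ι³γ k) qw) (*-congʳ (*-congˡ (*-congˡ (+-congˡ (-‿cong (*-congʳ w≈q³)))))) ⟩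
        1# * pow q 2 * (pow q⁻¹ k * pow w k * P E k * P (pow π N) k * (i k * i k * i k) * (P w k * (1# + - (pow q 3 * pow p k))) * (l * u k))
          ≈⟨ solve 6 (λ q f p w l u → one :* q :* (f :* (p :* w) :* (l :* u)) := f :* p :* (l :* q :* u :* w)) refl _ _ _ _ _ _ ⟩
        f′ k * (l * pow q 2 * u k * (1# + - (pow q 3 * pow p k))) ≈⟨ *-congˡ (*-congʳ (sym (θ-factored k))) ⟩
        f′ k * α′ k ∎
        where
        qw : q⁻¹ * w ≈ pow q 2
        qw = trans (*-congˡ w≈q³) (trans (solve 2 (λ a q → a :* (q :* (q :* (q :* one))) := (q :* a) :* (q :* (q :* one))) refl _ _) (trans (*-congʳ qq⁻¹≈1) (*-identityˡ _)))

      Odd : ℕ → Carrier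
      Odd = prod (λ j → 1# + - pow q (suc (j ℕ.+ j)))

      sg-ε : ∀ r → sg r * pow q r ≈ pow (- 1#) r * pow q (r ℕ.* r)
      sg-ε zero = refl
      sg-ε (suc r) = begin
        - (pow p r) * sg r * (q * pow q r) ≈⟨ solve 4 (λ x s q y → :- x :* s :* (q :* y) := :- (x :* q) :* (s :* y)) refl _ _ _ _ ⟩
        - (pow p r * q) * (sg r * pow q r) ≈⟨ *-cong (-‿cong (trans (*-comm _ _) (*-congˡ (pow-p r)))) (sg-ε r) ⟩
        - pow q (suc (r ℕ.+ r)) * (pow (- 1#) r * pow q (r ℕ.* r)) ≈⟨ solve 3 (λ x e y → :- x :* (e :* y) := :- one :* e :* (x :* y)) refl _ _ _ ⟩
        - 1# * pow (- 1#) r * (pow q (suc (r ℕ.+ r)) * pow q (r ℕ.* r)) ≈⟨ *-congˡ (trans (sym (pow-+ q (suc (r ℕ.+ r)) (r ℕ.* r))) (pow≡ q (e r))) ⟩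
        pow (- 1#) (suc r) * pow q (suc r ℕ.* suc r) ∎
        where
        e : ∀ r → suc (r ℕ.+ r) ℕ.+ r ℕ.* r ≡ suc r ℕ.* suc r
        e = solve-∀

      pow-qq⁻¹ : ∀ r → pow q r * pow q⁻¹ r ≈ 1#
      pow-qq⁻¹ r = trans (sym (pow-* q q⁻¹ r)) (trans (pow-cong r qq⁻¹≈1) (pow-1# r))

      W : Carrier
      W = sumAD (λ k t → pow w k * P E k * P (pow π N) k * β A AAp≈1 J J-inv k) N

      sum-cf : sum (λ k → c k * f k) N ≈ q * W
      sum-cf = begin
        sum (λ k → c k * f k) N ≈⟨ sum≈sumAD _ N ⟩
        sumAD (λ r t → c r * f r) N ≈⟨ sumAD-cong N term ⟩
        sumAD (λ r t → q * T r t) N ≈⟨ sumAD-*ˡ q T N ⟩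
        q * sumAD T N ≈⟨ *-congˡ (watson A AAp≈1 J J-inv M) ⟨
        q * W ∎
        where
        T : ℕ → ℕ → Carrier
        T r t = pow w r * P E r * P (pow π N) r * G A AAp≈1 J J-inv r * J (suc (N ℕ.+ r)) * P (w * pow π t) t
        term : ∀ r t → r ℕ.+ t ≡ N → c r * f r ≈ q * T r t
        term r t e with N ℕ.∸ r | ≡.trans (≡.cong (ℕ._∸ r) (≡.sym e)) (ℕP.m+n∸m≡n r t)
        ... | _ | ≡.refl = begin
          pow (- 1#) r * (q + - pow q (4 ℕ.* r)) * pow q (r ℕ.* r) * (pow q⁻¹ r * pow w r * pow w r * P E r * P (pow π N) r * (i r * i r * i r) * (P A r * P A r * P A r)
              * J (suc (N ℕ.+ r)) * P (w * pow π t) t)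
            ≈⟨ solve* 11 (λ e z y q′ w pe pπ ir pa j pw → e • z • y • (q′ • w • w • pe • pπ • ir • pa • j • pw) ≐
                 z • (e • y • q′) • (w • pe • pπ • (ir • pa • w) • j • pw)) refl _ _ _ _ _ _ _ _ _ _ _ ⟩
          (q + - pow q (4 ℕ.* r)) * (pow (- 1#) r * pow q (r ℕ.* r) * pow q⁻¹ r) * (pow w r * P E r * P (pow π N) r * (i r * i r * i r * (P A r * P A r * P A r) * pow w r) * J (suc (N ℕ.+ r)) * P (w * pow π t) t)
            ≈⟨ *-congʳ (*-cong q-q⁴ʳ (trans (*-congʳ (sym (sg-ε r))) (trans (*-assoc _ _ _) (trans (*-congˡ (pow-qq⁻¹ r)) (*-identityʳ _))))) ⟩
          q * (1# + - (A * pow p (r ℕ.+ r))) * sg r * (pow w r * P E r * P (pow π N) r * (i r * i r * i r * (P A r * P A r * P A r) * pow w r) * J (suc (N ℕ.+ r)) * P (w * pow π t) t)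
            ≈⟨ solve* 10 (λ q z s w pe pπ ir pa j pw → q • z • s • (w • pe • pπ • (ir • pa • w) • j • pw) ≐
                 q • (w • pe • pπ • (ir • s • pa • w • z) • j • pw)) refl _ _ _ _ _ _ _ _ _ _ ⟩
          q * T r t ∎
          where
          e₄ : ∀ r → 4 ℕ.* r ≡ r ℕ.+ r ℕ.+ (r ℕ.+ r)
          e₄ = solve-∀
          q-q⁴ʳ : q + - pow q (4 ℕ.* r) ≈ q * (1# + - (A * pow p (r ℕ.+ r)))
          q-q⁴ʳ = sym (trans (solve 3 (λ q a y → q :* (one :- a :* y) := q :- q :* a :* y) refl _ _ _)
            (+-congˡ (-‿cong (trans (*-cong qq⁻¹≈1 (trans (pow-p (r ℕ.+ r)) (pow≡ q (≡.sym (e₄ r))))) (*-identityˡ _)))))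

      sum-c′f′ : sum (λ k → c′ k * f′ k) N ≈ W
      sum-c′f′ = trans (sum≈sumAD _ N) (sumAD-cong N (λ k t _ → begin
        pow q k * (pow q⁻¹ k * pow w k * P E k * P (pow π N) k * (i k * i k * i k) * P w k)
          ≈⟨ solve 7 (λ q q′ w e z i pw → q :* (q′ :* w :* e :* z :* i :* pw) := q :* q′ :* (w :* e :* z :* (i :* pw))) refl _ _ _ _ _ _ _ ⟩
        pow q k * pow q⁻¹ k * (pow w k * P E k * P (pow π N) k * (i k * i k * i k * P w k)) ≈⟨ trans (*-congʳ (pow-qq⁻¹ k)) (*-identityˡ _) ⟩
        pow w k * P E k * P (pow π N) k * (i k * i k * i k * P w k) ∎))

      -- The factors on the left are 1 - q and 1 - q^(-(2i+1)) for i < m; making the exponents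
      -- positive costs (-1)ᵐ q^(-m²). This is the source of the power of -q in the theorem.
      P-wπ : ∀ m → P (w * pow π (suc m)) (suc m) * pow (- q) (m ℕ.* m) ≈ (1# + - q) * Odd m
      P-wπ zero = trans (*-congʳ (*-congˡ (+-congˡ (-‿cong wπ≈q)))) (solve 1 (λ q → one :* (one :- q) :* one := (one :- q) :* one) refl _)
        where
        wπ≈q : w * (π * 1#) * 1# ≈ q
        wπ≈q = trans (solve 2 (λ a p → a :* p :* p :* (a :* a :* one) :* one := (a :* a :* p) :* (a :* p)) refl _ _) (trans (*-cong AAp≈1 Ap≈q) (*-identityˡ q))
      P-wπ (suc m) = begin
        P (w * pow π (suc (suc m))) (suc (suc m)) * pow (- q) (suc m ℕ.* suc m)
          ≈⟨ *-cong (trans (P-head _ (suc m)) (*-congˡ (P-cong (suc m) (trans (solve 4 (λ w π x p → w :* (π :* x) :* p := w :* x :* (π :* p)) refl _ _ _ _) (trans (*-congˡ AAp≈1) (*-identityʳ _))))))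
               (trans (pow≡ (- q) (e₁ m)) (pow-+ (- q) (suc (m ℕ.+ m)) (m ℕ.* m))) ⟩
        (1# + - (w * pow π (suc (suc m)))) * P (w * pow π (suc m)) (suc m) * (pow (- q) (suc (m ℕ.+ m)) * pow (- q) (m ℕ.* m))
          ≈⟨ solve 4 (λ a b c d → a :* b :* (c :* d) := a :* c :* (b :* d)) refl _ _ _ _ ⟩
        (1# + - (w * pow π (suc (suc m)))) * pow (- q) (suc (m ℕ.+ m)) * (P (w * pow π (suc m)) (suc m) * pow (- q) (m ℕ.* m))
          ≈⟨ *-cong factor (P-wπ m) ⟩
        (1# + - pow q (suc (m ℕ.+ m))) * ((1# + - q) * Odd m) ≈⟨ solve 3 (λ a b c → a :* (b :* c) := b :* (c :* a)) refl _ _ _ ⟩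
        (1# + - q) * Odd (suc m) ∎
        where
        e₁ : ∀ m → suc m ℕ.* suc m ≡ suc (m ℕ.+ m) ℕ.+ m ℕ.* m
        e₁ = solve-∀
        pow-neg : pow (- q) (suc (m ℕ.+ m)) ≈ - pow q (suc (m ℕ.+ m))
        pow-neg = begin
          - q * pow (- q) (m ℕ.+ m) ≈⟨ *-congˡ (pow-+ (- q) m m) ⟩
          - q * (pow (- q) m * pow (- q) m) ≈⟨ *-congˡ (sym (pow-* (- q) (- q) m)) ⟩
          - q * pow (- q * - q) m ≈⟨ *-congˡ (trans (pow-cong m (solve 1 (λ q → :- q :* :- q := q :* (q :* one)) refl q)) (pow-p m)) ⟩
          - q * pow q (m ℕ.+ m) ≈⟨ sym (-‿distribˡ-* _ _) ⟩
          - pow q (suc (m ℕ.+ m)) ∎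
        factor : (1# + - (w * pow π (suc (suc m)))) * pow (- q) (suc (m ℕ.+ m)) ≈ 1# + - pow q (suc (m ℕ.+ m))
        factor = begin
          (1# + - (A * p * p * (π * (π * pow π m)))) * pow (- q) (suc (m ℕ.+ m)) ≈⟨ *-congˡ pow-neg ⟩
          (1# + - (A * p * p * (π * (π * pow π m)))) * - pow q (suc (m ℕ.+ m))
            ≈⟨ solve 5 (λ a p π x y → (one :- a :* p :* p :* (π :* (π :* x))) :* :- y := (π :* p) :* (π :* p) :* (a :* (x :* y)) :- y) refl _ _ _ _ _ ⟩
          (π * p) * (π * p) * (A * (pow π m * pow q (suc (m ℕ.+ m)))) + - pow q (suc (m ℕ.+ m))
            ≈⟨ +-congʳ (trans (*-cong (trans (*-cong AAp≈1 AAp≈1) (*-identityˡ 1#)) (trans (solve 4 (λ a x q y → a :* (x :* (q :* y)) := (q :* a) :* (x :* y)) refl _ _ _ _)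
                 (*-cong qq⁻¹≈1 (trans (*-congˡ (sym (pow-p m))) (pow-π-p π AAp≈1 m))))) (trans (*-identityˡ _) (*-identityˡ _))) ⟩
          1# + - pow q (suc (m ℕ.+ m)) ∎

      P-A : - q * P A (suc N) ≈ (1# + - q) * Odd N
      P-A = begin
        - q * P A (suc N) ≈⟨ *-congˡ (P-head A N) ⟩
        - q * ((1# + - A) * P (A * p) N) ≈⟨ solve 3 (λ q a x → :- q :* ((one :- a) :* x) := (q :* a :- q) :* x) refl _ _ _ ⟩
        (q * A + - q) * P (A * p) N ≈⟨ *-cong (+-congʳ qq⁻¹≈1) (prod-cong N (λ j _ → +-congˡ (-‿cong (*-cong Ap≈q (pow-p j))))) ⟩
        (1# + - q) * Odd N ∎

      α-N : α N ≈ 0#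
      α-N = trans (*-congˡ (trans (θ-factored N) (*-congˡ (*-congˡ (+-congˡ (-‿cong (pow-π-p π AAp≈1 N)))))))
        (solve 3 (λ a b c → a :* (b :* (c :* (one :- one))) := zeroᵉ) refl _ _ _)

    module _ (e : ℕ) (e+1≡M² : suc e ≡ M ℕ.* M) where

      private
        -- q(1 - q) times the prefactor [n](-q)^e, because 1 - qⁿ = (1 - q)[n].
        κ : Carrier
        κ = (1# + - l) * (q * pow (- q) e)

        κf₀≈q : κ * f 0 ≈ q
        κf₀≈q = begin
          κ * f 0 ≈⟨ *-congˡ (trans (*-congʳ (*-congˡ (reflexive (≡.cong (λ k → J (suc k)) (ℕP.+-identityʳ N)))))
                       (*-congʳ (solve 1 (λ j → one :* one :* one :* one :* one :* (one :* one :* one) :* (one :* one :* one) :* j := j) refl _))) ⟩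
          κ * (J (suc N) * Pz) ≈⟨ *-identityˡ _ ⟨
          1# * (κ * (J (suc N) * Pz)) ≈⟨ *-congʳ qq⁻¹≈1 ⟨
          q * q⁻¹ * ((1# + - l) * (q * pow (- q) e) * (J (suc N) * Pz))
            ≈⟨ solve 6 (λ q a l z j y → q :* a :* ((one :- l) :* (q :* z) :* (j :* y)) := a :* q :* (:- ((one :- l) :* j)) :* (y :* (:- q :* z))) refl _ _ _ _ _ _ ⟩
          q⁻¹ * q * (- ((1# + - l) * J (suc N))) * (Pz * pow (- q) (suc e)) ≈⟨ *-congˡ (trans (*-congˡ (pow≡ (- q) e+1≡M²)) (P-wπ M)) ⟩
          q⁻¹ * q * (- ((1# + - l) * J (suc N))) * ((1# + - q) * Odd M)
            ≈⟨ solve 6 (λ a q l j y o → a :* q :* (:- ((one :- l) :* j)) :* (y :* o) := :- (a :* q :* j :* (y :* (o :* (one :- l))))) refl _ _ _ _ _ _ ⟩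
          - (q⁻¹ * q * J (suc N) * ((1# + - q) * Odd N)) ≈⟨ -‿cong (*-congˡ P-A) ⟨
          - (q⁻¹ * q * J (suc N) * (- q * P A (suc N))) ≈⟨ solve 4 (λ a q j y → :- (a :* q :* j :* (:- q :* y)) := q :* a :* q :* (j :* y)) refl _ _ _ _ ⟩
          q * q⁻¹ * q * (J (suc N) * P A (suc N)) ≈⟨ *-cong (trans (*-congʳ qq⁻¹≈1) (*-identityˡ q)) (J-inv (suc N)) ⟩
          q * 1# ≈⟨ *-identityʳ q ⟩
          q ∎
          where Pz = P (w * pow π N) N

        -- f(0) divides the unit q.
        f₀-cancellable : ∀ y → f 0 * y ≈ 0# → y ≈ 0#
        f₀-cancellable y h = begin
          y ≈⟨ *-identityˡ y ⟨
          1# * y ≈⟨ *-congʳ qq⁻¹≈1 ⟨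
          q * q⁻¹ * y ≈⟨ *-congʳ (*-congʳ κf₀≈q) ⟨
          κ * f 0 * q⁻¹ * y ≈⟨ solve 4 (λ k f a y → k :* f :* a :* y := k :* a :* (f :* y)) refl _ _ _ _ ⟩
          κ * q⁻¹ * (f 0 * y) ≈⟨ trans (*-congˡ h) (zeroʳ _) ⟩
          0# ∎

      exact-identity : ∀ k → difference κ (N ℕ.+ k) N ≈ 0#
      exact-identity k = f₀-cancellable _ (begin
        f 0 * (prod γ′ N * clearedSum c α γ (N ℕ.+ k) + - (κ * (prod γ (N ℕ.+ k) * clearedSum c′ α′ γ′ N)))
          ≈⟨ *-congˡ (+-cong (*-congˡ (clearedSum-stop c α γ N k α-N)) (-‿cong (*-congˡ (*-congʳ (prod-+ γ N k))))) ⟩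
        f 0 * (prod γ′ N * (clearedSum c α γ N * tail) + - (κ * (prod γ N * tail * clearedSum c′ α′ γ′ N)))
          ≈⟨ solve 7 (λ f g s t k h r → f :* (g :* (s :* t) :- k :* (h :* t :* r)) := t :* g :* (f :* s) :- t :* h :* (k :* f) :* r) refl _ _ _ _ _ _ _ ⟩
        tail * prod γ′ N * (f 0 * clearedSum c α γ N) + - (tail * prod γ N * (κ * f 0) * clearedSum c′ α′ γ′ N)
          ≈⟨ +-cong (*-congˡ (trans (clearedSum-recurrent c α γ f N f-recurrent) (*-congʳ sum-cf))) (-‿cong (*-cong (*-congˡ κf₀≈q) R-sum)) ⟩
        tail * prod γ′ N * (q * W * prod γ N) + - (tail * prod γ N * q * (W * prod γ′ N))
          ≈⟨ solve 5 (λ t g q w h → t :* g :* (q :* w :* h) :- t :* h :* q :* (w :* g) := zeroᵉ) refl _ _ _ _ _ ⟩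
        0# ∎)
        where
        tail = prod (λ j → γ (N ℕ.+ j)) k
        R-sum : clearedSum c′ α′ γ′ N ≈ W * prod γ′ N
        R-sum = begin
          clearedSum c′ α′ γ′ N ≈⟨ solve 1 (λ x → x := one :* one :* one :* one :* (one :* one :* one) :* one :* x) refl _ ⟩
          f′ 0 * clearedSum c′ α′ γ′ N ≈⟨ clearedSum-recurrent c′ α′ γ′ f′ N f′-recurrent ⟩
          sum (λ k → c′ k * f′ k) N * prod γ′ N ≈⟨ *-congʳ sum-c′f′ ⟩
          W * prod γ′ N ∎

-- Divisibility, and coprimality up to integer constants

module Divisibility (R : CommutativeRing 0ℓ 0ℓ) where
  open RingOps R

  infix 4 _∣_
  record _∣_ (f g : Carrier) : Set where
    constructor _,_
    field
      quotient : Carrier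
      equality : f * quotient ≈ g
  open _∣_ public

  ∣-resp : ∀ {f g h} → g ≈ h → f ∣ g → f ∣ h
  ∣-resp e (k , p) = k , trans p e

  ∣-respˡ : ∀ {f g h} → f ≈ g → f ∣ h → g ∣ h
  ∣-respˡ e (k , p) = k , trans (*-congʳ (sym e)) p

  ∣-trans : ∀ {f g h} → f ∣ g → g ∣ h → f ∣ h
  ∣-trans (k , p) (k′ , p′) = k * k′ , trans (sym (*-assoc _ _ _)) (trans (*-congʳ p) p′)

  ∣-refl : ∀ {f} → f ∣ f
  ∣-refl = 1# , *-identityʳ _

  1∣ : ∀ f → 1# ∣ f
  1∣ f = f , *-identityˡ f

  ∣0 : ∀ {f} → f ∣ 0#
  ∣0 = 0# , zeroʳ _

  ∣-+ : ∀ {f g h} → f ∣ g → f ∣ h → f ∣ g + h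
  ∣-+ (k , p) (k′ , p′) = k + k′ , trans (distribˡ _ _ _) (+-cong p p′)

  ∣-neg : ∀ {f g} → f ∣ g → f ∣ - g
  ∣-neg (k , p) = - k , trans (sym (-‿distribʳ-* _ _)) (-‿cong p)

  ∣-*ʳ : ∀ {f g} h → f ∣ g → f ∣ g * h
  ∣-*ʳ h (k , p) = k * h , trans (sym (*-assoc _ _ _)) (*-congʳ p)

  ∣-*ˡ : ∀ {f g} h → f ∣ g → f ∣ h * g
  ∣-*ˡ h d = ∣-resp (*-comm _ _) (∣-*ʳ h d)

  *-mono-∣ : ∀ {f g f′ g′} → f ∣ g → f′ ∣ g′ → f * f′ ∣ g * g′
  *-mono-∣ (k , p) (k′ , p′) = k * k′ , trans (solve 4 (λ a b c d → a :* b :* (c :* d) := a :* c :* (b :* d)) refl _ _ _ _) (*-cong p p′)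

  prod-mono-∣ : ∀ f g n → (∀ k → f k ∣ g k) → prod f n ∣ prod g n
  prod-mono-∣ f g zero d = ∣-refl
  prod-mono-∣ f g (suc n) d = *-mono-∣ (prod-mono-∣ f g n d) (d n)

  prod-prefix-∣ : ∀ f {m n} → m ℕ.≤ n → prod f m ∣ prod f n
  prod-prefix-∣ f {m} m≤n with ℕP.m≤n⇒∃[o]m+o≡n m≤n
  ... | o , ≡.refl = _ , sym (prod-+ f m o)

  -- Content 1 in operational form: a non-zero integer can be cancelled from a multiple of f.
  Primitive : Carrier → Set
  Primitive f = ∀ c g → c ≢ + 0 → f ∣ fromℤ c * g → f ∣ g

  -- ℤ[q] is not a Bézout domain. This is coprimality over ℚ[q] with denominators cleared;
  -- `Primitive` disposes of the integer afterwards.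
  record Coprime (f g : Carrier) : Set where
    constructor coprime
    field
      bézoutˡ bézoutʳ : Carrier
      const : ℤ
      const≢0 : const ≢ + 0
      bézout : f * bézoutˡ + g * bézoutʳ ≈ fromℤ const

  coprime-sym : ∀ {f g} → Coprime f g → Coprime g f
  coprime-sym (coprime x y c c≢0 e) = coprime y x c c≢0 (trans (+-comm _ _) e)

  coprime-resp : ∀ {f g g′} → g ≈ g′ → Coprime f g → Coprime f g′
  coprime-resp p (coprime x y c c≢0 e) = coprime x y c c≢0 (trans (+-congˡ (*-congʳ (sym p))) e)

  coprime-1 : ∀ {f} → Coprime f 1#
  coprime-1 = coprime 0# 1# (+ 1) (λ ()) (solve 1 (λ f → f :* zeroᵉ :+ one :* one := one) refl _)

  coprime-* : ∀ {f g h} → Coprime f g → Coprime f h → Coprime f (g * h)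
  coprime-* {f} {g} {h} (coprime x y c c≢0 e) (coprime x′ y′ c′ c′≢0 e′) =
    coprime (x * (f * x′ + h * y′) + g * y * x′) (y * y′) (c ℤ.* c′)
      (λ p → [ c≢0 , c′≢0 ]′ (ℤP.i*j≡0⇒i≡0∨j≡0 c p))
      (trans (solve 7 (λ f g h x y x′ y′ → f :* (x :* (f :* x′ :+ h :* y′) :+ g :* y :* x′) :+ g :* h :* (y :* y′) := (f :* x :+ g :* y) :* (f :* x′ :+ h :* y′)) refl _ _ _ _ _ _ _)
        (trans (*-cong e e′) (sym (fromℤ-* c c′))))

  coprime-pow : ∀ {f g} n → Coprime f g → Coprime f (pow g n)
  coprime-pow zero p = coprime-1
  coprime-pow (suc n) p = coprime-* p (coprime-pow n p)

  coprime-prod : ∀ {f} g n → (∀ k → k ℕ.< n → Coprime f (g k)) → Coprime f (prod g n)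
  coprime-prod g zero p = coprime-1
  coprime-prod g (suc n) p = coprime-* (coprime-prod g n (λ k k<n → p k (ℕP.m<n⇒m<1+n k<n))) (p n ℕP.≤-refl)

  coprime-divisor : ∀ {f g h} → h ∣ g → Coprime f g → Coprime f h
  coprime-divisor (k , p) (coprime x y c c≢0 e) =
    coprime x (k * y) c c≢0 (trans (+-congˡ (trans (sym (*-assoc _ _ _)) (*-congʳ p))) e)

  coprime-shift : ∀ {f g h} → f ∣ g + - h → Coprime f g → Coprime f h
  coprime-shift {f} {g} {h} (k , p) (coprime x y c c≢0 e) = coprime (x + k * y) y c c≢0 (begin
    f * (x + k * y) + h * y ≈⟨ solve 5 (λ f x k y h → f :* (x :+ k :* y) :+ h :* y := f :* x :+ (f :* k :+ h) :* y) refl _ _ _ _ _ ⟩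
    f * x + (f * k + h) * y ≈⟨ +-congˡ (*-congʳ (trans (+-congʳ p) (solve 2 (λ g h → (g :- h) :+ h := g) refl _ _))) ⟩
    f * x + g * y ≈⟨ e ⟩
    fromℤ c ∎)

  coprime-∣ : ∀ {f g h} → Primitive f → Coprime f g → f ∣ g * h → f ∣ h
  coprime-∣ {f} {g} {h} prim (coprime x y c c≢0 e) d = prim c h c≢0 (∣-resp (begin
    f * (x * h) + g * h * y ≈⟨ solve 5 (λ f x h g y → f :* (x :* h) :+ g :* h :* y := (f :* x :+ g :* y) :* h) refl _ _ _ _ _ ⟩
    (f * x + g * y) * h ≈⟨ *-congʳ e ⟩
    fromℤ c * h ∎) (∣-+ (x * h , refl) (∣-*ʳ y d)))

  coprime-product-∣ : ∀ {f g h} → Primitive g → Coprime f g → f ∣ h → g ∣ h → f * g ∣ h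
  coprime-product-∣ {f} {g} prim cop (k , p) d with coprime-∣ prim (coprime-sym cop) (∣-resp (sym p) d)
  ... | l , p′ = l , trans (*-assoc _ _ _) (trans (*-congˡ p′) p)

  module _ (q : Carrier) where
    open RootOfUnity R q using (Cancellable; cancel)

    X : ℕ → Carrier
    X n = pow q n + - 1#

    private
      -- `geo y k` is 1 + y + ... + yᵏ⁻¹, and `quo y k` is (`geo y k` - k)/(y - 1).
      geo quo : Carrier → ℕ → Carrier
      geo y zero = 0#
      geo y (suc k) = 1# + y * geo y k
      quo y zero = 0#
      quo y (suc k) = quo y k + geo y k

      geo-sum : ∀ y k → (y + - 1#) * geo y k ≈ pow y k + - 1#
      geo-sum y zero = solve 1 (λ y → (y :- one) :* zeroᵉ := one :- one) refl _
      geo-sum y (suc k) = begin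
        (y + - 1#) * (1# + y * geo y k) ≈⟨ solve 2 (λ y g → (y :- one) :* (one :+ y :* g) := y :- one :+ y :* ((y :- one) :* g)) refl _ _ ⟩
        y + - 1# + y * ((y + - 1#) * geo y k) ≈⟨ +-congˡ (*-congˡ (geo-sum y k)) ⟩
        y + - 1# + y * (pow y k + - 1#) ≈⟨ solve 2 (λ y z → y :- one :+ y :* (z :- one) := y :* z :- one) refl _ _ ⟩
        y * pow y k + - 1# ∎

      geo-residue : ∀ y k → geo y k ≈ fromℤ (+ k) + (y + - 1#) * quo y k
      geo-residue y zero = solve 1 (λ y → zeroᵉ := zeroᵉ :+ (y :- one) :* zeroᵉ) refl _
      geo-residue y (suc k) = begin
        1# + y * geo y k ≈⟨ solve 2 (λ y g → one :+ y :* g := one :+ g :+ (y :- one) :* g) refl _ _ ⟩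
        1# + geo y k + (y + - 1#) * geo y k ≈⟨ +-congʳ (+-congˡ (geo-residue y k)) ⟩
        1# + (fromℤ (+ k) + (y + - 1#) * quo y k) + (y + - 1#) * geo y k
          ≈⟨ solve 4 (λ k y r g → one :+ (k :+ (y :- one) :* r) :+ (y :- one) :* g := one :+ k :+ (y :- one) :* (r :+ g)) refl _ _ _ _ ⟩
        1# + fromℤ (+ k) + (y + - 1#) * quo y (suc k) ≈⟨ +-congʳ (fromℤ-+ (+ 1) (+ k)) ⟨
        fromℤ (+ suc k) + (y + - 1#) * quo y (suc k) ∎

    X-∣ : ∀ {d n} → d ℕD.∣ n → X d ∣ X n
    X-∣ {d} (ℕD.divides k ≡.refl) = geo (pow q d) k , trans (geo-sum (pow q d) k) (+-congʳ (pow-pow q d k))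

    X-+ : ∀ m n → X (m ℕ.+ n) ≈ X m * pow q n + X n
    X-+ m n = trans (+-congʳ (pow-+ q m n)) (solve 2 (λ a b → a :* b :- one := (a :- one) :* b :+ (b :- one)) refl _ _)

    -- (qᵈ - 1)/(qᵍ - 1) is congruent to d/g modulo qᵍ - 1.
    factor-coprime : ∀ {f g d} → g ℕD.∣ d → d ≢ 0 → Cancellable (X g) → f * X g ∣ X d → Coprime f (X g)
    factor-coprime {f} {g} (ℕD.divides k ≡.refl) d≢0 canc (h , e) = coprime h (- quo y k) (+ k) (λ { ≡.refl → d≢0 ≡.refl }) (begin
      f * h + X g * - quo y k ≈⟨ +-congʳ fh≈geo ⟩
      geo y k + X g * - quo y k ≈⟨ +-congʳ (geo-residue y k) ⟩
      fromℤ (+ k) + X g * quo y k + X g * - quo y k ≈⟨ solve 3 (λ c x r → c :+ x :* r :+ x :* :- r := c) refl _ _ _ ⟩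
      fromℤ (+ k) ∎)
      where
      y = pow q g
      fh≈geo : f * h ≈ geo y k
      fh≈geo = cancel canc (begin
        X g * (f * h) ≈⟨ solve 3 (λ x f h → x :* (f :* h) := f :* x :* h) refl _ _ _ ⟩
        f * X g * h ≈⟨ e ⟩
        X (k ℕ.* g) ≈⟨ +-congʳ (pow-pow q g k) ⟨
        pow y k + - 1# ≈⟨ geo-sum y k ⟨
        X g * geo y k ∎)

    private
      gcd-ideal : ∀ {f} x d y e g → g ℕ.+ y ℕ.* e ≡ x ℕ.* d → f ∣ X d → Coprime f (X g) → Coprime f (X e)
      gcd-ideal {f} x d y e g eq f∣Xd cop = coprime-shift′ (coprime-sub cop)
        where
        -- X g = X (xd) - X (ye) - X g X (ye)
        f∣ : f ∣ X g + - (- X (y ℕ.* e) * pow q g)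
        f∣ = ∣-resp (begin
          X (x ℕ.* d) ≡⟨ ≡.cong X (≡.trans (≡.sym eq) (ℕP.+-comm g (y ℕ.* e))) ⟩
          X (y ℕ.* e ℕ.+ g) ≈⟨ X-+ (y ℕ.* e) g ⟩
          X (y ℕ.* e) * pow q g + X g ≈⟨ solve 3 (λ a b c → a :* b :+ c := c :- (:- a :* b)) refl _ _ _ ⟩
          X g + - (- X (y ℕ.* e) * pow q g) ∎) (∣-trans f∣Xd (X-∣ (ℕD.divides x ≡.refl)))
        coprime-sub : Coprime f (X g) → Coprime f (- X (y ℕ.* e) * pow q g)
        coprime-sub = coprime-shift f∣
        coprime-shift′ : Coprime f (- X (y ℕ.* e) * pow q g) → Coprime f (X e)
        coprime-shift′ = coprime-divisor (∣-trans (X-∣ (ℕD.divides y ≡.refl)) (∣-*ʳ _ (- 1# , solve 1 (λ x → x :* :- one := :- x) refl _)))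

    -- Bézout on the exponents: with g = gcd(d,e), q^g - 1 lies in the ideal of q^d - 1 and q^e - 1.
    -- As f divides the first generator, q^g - 1 is modulo f a multiple of the second.
    coprime-gcd : ∀ {f} d e → f ∣ X d → Coprime f (X (GCD.gcd d e)) → Coprime f (X e)
    coprime-gcd {f} d e f∣Xd cop with GCD.Bézout.identity (GCD.gcd-GCD d e)
    ... | GCD.Bézout.Identity.+- x y eq = gcd-ideal x d y e _ eq f∣Xd cop
    ... | GCD.Bézout.Identity.-+ x y eq = coprime-divisor (X-∣ (ℕD.divides y ≡.refl)) (coprime-shift (∣-resp (begin
        - (X (x ℕ.* d) * pow q g) ≈⟨ solve 3 (λ a b c → :- (a :* b) := c :- (a :* b :+ c)) refl _ _ _ ⟩
        X g + - (X (x ℕ.* d) * pow q g + X g) ≈⟨ +-congˡ (-‿cong (X-+ (x ℕ.* d) g)) ⟨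
        X g + - X (x ℕ.* d ℕ.+ g) ≡⟨ ≡.cong (λ k → X g + - X k) (≡.trans (ℕP.+-comm (x ℕ.* d) g) eq) ⟩
        X g + - X (y ℕ.* e) ∎) (∣-neg (∣-*ʳ _ (∣-trans f∣Xd (X-∣ (ℕD.divides x ≡.refl)))))) cop)
      where g = GCD.gcd d e

-- Quotients, dual numbers, homomorphisms and localizations

module QuotientRing (R : CommutativeRing 0ℓ 0ℓ) (g : CommutativeRing.Carrier R) where
  open RingOps R
  open Divisibility R

  infix 4 _≡ₘ_
  record _≡ₘ_ (x y : Carrier) : Set where
    constructor congruent
    field divides : g ∣ x + - y
  open _≡ₘ_ public

  lift : ∀ {x y} → x ≈ y → x ≡ₘ y
  lift e = congruent (∣-resp (trans (sym (-‿inverseʳ _)) (+-congʳ (sym e))) ∣0)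

  quotientRing : CommutativeRing 0ℓ 0ℓ
  quotientRing = record
    { Carrier = Carrier ; _≈_ = _≡ₘ_ ; _+_ = _+_ ; _*_ = _*_ ; -_ = -_ ; 0# = 0# ; 1# = 1#
    ; isCommutativeRing = record
      { isRing = record
        { +-isAbelianGroup = record
          { isGroup = record
            { isMonoid = record
              { isSemigroup = record
                { isMagma = record
                  { isEquivalence = record
                    { refl = lift refl
                    ; sym = λ p → congruent (∣-resp (solve 2 (λ x y → :- (x :- y) := y :- x) refl _ _) (∣-neg (divides p)))
                    ; trans = λ p r → congruent (∣-resp (solve 3 (λ x y z → x :- y :+ (y :- z) := x :- z) refl _ _ _) (∣-+ (divides p) (divides r))) }
                  ; ∙-cong = λ p r → congruent (∣-resp (solve 4 (λ x y u v → x :- y :+ (u :- v) := x :+ u :- (y :+ v)) refl _ _ _ _) (∣-+ (divides p) (divides r))) }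
                ; assoc = λ x y z → lift (+-assoc x y z) }
              ; identity = (λ x → lift (+-identityˡ x)) , (λ x → lift (+-identityʳ x)) }
            ; inverse = (λ x → lift (-‿inverseˡ x)) , (λ x → lift (-‿inverseʳ x))
            ; ⁻¹-cong = λ p → congruent (∣-resp (solve 2 (λ x y → :- (x :- y) := :- x :- :- y) refl _ _) (∣-neg (divides p))) }
          ; comm = λ x y → lift (+-comm x y) }
        ; *-cong = λ {x} {y} {u} {v} p r → congruent (∣-resp (solve 4 (λ x y u v → (x :- y) :* u :+ y :* (u :- v) := x :* u :- y :* v) refl _ _ _ _) (∣-+ (∣-*ʳ u (divides p)) (∣-*ˡ y (divides r))))
        ; *-assoc = λ x y z → lift (*-assoc x y z)
        ; *-identity = (λ x → lift (*-identityˡ x)) , (λ x → lift (*-identityʳ x))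
        ; distrib = (λ x y z → lift (distribˡ x y z)) , (λ x y z → lift (distribʳ x y z)) }
      ; *-comm = λ x y → lift (*-comm x y) } }

  ≡ₘ0⇒∣ : ∀ {x} → x ≡ₘ 0# → g ∣ x
  ≡ₘ0⇒∣ p = ∣-resp (solve 1 (λ x → x :- zeroᵉ := x) refl _) (divides p)

  ∣⇒≡ₘ0 : ∀ {x} → g ∣ x → x ≡ₘ 0#
  ∣⇒≡ₘ0 d = congruent (∣-resp (solve 1 (λ x → x := x :- zeroᵉ) refl _) d)

module DualNumbers (R : CommutativeRing 0ℓ 0ℓ) where
  open RingOps R

  infix 4 _≈ᵈ_
  record _≈ᵈ_ (x y : Carrier × Carrier) : Set where
    constructor _,ᵈ_
    field
      fst : proj₁ x ≈ proj₁ y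
      snd : proj₂ x ≈ proj₂ y
  open _≈ᵈ_ public

  _+ᵈ_ _*ᵈ_ : Carrier × Carrier → Carrier × Carrier → Carrier × Carrier
  (a , b) +ᵈ (c , d) = a + c , b + d
  (a , b) *ᵈ (c , d) = a * c , a * d + b * c

  -ᵈ_ : Carrier × Carrier → Carrier × Carrier
  -ᵈ (a , b) = - a , - b

  dualRing : CommutativeRing 0ℓ 0ℓ
  dualRing = record
    { Carrier = Carrier × Carrier ; _≈_ = _≈ᵈ_ ; _+_ = _+ᵈ_ ; _*_ = _*ᵈ_ ; -_ = -ᵈ_ ; 0# = 0# , 0# ; 1# = 1# , 0#
    ; isCommutativeRing = record
      { isRing = record
        { +-isAbelianGroup = record
          { isGroup = record
            { isMonoid = record
              { isSemigroup = record
                { isMagma = record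
                  { isEquivalence = record
                    { refl = refl ,ᵈ refl
                    ; sym = λ p → sym (fst p) ,ᵈ sym (snd p)
                    ; trans = λ p r → trans (fst p) (fst r) ,ᵈ trans (snd p) (snd r) }
                  ; ∙-cong = λ p r → +-cong (fst p) (fst r) ,ᵈ +-cong (snd p) (snd r) }
                ; assoc = λ x y z → +-assoc _ _ _ ,ᵈ +-assoc _ _ _ }
              ; identity = (λ x → +-identityˡ _ ,ᵈ +-identityˡ _) , (λ x → +-identityʳ _ ,ᵈ +-identityʳ _) }
            ; inverse = (λ x → -‿inverseˡ _ ,ᵈ -‿inverseˡ _) , (λ x → -‿inverseʳ _ ,ᵈ -‿inverseʳ _)
            ; ⁻¹-cong = λ p → -‿cong (fst p) ,ᵈ -‿cong (snd p) }
          ; comm = λ x y → +-comm _ _ ,ᵈ +-comm _ _ }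
        ; *-cong = λ p r → *-cong (fst p) (fst r) ,ᵈ +-cong (*-cong (fst p) (snd r)) (*-cong (snd p) (fst r))
        ; *-assoc = λ x y z → *-assoc _ _ _ ,ᵈ
            solve 6 (λ a b c d e f → a :* c :* f :+ (a :* d :+ b :* c) :* e := a :* (c :* f :+ d :* e) :+ b :* (c :* e)) refl _ _ _ _ _ _
        ; *-identity = (λ x → *-identityˡ _ ,ᵈ solve 2 (λ a b → one :* b :+ zeroᵉ :* a := b) refl _ _)
                     , (λ x → *-identityʳ _ ,ᵈ solve 2 (λ a b → a :* zeroᵉ :+ b :* one := b) refl _ _)
        ; distrib = (λ x y z → distribˡ _ _ _ ,ᵈ solve 6 (λ a b c d e f → a :* (d :+ f) :+ b :* (c :+ e) := a :* d :+ b :* c :+ (a :* f :+ b :* e)) refl _ _ _ _ _ _)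
                  , (λ x y z → distribʳ _ _ _ ,ᵈ solve 6 (λ a b c d e f → (c :+ e) :* b :+ (d :+ f) :* a := c :* b :+ d :* a :+ (e :* b :+ f :* a)) refl _ _ _ _ _ _) }
      ; *-comm = λ x y → *-comm _ _ ,ᵈ solve 4 (λ a b c d → a :* d :+ b :* c := c :* b :+ d :* a) refl _ _ _ _ } }

module RingHoms (A B : CommutativeRing 0ℓ 0ℓ) where
  private
    module A = RingOps A
    module B = RingOps B
  open B

  record RingHom : Set where
    field
      φ : A.Carrier → B.Carrier
      φ-+ : ∀ x y → φ (x A.+ y) ≈ φ x + φ y
      φ-* : ∀ x y → φ (x A.* y) ≈ φ x * φ y
      φ-neg : ∀ x → φ (A.- x) ≈ - φ x
      φ-1 : φ A.1# ≈ 1#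

    φ-pow : ∀ x n → φ (A.pow x n) ≈ pow (φ x) n
    φ-pow x zero = φ-1
    φ-pow x (suc n) = trans (φ-* _ _) (*-congˡ (φ-pow x n))

    φ-prod : ∀ {f g} → (∀ k → φ (f k) ≈ g k) → ∀ n → φ (A.prod f n) ≈ prod g n
    φ-prod e zero = φ-1
    φ-prod e (suc n) = trans (φ-* _ _) (*-cong (φ-prod e n) (e n))

    φ-sub : ∀ {x y x′ y′} → φ x ≈ x′ → φ y ≈ y′ → φ (x A.+ A.- y) ≈ x′ + - y′
    φ-sub e f = trans (φ-+ _ _) (+-cong e (trans (φ-neg _) (-‿cong f)))

    φ-mul : ∀ {x y x′ y′} → φ x ≈ x′ → φ y ≈ y′ → φ (x A.* y) ≈ x′ * y′
    φ-mul e f = trans (φ-* _ _) (*-cong e f)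

    φ-pow′ : ∀ {x x′} n → φ x ≈ x′ → φ (A.pow x n) ≈ pow x′ n
    φ-pow′ n e = trans (φ-pow _ n) (pow-cong n e)

    module _ {q l x : A.Carrier} {q′ l′ x′ : B.Carrier} (φq : φ q ≈ q′) (φl : φ l ≈ l′) (φx : φ x ≈ x′) where
      private
        module SA = Series A._+_ A._*_ A.-_ A.1# q l x
        module SB = Series _+_ _*_ -_ 1# q′ l′ x′

        φ-p : ∀ j → φ (A.pow SA.p j) ≈ pow SB.p j
        φ-p j = φ-pow′ j (φ-pow′ 2 φq)

        φ-1-p : ∀ j → φ (A.1# A.+ A.- A.pow SA.p (suc j)) ≈ 1# + - pow SB.p (suc j)
        φ-1-p j = φ-sub φ-1 (φ-p (suc j))

        φ-θ : ∀ j → φ (SA.θ j) ≈ SB.θ j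
        φ-θ j = φ-sub (φ-mul φl (φ-mul (φ-sub φq (φ-p j)) (φ-sub φq (φ-p j)))) (φ-mul φx (φ-mul φq (φ-p j)))

      φ-α : ∀ j → φ (SA.α j) ≈ SB.α j
      φ-α j = φ-mul (φ-pow′ 3 (φ-sub φq (φ-p j))) (φ-θ j)

      φ-γ : ∀ j → φ (SA.γ j) ≈ SB.γ j
      φ-γ j = φ-mul (φ-pow′ 3 (φ-1-p j)) (φ-sub (φ-mul φl (φ-mul (φ-1-p j) (φ-1-p j))) (φ-mul φx (φ-p (suc j))))

      φ-α′ : ∀ j → φ (SA.α′ j) ≈ SB.α′ j
      φ-α′ j = φ-mul (φ-θ j) (φ-sub φ-1 (φ-mul (φ-pow′ 3 φq) (φ-p j)))

      φ-γ′ : ∀ j → φ (SA.γ′ j) ≈ SB.γ′ j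
      φ-γ′ j = φ-mul (φ-pow′ 3 (φ-1-p j)) φl

      φ-c : ∀ k → φ (SA.c k) ≈ SB.c k
      φ-c k = φ-mul (φ-mul (φ-pow′ k (trans (φ-neg _) (-‿cong φ-1))) (φ-sub φq (φ-pow′ (4 ℕ.* k) φq))) (φ-pow′ (k ℕ.* k) φq)

      φ-clearedSum : ∀ {c α γ c′ α′ γ′} → (∀ k → φ (c k) ≈ c′ k) → (∀ k → φ (α k) ≈ α′ k) → (∀ k → φ (γ k) ≈ γ′ k) →
        ∀ m → φ (SA.clearedSum c α γ m) ≈ SB.clearedSum c′ α′ γ′ m
      φ-clearedSum ec eα eγ zero = ec 0
      φ-clearedSum ec eα eγ (suc m) = trans (φ-+ _ _) (+-cong (φ-mul (φ-clearedSum ec eα eγ m) (eγ m)) (φ-mul (ec (suc m)) (φ-prod eα (suc m))))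

      φ-difference : ∀ {κ κ′} → φ κ ≈ κ′ → ∀ m N → φ (SA.difference κ m N) ≈ SB.difference κ′ m N
      φ-difference φκ m N = φ-sub (φ-mul (φ-prod φ-γ′ N) (φ-clearedSum φ-c φ-α φ-γ m))
        (φ-mul φκ (φ-mul (φ-prod φ-γ m) (φ-clearedSum (λ k → φ-pow′ k φq) φ-α′ φ-γ′ N)))

module Localization (R : CommutativeRing 0ℓ 0ℓ) (q : CommutativeRing.Carrier R)
  (S : CommutativeRing.Carrier R → Set)
  (S-cancellable : ∀ {s} → S s → RootOfUnity.Cancellable R q s)
  (S-1 : S (CommutativeRing.1# R))
  (S-* : ∀ {s t} → S s → S t → S (CommutativeRing._*_ R s t))
  where
  open RingOps R
  open RootOfUnity R q using (cancel)

  infixl 5 _/_[_]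
  record Fraction : Set where
    constructor _/_[_]
    field
      numer denom : Carrier
      denom∈S : S denom
  open Fraction public

  infix 4 _≈ᶠ_
  record _≈ᶠ_ (x y : Fraction) : Set where
    constructor cross
    field crossed : numer x * denom y ≈ numer y * denom x
  open _≈ᶠ_ public

  _+ᶠ_ _*ᶠ_ : Fraction → Fraction → Fraction
  (a / s [ p ]) +ᶠ (b / t [ r ]) = a * t + b * s / s * t [ S-* p r ]
  (a / s [ p ]) *ᶠ (b / t [ r ]) = a * b / s * t [ S-* p r ]

  -ᶠ_ : Fraction → Fraction
  -ᶠ (a / s [ p ]) = - a / s [ p ]

  embed : Carrier → Fraction
  embed x = x / 1# [ S-1 ]

  private
    trans′ : ∀ {x y z} → x ≈ᶠ y → y ≈ᶠ z → x ≈ᶠ z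
    trans′ {a / s [ _ ]} {b / t [ p ]} {c / u [ _ ]} (cross e) (cross f) = cross (cancel (S-cancellable p) (begin
      t * (a * u) ≈⟨ solve 3 (λ t a u → t :* (a :* u) := a :* t :* u) refl _ _ _ ⟩
      a * t * u ≈⟨ *-congʳ e ⟩
      b * s * u ≈⟨ solve 3 (λ b s u → b :* s :* u := b :* u :* s) refl _ _ _ ⟩
      b * u * s ≈⟨ *-congʳ f ⟩
      c * t * s ≈⟨ solve 3 (λ c t s → c :* t :* s := t :* (c :* s)) refl _ _ _ ⟩
      t * (c * s) ∎))

    +-cong′ : ∀ {x y u v} → x ≈ᶠ y → u ≈ᶠ v → x +ᶠ u ≈ᶠ y +ᶠ v
    +-cong′ {a / s [ _ ]} {b / t [ _ ]} {c / u [ _ ]} {d / v [ _ ]} (cross e) (cross f) = cross (begin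
      (a * u + c * s) * (t * v) ≈⟨ solve 6 (λ a u c s t v → (a :* u :+ c :* s) :* (t :* v) := a :* t :* (u :* v) :+ c :* v :* (s :* t)) refl _ _ _ _ _ _ ⟩
      a * t * (u * v) + c * v * (s * t) ≈⟨ +-cong (*-congʳ e) (*-congʳ f) ⟩
      b * s * (u * v) + d * u * (s * t) ≈⟨ solve 6 (λ b s u v d t → b :* s :* (u :* v) :+ d :* u :* (s :* t) := (b :* v :+ d :* t) :* (s :* u)) refl _ _ _ _ _ _ ⟩
      (b * v + d * t) * (s * u) ∎)

    *-cong′ : ∀ {x y u v} → x ≈ᶠ y → u ≈ᶠ v → x *ᶠ u ≈ᶠ y *ᶠ v
    *-cong′ {a / s [ _ ]} {b / t [ _ ]} {c / u [ _ ]} {d / v [ _ ]} (cross e) (cross f) = cross (begin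
      a * c * (t * v) ≈⟨ solve 4 (λ a c t v → a :* c :* (t :* v) := a :* t :* (c :* v)) refl _ _ _ _ ⟩
      a * t * (c * v) ≈⟨ *-cong e f ⟩
      b * s * (d * u) ≈⟨ solve 4 (λ b s d u → b :* s :* (d :* u) := b :* d :* (s :* u)) refl _ _ _ _ ⟩
      b * d * (s * u) ∎)

  localRing : CommutativeRing 0ℓ 0ℓ
  localRing = record
    { Carrier = Fraction ; _≈_ = _≈ᶠ_ ; _+_ = _+ᶠ_ ; _*_ = _*ᶠ_ ; -_ = -ᶠ_ ; 0# = embed 0# ; 1# = embed 1#
    ; isCommutativeRing = record
      { isRing = record
        { +-isAbelianGroup = record
          { isGroup = record
            { isMonoid = record
              { isSemigroup = record
                { isMagma = record
                  { isEquivalence = record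
                    { refl = cross refl
                    ; sym = λ p → cross (sym (crossed p))
                    ; trans = trans′ }
                  ; ∙-cong = +-cong′ }
                ; assoc = λ x y z → cross (solve 6 (λ a s b t c u → ((a :* t :+ b :* s) :* u :+ c :* (s :* t)) :* (s :* (t :* u)) := (a :* (t :* u) :+ (b :* u :+ c :* t) :* s) :* (s :* t :* u)) refl _ _ _ _ _ _) }
              ; identity = (λ x → cross (solve 2 (λ a s → (zeroᵉ :* s :+ a :* one) :* s := a :* (one :* s)) refl _ _))
                         , (λ x → cross (solve 2 (λ a s → (a :* one :+ zeroᵉ :* s) :* s := a :* (s :* one)) refl _ _)) }
            ; inverse = (λ x → cross (solve 2 (λ a s → (:- a :* s :+ a :* s) :* one := zeroᵉ :* (s :* s)) refl _ _))
                      , (λ x → cross (solve 2 (λ a s → (a :* s :+ :- a :* s) :* one := zeroᵉ :* (s :* s)) refl _ _))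
            ; ⁻¹-cong = λ p → cross (trans (sym (-‿distribˡ-* _ _)) (trans (-‿cong (crossed p)) (-‿distribˡ-* _ _))) }
          ; comm = λ x y → cross (solve 4 (λ a s b t → (a :* t :+ b :* s) :* (t :* s) := (b :* s :+ a :* t) :* (s :* t)) refl _ _ _ _) }
        ; *-cong = *-cong′
        ; *-assoc = λ x y z → cross (solve 6 (λ a s b t c u → a :* b :* c :* (s :* (t :* u)) := a :* (b :* c) :* (s :* t :* u)) refl _ _ _ _ _ _)
        ; *-identity = (λ x → cross (solve 2 (λ a s → one :* a :* s := a :* (one :* s)) refl _ _))
                     , (λ x → cross (solve 2 (λ a s → a :* one :* s := a :* (s :* one)) refl _ _))
        ; distrib = (λ x y z → cross (solve 6 (λ a s b t c u → a :* (b :* u :+ c :* t) :* (s :* t :* (s :* u)) := (a :* b :* (s :* u) :+ a :* c :* (s :* t)) :* (s :* (t :* u))) refl _ _ _ _ _ _))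
                  , (λ x y z → cross (solve 6 (λ a s b t c u → (b :* u :+ c :* t) :* a :* (t :* s :* (u :* s)) := (b :* a :* (u :* s) :+ c :* a :* (t :* s)) :* (t :* u :* s)) refl _ _ _ _ _ _)) }
      ; *-comm = λ x y → cross (solve 4 (λ a s b t → a :* b :* (t :* s) := b :* a :* (s :* t)) refl _ _ _ _) } }

  embedHom : RingHoms.RingHom R localRing
  embedHom = record
    { φ = embed
    ; φ-+ = λ x y → cross (solve 2 (λ x y → (x :+ y) :* (one :* one) := (x :* one :+ y :* one) :* one) refl _ _)
    ; φ-* = λ x y → cross (solve 2 (λ x y → x :* y :* (one :* one) := x :* y :* one) refl _ _)
    ; φ-neg = λ x → cross refl
    ; φ-1 = cross refl }

  embed-injective : ∀ {x y} → embed x ≈ᶠ embed y → x ≈ y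
  embed-injective (cross e) = trans (sym (*-identityʳ _)) (trans e (*-identityʳ _))

  recip : ∀ {s} → S s → Fraction
  recip {s} p = 1# / s [ p ]

  recip-inverse : ∀ {s} (p : S s) → recip p *ᶠ embed s ≈ᶠ embed 1#
  recip-inverse p = cross (solve 1 (λ s → one :* s :* one := one :* (s :* one)) refl _)

  open CommutativeRing localRing using () renaming
    (trans to transᶠ; sym to symᶠ; *-congˡ to *ᶠ-congˡ; *-congʳ to *ᶠ-congʳ; *-identityˡ to *ᶠ-identityˡ; *-identityʳ to *ᶠ-identityʳ; *-assoc to *ᶠ-assoc; -‿cong to -ᶠ-cong)

  -- n and d are bare elements, as in `Frac`; that d lies in S is part of what is asserted.
  record Value (n d : Carrier) (k : Fraction) : Set where
    constructor hasValue
    field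
      d∈S : S d
      value≈ : n / d [ d∈S ] ≈ᶠ k
  open Value public

  value-resp : ∀ {n d k l} → k ≈ᶠ l → Value n d k → Value n d l
  value-resp e (hasValue p v) = hasValue p (transᶠ v e)

  value-embed : ∀ x → Value x 1# (embed x)
  value-embed x = hasValue S-1 (cross refl)

  value-recip : ∀ {s} (p : S s) → Value 1# s (recip p)
  value-recip p = hasValue p (cross refl)

  value-+ : ∀ {a s b t k l} → Value a s k → Value b t l → Value (a * t + b * s) (s * t) (k +ᶠ l)
  value-+ (hasValue p v) (hasValue r w) = hasValue (S-* p r) (+-cong′ v w)

  value-* : ∀ {a s b t k l} → Value a s k → Value b t l → Value (a * b) (s * t) (k *ᶠ l)
  value-* (hasValue p v) (hasValue r w) = hasValue (S-* p r) (*-cong′ v w)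

  value-neg : ∀ {a s k} → Value a s k → Value (- a) s (-ᶠ k)
  value-neg (hasValue p v) = hasValue p (-ᶠ-cong v)

  -- Inversion turns the numerator into the denominator, which therefore has to lie in S.
  value-flip : ∀ {a s k l} → S a → k *ᶠ l ≈ᶠ embed 1# → Value a s k → Value s a l
  value-flip {a} {s} {k} {l} r kl≈1 (hasValue p v) = hasValue r
    (transᶠ (symᶠ (*ᶠ-identityʳ x)) (transᶠ (*ᶠ-congˡ (symᶠ kl≈1)) (transᶠ (symᶠ (*ᶠ-assoc x k l))
      (transᶠ (*ᶠ-congʳ (transᶠ (*ᶠ-congˡ (symᶠ v)) (cross (solve 2 (λ a s → s :* a :* one := one :* (a :* s)) refl _ _)))) (*ᶠ-identityˡ l)))))
    where x = s / a [ r ]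

  value-crossed : ∀ {n d k s u} → Value n d k → embed s *ᶠ k ≈ᶠ embed u → s * n ≈ u * d
  value-crossed {n} {d} {k} {s} {u} (hasValue p v) e with transᶠ (*ᶠ-congˡ {embed s} v) e
  ... | cross f = trans (sym (*-identityʳ _)) (trans f (*-congˡ (*-identityˡ d)))

-- Vanishing of the deformed left-hand sum

module SeriesVanishing (R : CommutativeRing 0ℓ 0ℓ) (q l x : CommutativeRing.Carrier R) where
  open RingOps R
  open RootOfUnity R q hiding (c; cancel)
  open SeriesOver R q l x

  module _
    (d M : ℕ) (d+1≡2M : suc d ≡ M ℕ.+ M) (M<d : M ℕ.< d)
    (qᵈ≈1 : pow q d ≈ 1#) (two : ∀ y → y + y ≈ 0# → y ≈ 0#)
    (γ-cancellable : ∀ k → suc k ℕ.< d → Cancellable (γ k))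
    where

    private
      pow-p : ∀ k → pow p k ≈ pow q (k ℕ.* 2)
      pow-p k = pow-pow q 2 k

      pᵈ≈1 : pow p d ≈ 1#
      pᵈ≈1 = trans (pow-p d) (trans (pow≡ q (ℕP.*-comm d 2)) (trans (sym (pow-pow q d 2)) (trans (pow-cong 2 qᵈ≈1) (pow-1# 2))))

      p-periodic : ∀ k → pow p (d ℕ.+ k) ≈ pow p k
      p-periodic k = trans (pow-+ p d k) (trans (*-congʳ pᵈ≈1) (*-identityˡ _))

      pᴹ≈q : pow p M ≈ q
      pᴹ≈q = trans (pow-p M) (trans (pow≡ q (≡.trans (e M) (≡.sym d+1≡2M))) (trans (*-congˡ qᵈ≈1) (*-identityʳ q)))
        where
        e : ∀ m → m ℕ.* 2 ≡ m ℕ.+ m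
        e = solve-∀

      θ-cong : ∀ {y z} → y ≈ z → l * ((q + - y) * (q + - y)) + - (x * (q * y)) ≈ l * ((q + - z) * (q + - z)) + - (x * (q * z))
      θ-cong e = +-cong (*-congˡ (*-cong (+-congˡ (-‿cong e)) (+-congˡ (-‿cong e)))) (-‿cong (*-congˡ (*-congˡ e)))

      α-periodic : ∀ k → α (d ℕ.+ k) ≈ α k
      α-periodic k = *-cong (pow-cong 3 (+-congˡ (-‿cong (p-periodic k)))) (θ-cong (p-periodic k))

      γ-periodic : ∀ k → γ (d ℕ.+ k) ≈ γ k
      γ-periodic k = *-cong (pow-cong 3 y) (+-cong (*-congˡ (*-cong y y)) (-‿cong (*-congˡ e)))
        where
        e : pow p (suc (d ℕ.+ k)) ≈ pow p (suc k)
        e = *-congˡ (p-periodic k)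
        y : 1# + - pow p (suc (d ℕ.+ k)) ≈ 1# + - pow p (suc k)
        y = +-congˡ (-‿cong e)

      -- With u = q²ᵃ and v = q²ᵇ⁺² one has u v = q, so q - u = -u(1 - v).
      α-reflect : ∀ a b → a ℕ.+ suc b ≡ M → α a ≈ - (pow q (10 ℕ.* a) * γ b)
      α-reflect a b e = begin
        pow (q + - u) 3 * (l * ((q + - u) * (q + - u)) + - (x * (q * u)))
          ≈⟨ *-cong (pow-cong 3 q-u) (+-cong (*-congˡ (*-cong q-u q-u)) (-‿cong (*-congˡ (*-congʳ (sym uv≈q))))) ⟩
        pow (u * v + - u) 3 * (l * ((u * v + - u) * (u * v + - u)) + - (x * (u * v * u)))
          ≈⟨ solve 4 (λ u v l x →
               (u :* v :- u) :* ((u :* v :- u) :* ((u :* v :- u) :* one)) :* (l :* ((u :* v :- u) :* (u :* v :- u)) :- x :* (u :* v :* u)) :=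
               :- (u :* (u :* (u :* (u :* (u :* one)))) :* ((one :- v) :* ((one :- v) :* ((one :- v) :* one)) :* (l :* ((one :- v) :* (one :- v)) :- x :* v)))) refl _ _ _ _ ⟩
        - (pow u 5 * γ b) ≈⟨ -‿cong (*-congʳ (trans (pow-pow p a 5) (trans (pow-pow q 2 (5 ℕ.* a)) (pow≡ q (e₅ a))))) ⟩
        - (pow q (10 ℕ.* a) * γ b) ∎
        where
        u = pow p a
        v = pow p (suc b)
        uv≈q : u * v ≈ q
        uv≈q = trans (sym (pow-+ p a (suc b))) (trans (pow≡ p e) pᴹ≈q)
        q-u : q + - u ≈ u * v + - u
        q-u = +-congʳ (sym uv≈q)
        e₅ : ∀ a → 5 ℕ.* a ℕ.* 2 ≡ 10 ℕ.* a
        e₅ = solve-∀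

      α-M : α M ≈ 0#
      α-M = trans (*-congʳ (*-congʳ (trans (+-congʳ (sym pᴹ≈q)) (-‿inverseʳ _)))) (solve 2 (λ a b → zeroᵉ :* a :* b := zeroᵉ) refl _ _)

    open Vanishing d M d+1≡2M M<d qᵈ≈1 two α γ α-periodic γ-periodic γ-cancellable α-reflect α-M public using (blocks; block)

    clearedSum-vanishes : ∀ k → M ℕ.+ k ℕ.< d → clearedSum c α γ (M ℕ.+ k) ≈ 0#
    clearedSum-vanishes k M+k<d = f₀-cancellable _ (begin
      f 0 * clearedSum c α γ m ≈⟨ clearedSum-recurrent c α γ f m rec ⟩
      sum (λ k → c k * f k) m * prod γ m ≈⟨ *-congʳ (block f k M+k<d rec) ⟩
      0# * prod γ m ≈⟨ zeroˡ _ ⟩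
      0# ∎)
      where
      m = M ℕ.+ k
      -- The solution of the recurrence scaled by all γ's below m, so that no quotient occurs; f(0)
      -- is a product of cancellable factors.
      f : ℕ → Carrier
      f j = prod α j * prod (λ i → γ (j ℕ.+ i)) (m ℕ.∸ j)
      f₀-cancellable : Cancellable (f 0)
      f₀-cancellable = Cancellable-* (Cancellable-unit 1# (*-identityˡ 1#)) (Cancellable-prod γ m (λ j j<m → γ-cancellable j (ℕP.≤-<-trans j<m M+k<d)))
      rec : Recurrent α γ f m
      rec j j<m = begin
        prod α j * α j * prod (λ i → γ (suc j ℕ.+ i)) (m ℕ.∸ suc j) * γ j
          ≈⟨ solve 4 (λ a b g h → a :* b :* g :* h := a :* (h :* g) :* b) refl _ _ _ _ ⟩
        prod α j * (γ j * prod (λ i → γ (suc j ℕ.+ i)) (m ℕ.∸ suc j)) * α j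
          ≈⟨ *-congʳ (*-congˡ (*-cong (reflexive (≡.cong γ (≡.sym (ℕP.+-identityʳ j)))) (prod-cong (m ℕ.∸ suc j) (λ i _ → reflexive (≡.cong γ (≡.sym (ℕP.+-suc j i))))))) ⟩
        prod α j * (γ (j ℕ.+ 0) * prod (λ i → γ (j ℕ.+ suc i)) (m ℕ.∸ suc j)) * α j
          ≈⟨ *-congʳ (*-congˡ (prod-head (λ i → γ (j ℕ.+ i)) (m ℕ.∸ suc j))) ⟨
        prod α j * prod (λ i → γ (j ℕ.+ i)) (suc (m ℕ.∸ suc j)) * α j
          ≈⟨ *-congʳ (*-congˡ (reflexive (≡.cong (prod (λ i → γ (j ℕ.+ i))) (≡.sym (ℕP.+-∸-assoc 1 j<m))))) ⟩
        f j * α j ∎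

module Modulo (R : CommutativeRing 0ℓ 0ℓ) (q g : CommutativeRing.Carrier R) where
  open RingOps R
  open Divisibility R
  open QuotientRing R g

  coprime⇒cancellable : ∀ {s} → Primitive g → Coprime g s → RootOfUnity.Cancellable quotientRing q s
  coprime⇒cancellable prim cop y e = ∣⇒≡ₘ0 (coprime-∣ prim cop (≡ₘ0⇒∣ e))

  two-cancellable : Primitive g → ∀ y → (y + y) ≡ₘ 0# → y ≡ₘ 0#
  two-cancellable prim y e = ∣⇒≡ₘ0 (prim (+ 2) y (λ ()) (∣-resp (solve 1 (λ y → y :+ y := Κ (+ 2) :* y) refl y) (≡ₘ0⇒∣ e)))

-- First-order deformation and divisibility by a cube

module Cube (R : CommutativeRing 0ℓ 0ℓ) (q g κ : CommutativeRing.Carrier R) (n M : ℕ) (n+1≡2M : suc n ≡ M ℕ.+ M) (M<n : M ℕ.< n) where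
  open RingOps R
  open Divisibility R

  private
    l ξ : Carrier
    l = pow q n
    ξ = (1# + - l) * (1# + - l)
    module S (x : Carrier) = Series _+_ _*_ -_ 1# q l x

  module _
    (g-primitive : Primitive g) (g∣1-l : g ∣ 1# + - l) (g∣κ : g ∣ κ)
    (coprime-p : ∀ k → suc k ℕ.< n → Coprime g (1# + - pow (pow q 2) (suc k)))
    (k : ℕ) (M+k<n : M ℕ.+ k ℕ.< n)
    (exact : S.difference ξ κ (M ℕ.+ k) M ≈ 0#)
    where

    private
      module Q = QuotientRing R g
      module D = DualNumbers R
      module DQ = DualNumbers Q.quotientRing
      module DR = RingOps D.dualRing
      module DQR = RingOps DQ.dualRing
      module QR = RingOps Q.quotientRing
      open Q using (_≡ₘ_)
      open DQ using (_,ᵈ_)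

      constant : Carrier → Carrier × Carrier
      constant y = y , 0#

      module Sε = Series D._+ᵈ_ D._*ᵈ_ D.-ᵈ_ (constant 1#) (constant q) (constant l) (0# , 1#)

      firstHom : RingHoms.RingHom D.dualRing R
      firstHom = record { φ = proj₁ ; φ-+ = λ _ _ → refl ; φ-* = λ _ _ → refl ; φ-neg = λ _ → refl ; φ-1 = refl }

      module Qξ = QuotientRing R (ξ * ξ)

      -- The evaluation ε ↦ ξ is multiplicative only modulo ξ², because ε² = 0.
      evaluationHom : RingHoms.RingHom D.dualRing Qξ.quotientRing
      evaluationHom = record
        { φ = λ { (u , v) → u + ξ * v }
        ; φ-+ = λ x y → Qξ.lift (solve 5 (λ a b c d z → a :+ c :+ z :* (b :+ d) := a :+ z :* b :+ (c :+ z :* d)) refl _ _ _ _ _)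
        ; φ-* = λ { (a , b) (c , d) → Qξ.congruent (- (b * d) , solve 5 (λ a b c d z → z :* z :* :- (b :* d) := a :* c :+ z :* (a :* d :+ b :* c) :- (a :+ z :* b) :* (c :+ z :* d)) refl _ _ _ _ _) }
        ; φ-neg = λ x → Qξ.lift (solve 3 (λ a b z → :- a :+ z :* :- b := :- (a :+ z :* b)) refl _ _ _)
        ; φ-1 = Qξ.lift (solve 1 (λ z → one :+ z :* zeroᵉ := one) refl _) }

      -- Cancelling a in the constant part gives c = 0; then ad + bc = 0 gives d = 0.
      cancellable-dual : ∀ {a b} → RootOfUnity.Cancellable Q.quotientRing q a → RootOfUnity.Cancellable DQ.dualRing (constant q) (a , b)
      cancellable-dual {a} {b} canc (c , d) (e DQ.,ᵈ f) = c≈0 ,ᵈ canc d (QR.trans (QR.sym (QR.trans (QR.+-congˡ (QR.trans (QR.*-congˡ c≈0) (QR.zeroʳ b))) (QR.+-identityʳ _))) f)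
        where
        c≈0 : c ≡ₘ 0#
        c≈0 = canc c e

      m : ℕ
      m = M ℕ.+ k

      value : Carrier × Carrier
      value = Sε.difference (constant κ) m M

      qⁿ≈1 : DQR.pow (constant q) n DQ.≈ᵈ constant 1#
      qⁿ≈1 = DQR.trans (DQR.sym (RingHoms.RingHom.φ-pow constantHom q n))
          (Q.congruent (∣-resp (solve 1 (λ l → :- (one :- l) := l :- one) refl l) (∣-neg g∣1-l)) ,ᵈ QR.refl)
        where
        constantHom : RingHoms.RingHom Q.quotientRing DQ.dualRing
        constantHom = record
          { φ = constant
          ; φ-+ = λ x y → QR.refl ,ᵈ Q.lift (sym (+-identityʳ 0#))
          ; φ-* = λ x y → QR.refl ,ᵈ Q.lift (solve 2 (λ x y → zeroᵉ := x :* zeroᵉ :+ zeroᵉ :* y) refl _ _)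
          ; φ-neg = λ x → QR.refl ,ᵈ Q.lift (sym -0#≈0#)
          ; φ-1 = QR.refl ,ᵈ QR.refl }

      γ-first : ∀ j → proj₁ (Sε.γ j) ≈ pow (1# + - pow (pow q 2) (suc j)) 3 * (l * ((1# + - pow (pow q 2) (suc j)) * (1# + - pow (pow q 2) (suc j))))
      γ-first j = trans (RingHoms.RingHom.φ-γ firstHom {q = constant q} {constant l} {0# , 1#} {q} {l} {0#} refl refl refl j)
        (*-congˡ (solve 2 (λ a y → a :- zeroᵉ :* y := a) refl _ _))

      l-coprime : Coprime g l
      l-coprime = coprime-shift g∣1-l coprime-1

      γ-cancellable : ∀ j → suc j ℕ.< n → RootOfUnity.Cancellable DQ.dualRing (constant q) (Sε.γ j)
      γ-cancellable j lt = cancellable-dual (Modulo.coprime⇒cancellable R q g g-primitive (coprime-resp (sym (γ-first j))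
        (coprime-* (coprime-pow 3 (coprime-p j lt)) (coprime-* l-coprime (coprime-* (coprime-p j lt) (coprime-p j lt))))))

      two : ∀ y → y D.+ᵈ y DQ.≈ᵈ constant 0# → y DQ.≈ᵈ constant 0#
      two (a , b) (e DQ.,ᵈ f) = Modulo.two-cancellable R q g g-primitive a e ,ᵈ Modulo.two-cancellable R q g g-primitive b f

      -- The left sum vanishes by reflection over the dual numbers, the right one through κ. The
      -- ε-component of this equation is g | Z₁.
      vanishes : value DQ.≈ᵈ constant 0#
      vanishes = DQR.trans (DQR.+-cong (DQR.trans (DQR.*-congˡ (SeriesVanishing.clearedSum-vanishes DQ.dualRing (constant q) (constant l) (0# , 1#) n M n+1≡2M M<n qⁿ≈1 two γ-cancellable k M+k<n)) (DQR.zeroʳ _))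
          (DQR.-‿cong (DQR.trans (DQR.*-congʳ (Q.∣⇒≡ₘ0 g∣κ ,ᵈ QR.refl)) (DQR.zeroˡ _))))
        (DQR.-‿inverseʳ (constant 0#))

      Z₀ Z₁ : Carrier
      Z₀ = proj₁ value
      Z₁ = proj₂ value

      g∣Z₁ : g ∣ Z₁
      g∣Z₁ = Q.≡ₘ0⇒∣ (DQ.snd vanishes)

      evaluated : Z₀ + ξ * Z₁ Qξ.≡ₘ 0#
      evaluated = Qtrans (RingHoms.RingHom.φ-difference evaluationHom {q′ = q} {l} {ξ}
          (Qξ.lift (solve 2 (λ a z → a :+ z :* zeroᵉ := a) refl _ _)) (Qξ.lift (solve 2 (λ a z → a :+ z :* zeroᵉ := a) refl _ _))
          (Qξ.lift (solve 1 (λ z → zeroᵉ :+ z :* one := z) refl _)) (Qξ.lift (solve 2 (λ a z → a :+ z :* zeroᵉ := a) refl _ _)) m M) (Qξ.lift exact)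
        where Qtrans = CommutativeRing.trans Qξ.quotientRing

    -- The exact identity at x = ξ reads Z₀ + ξZ₁ ≡ 0 modulo ξ². Since g² | ξ and g | Z₁, the cube
    -- of g divides ξ² and ξZ₁, hence also Z₀, the value at x = 0.
    cube∣difference : g * (g * g) ∣ S.difference 0# κ m M
    cube∣difference = ∣-resp (RingHoms.RingHom.φ-difference firstHom {q = constant q} {constant l} {0# , 1#} {q} {l} {0#} refl refl refl {constant κ} refl m M)
      (∣-resp (solve 2 (λ a b → a :+ b :- b := a) refl Z₀ (ξ * Z₁)) (∣-+ (∣-trans g³∣ξ² (Qξ.≡ₘ0⇒∣ evaluated)) (∣-neg (∣-resp (*-comm Z₁ ξ) (*-mono-∣ g∣Z₁ g²∣ξ)))))
      where
      g²∣ξ : g * g ∣ ξ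
      g²∣ξ = *-mono-∣ g∣1-l g∣1-l
      g³∣ξ² : g * (g * g) ∣ ξ * ξ
      g³∣ξ² = *-mono-∣ (∣-trans (g , refl) g²∣ξ) g²∣ξ

-- The sums of the theorem over a ring with invertible denominators

module RationalSums (R : CommutativeRing 0ℓ 0ℓ) (q q⁻¹ l : CommutativeRing.Carrier R) where
  open RingOps R
  open RootOfUnity R q using (Recurrent)
  open SeriesOver R q l 0#

  module _ (qq⁻¹≈1 : q * q⁻¹ ≈ 1#) (ι : ℕ → Carrier) (ι-inv : ∀ k → ι k * (1# + - pow p (suc k)) ≈ 1#)
    (j : ℕ → Carrier) (j-spec : ∀ k → q * (1# + - q) * j k ≈ q + - pow q (4 ℕ.* k))
    where

    a z b⁻¹ : ℕ → Carrier
    a = prod (λ i → 1# + - (q⁻¹ * pow p i))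
    z = prod (λ i → 1# + - (pow q 3 * pow p i))
    b⁻¹ = prod ι

    termˡ termʳ : ℕ → Carrier
    termˡ k = pow (- 1#) k * (j k * ((pow (a k) 5 * pow (b⁻¹ k) 5) * pow q (k ℕ.* k ℕ.+ 5 ℕ.* k)))
    termʳ k = ((pow (a k) 2 * z k) * pow (b⁻¹ k) 3) * pow q (3 ℕ.* k)

    private
      f f′ : ℕ → Carrier
      f k = pow (a k) 5 * pow (b⁻¹ k) 5 * pow q (5 ℕ.* k)
      f′ k = pow (a k) 2 * z k * pow (b⁻¹ k) 3 * pow q (2 ℕ.* k)

      q-p : ∀ k → q + - pow p k ≈ q * (1# + - (q⁻¹ * pow p k))
      q-p k = sym (trans (solve 3 (λ q a y → q :* (one :- a :* y) := q :- (q :* a) :* y) refl _ _ _) (+-congˡ (-‿cong (trans (*-congʳ qq⁻¹≈1) (*-identityˡ _)))))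

      θ₀ : ∀ k → θ k ≈ l * ((q * (1# + - (q⁻¹ * pow p k))) * (q * (1# + - (q⁻¹ * pow p k))))
      θ₀ k = trans (solve 4 (λ q y l d → l :* d :- zeroᵉ :* (q :* y) := l :* d) refl _ _ _ _) (*-congˡ (*-cong (q-p k) (q-p k)))

      -- At x = 0 both α and γ carry exactly one factor l, so the recurrence holds for every l. It
      -- is applied with l = qⁿ for Φₙ³ and with l = 1 for the smaller divisors.
      f-recurrent : ∀ m → Recurrent α γ f m
      f-recurrent m k _ = begin
        pow (a k * u) 5 * pow (b⁻¹ k * ι k) 5 * pow q (5 ℕ.* suc k) * (pow v 3 * (l * (v * v) + - (0# * pow p (suc k))))
          ≈⟨ *-congʳ (*-congˡ (trans (pow≡ q (ℕP.*-suc 5 k)) (pow-+ q 5 (5 ℕ.* k)))) ⟩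
        pow (a k * u) 5 * pow (b⁻¹ k * ι k) 5 * (pow q 5 * pow q (5 ℕ.* k)) * (pow v 3 * (l * (v * v) + - (0# * pow p (suc k))))
          ≈⟨ solve 9 (λ a u b i q y v l w →
               (a :* u) :^ 5 :* (b :* i) :^ 5 :* (q :^ 5 :* y) :* (v :^ 3 :* (l :* (v :* v) :- zeroᵉ :* w)) :=
               (i :* v) :^ 5 :* (a :^ 5 :* b :^ 5 :* y :* ((q :* u) :^ 3 :* (l :* ((q :* u) :* (q :* u)))))) refl _ _ _ _ _ _ _ _ _ ⟩
        pow (ι k * v) 5 * (f k * (pow (q * u) 3 * (l * ((q * u) * (q * u)))))
          ≈⟨ trans (*-congʳ (trans (pow-cong 5 (ι-inv k)) (pow-1# 5))) (*-identityˡ _) ⟩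
        f k * (pow (q * u) 3 * (l * ((q * u) * (q * u)))) ≈⟨ *-congˡ (*-cong (pow-cong 3 (sym (q-p k))) (sym (θ₀ k))) ⟩
        f k * α k ∎
        where
        u = 1# + - (q⁻¹ * pow p k)
        v = 1# + - pow p (suc k)

      f′-recurrent : ∀ m → Recurrent α′ γ′ f′ m
      f′-recurrent m k _ = begin
        pow (a k * u) 2 * (z k * t) * pow (b⁻¹ k * ι k) 3 * pow q (2 ℕ.* suc k) * (pow v 3 * l)
          ≈⟨ *-congʳ (*-congˡ (trans (pow≡ q (ℕP.*-suc 2 k)) (pow-+ q 2 (2 ℕ.* k)))) ⟩
        pow (a k * u) 2 * (z k * t) * pow (b⁻¹ k * ι k) 3 * (pow q 2 * pow q (2 ℕ.* k)) * (pow v 3 * l)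
          ≈⟨ solve 10 (λ a u z t b i q y v l →
               (a :* u) :^ 2 :* (z :* t) :* (b :* i) :^ 3 :* (q :^ 2 :* y) :* (v :^ 3 :* l) :=
               (i :* v) :^ 3 :* (a :^ 2 :* z :* b :^ 3 :* y :* (l :* ((q :* u) :* (q :* u)) :* t))) refl _ _ _ _ _ _ _ _ _ _ ⟩
        pow (ι k * v) 3 * (f′ k * (l * ((q * u) * (q * u)) * t))
          ≈⟨ trans (*-congʳ (trans (pow-cong 3 (ι-inv k)) (pow-1# 3))) (*-identityˡ _) ⟩
        f′ k * (l * ((q * u) * (q * u)) * t) ≈⟨ *-congˡ (*-congʳ (sym (θ₀ k))) ⟩
        f′ k * α′ k ∎
        where
        u = 1# + - (q⁻¹ * pow p k)
        v = 1# + - pow p (suc k)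
        t = 1# + - (pow q 3 * pow p k)

      one-f₀ : ∀ {f₀ x y} → f₀ ≈ 1# → f₀ * x ≈ y → y ≈ x
      one-f₀ e h = trans (sym h) (trans (*-congʳ e) (*-identityˡ _))

    left-cleared : ∀ m → q * (1# + - q) * sum termˡ m * prod γ m ≈ clearedSum c α γ m
    left-cleared m = trans (*-congʳ (trans (sym (sum-*ˡ _ termˡ m)) (sum-cong m (λ k _ → term k))))
      (one-f₀ (solve 0 (one :^ 5 :* one :^ 5 :* one := one) refl) (clearedSum-recurrent c α γ f m (f-recurrent m)))
      where
      term : ∀ k → q * (1# + - q) * termˡ k ≈ c k * f k
      term k = begin
        q * (1# + - q) * (pow (- 1#) k * (j k * ((pow (a k) 5 * pow (b⁻¹ k) 5) * pow q (k ℕ.* k ℕ.+ 5 ℕ.* k))))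
          ≈⟨ *-congˡ (*-congˡ (*-congˡ (*-congˡ (pow-+ q (k ℕ.* k) (5 ℕ.* k))))) ⟩
        q * (1# + - q) * (pow (- 1#) k * (j k * ((pow (a k) 5 * pow (b⁻¹ k) 5) * (pow q (k ℕ.* k) * pow q (5 ℕ.* k)))))
          ≈⟨ solve 6 (λ w e j x y z → w :* (e :* (j :* (x :* (y :* z)))) := e :* (w :* j) :* y :* (x :* z)) refl _ _ _ _ _ _ ⟩
        pow (- 1#) k * (q * (1# + - q) * j k) * pow q (k ℕ.* k) * f k ≈⟨ *-congʳ (*-congʳ (*-congˡ (j-spec k))) ⟩
        c k * f k ∎

    right-cleared : ∀ m → sum termʳ m * prod γ′ m ≈ clearedSum c′ α′ γ′ m
    right-cleared m = trans (*-congʳ (sum-cong m (λ k _ → term k)))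
      (one-f₀ (solve 0 (one :^ 2 :* one :* one :^ 3 :* one := one) refl) (clearedSum-recurrent c′ α′ γ′ f′ m (f′-recurrent m)))
      where
      term : ∀ k → termʳ k ≈ c′ k * f′ k
      term k = trans (*-congˡ (pow-+ q k (2 ℕ.* k))) (solve 3 (λ x y z → x :* (y :* z) := y :* (x :* z)) refl _ _ _)

    difference-cleared : ∀ κ r m N → κ ≈ q * (1# + - q) * r →
      difference κ m N ≈ prod γ′ N * prod γ m * (q * (1# + - q)) * (sum termˡ m + - (r * sum termʳ N))
    difference-cleared κ r m N κ≈ = begin
      prod γ′ N * clearedSum c α γ m + - (κ * (prod γ m * clearedSum c′ α′ γ′ N))
        ≈⟨ +-cong (*-congˡ (left-cleared m)) (-‿cong (*-cong (sym κ≈) (*-congˡ (right-cleared N)))) ⟨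
      prod γ′ N * (q * (1# + - q) * sum termˡ m * prod γ m) + - (q * (1# + - q) * r * (prod γ m * (sum termʳ N * prod γ′ N)))
        ≈⟨ solve 6 (λ g h w x r y → g :* (w :* x :* h) :- w :* r :* (h :* (y :* g)) := g :* h :* w :* (x :- r :* y)) refl _ _ _ _ _ _ ⟩
      prod γ′ N * prod γ m * (q * (1# + - q)) * (sum termˡ m + - (r * sum termʳ N)) ∎

-- (q⁻¹;q²)ₖ/(q²;q²)ₖ and (q³;q²)ₖ/(q²;q²)ₖ are polynomials (q-Catalan numbers and central
-- q-binomials) over powers of q and of (-q;q)ₖ; the latter are units modulo Φ_d for odd d.
module QBinomial (R : CommutativeRing 0ℓ 0ℓ) (q : CommutativeRing.Carrier R) where
  open RingOps R
  open RootOfUnity R q hiding (c)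
  open SeriesOver R q 1# 0# using (α; γ; α′; γ′; p)

  module _ (1-q-cancellable : ∀ k → Cancellable (1# + - pow q (suc k))) where

    -- The Gaussian binomial of r + s over r.
    gauss : ℕ → ℕ → Carrier
    gauss zero s = 1#
    gauss (suc r) zero = 1#
    gauss (suc r) (suc s) = gauss r (suc s) + pow q (suc r) * gauss (suc r) s

    private
      F : ℕ → Carrier
      F = prod (λ j → 1# + - pow q (suc j))

      F-cancellable : ∀ k → Cancellable (F k)
      F-cancellable k = Cancellable-prod _ k (λ j _ → 1-q-cancellable j)

    gauss-F : ∀ r s → gauss r s * (F r * F s) ≈ F (r ℕ.+ s)
    gauss-F zero s = solve 1 (λ f → one :* (one :* f) := f) refl _
    gauss-F (suc r) zero = trans (solve 1 (λ f → one :* (f :* one) := f) refl _) (reflexive (≡.cong F (≡.sym (ℕP.+-identityʳ (suc r)))))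
    gauss-F (suc r) (suc s) = begin
      (gauss r (suc s) + y * gauss (suc r) s) * (F r * (1# + - y) * (F s * (1# + - x)))
        ≈⟨ solve 6 (λ g y h f k x → (g :+ y :* h) :* (f :* (one :- y) :* (k :* (one :- x))) :=
             g :* (f :* (k :* (one :- x))) :* (one :- y) :+ h :* (f :* (one :- y) :* k) :* (y :* (one :- x))) refl _ _ _ _ _ _ ⟩
      gauss r (suc s) * (F r * F (suc s)) * (1# + - y) + gauss (suc r) s * (F (suc r) * F s) * (y * (1# + - x))
        ≈⟨ +-cong (*-congʳ (trans (gauss-F r (suc s)) (reflexive (≡.cong F (ℕP.+-suc r s))))) (*-congʳ (gauss-F (suc r) s)) ⟩
      F (suc (r ℕ.+ s)) * (1# + - y) + F (suc (r ℕ.+ s)) * (y * (1# + - x))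
        ≈⟨ solve 3 (λ f y x → f :* (one :- y) :+ f :* (y :* (one :- x)) := f :* (one :- y :* x)) refl _ _ _ ⟩
      F (suc (r ℕ.+ s)) * (1# + - (y * x))
        ≈⟨ *-congˡ (+-congˡ (-‿cong (trans (sym (pow-+ q (suc r) (suc s))) (pow≡ q (≡.cong suc (ℕP.+-suc r s)))))) ⟩
      F (suc (suc (r ℕ.+ s))) ≡⟨ ≡.cong (λ k → F (suc k)) (≡.sym (ℕP.+-suc r s)) ⟩
      F (suc r ℕ.+ suc s) ∎
      where
      y = pow q (suc r)
      x = pow q (suc s)

    -- The difference form exhibits the q-Catalan number as a polynomial; its quotient form is
    -- `catalan-central`.
    central catalan : ℕ → Carrier
    central k = gauss k k
    catalan zero = 1#
    catalan (suc k) = central (suc k) + - (q * gauss (suc (suc k)) k)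

    private
      Y : ℕ → Carrier
      Y k = pow q k

    catalan-central : ∀ k → catalan k * (1# + - Y (suc k)) ≈ (1# + - q) * central k
    catalan-central zero = solve 1 (λ q → one :* (one :- q :* one) := (one :- q) :* one) refl _
    catalan-central (suc k) = begin
      (C + - (q * g)) * (1# + - (q * y)) ≈⟨ solve 4 (λ c q g y → (c :- q :* g) :* (one :- q :* y) := c :* (one :- q :* y) :- q :* (g :* (one :- q :* y))) refl _ _ _ _ ⟩
      C * (1# + - (q * y)) + - (q * (g * (1# + - (q * y)))) ≈⟨ +-congˡ (-‿cong (*-congˡ shifted)) ⟩
      C * (1# + - (q * y)) + - (q * (C * (1# + - y))) ≈⟨ solve 3 (λ c q y → c :* (one :- q :* y) :- q :* (c :* (one :- y)) := (one :- q) :* c) refl _ _ _ ⟩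
      (1# + - q) * C ∎
      where
      C = central (suc k)
      g = gauss (suc (suc k)) k
      y = Y (suc k)
      shifted : g * (1# + - (q * y)) ≈ C * (1# + - y)
      shifted = cancel (Cancellable-* (F-cancellable (suc k)) (F-cancellable k)) (begin
        F (suc k) * F k * (g * (1# + - (q * y))) ≈⟨ solve 4 (λ a b g z → a :* b :* (g :* z) := g :* (a :* z :* b)) refl _ _ _ _ ⟩
        g * (F (suc (suc k)) * F k) ≈⟨ gauss-F (suc (suc k)) k ⟩
        F (suc (suc k) ℕ.+ k) ≡⟨ ≡.cong F (≡.sym (ℕP.+-suc (suc k) k)) ⟩
        F (suc k ℕ.+ suc k) ≈⟨ gauss-F (suc k) (suc k) ⟨
        C * (F (suc k) * (F k * (1# + - y))) ≈⟨ solve 4 (λ c a b z → c :* (a :* (b :* z)) := a :* b :* (c :* z)) refl _ _ _ _ ⟩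
        F (suc k) * F k * (C * (1# + - y)) ∎)

    central-suc : ∀ k → central (suc k) * ((1# + - Y (suc k)) * (1# + - Y (suc k))) ≈
      central k * ((1# + - Y (suc (k ℕ.+ k))) * (1# + - Y (suc (suc (k ℕ.+ k)))))
    central-suc k = cancel (Cancellable-* (F-cancellable k) (F-cancellable k)) (begin
      F k * F k * (central (suc k) * ((1# + - Y (suc k)) * (1# + - Y (suc k))))
        ≈⟨ solve 3 (λ f c y → f :* f :* (c :* (y :* y)) := c :* (f :* y :* (f :* y))) refl _ _ _ ⟩
      central (suc k) * (F (suc k) * F (suc k)) ≈⟨ gauss-F (suc k) (suc k) ⟩
      F (suc k ℕ.+ suc k) ≡⟨ ≡.cong (λ j → F (suc j)) (ℕP.+-suc k k) ⟩
      F (k ℕ.+ k) * (1# + - Y (suc (k ℕ.+ k))) * (1# + - Y (suc (suc (k ℕ.+ k)))) ≈⟨ *-congʳ (*-congʳ (gauss-F k k)) ⟨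
      central k * (F k * F k) * (1# + - Y (suc (k ℕ.+ k))) * (1# + - Y (suc (suc (k ℕ.+ k))))
        ≈⟨ solve 4 (λ c f x y → c :* (f :* f) :* x :* y := f :* f :* (c :* (x :* y))) refl _ _ _ _ ⟩
      F k * F k * (central k * ((1# + - Y (suc (k ℕ.+ k))) * (1# + - Y (suc (suc (k ℕ.+ k)))))) ∎)

    e : ℕ → Carrier
    e j = 1# + Y (suc j)

    tail : ℕ → ℕ → Carrier
    tail k = prod (λ j → e (k ℕ.+ j) * e (k ℕ.+ j))

    bracket : ℕ → Carrier
    bracket zero = 0#
    bracket (suc k) = 1# + q * bracket k

    -- For k ≤ m, `v m k` is qᵏ(q⁻¹;q²)ₖ/(q²;q²)ₖ and `z m k` is (q³;q²)ₖ/(q²;q²)ₖ, each multiplied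
    -- by (-q;q)ₘ². `tail` is what remains of that factor after cancelling the denominator.
    v z : ℕ → ℕ → Carrier
    v m zero = tail 0 m
    v m (suc k) = - (Y k * catalan k * e k) * tail (suc k) (m ℕ.∸ suc k)
    z m k = bracket (suc (k ℕ.+ k)) * central k * tail k (m ℕ.∸ k)

    private
      bracket-spec : ∀ k → (1# + - q) * bracket k ≈ 1# + - Y k
      bracket-spec zero = solve 1 (λ q → (one :- q) :* zeroᵉ := one :- one) refl _
      bracket-spec (suc k) = begin
        (1# + - q) * (1# + q * bracket k) ≈⟨ solve 2 (λ q b → (one :- q) :* (one :+ q :* b) := one :- q :+ q :* ((one :- q) :* b)) refl _ _ ⟩
        1# + - q + q * ((1# + - q) * bracket k) ≈⟨ +-congˡ (*-congˡ (bracket-spec k)) ⟩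
        1# + - q + q * (1# + - Y k) ≈⟨ solve 2 (λ q y → one :- q :+ q :* (one :- y) := one :- q :* y) refl _ _ ⟩
        1# + - Y (suc k) ∎

      tail-suc : ∀ {m} k → k ℕ.< m → tail k (m ℕ.∸ k) ≈ e k * e k * tail (suc k) (m ℕ.∸ suc k)
      tail-suc {m} k k<m = begin
        tail k (m ℕ.∸ k) ≡⟨ ≡.cong (tail k) (ℕP.+-∸-assoc 1 k<m) ⟩
        tail k (suc (m ℕ.∸ suc k)) ≈⟨ prod-head (λ j → e (k ℕ.+ j) * e (k ℕ.+ j)) (m ℕ.∸ suc k) ⟩
        e (k ℕ.+ 0) * e (k ℕ.+ 0) * prod (λ j → e (k ℕ.+ suc j) * e (k ℕ.+ suc j)) (m ℕ.∸ suc k)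
          ≈⟨ *-cong (reflexive (≡.cong (λ i → e i * e i) (ℕP.+-identityʳ k))) (prod-cong (m ℕ.∸ suc k) (λ j _ → reflexive (≡.cong (λ i → e i * e i) (ℕP.+-suc k j)))) ⟩
        e k * e k * tail (suc k) (m ℕ.∸ suc k) ∎

      p^ : ∀ k → pow p k ≈ Y (k ℕ.+ k)
      p^ k = trans (pow-pow q 2 k) (pow≡ q (eq k))
        where
        eq : ∀ k → k ℕ.* 2 ≡ k ℕ.+ k
        eq = solve-∀

      1-p : ∀ k → 1# + - pow p (suc k) ≈ (1# + - Y (suc k)) * e k
      1-p k = trans (+-congˡ (-‿cong (trans (p^ (suc k)) (pow-+ q (suc k) (suc k))))) (solve 1 (λ y → one :- y :* y := (one :- y) :* (one :+ y)) refl _)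

      Y-even : ∀ k → 1# + - Y (suc (suc (k ℕ.+ k))) ≈ (1# + - Y (suc k)) * e k
      Y-even k = trans (+-congˡ (-‿cong (trans (pow≡ q (≡.cong suc (≡.sym (ℕP.+-suc k k)))) (sym (p^ (suc k)))))) (1-p k)

      catalan-suc : ∀ k → catalan (suc k) * (1# + - Y (suc (suc k))) ≈ catalan k * e k * (1# + - Y (suc (k ℕ.+ k)))
      catalan-suc k = cancel (Cancellable-* (1-q-cancellable k) (1-q-cancellable k)) (begin
        y * y * (catalan (suc k) * (1# + - Y (suc (suc k)))) ≈⟨ *-congˡ (catalan-central (suc k)) ⟩
        y * y * ((1# + - q) * central (suc k)) ≈⟨ solve 3 (λ y w c → y :* y :* (w :* c) := w :* (c :* (y :* y))) refl _ _ _ ⟩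
        (1# + - q) * (central (suc k) * (y * y)) ≈⟨ *-congˡ (trans (central-suc k) (*-congˡ (*-congˡ (Y-even k)))) ⟩
        (1# + - q) * (central k * (o * (y * e k))) ≈⟨ solve 5 (λ w c o y e → w :* (c :* (o :* (y :* e))) := w :* c :* (y :* (e :* o))) refl _ _ _ _ _ ⟩
        (1# + - q) * central k * (y * (e k * o)) ≈⟨ *-congʳ (catalan-central k) ⟨
        catalan k * y * (y * (e k * o)) ≈⟨ solve 4 (λ c y e o → c :* y :* (y :* (e :* o)) := y :* y :* (c :* e :* o)) refl _ _ _ _ ⟩
        y * y * (catalan k * e k * o) ∎)
        where
        y = 1# + - Y (suc k)
        o = 1# + - Y (suc (k ℕ.+ k))

    v-recurrent : ∀ m k → k ℕ.< m → v m (suc k) * (1# + - pow p (suc k)) ≈ v m k * (q + - pow p k)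
    v-recurrent m zero 0<m = begin
      - (1# * 1# * e 0) * tail 1 (m ℕ.∸ 1) * (1# + - pow p 1) ≈⟨ *-congˡ (1-p 0) ⟩
      - (1# * 1# * e 0) * tail 1 (m ℕ.∸ 1) * ((1# + - (q * 1#)) * e 0)
        ≈⟨ solve 3 (λ e t q → :- (one :* one :* e) :* t :* ((one :- q :* one) :* e) := e :* e :* t :* (q :- one)) refl _ _ _ ⟩
      e 0 * e 0 * tail 1 (m ℕ.∸ 1) * (q + - 1#) ≈⟨ *-congʳ (tail-suc 0 0<m) ⟨
      tail 0 m * (q + - 1#) ∎
    v-recurrent m (suc k) k<m = begin
      - (q * Y k * catalan (suc k) * e (suc k)) * T * (1# + - pow p (suc (suc k))) ≈⟨ *-congˡ (1-p (suc k)) ⟩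
      - (q * Y k * catalan (suc k) * e (suc k)) * T * ((1# + - Y (suc (suc k))) * e (suc k))
        ≈⟨ solve 6 (λ q y c e t w → :- (q :* y :* c :* e) :* t :* (w :* e) := :- (q :* y :* (c :* w) :* (e :* e :* t))) refl _ _ _ _ _ _ ⟩
      - (q * Y k * (catalan (suc k) * (1# + - Y (suc (suc k)))) * (e (suc k) * e (suc k) * T)) ≈⟨ -‿cong (*-cong (*-congˡ (catalan-suc k)) (sym (tail-suc (suc k) k<m))) ⟩
      - (q * Y k * (catalan k * e k * (1# + - Y (suc (k ℕ.+ k)))) * tail (suc k) (m ℕ.∸ suc k))
        ≈⟨ solve 6 (λ q y c e o t → :- (q :* y :* (c :* e :* (one :- o)) :* t) := :- (y :* c :* e) :* t :* (q :- q :* o)) refl _ _ _ _ _ _ ⟩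
      - (Y k * catalan k * e k) * tail (suc k) (m ℕ.∸ suc k) * (q + - (q * Y (suc (k ℕ.+ k))))
        ≈⟨ *-congˡ (+-congˡ (-‿cong (trans (p^ (suc k)) (pow≡ q (≡.cong suc (ℕP.+-suc k k)))))) ⟨
      v m (suc k) * (q + - pow p (suc k)) ∎
      where T = tail (suc (suc k)) (m ℕ.∸ suc (suc k))

    z-recurrent : ∀ m k → k ℕ.< m → z m (suc k) * (1# + - pow p (suc k)) ≈ z m k * (1# + - (pow q 3 * pow p k))
    z-recurrent m k k<m = cancel (Cancellable-* 1-q (Cancellable-* (1-q-cancellable k) (1-q-cancellable k))) (begin
      (1# + - q) * (y * y) * (bracket (suc (suc k ℕ.+ suc k)) * central (suc k) * T * (1# + - pow p (suc k)))
        ≈⟨ solve 6 (λ w y b c t p → w :* (y :* y) :* (b :* c :* t :* p) := w :* b :* (c :* (y :* y)) :* t :* p) refl _ _ _ _ _ _ ⟩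
      (1# + - q) * bracket (suc (suc k ℕ.+ suc k)) * (central (suc k) * (y * y)) * T * (1# + - pow p (suc k))
        ≈⟨ *-cong (*-congʳ (*-cong (bracket-spec (suc (suc k ℕ.+ suc k))) (trans (central-suc k) (*-congˡ (*-congˡ (Y-even k)))))) (1-p k) ⟩
      (1# + - Y (suc (suc k ℕ.+ suc k))) * (central k * (o * (y * e k))) * T * (y * e k)
        ≈⟨ *-congʳ (*-congʳ (*-congʳ (+-congˡ (-‿cong q³p)))) ⟩
      (1# + - (pow q 3 * pow p k)) * (central k * (o * (y * e k))) * T * (y * e k)
        ≈⟨ solve 6 (λ w c o y e t → w :* (c :* (o :* (y :* e))) :* t :* (y :* e) := y :* y :* (o :* c :* (e :* e :* t) :* w)) refl _ _ _ _ _ _ ⟩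
      y * y * (o * central k * (e k * e k * T) * (1# + - (pow q 3 * pow p k)))
        ≈⟨ *-congˡ (*-congʳ (*-cong (*-congʳ (bracket-spec (suc (k ℕ.+ k)))) (tail-suc k k<m))) ⟨
      y * y * ((1# + - q) * bracket (suc (k ℕ.+ k)) * central k * tail k (m ℕ.∸ k) * (1# + - (pow q 3 * pow p k)))
        ≈⟨ solve 6 (λ y w b c t p → y :* y :* (w :* b :* c :* t :* p) := w :* (y :* y) :* (b :* c :* t :* p)) refl _ _ _ _ _ _ ⟩
      (1# + - q) * (y * y) * (z m k * (1# + - (pow q 3 * pow p k))) ∎)
      where
      y = 1# + - Y (suc k)
      o = 1# + - Y (suc (k ℕ.+ k))
      T = tail (suc k) (m ℕ.∸ suc k)
      1-q : Cancellable (1# + - q)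
      1-q x h = 1-q-cancellable 0 x (trans (*-congʳ (+-congˡ (-‿cong (*-identityʳ q)))) h)
      q³p : Y (suc (suc k ℕ.+ suc k)) ≈ pow q 3 * pow p k
      q³p = trans (pow≡ q (≡.cong (λ j → suc (suc j)) (ℕP.+-suc k k))) (trans (pow-+ q 3 (k ℕ.+ k)) (*-congˡ (sym (p^ k))))

    V V′ : ℕ → ℕ → Carrier
    V m k = pow (v m k) 5
    V′ m k = pow (v m k) 2 * z m k

    -- A solution by polynomials at l = 1, x = 0. It is obtained where every 1 - qᵏ can be cancelled
    -- and survives reduction modulo Φ_d, where 1 - q^d becomes zero.
    V-recurrent : ∀ m → Recurrent α γ (V m) m
    V-recurrent m k k<m = begin
      pow (v m (suc k)) 5 * (pow y 3 * (1# * (y * y) + - (0# * pow p (suc k))))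
        ≈⟨ solve 3 (λ v y w → v :^ 5 :* (y :^ 3 :* (one :* (y :* y) :- zeroᵉ :* w)) := (v :* y) :^ 5) refl _ _ _ ⟩
      pow (v m (suc k) * y) 5 ≈⟨ pow-cong 5 (v-recurrent m k k<m) ⟩
      pow (v m k * x) 5 ≈⟨ solve 3 (λ v x w → (v :* x) :^ 5 := v :^ 5 :* (x :^ 3 :* (one :* (x :* x) :- zeroᵉ :* w))) refl _ _ _ ⟩
      pow (v m k) 5 * (pow x 3 * (1# * (x * x) + - (0# * (q * pow p k)))) ∎
      where
      y = 1# + - pow p (suc k)
      x = q + - pow p k

    V′-recurrent : ∀ m → Recurrent α′ γ′ (V′ m) m
    V′-recurrent m k k<m = begin
      pow (v m (suc k)) 2 * z m (suc k) * (pow y 3 * 1#) ≈⟨ solve 3 (λ v z y → v :^ 2 :* z :* (y :^ 3 :* one) := (v :* y) :^ 2 :* (z :* y)) refl _ _ _ ⟩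
      pow (v m (suc k) * y) 2 * (z m (suc k) * y) ≈⟨ *-cong (pow-cong 2 (v-recurrent m k k<m)) (z-recurrent m k k<m) ⟩
      pow (v m k * x) 2 * (z m k * w) ≈⟨ solve 5 (λ v x z w t → (v :* x) :^ 2 :* (z :* w) := v :^ 2 :* z :* ((one :* (x :* x) :- zeroᵉ :* t) :* w)) refl _ _ _ _ _ ⟩
      V′ m k * α′ k ∎
      where
      y = 1# + - pow p (suc k)
      x = q + - pow p k
      w = 1# + - (pow q 3 * pow p k)

-- _≈P_ unfolds to a function type, from which unification cannot recover its arguments.
infix 4 _≋_
record _≋_ (f g : Poly) : Set where
  constructor coeffwise
  field coeffs : f ≈P g
open _≋_ public

≋-refl : ∀ {f} → f ≋ f
≋-refl = coeffwise λ i → ≡.refl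

≋-sym : ∀ {f g} → f ≋ g → g ≋ f
≋-sym p = coeffwise λ i → ≡.sym (coeffs p i)

≋-trans : ∀ {f g h} → f ≋ g → g ≋ h → f ≋ h
≋-trans p r = coeffwise λ i → ≡.trans (coeffs p i) (coeffs r i)

≋-setoid : Setoid 0ℓ 0ℓ
≋-setoid = record { Carrier = Poly ; _≈_ = _≋_ ; isEquivalence = record { refl = ≋-refl ; sym = ≋-sym ; trans = ≋-trans } }

module ≋-Reasoning = Relation.Binary.Reasoning.Setoid ≋-setoid

-- The commutative ring ℤ[q]

coeff-⊕ : ∀ f g i → coeff (f ⊕ g) i ≡ coeff f i ℤ.+ coeff g i
coeff-⊕ [] g i = ≡.sym (ℤP.+-identityˡ _)
coeff-⊕ (a ∷ f) [] i = ≡.sym (ℤP.+-identityʳ _)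
coeff-⊕ (a ∷ f) (b ∷ g) zero = ≡.refl
coeff-⊕ (a ∷ f) (b ∷ g) (suc i) = coeff-⊕ f g i

coeff-scale : ∀ c f i → coeff (scale c f) i ≡ c ℤ.* coeff f i
coeff-scale c [] i = ≡.sym (ℤP.*-zeroʳ c)
coeff-scale c (a ∷ f) zero = ≡.refl
coeff-scale c (a ∷ f) (suc i) = coeff-scale c f i

coeff-pneg : ∀ f i → coeff (pneg f) i ≡ ℤ.- coeff f i
coeff-pneg [] i = ≡.refl
coeff-pneg (a ∷ f) zero = ≡.refl
coeff-pneg (a ∷ f) (suc i) = coeff-pneg f i

∷-cong : ∀ {a b f g} → a ≡ b → f ≋ g → a ∷ f ≋ b ∷ g
∷-cong p r = coeffwise λ { zero → p ; (suc i) → coeffs r i }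

⊕-cong : ∀ {f f′ g g′} → f ≋ f′ → g ≋ g′ → f ⊕ g ≋ f′ ⊕ g′
⊕-cong {f} {f′} {g} {g′} p r = coeffwise λ i →
  ≡.trans (coeff-⊕ f g i) (≡.trans (≡.cong₂ ℤ._+_ (coeffs p i) (coeffs r i)) (≡.sym (coeff-⊕ f′ g′ i)))

pneg-cong : ∀ {f g} → f ≋ g → pneg f ≋ pneg g
pneg-cong {f} {g} p = coeffwise λ i →
  ≡.trans (coeff-pneg f i) (≡.trans (≡.cong ℤ.-_ (coeffs p i)) (≡.sym (coeff-pneg g i)))

scale-cong : ∀ c {f g} → f ≋ g → scale c f ≋ scale c g
scale-cong c {f} {g} p = coeffwise λ i →
  ≡.trans (coeff-scale c f i) (≡.trans (≡.cong (c ℤ.*_) (coeffs p i)) (≡.sym (coeff-scale c g i)))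

⊕-assoc : ∀ f g h → (f ⊕ g) ⊕ h ≋ f ⊕ (g ⊕ h)
⊕-assoc f g h = coeffwise λ i → begin
  coeff ((f ⊕ g) ⊕ h) i ≡⟨ coeff-⊕ (f ⊕ g) h i ⟩
  coeff (f ⊕ g) i ℤ.+ coeff h i ≡⟨ ≡.cong (ℤ._+ coeff h i) (coeff-⊕ f g i) ⟩
  coeff f i ℤ.+ coeff g i ℤ.+ coeff h i ≡⟨ ℤP.+-assoc (coeff f i) (coeff g i) (coeff h i) ⟩
  coeff f i ℤ.+ (coeff g i ℤ.+ coeff h i) ≡⟨ ≡.cong (λ x → coeff f i ℤ.+ x) (≡.sym (coeff-⊕ g h i)) ⟩
  coeff f i ℤ.+ coeff (g ⊕ h) i ≡⟨ ≡.sym (coeff-⊕ f (g ⊕ h) i) ⟩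
  coeff (f ⊕ (g ⊕ h)) i ∎
  where open ≡.≡-Reasoning

⊕-comm : ∀ f g → f ⊕ g ≋ g ⊕ f
⊕-comm f g = coeffwise λ i →
  ≡.trans (coeff-⊕ f g i) (≡.trans (ℤP.+-comm (coeff f i) (coeff g i)) (≡.sym (coeff-⊕ g f i)))

⊕-identityʳ : ∀ f → f ⊕ [] ≋ f
⊕-identityʳ f = ⊕-comm f []

⊕-inverseˡ : ∀ f → pneg f ⊕ f ≋ []
⊕-inverseˡ f = coeffwise λ i →
  ≡.trans (coeff-⊕ (pneg f) f i) (≡.trans (≡.cong (ℤ._+ coeff f i) (coeff-pneg f i)) (ℤP.+-inverseˡ (coeff f i)))

⊕-inverseʳ : ∀ f → f ⊕ pneg f ≋ []
⊕-inverseʳ f = ≋-trans (⊕-comm f (pneg f)) (⊕-inverseˡ f)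

infixr 8 q·_
q·_ : Poly → Poly
q· f = + 0 ∷ f

q·-cong : ∀ {f g} → f ≋ g → q· f ≋ q· g
q·-cong = ∷-cong ≡.refl

q·[]≋[] : q· [] ≋ []
q·[]≋[] = coeffwise λ { zero → ≡.refl ; (suc i) → ≡.refl }

q·-⊕ : ∀ f g → q· (f ⊕ g) ≋ q· f ⊕ q· g
q·-⊕ f g = coeffwise λ { zero → ≡.refl ; (suc i) → ≡.refl }

scale-⊕ : ∀ c f g → scale c (f ⊕ g) ≋ scale c f ⊕ scale c g
scale-⊕ c f g = coeffwise λ i → begin
  coeff (scale c (f ⊕ g)) i ≡⟨ coeff-scale c (f ⊕ g) i ⟩
  c ℤ.* coeff (f ⊕ g) i ≡⟨ ≡.cong (c ℤ.*_) (coeff-⊕ f g i) ⟩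
  c ℤ.* (coeff f i ℤ.+ coeff g i) ≡⟨ ℤP.*-distribˡ-+ c (coeff f i) (coeff g i) ⟩
  c ℤ.* coeff f i ℤ.+ c ℤ.* coeff g i ≡⟨ ≡.sym (≡.cong₂ ℤ._+_ (coeff-scale c f i) (coeff-scale c g i)) ⟩
  coeff (scale c f) i ℤ.+ coeff (scale c g) i ≡⟨ ≡.sym (coeff-⊕ (scale c f) (scale c g) i) ⟩
  coeff (scale c f ⊕ scale c g) i ∎
  where open ≡.≡-Reasoning

scale-scale : ∀ c d f → scale c (scale d f) ≋ scale (c ℤ.* d) f
scale-scale c d f = coeffwise λ i → begin
  coeff (scale c (scale d f)) i ≡⟨ coeff-scale c (scale d f) i ⟩
  c ℤ.* coeff (scale d f) i ≡⟨ ≡.cong (c ℤ.*_) (coeff-scale d f i) ⟩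
  c ℤ.* (d ℤ.* coeff f i) ≡⟨ ≡.sym (ℤP.*-assoc c d (coeff f i)) ⟩
  c ℤ.* d ℤ.* coeff f i ≡⟨ ≡.sym (coeff-scale (c ℤ.* d) f i) ⟩
  coeff (scale (c ℤ.* d) f) i ∎
  where open ≡.≡-Reasoning

scale-q· : ∀ c f → scale c (q· f) ≋ q· (scale c f)
scale-q· c f = ∷-cong (ℤP.*-zeroʳ c) ≋-refl

scale-1 : ∀ f → scale (+ 1) f ≋ f
scale-1 f = coeffwise λ i → ≡.trans (coeff-scale (+ 1) f i) (ℤP.*-identityˡ (coeff f i))

scale-0 : ∀ f → scale (+ 0) f ≋ []
scale-0 f = coeffwise λ i → ≡.trans (coeff-scale (+ 0) f i) (ℤP.*-zeroˡ (coeff f i))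

⊗-zeroʳ : ∀ f → f ⊗ [] ≋ []
⊗-zeroʳ [] = ≋-refl
⊗-zeroʳ (a ∷ f) = ≋-trans (q·-cong (⊗-zeroʳ f)) q·[]≋[]

⊕-interchange : ∀ a b c d → (a ⊕ b) ⊕ (c ⊕ d) ≋ (a ⊕ c) ⊕ (b ⊕ d)
⊕-interchange a b c d = begin
  (a ⊕ b) ⊕ (c ⊕ d) ≈⟨ ⊕-assoc a b (c ⊕ d) ⟩
  a ⊕ (b ⊕ (c ⊕ d)) ≈⟨ ⊕-cong (≋-refl {a}) (⊕-assoc b c d) ⟨
  a ⊕ ((b ⊕ c) ⊕ d) ≈⟨ ⊕-cong (≋-refl {a}) (⊕-cong (⊕-comm b c) (≋-refl {d})) ⟩
  a ⊕ ((c ⊕ b) ⊕ d) ≈⟨ ⊕-cong (≋-refl {a}) (⊕-assoc c b d) ⟩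
  a ⊕ (c ⊕ (b ⊕ d)) ≈⟨ ⊕-assoc a c (b ⊕ d) ⟨
  (a ⊕ c) ⊕ (b ⊕ d) ∎
  where open ≋-Reasoning

⊗-∷ : ∀ f b g → f ⊗ (b ∷ g) ≋ scale b f ⊕ q· (f ⊗ g)
⊗-∷ [] b g = ≋-sym q·[]≋[]
⊗-∷ (a ∷ f) b g = ∷-cong (≡.cong (ℤ._+ + 0) (ℤP.*-comm a b)) (begin
  scale a g ⊕ f ⊗ (b ∷ g) ≈⟨ ⊕-cong ≋-refl (⊗-∷ f b g) ⟩
  scale a g ⊕ (scale b f ⊕ q· (f ⊗ g)) ≈⟨ ⊕-assoc (scale a g) (scale b f) _ ⟨
  (scale a g ⊕ scale b f) ⊕ q· (f ⊗ g) ≈⟨ ⊕-cong (⊕-comm (scale a g) (scale b f)) ≋-refl ⟩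
  (scale b f ⊕ scale a g) ⊕ q· (f ⊗ g) ≈⟨ ⊕-assoc (scale b f) (scale a g) _ ⟩
  scale b f ⊕ (scale a g ⊕ q· (f ⊗ g)) ∎)
  where open ≋-Reasoning

⊗-comm : ∀ f g → f ⊗ g ≋ g ⊗ f
⊗-comm [] g = ≋-sym (⊗-zeroʳ g)
⊗-comm (a ∷ f) g = ≋-trans (⊕-cong ≋-refl (q·-cong (⊗-comm f g))) (≋-sym (⊗-∷ g a f))

⊗-congʳ : ∀ f {g h} → g ≋ h → f ⊗ g ≋ f ⊗ h
⊗-congʳ [] p = ≋-refl
⊗-congʳ (a ∷ f) p = ⊕-cong (scale-cong a p) (q·-cong (⊗-congʳ f p))

⊗-cong : ∀ {f f′ g g′} → f ≋ f′ → g ≋ g′ → f ⊗ g ≋ f′ ⊗ g′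
⊗-cong {f} {f′} {g} {g′} p r = begin
  f ⊗ g ≈⟨ ⊗-congʳ f r ⟩
  f ⊗ g′ ≈⟨ ⊗-comm f g′ ⟩
  g′ ⊗ f ≈⟨ ⊗-congʳ g′ p ⟩
  g′ ⊗ f′ ≈⟨ ⊗-comm g′ f′ ⟩
  f′ ⊗ g′ ∎
  where open ≋-Reasoning

⊗-distribˡ : ∀ f g h → f ⊗ (g ⊕ h) ≋ (f ⊗ g) ⊕ (f ⊗ h)
⊗-distribˡ [] g h = ≋-refl
⊗-distribˡ (a ∷ f) g h = begin
  scale a (g ⊕ h) ⊕ q· (f ⊗ (g ⊕ h)) ≈⟨ ⊕-cong (scale-⊕ a g h) (≋-trans (q·-cong (⊗-distribˡ f g h)) (q·-⊕ (f ⊗ g) (f ⊗ h))) ⟩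
  (scale a g ⊕ scale a h) ⊕ (q· (f ⊗ g) ⊕ q· (f ⊗ h)) ≈⟨ ⊕-interchange (scale a g) (scale a h) _ _ ⟩
  (scale a g ⊕ q· (f ⊗ g)) ⊕ (scale a h ⊕ q· (f ⊗ h)) ∎
  where open ≋-Reasoning

⊗-distribʳ : ∀ h f g → (f ⊕ g) ⊗ h ≋ (f ⊗ h) ⊕ (g ⊗ h)
⊗-distribʳ h f g = begin
  (f ⊕ g) ⊗ h ≈⟨ ⊗-comm (f ⊕ g) h ⟩
  h ⊗ (f ⊕ g) ≈⟨ ⊗-distribˡ h f g ⟩
  h ⊗ f ⊕ h ⊗ g ≈⟨ ⊕-cong (⊗-comm h f) (⊗-comm h g) ⟩
  f ⊗ h ⊕ g ⊗ h ∎
  where open ≋-Reasoning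

scale-⊗ : ∀ c f g → scale c f ⊗ g ≋ scale c (f ⊗ g)
scale-⊗ c [] g = ≋-refl
scale-⊗ c (a ∷ f) g = begin
  scale (c ℤ.* a) g ⊕ q· (scale c f ⊗ g) ≈⟨ ⊕-cong (≋-sym (scale-scale c a g)) (q·-cong (scale-⊗ c f g)) ⟩
  scale c (scale a g) ⊕ q· (scale c (f ⊗ g)) ≈⟨ ⊕-cong ≋-refl (scale-q· c (f ⊗ g)) ⟨
  scale c (scale a g) ⊕ scale c (q· (f ⊗ g)) ≈⟨ scale-⊕ c (scale a g) _ ⟨
  scale c (scale a g ⊕ q· (f ⊗ g)) ∎
  where open ≋-Reasoning

q·-⊗ : ∀ f g → (q· f) ⊗ g ≋ q· (f ⊗ g)
q·-⊗ f g = ⊕-cong (scale-0 g) ≋-refl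

⊗-assoc : ∀ f g h → (f ⊗ g) ⊗ h ≋ f ⊗ (g ⊗ h)
⊗-assoc [] g h = ≋-refl
⊗-assoc (a ∷ f) g h = begin
  (scale a g ⊕ q· (f ⊗ g)) ⊗ h ≈⟨ ⊗-distribʳ h (scale a g) _ ⟩
  scale a g ⊗ h ⊕ (q· (f ⊗ g)) ⊗ h ≈⟨ ⊕-cong (scale-⊗ a g h) (≋-trans (q·-⊗ (f ⊗ g) h) (q·-cong (⊗-assoc f g h))) ⟩
  scale a (g ⊗ h) ⊕ q· (f ⊗ (g ⊗ h)) ∎
  where open ≋-Reasoning

pconst-⊗ : ∀ c f → pconst c ⊗ f ≋ scale c f
pconst-⊗ c f = ≋-trans (⊕-cong ≋-refl q·[]≋[]) (⊕-identityʳ (scale c f))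

⊗-identityˡ : ∀ f → pone ⊗ f ≋ f
⊗-identityˡ f = ≋-trans (pconst-⊗ (+ 1) f) (scale-1 f)

polyRing : CommutativeRing 0ℓ 0ℓ
polyRing = record
  { Carrier = Poly ; _≈_ = _≋_ ; _+_ = _⊕_ ; _*_ = _⊗_ ; -_ = pneg ; 0# = [] ; 1# = pone
  ; isCommutativeRing = record
    { isRing = record
      { +-isAbelianGroup = record
        { isGroup = record
          { isMonoid = record
            { isSemigroup = record
              { isMagma = record
                { isEquivalence = Setoid.isEquivalence ≋-setoid
                ; ∙-cong = ⊕-cong }
              ; assoc = ⊕-assoc }
            ; identity = (λ f → ≋-refl) , ⊕-identityʳ }
          ; inverse = ⊕-inverseˡ , ⊕-inverseʳ
          ; ⁻¹-cong = pneg-cong }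
        ; comm = ⊕-comm }
      ; *-cong = ⊗-cong
      ; *-assoc = ⊗-assoc
      ; *-identity = ⊗-identityˡ , λ f → ≋-trans (⊗-comm f pone) (⊗-identityˡ f)
      ; distrib = ⊗-distribˡ , ⊗-distribʳ }
    ; *-comm = ⊗-comm } }

module PR = RingOps polyRing
open PR using () renaming (solve to solveᴾ)
open Divisibility polyRing public
open RootOfUnity polyRing pq using (Cancellable; Cancellable-*; Cancellable-unit; cancel) public

head-coeff-⊗ : ∀ f g → coeff (f ⊗ g) 0 ≡ coeff f 0 ℤ.* coeff g 0
head-coeff-⊗ [] g = ≡.sym (ℤP.*-zeroˡ (coeff g 0))
head-coeff-⊗ (a ∷ f) g = ≡.trans (coeff-⊕ (scale a g) (q· (f ⊗ g)) 0) (≡.trans (ℤP.+-identityʳ _) (coeff-scale a g 0))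

tail-≋ : ∀ {a b f g} → a ∷ f ≋ b ∷ g → f ≋ g
tail-≋ e = coeffwise λ i → coeffs e (suc i)

⊗-q· : ∀ f g → f ⊗ (q· g) ≋ q· (f ⊗ g)
⊗-q· f g = ≋-trans (⊗-comm f (q· g)) (≋-trans (q·-⊗ g f) (q·-cong (⊗-comm g f)))

⊗-scale : ∀ c f g → f ⊗ scale c g ≋ scale c (f ⊗ g)
⊗-scale c f g = ≋-trans (⊗-comm f (scale c g)) (≋-trans (scale-⊗ c g f) (scale-cong c (⊗-comm g f)))

pq-⊗ : ∀ f → pq ⊗ f ≋ q· f
pq-⊗ f = ≋-trans (q·-⊗ pone f) (q·-cong (⊗-identityˡ f))

fromℤ≋pconst : ∀ c → PR.fromℤ c ≋ pconst c
fromℤ≋pconst (+ n) = nonneg n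
  where
  nonneg : ∀ n → PR.fromℤ (+ n) ≋ pconst (+ n)
  nonneg zero = ≋-sym q·[]≋[]
  nonneg (suc n) = ≋-trans (PR.fromℤ-+ (+ 1) (+ n)) (⊕-cong (≋-refl {pone}) (nonneg n))
fromℤ≋pconst -[1+ n ] = ≋-trans (PR.fromℤ-neg (+ suc n)) (pneg-cong (fromℤ≋pconst (+ suc n)))

fromℤ-scale : ∀ c f → PR.fromℤ c ⊗ f ≋ scale c f
fromℤ-scale c f = ≋-trans (⊗-cong (fromℤ≋pconst c) (≋-refl {f})) (pconst-⊗ c f)

scale-cancel : ∀ {c f g} → c ≢ + 0 → scale c f ≋ scale c g → f ≋ g
scale-cancel {c} {f} {g} c≢0 e = coeffwise λ i →
  ℤP.*-cancelˡ-≡ c (coeff f i) (coeff g i) {{ℤ.≢-nonZero c≢0}} (≡.trans (≡.sym (coeff-scale c f i)) (≡.trans (coeffs e i) (coeff-scale c g i)))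

-- The constant term of h has to vanish, and the argument repeats for h divided by q.
head≢0⇒cancellable : ∀ {f} → coeff f 0 ≢ + 0 → Cancellable f
head≢0⇒cancellable {f} f₀≢0 = go
  where
  go : ∀ h → f ⊗ h ≋ [] → h ≋ []
  go [] e = ≋-refl
  go (a ∷ h) e with ℤP.i*j≡0⇒i≡0∨j≡0 (coeff f 0) (≡.trans (≡.sym (head-coeff-⊗ f (a ∷ h))) (coeffs e 0))
  ... | inj₁ f₀≡0 = ⊥-elim (f₀≢0 f₀≡0)
  ... | inj₂ ≡.refl = ≋-trans (q·-cong (go h (tail-≋ (≋-trans (≋-sym (⊗-q· f h)) (≋-trans e (≋-sym q·[]≋[])))))) q·[]≋[]

pq-cancellable : Cancellable pq
pq-cancellable h e = tail-≋ (≋-trans (≋-sym (pq-⊗ h)) (≋-trans e (≋-sym q·[]≋[])))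

-- Constant term ±1: over ℤ these polynomials behave like units of ℤ⟦q⟧.
record UnitHead (f : Poly) : Set where
  constructor unitHead
  field ∣head∣≡1 : ℤ.∣ coeff f 0 ∣ ≡ 1
open UnitHead public

UnitHead-resp : ∀ {f g} → f ≋ g → UnitHead f → UnitHead g
UnitHead-resp e (unitHead u) = unitHead (≡.trans (≡.cong ℤ.∣_∣ (≡.sym (coeffs e 0))) u)

UnitHead-⊗ : ∀ {f g} → UnitHead f → UnitHead g → UnitHead (f ⊗ g)
UnitHead-⊗ {f} {g} (unitHead u) (unitHead v) = unitHead
  (≡.trans (≡.cong ℤ.∣_∣ (head-coeff-⊗ f g)) (≡.trans (ℤP.abs-* (coeff f 0) (coeff g 0)) (≡.cong₂ ℕ._*_ u v)))

UnitHead-divisor : ∀ {f g} → f ∣ g → UnitHead g → UnitHead f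
UnitHead-divisor {f} {g} (h , e) (unitHead u) = unitHead (ℕP.m*n≡1⇒m≡1 _ ℤ.∣ coeff h 0 ∣ (≡.trans (≡.sym (ℤP.abs-* (coeff f 0) (coeff h 0)))
  (≡.trans (≡.cong ℤ.∣_∣ (≡.sym (head-coeff-⊗ f h))) (≡.trans (≡.cong ℤ.∣_∣ (coeffs e 0)) u))))

UnitHead⇒head≢0 : ∀ {f} → UnitHead f → coeff f 0 ≢ + 0
UnitHead⇒head≢0 (unitHead u) e with ≡.trans (≡.sym u) (≡.cong ℤ.∣_∣ e)
... | ()

UnitHead-square : ∀ {f} → UnitHead f → coeff f 0 ℤ.* coeff f 0 ≡ + 1
UnitHead-square {f} (unitHead u) with coeff f 0 | u
... | + 1 | _ = ≡.refl
... | -[1+ 0 ] | _ = ≡.refl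

UnitHead⇒cancellable : ∀ {f} → UnitHead f → Cancellable f
UnitHead⇒cancellable {f} u = head≢0⇒cancellable {f} (UnitHead⇒head≢0 u)

-- The coefficients of the cofactor are found from the constant term upwards. As that of f is ±1,
-- each of them is a multiple of c, so c cancels.
UnitHead⇒primitive : ∀ {f} → UnitHead f → Primitive f
UnitHead⇒primitive {f} u c g c≢0 (h , e) with go h g (≋-trans e (fromℤ-scale c g))
  where
  go : ∀ h g → f ⊗ h ≋ scale c g → Σ Poly λ h′ → h ≋ scale c h′
  go [] g e = [] , ≋-refl
  go (a ∷ h) g e = k ∷ proj₁ rec , ∷-cong a≡ck (proj₂ rec)
    where
    f₀ g₀ k : ℤ
    f₀ = coeff f 0
    g₀ = coeff g 0
    -- This is g₀/f₀, because f₀ is its own inverse.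
    k = f₀ ℤ.* g₀
    a≡ck : a ≡ c ℤ.* k
    a≡ck = begin
      a ≡⟨ ≡.sym (ℤP.*-identityˡ a) ⟩
      + 1 ℤ.* a ≡⟨ ≡.cong (ℤ._* a) (≡.sym (UnitHead-square {f} u)) ⟩
      f₀ ℤ.* f₀ ℤ.* a ≡⟨ ℤP.*-assoc f₀ f₀ a ⟩
      f₀ ℤ.* (f₀ ℤ.* a) ≡⟨ ≡.cong (f₀ ℤ.*_) (≡.trans (≡.sym (head-coeff-⊗ f (a ∷ h))) (≡.trans (coeffs e 0) (coeff-scale c g 0))) ⟩
      f₀ ℤ.* (c ℤ.* g₀) ≡⟨ swap f₀ c g₀ ⟩
      c ℤ.* (f₀ ℤ.* g₀) ∎
      where
      open ≡.≡-Reasoning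
      swap : ∀ x y z → x ℤ.* (y ℤ.* z) ≡ y ℤ.* (x ℤ.* z)
      swap = ℤS.solve-∀
    tail : Poly → Poly
    tail [] = []
    tail (_ ∷ x) = x
    coeff-tail : ∀ x i → coeff (tail x) i ≡ coeff x (suc i)
    coeff-tail [] i = ≡.refl
    coeff-tail (_ ∷ x) i = ≡.refl
    rest : Poly
    rest = tail (g ⊖ scale k f)
    rec : Σ Poly λ h′ → h ≋ scale c h′
    rec = go h rest (coeffwise λ i → begin
      coeff (f ⊗ h) i ≡⟨ x≡y+x-y _ (c ℤ.* k ℤ.* coeff f (suc i)) ⟩
      (c ℤ.* k ℤ.* coeff f (suc i) ℤ.+ coeff (f ⊗ h) i) ℤ.- c ℤ.* k ℤ.* coeff f (suc i)
        ≡⟨ ≡.cong (ℤ._- c ℤ.* k ℤ.* coeff f (suc i)) (lemma i) ⟩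
      c ℤ.* coeff g (suc i) ℤ.- c ℤ.* k ℤ.* coeff f (suc i) ≡⟨ factor c k (coeff f (suc i)) (coeff g (suc i)) ⟩
      c ℤ.* (coeff g (suc i) ℤ.- k ℤ.* coeff f (suc i)) ≡⟨ ≡.cong (c ℤ.*_) (≡.sym (coeff-rest i)) ⟩
      c ℤ.* coeff rest i ≡⟨ ≡.sym (coeff-scale c rest i) ⟩
      coeff (scale c rest) i ∎)
      where
      open ≡.≡-Reasoning
      x≡y+x-y : ∀ x y → x ≡ (y ℤ.+ x) ℤ.- y
      x≡y+x-y = ℤS.solve-∀
      factor : ∀ c k x y → c ℤ.* y ℤ.- c ℤ.* k ℤ.* x ≡ c ℤ.* (y ℤ.- k ℤ.* x)
      factor = ℤS.solve-∀
      coeff-rest : ∀ i → coeff rest i ≡ coeff g (suc i) ℤ.- k ℤ.* coeff f (suc i)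
      coeff-rest i = ≡.trans (coeff-tail (g ⊖ scale k f) i) (≡.trans (coeff-⊕ g (pneg (scale k f)) (suc i))
        (≡.cong (λ x → coeff g (suc i) ℤ.+ x) (≡.trans (coeff-pneg (scale k f) (suc i)) (≡.cong ℤ.-_ (coeff-scale k f (suc i))))))
      lemma : ∀ i → c ℤ.* k ℤ.* coeff f (suc i) ℤ.+ coeff (f ⊗ h) i ≡ c ℤ.* coeff g (suc i)
      lemma i = begin
        c ℤ.* k ℤ.* coeff f (suc i) ℤ.+ coeff (f ⊗ h) i ≡⟨ ≡.cong (λ x → x ℤ.* coeff f (suc i) ℤ.+ coeff (f ⊗ h) i) (≡.sym a≡ck) ⟩
        a ℤ.* coeff f (suc i) ℤ.+ coeff (f ⊗ h) i ≡⟨ ≡.cong (ℤ._+ coeff (f ⊗ h) i) (≡.sym (coeff-scale a f (suc i))) ⟩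
        coeff (scale a f) (suc i) ℤ.+ coeff (q· (f ⊗ h)) (suc i) ≡⟨ ≡.sym (coeff-⊕ (scale a f) (q· (f ⊗ h)) (suc i)) ⟩
        coeff (scale a f ⊕ q· (f ⊗ h)) (suc i) ≡⟨ ≡.sym (coeffs (⊗-∷ f a h) (suc i)) ⟩
        coeff (f ⊗ (a ∷ h)) (suc i) ≡⟨ coeffs e (suc i) ⟩
        coeff (scale c g) (suc i) ≡⟨ coeff-scale c g (suc i) ⟩
        c ℤ.* coeff g (suc i) ∎
... | h′ , h≋ = h′ , scale-cancel c≢0 (≋-trans (≋-sym (⊗-scale c f h′)) (≋-trans (⊗-cong (≋-refl {f}) (≋-sym h≋)) (≋-trans e (fromℤ-scale c g))))

-- Gauss's lemma, greatest common divisors and reduced forms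

ScaledBy : ℤ → Poly → Set
ScaledBy c f = Σ Poly λ f′ → f ≋ scale c f′

private
  ∣⇒scaled : ∀ p a → p ℕD.∣ ℤ.∣ a ∣ → Σ ℤ λ b → a ≡ + p ℤ.* b
  ∣⇒scaled p (+ _) (ℕD.divides b ≡.refl) = + b , ≡.trans (≡.cong +_ (ℕP.*-comm b p)) (ℤP.pos-* p b)
  ∣⇒scaled p -[1+ n ] (ℕD.divides b e) = ℤ.- (+ b) , (begin
    ℤ.- (+ suc n) ≡⟨ ≡.cong (λ x → ℤ.- (+ x)) (≡.trans e (ℕP.*-comm b p)) ⟩
    ℤ.- (+ (p ℕ.* b)) ≡⟨ ≡.cong ℤ.-_ (ℤP.pos-* p b) ⟩
    ℤ.- (+ p ℤ.* + b) ≡⟨ ℤP.neg-distribʳ-* (+ p) (+ b) ⟩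
    + p ℤ.* ℤ.- (+ b) ∎)
    where open ≡.≡-Reasoning

  tail : Poly → Poly
  tail [] = []
  tail (_ ∷ f) = f

  q·-tail : ∀ f → coeff f 0 ≡ + 0 → q· tail f ≋ f
  q·-tail [] _ = q·[]≋[]
  q·-tail (a ∷ f) z = ∷-cong (≡.sym z) ≋-refl

  tail-scaled : ∀ c f g → q· f ≋ scale c g → f ≋ scale c (tail g)
  tail-scaled c f [] e = tail-≋ (≋-trans e (≋-sym q·[]≋[]))
  tail-scaled c f (x ∷ g) e = tail-≋ e

  scaled-tail : ∀ {c a a′ x y f g} → a ≡ c ℤ.* a′ → x ≋ scale a y ⊕ q· f → x ≋ scale c g → ScaledBy c f
  scaled-tail {c} {a} {a′} {x} {y} {f} {g} ≡.refl e e′ = _ , tail-scaled c f (g ⊖ scale a′ y) (begin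
    q· f ≈⟨ solveᴾ 2 (λ u v → u := v :+ u :- v) ≋-refl (q· f) (scale a y) ⟩
    (scale a y ⊕ q· f) ⊖ scale a y ≈⟨ ⊕-cong (≋-trans (≋-sym e) e′) (pneg-cong (≋-sym (scale-scale c a′ y))) ⟩
    scale c g ⊖ scale c (scale a′ y) ≈⟨ ⊕-cong (pconst-⊗ c g) (pneg-cong (pconst-⊗ c (scale a′ y))) ⟨
    pconst c ⊗ g ⊖ pconst c ⊗ scale a′ y ≈⟨ solveᴾ 3 (λ c g y → c :* g :- c :* y := c :* (g :- y)) ≋-refl (pconst c) g (scale a′ y) ⟩
    pconst c ⊗ (g ⊖ scale a′ y) ≈⟨ pconst-⊗ c _ ⟩
    scale c (g ⊖ scale a′ y) ∎)
    where open ≋-Reasoning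

  ∷-scaled : ∀ {c a f} → Σ ℤ (λ b → a ≡ c ℤ.* b) → ScaledBy c f → ScaledBy c (a ∷ f)
  ∷-scaled (b , e) (f′ , e′) = b ∷ f′ , ∷-cong e e′

-- Primes of ℤ remain prime in ℤ[q]: p divides one of the two constant terms by Euclid's lemma; that
-- term is split off and the induction continues with the tail.
prime-scaled : ∀ {p} → Prime p → ∀ f g → ScaledBy (+ p) (f ⊗ g) → ScaledBy (+ p) f ⊎ ScaledBy (+ p) g
prime-scaled pr [] g _ = inj₁ ([] , ≋-refl)
prime-scaled {p} pr (a ∷ f) = go
  where
  p∣head : ∀ b g h → (a ∷ f) ⊗ (b ∷ g) ≋ scale (+ p) h → p ℕD.∣ ℤ.∣ a ∣ ℕ.* ℤ.∣ b ∣
  p∣head b g h e = ℕD.divides ℤ.∣ coeff h 0 ∣ (begin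
    ℤ.∣ a ∣ ℕ.* ℤ.∣ b ∣ ≡⟨ ≡.sym (ℤP.abs-* a b) ⟩
    ℤ.∣ a ℤ.* b ∣ ≡⟨ ≡.cong ℤ.∣_∣ (≡.trans (≡.sym (head-coeff-⊗ (a ∷ f) (b ∷ g))) (≡.trans (coeffs e 0) (coeff-scale (+ p) h 0))) ⟩
    ℤ.∣ + p ℤ.* coeff h 0 ∣ ≡⟨ ℤP.abs-* (+ p) (coeff h 0) ⟩
    p ℕ.* ℤ.∣ coeff h 0 ∣ ≡⟨ ℕP.*-comm p _ ⟩
    ℤ.∣ coeff h 0 ∣ ℕ.* p ∎)
    where open ≡.≡-Reasoning
  go : ∀ g → ScaledBy (+ p) ((a ∷ f) ⊗ g) → ScaledBy (+ p) (a ∷ f) ⊎ ScaledBy (+ p) g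
  go [] _ = inj₂ ([] , ≋-refl)
  go (b ∷ g) (h , e) with euclidsLemma ℤ.∣ a ∣ ℤ.∣ b ∣ pr (p∣head b g h e)
  ... | inj₁ p∣a with ∣⇒scaled p a p∣a
  ... | a′ , a≡ = map₁ (∷-scaled {+ p} (a′ , a≡)) (prime-scaled pr f (b ∷ g) (scaled-tail {c = + p} {a′ = a′} {y = b ∷ g} a≡ ≋-refl e))
  go (b ∷ g) (h , e) | inj₂ p∣b with ∣⇒scaled p b p∣b
  ... | b′ , b≡ = map₂ (∷-scaled {+ p} (b′ , b≡)) (go g (scaled-tail {c = + p} {a′ = b′} {y = a ∷ f} b≡ (⊗-∷ (a ∷ f) b g) e))

record PrimitivePart (g d : Poly) : Set where
  field
    part : Poly
    content : ℤ
    content≢0 : content ≢ + 0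
    scaled : g ≋ scale content part
    part∣ : part ∣ d

-- By `prime-scaled` each prime can be taken out of g or of h. Those taken from g form `content`,
-- those from h cancel, and what is left of g divides d itself.
gauss : ∀ ps → All Prime ps → ∀ g h d → g ⊗ h ≋ scale (+ product ps) d → PrimitivePart g d
gauss [] [] g h d e = record { part = g ; content = + 1 ; content≢0 = λ () ; scaled = ≋-sym (scale-1 g) ; part∣ = h , ≋-trans e (scale-1 d) }
gauss (p ∷ ps) (pr ∷ prs) g h d e with prime-scaled pr g h (scale (+ product ps) d , ≋-trans e (≋-sym (≋-trans (scale-scale (+ p) (+ product ps) d) (PR.reflexive (≡.cong (λ c → scale c d) (≡.sym (ℤP.pos-* p (product ps))))))))
... | s = [ left , right ]′ s
  where
  p≢0 : + p ≢ + 0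
  p≢0 p≡0 = ℕ.≢-nonZero⁻¹ p {{prime⇒nonZero pr}} (ℤP.+-injective p≡0)
  rescaled : scale (+ product (p ∷ ps)) d ≋ scale (+ p) (scale (+ product ps) d)
  rescaled = ≋-sym (≋-trans (scale-scale (+ p) (+ product ps) d) (PR.reflexive (≡.cong (λ c → scale c d) (≡.sym (ℤP.pos-* p (product ps))))))
  left : ScaledBy (+ p) g → PrimitivePart g d
  left (g′ , e′) = record
    { part = part ; content = + p ℤ.* content
    ; content≢0 = λ z → [ p≢0 , content≢0 ]′ (ℤP.i*j≡0⇒i≡0∨j≡0 (+ p) z)
    ; scaled = ≋-trans e′ (≋-trans (scale-cong (+ p) scaled) (scale-scale (+ p) content part))
    ; part∣ = part∣ }
    where
    open PrimitivePart (gauss ps prs g′ h d (scale-cancel p≢0 (≋-trans (≋-sym (scale-⊗ (+ p) g′ h)) (≋-trans (⊗-cong (≋-sym e′) (≋-refl {h})) (≋-trans e rescaled)))))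
  right : ScaledBy (+ p) h → PrimitivePart g d
  right (h′ , e′) = gauss ps prs g h′ d (scale-cancel p≢0 (≋-trans (≋-sym (⊗-scale (+ p) g h′)) (≋-trans (⊗-cong (≋-refl {g}) (≋-sym e′)) (≋-trans e rescaled))))

primitivePart : ∀ {c g d} → c ≢ + 0 → g ∣ scale c d → PrimitivePart g d
primitivePart {+ zero} c≢0 _ = ⊥-elim (c≢0 ≡.refl)
primitivePart {+ suc n} {g} {d} _ (h , e) = gauss (factors F) (factorsPrime F) g h d
  (≋-trans e (PR.reflexive (≡.cong (λ k → scale (+ k) d) (isFactorisation F))))
  where
  open PrimeFactorisation
  F = factorise (suc n)
primitivePart { -[1+ n ]} {g} {d} _ (h , e) = gauss (factors F) (factorsPrime F) g (pneg h) d (begin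
  g ⊗ pneg h ≈⟨ solveᴾ 2 (λ g h → g :* :- h := :- (g :* h)) ≋-refl g h ⟩
  pneg (g ⊗ h) ≈⟨ pneg-cong e ⟩
  pneg (scale -[1+ n ] d) ≈⟨ pneg-cong (pconst-⊗ -[1+ n ] d) ⟨
  pneg (pneg (pconst (+ suc n)) ⊗ d) ≈⟨ solveᴾ 2 (λ c d → :- (:- c :* d) := c :* d) ≋-refl (pconst (+ suc n)) d ⟩
  pconst (+ suc n) ⊗ d ≈⟨ pconst-⊗ (+ suc n) d ⟩
  scale (+ suc n) d ≡⟨ ≡.cong (λ k → scale (+ k) d) (isFactorisation F) ⟩
  scale (+ product (factors F)) d ∎)
  where
  open ≋-Reasoning
  open PrimeFactorisation
  F = factorise (suc n)

-- A greatest common divisor over ℚ[q,q⁻¹], by elimination from the constant term upwards.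
record LaurentGcd (f g : Poly) : Set where
  field
    divisor : Poly
    multˡ multʳ : ℤ
    multˡ≢0 : multˡ ≢ + 0
    multʳ≢0 : multʳ ≢ + 0
    divides-l : divisor ∣ scale multˡ f
    divides-r : divisor ∣ scale multʳ g
    bézoutˡ bézoutʳ : Poly
    exponent : ℕ
    bézout : f ⊗ bézoutˡ ⊕ g ⊗ bézoutʳ ≋ PR.pow pq exponent ⊗ divisor

private
  *≢0 : ∀ {a b} → a ≢ + 0 → b ≢ + 0 → a ℤ.* b ≢ + 0
  *≢0 {a} a≢0 b≢0 z = [ a≢0 , b≢0 ]′ (ℤP.i*j≡0⇒i≡0∨j≡0 a z)

  length-⊕ : ∀ f g → length (f ⊕ g) ≡ length f ℕ.⊔ length g
  length-⊕ [] g = ≡.refl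
  length-⊕ (a ∷ f) [] = ≡.refl
  length-⊕ (a ∷ f) (b ∷ g) = ≡.cong suc (length-⊕ f g)

  eliminate : ℤ → Poly → ℤ → Poly → Poly
  eliminate a f b g = scale b f ⊖ scale a g

  length-eliminate : ∀ a f b g → length (eliminate a f b g) ≡ length f ℕ.⊔ length g
  length-eliminate a f b g = ≡.trans (length-⊕ (scale b f) _)
    (≡.cong₂ ℕ._⊔_ (ListP.length-map _ f) (≡.trans (ListP.length-map _ (scale a g)) (ListP.length-map _ g)))

  eliminate-spec : ∀ a f b g → q· eliminate a f b g ≋ pconst b ⊗ (a ∷ f) ⊖ pconst a ⊗ (b ∷ g)
  eliminate-spec a f b g = ≋-sym (≋-trans (⊕-cong (pconst-⊗ b (a ∷ f)) (pneg-cong (pconst-⊗ a (b ∷ g))))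
    (∷-cong (≡.trans (≡.cong (λ x → x ℤ.- a ℤ.* b) (ℤP.*-comm b a)) (ℤP.+-inverseʳ (a ℤ.* b))) ≋-refl))

  gcd-swap : ∀ {f g} → LaurentGcd f g → LaurentGcd g f
  gcd-swap {f} {g} r = record
    { divisor = divisor ; multˡ = multʳ ; multʳ = multˡ ; multˡ≢0 = multʳ≢0 ; multʳ≢0 = multˡ≢0
    ; divides-l = divides-r ; divides-r = divides-l ; bézoutˡ = bézoutʳ ; bézoutʳ = bézoutˡ ; exponent = exponent
    ; bézout = ≋-trans (⊕-comm (g ⊗ bézoutʳ) (f ⊗ bézoutˡ)) bézout }
    where open LaurentGcd r

  gcd-shift : ∀ {f g} → LaurentGcd f g → LaurentGcd (q· f) g
  gcd-shift {f} {g} r = record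
    { divisor = divisor ; multˡ = multˡ ; multʳ = multʳ ; multˡ≢0 = multˡ≢0 ; multʳ≢0 = multʳ≢0
    ; divides-l = ∣-resp (≋-trans (pq-⊗ (scale multˡ f)) (≋-sym (scale-q· multˡ f))) (∣-*ˡ pq divides-l) ; divides-r = divides-r
    ; bézoutˡ = bézoutˡ ; bézoutʳ = pq ⊗ bézoutʳ ; exponent = suc exponent
    ; bézout = begin
        (q· f) ⊗ bézoutˡ ⊕ g ⊗ (pq ⊗ bézoutʳ) ≈⟨ ⊕-cong (⊗-cong (pq-⊗ f) (≋-refl {bézoutˡ})) (≋-refl {g ⊗ (pq ⊗ bézoutʳ)}) ⟨
        (pq ⊗ f) ⊗ bézoutˡ ⊕ g ⊗ (pq ⊗ bézoutʳ) ≈⟨ solveᴾ 5 (λ q f u g v → q :* f :* u :+ g :* (q :* v) := q :* (f :* u :+ g :* v)) ≋-refl pq f bézoutˡ g bézoutʳ ⟩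
        pq ⊗ (f ⊗ bézoutˡ ⊕ g ⊗ bézoutʳ) ≈⟨ ⊗-cong (≋-refl {pq}) bézout ⟩
        pq ⊗ (PR.pow pq exponent ⊗ divisor) ≈⟨ ⊗-assoc pq (PR.pow pq exponent) divisor ⟨
        PR.pow pq (suc exponent) ⊗ divisor ∎ }
    where
    open LaurentGcd r
    open ≋-Reasoning

  gcd-eliminate : ∀ {a f b g} → a ≢ + 0 → b ≢ + 0 → LaurentGcd (eliminate a f b g) (b ∷ g) → LaurentGcd (a ∷ f) (b ∷ g)
  gcd-eliminate {a} {f} {b} {g} a≢0 b≢0 r = record
    { divisor = divisor ; multˡ = multˡ ℤ.* multʳ ℤ.* b ; multʳ = multʳ ; multˡ≢0 = *≢0 (*≢0 multˡ≢0 multʳ≢0) b≢0 ; multʳ≢0 = multʳ≢0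
    ; divides-l = ∣-resp (begin
        pconst multʳ ⊗ (pq ⊗ scale multˡ h) ⊕ pconst (a ℤ.* multˡ) ⊗ scale multʳ g′
          ≈⟨ ⊕-cong (⊗-cong (≋-refl {pconst multʳ}) (≋-trans (pq-⊗ (scale multˡ h)) (≋-sym (scale-q· multˡ h)))) (≋-refl {pconst (a ℤ.* multˡ) ⊗ scale multʳ g′}) ⟩
        pconst multʳ ⊗ scale multˡ (q· h) ⊕ pconst (a ℤ.* multˡ) ⊗ scale multʳ g′
          ≈⟨ ⊕-cong (⊗-cong (≋-refl {pconst multʳ}) (≋-trans (≋-sym (pconst-⊗ multˡ (q· h))) (⊗-cong (≋-refl {pconst multˡ}) (eliminate-spec a f b g))))
               (⊗-cong (≋-sym (const-* a multˡ)) (≋-sym (pconst-⊗ multʳ g′))) ⟩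
        pconst multʳ ⊗ (pconst multˡ ⊗ (pconst b ⊗ f′ ⊖ pconst a ⊗ g′)) ⊕ (pconst a ⊗ pconst multˡ) ⊗ (pconst multʳ ⊗ g′)
          ≈⟨ solveᴾ 6 (λ m n b f a g → m :* (n :* (b :* f :- a :* g)) :+ a :* n :* (m :* g) := n :* m :* b :* f) ≋-refl (pconst multʳ) (pconst multˡ) (pconst b) f′ (pconst a) g′ ⟩
        ((pconst multˡ ⊗ pconst multʳ) ⊗ pconst b) ⊗ f′
          ≈⟨ ⊗-cong (≋-trans (⊗-cong (const-* multˡ multʳ) (≋-refl {pconst b})) (const-* (multˡ ℤ.* multʳ) b)) (≋-refl {f′}) ⟩
        pconst (multˡ ℤ.* multʳ ℤ.* b) ⊗ f′ ≈⟨ pconst-⊗ (multˡ ℤ.* multʳ ℤ.* b) f′ ⟩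
        scale (multˡ ℤ.* multʳ ℤ.* b) f′ ∎) (∣-+ (∣-*ˡ (pconst multʳ) (∣-*ˡ pq divides-l)) (∣-*ˡ (pconst (a ℤ.* multˡ)) divides-r))
    ; divides-r = divides-r
    ; bézoutˡ = pconst b ⊗ bézoutˡ ; bézoutʳ = pq ⊗ bézoutʳ ⊖ pconst a ⊗ bézoutˡ ; exponent = suc exponent
    ; bézout = begin
        f′ ⊗ (pconst b ⊗ bézoutˡ) ⊕ g′ ⊗ (pq ⊗ bézoutʳ ⊖ pconst a ⊗ bézoutˡ)
          ≈⟨ solveᴾ 7 (λ f b u g q v a → f :* (b :* u) :+ g :* (q :* v :- a :* u) := (b :* f :- a :* g) :* u :+ q :* (g :* v)) ≋-refl f′ (pconst b) bézoutˡ g′ pq bézoutʳ (pconst a) ⟩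
        (pconst b ⊗ f′ ⊖ pconst a ⊗ g′) ⊗ bézoutˡ ⊕ pq ⊗ (g′ ⊗ bézoutʳ)
          ≈⟨ ⊕-cong (⊗-cong (≋-trans (pq-⊗ h) (eliminate-spec a f b g)) (≋-refl {bézoutˡ})) (≋-refl {pq ⊗ (g′ ⊗ bézoutʳ)}) ⟨
        (pq ⊗ h) ⊗ bézoutˡ ⊕ pq ⊗ (g′ ⊗ bézoutʳ)
          ≈⟨ solveᴾ 4 (λ q h u w → q :* h :* u :+ q :* w := q :* (h :* u :+ w)) ≋-refl pq h bézoutˡ (g′ ⊗ bézoutʳ) ⟩
        pq ⊗ (h ⊗ bézoutˡ ⊕ g′ ⊗ bézoutʳ) ≈⟨ ⊗-cong (≋-refl {pq}) bézout ⟩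
        pq ⊗ (PR.pow pq exponent ⊗ divisor) ≈⟨ ⊗-assoc pq (PR.pow pq exponent) divisor ⟨
        PR.pow pq (suc exponent) ⊗ divisor ∎ }
    where
    open LaurentGcd r
    open ≋-Reasoning
    f′ = a ∷ f
    g′ = b ∷ g
    h = eliminate a f b g
    const-* : ∀ c d → pconst c ⊗ pconst d ≋ pconst (c ℤ.* d)
    const-* c d = pconst-⊗ c (pconst d)

  gcd-fuel : ∀ n f g → length f ℕ.+ length g ℕ.≤ n → coeff g 0 ≢ + 0 → LaurentGcd f g
  gcd-fuel n [] g _ _ = record
    { divisor = g ; multˡ = + 1 ; multʳ = + 1 ; multˡ≢0 = λ () ; multʳ≢0 = λ ()
    ; divides-l = ∣0 ; divides-r = ∣-resp (≋-sym (scale-1 g)) ∣-refl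
    ; bézoutˡ = [] ; bézoutʳ = pone ; exponent = 0 ; bézout = ⊗-comm g pone }
  gcd-fuel n (a ∷ f) [] _ g₀≢0 = ⊥-elim (g₀≢0 ≡.refl)
  gcd-fuel (suc n) (a ∷ f) (b ∷ g) (ℕ.s≤s len) b≢0 with a ℤP.≟ + 0
  ... | yes ≡.refl = gcd-shift (gcd-fuel n f (b ∷ g) len b≢0)
  -- The constant term is eliminated from the longer list, so that the total length drops.
  ... | no a≢0 with ℕP.≤-total (length g) (length f)
  ... | inj₁ g≤f = gcd-eliminate a≢0 b≢0 (gcd-fuel n (eliminate a f b g) (b ∷ g)
    (≡.subst (λ k → k ℕ.+ suc (length g) ℕ.≤ n) (≡.sym (≡.trans (length-eliminate a f b g) (ℕP.m≥n⇒m⊔n≡m g≤f))) len) b≢0)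
  ... | inj₂ f≤g = gcd-swap (gcd-eliminate b≢0 a≢0 (gcd-fuel n (eliminate b g a f) (a ∷ f)
    (≡.subst (λ k → k ℕ.+ suc (length f) ℕ.≤ n) (≡.sym (≡.trans (length-eliminate b g a f) (ℕP.m≥n⇒m⊔n≡m f≤g)))
      (≡.subst (ℕ._≤ n) (≡.trans (ℕP.+-suc (length f) (length g)) (≡.trans (≡.cong suc (ℕP.+-comm (length f) (length g))) (≡.sym (ℕP.+-suc (length g) (length f))))) len)) a≢0))

laurentGcd : ∀ f g → coeff g 0 ≢ + 0 → LaurentGcd f g
laurentGcd f g = gcd-fuel _ f g ℕP.≤-refl

-- The denominators of both sides are of this kind: they are built from the q of q⁻¹ and from
-- factors 1 - q^(2j) with constant term 1.
record MonomialTimesUnit (f : Poly) : Set where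
  constructor monomialTimes
  field
    order : ℕ
    unitPart : Poly
    unitPart-head : UnitHead unitPart
    factored : f ≋ PR.pow pq order ⊗ unitPart

Reduced : Poly → Poly → Set
Reduced n d = Σ Poly λ n′ → Σ Poly λ d′ → ¬ (d′ ≋ []) × (∀ h → h ∣ n′ → h ∣ d′ → h ∣ pone) × (n′ ⊗ d ≋ n ⊗ d′)

pow-pq-cancellable : ∀ k → Cancellable (PR.pow pq k)
pow-pq-cancellable zero = Cancellable-unit {pone} pone (⊗-identityˡ pone)
pow-pq-cancellable (suc k) = Cancellable-* {pq} {PR.pow pq k} pq-cancellable (pow-pq-cancellable k)

private
  ∣-pow-pq⇒∣ : ∀ {h} k d → coeff h 0 ≢ + 0 → h ∣ PR.pow pq k ⊗ d → h ∣ d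
  ∣-pow-pq⇒∣ zero d h₀≢0 hd = ∣-resp (⊗-identityˡ d) hd
  ∣-pow-pq⇒∣ {h} (suc k) d h₀≢0 (c , e) = ∣-pow-pq⇒∣ k d h₀≢0 (divide c (≋-trans e (≋-trans (⊗-assoc pq (PR.pow pq k) d) (pq-⊗ _))))
    where
    divide : ∀ c → h ⊗ c ≋ q· (PR.pow pq k ⊗ d) → h ∣ PR.pow pq k ⊗ d
    divide [] e = [] , ≋-trans (⊗-zeroʳ h) (tail-≋ (≋-trans q·[]≋[] (≋-trans (≋-sym (⊗-zeroʳ h)) e)))
    divide (a ∷ c) e with ℤP.i*j≡0⇒i≡0∨j≡0 (coeff h 0) (≡.trans (≡.sym (head-coeff-⊗ h (a ∷ c))) (coeffs e 0))
    ... | inj₁ z = ⊥-elim (h₀≢0 z)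
    ... | inj₂ ≡.refl = c , tail-≋ (≋-trans (≋-sym (⊗-q· h c)) e)

  head≢0-divisor : ∀ {h f} → h ∣ f → coeff f 0 ≢ + 0 → coeff h 0 ≢ + 0
  head≢0-divisor {h} (c , e) f₀≢0 h₀≡0 = f₀≢0 (≡.trans (≡.sym (coeffs e 0)) (≡.trans (head-coeff-⊗ h c) (≡.trans (≡.cong (ℤ._* coeff c 0) h₀≡0) (ℤP.*-zeroˡ (coeff c 0)))))

  -- n and d are coprime up to qᵉ and the integer k, so only common factors q are left, and they are
  -- removed one at a time. After that a common divisor has constant term ±1, hence divides k, hence
  -- 1.
  strip : ∀ a n d → UnitHead d → (u v : Poly) (e : ℕ) (k : ℤ) → k ≢ + 0 → n ⊗ u ⊕ d ⊗ v ≋ PR.pow pq e ⊗ pconst k → Reduced n (PR.pow pq a ⊗ d)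
  strip′ : ∀ a n d → UnitHead d → (u v : Poly) (e : ℕ) (k : ℤ) → k ≢ + 0 → n ⊗ u ⊕ d ⊗ v ≋ PR.pow pq e ⊗ pconst k →
    (∀ h → h ∣ n → h ∣ PR.pow pq a ⊗ d → UnitHead h × (h ∣ d)) → Reduced n (PR.pow pq a ⊗ d)
  strip′ a n d ud u v e k k≢0 bez hyp = n , PR.pow pq a ⊗ d , nonzero , cop , ≋-refl
    where
    nonzero : ¬ (PR.pow pq a ⊗ d ≋ [])
    nonzero z = UnitHead⇒head≢0 {d} ud (coeffs (pow-pq-cancellable a d z) 0)
    cop : ∀ h → h ∣ n → h ∣ PR.pow pq a ⊗ d → h ∣ pone
    cop h hn hd with hyp h hn hd
    ... | uh , hd′ = UnitHead⇒primitive {h} uh k pone k≢0 (∣-resp (≋-trans (≋-sym (fromℤ≋pconst k)) (≋-sym (≋-trans (⊗-comm _ pone) (⊗-identityˡ _))))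
      (∣-pow-pq⇒∣ e (pconst k) (UnitHead⇒head≢0 {h} uh) (∣-resp bez (∣-+ (∣-*ʳ u hn) (∣-*ʳ v hd′)))))
  strip zero n d ud u v e k k≢0 bez = strip′ zero n d ud u v e k k≢0 bez (λ h hn hd →
    let hd′ = ∣-resp (⊗-identityˡ d) hd in UnitHead-divisor hd′ ud , hd′)
  strip (suc a) n d ud u v e k k≢0 bez with coeff n 0 ℤP.≟ + 0
  ... | no n₀≢0 = strip′ (suc a) n d ud u v e k k≢0 bez (λ h hn hd →
    let hd′ = ∣-pow-pq⇒∣ (suc a) d (head≢0-divisor hn n₀≢0) hd in UnitHead-divisor hd′ ud , hd′)
  ... | yes n₀≡0 with strip a (tail n) d ud (pq ⊗ u) v e k k≢0 (≋-trans (⊕-cong shift (≋-refl {d ⊗ v})) bez)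
    where
    shift : tail n ⊗ (pq ⊗ u) ≋ n ⊗ u
    shift = ≋-trans (solveᴾ 3 (λ n q u → n :* (q :* u) := q :* n :* u) ≋-refl (tail n) pq u) (⊗-cong (≋-trans (pq-⊗ (tail n)) (q·-tail n n₀≡0)) (≋-refl {u}))
  ... | n′ , d′ , nz , cop , eq = n′ , d′ , nz , cop , (begin
    n′ ⊗ ((pq ⊗ PR.pow pq a) ⊗ d) ≈⟨ solveᴾ 4 (λ n q x d → n :* (q :* x :* d) := q :* (n :* (x :* d))) ≋-refl n′ pq (PR.pow pq a) d ⟩
    pq ⊗ (n′ ⊗ (PR.pow pq a ⊗ d)) ≈⟨ ⊗-cong (≋-refl {pq}) eq ⟩
    pq ⊗ (tail n ⊗ d′) ≈⟨ ⊗-assoc pq (tail n) d′ ⟨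
    (pq ⊗ tail n) ⊗ d′ ≈⟨ ⊗-cong (≋-trans (pq-⊗ (tail n)) (q·-tail n n₀≡0)) (≋-refl {d′}) ⟩
    n ⊗ d′ ∎)
    where
    open ≋-Reasoning

-- The Laurent gcd divides only integer multiples of n and d″. Its primitive part divides d″,
-- therefore has constant term ±1, and therefore divides n as well.
reducedForm : ∀ n d → MonomialTimesUnit d → Reduced n d
reducedForm n d (monomialTimes a d″ ud d≋) = finish (strip a n₁ d₁ (UnitHead-divisor {d₁} {d″} (g , ≋-trans (⊗-comm d₁ g) gd) ud) bézoutˡ bézoutʳ exponent content content≢0
    (cancel {g} (UnitHead⇒cancellable {g} ug) (begin
      g ⊗ (n₁ ⊗ bézoutˡ ⊕ d₁ ⊗ bézoutʳ) ≈⟨ solveᴾ 5 (λ g n u d v → g :* (n :* u :+ d :* v) := g :* n :* u :+ g :* d :* v) ≋-refl g n₁ bézoutˡ d₁ bézoutʳ ⟩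
      (g ⊗ n₁) ⊗ bézoutˡ ⊕ (g ⊗ d₁) ⊗ bézoutʳ ≈⟨ ⊕-cong (⊗-cong gn (≋-refl {bézoutˡ})) (⊗-cong gd (≋-refl {bézoutʳ})) ⟩
      n ⊗ bézoutˡ ⊕ d″ ⊗ bézoutʳ ≈⟨ bézout ⟩
      PR.pow pq exponent ⊗ divisor ≈⟨ ⊗-cong (≋-refl {PR.pow pq exponent}) (≋-trans scaled (≋-sym (pconst-⊗ content g))) ⟩
      PR.pow pq exponent ⊗ (pconst content ⊗ g) ≈⟨ solveᴾ 3 (λ x c g → x :* (c :* g) := g :* (x :* c)) ≋-refl (PR.pow pq exponent) (pconst content) g ⟩
      g ⊗ (PR.pow pq exponent ⊗ pconst content) ∎)))
  where
  open ≋-Reasoning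
  open LaurentGcd (laurentGcd n d″ (UnitHead⇒head≢0 {d″} ud))
  open PrimitivePart (primitivePart {multʳ} {divisor} {d″} multʳ≢0 divides-r) renaming (part to g)
  ug : UnitHead g
  ug = UnitHead-divisor part∣ ud
  g∣n : g ∣ n
  g∣n = UnitHead⇒primitive {g} ug multˡ n multˡ≢0 (∣-resp (≋-sym (fromℤ-scale multˡ n))
    (∣-trans (pconst content , ≋-trans (⊗-comm g (pconst content)) (≋-trans (pconst-⊗ content g) (≋-sym scaled))) divides-l))
  n₁ d₁ : Poly
  n₁ = quotient g∣n
  d₁ = quotient part∣
  gn : g ⊗ n₁ ≋ n
  gn = equality g∣n
  gd : g ⊗ d₁ ≋ d″
  gd = equality part∣
  finish : Reduced n₁ (PR.pow pq a ⊗ d₁) → Reduced n d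
  finish (n′ , d′ , nz , cop , eq) = n′ , d′ , nz , cop , (begin
    n′ ⊗ d ≈⟨ ⊗-cong (≋-refl {n′}) (≋-trans d≋ (⊗-cong (≋-refl {PR.pow pq a}) (≋-sym gd))) ⟩
    n′ ⊗ (PR.pow pq a ⊗ (g ⊗ d₁)) ≈⟨ solveᴾ 4 (λ n x g d → n :* (x :* (g :* d)) := g :* (n :* (x :* d))) ≋-refl n′ (PR.pow pq a) g d₁ ⟩
    g ⊗ (n′ ⊗ (PR.pow pq a ⊗ d₁)) ≈⟨ ⊗-cong (≋-refl {g}) eq ⟩
    g ⊗ (n₁ ⊗ d′) ≈⟨ ⊗-assoc g n₁ d′ ⟨
    (g ⊗ n₁) ⊗ d′ ≈⟨ ⊗-cong gn (≋-refl {d′}) ⟩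
    n ⊗ d′ ∎)

-- The auxiliary functions behind monicQuot and Φ are private; the equations they satisfy
-- determine them by unification.
mutual
  cyclotomic : ℕ → ℕ → Poly
  cyclotomic = _

  Φ-suc : ∀ n → Φ (suc n) ≡ monicQuot (pmon (suc n) ⊖ pone) (pprod (map (cyclotomic n) (properDivisors (suc n))))
  Φ-suc n = ≡.refl

highFirst : Poly → List ℤ
highFirst f = dropWhile (λ x → x ℤP.≟ + 0) (reverse f)

mutual
  divide : ℕ → List ℤ → List ℤ → List ℤ
  divide = _

  monicQuot-divide : ∀ f g b bs → highFirst g ≡ b ∷ bs → monicQuot f g ≡ reverse (divide (length (highFirst f)) (highFirst f) bs)
  monicQuot-divide f g b bs e with highFirst g
  -- The abstractions turn every argument into a variable, so that unification meets `divide`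
  -- applied to distinct variables and can solve it.
  monicQuot-divide f g b bs ≡.refl | .(b ∷ bs) with highFirst f
  ... | as with length as
  ... | k with reverse {A = ℤ}
  ... | rev = ≡.refl

mutual
  subtract : List ℤ → List ℤ → List ℤ
  subtract = _

  divide-step : ∀ k a as bs → ¬ (length as ℕ.< length bs) → divide (suc k) (a ∷ as) bs ≡ a ∷ divide k (subtract as (scale a bs)) bs
  divide-step k a as bs nlt with length as <? length bs
  ... | yes lt = contradiction lt nlt
  ... | no _ with scale a bs
  ... | cs = ≡.refl

divide-stop : ∀ k a as bs → length as ℕ.< length bs → divide (suc k) (a ∷ as) bs ≡ []
divide-stop k a as bs lt with length as <? length bs
... | yes _ = ≡.refl
... | no nlt = contradiction lt nlt

-- Long division by a monic polynomial

private
  Q : ℕ → Poly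
  Q = PR.pow pq

pmon≋pow : ∀ k → pmon k ≋ PR.pow pq k
pmon≋pow zero = ≋-refl
pmon≋pow (suc k) = ≋-trans (q·-cong (pmon≋pow k)) (≋-sym (pq-⊗ (Q k)))

-- For lists with the highest coefficient first, as in `divide`; the degree of a coefficient is the
-- length of what follows it.
value : List ℤ → Poly
value [] = []
value (a ∷ as) = scale a (pmon (length as)) ⊕ value as

value-∷ : ∀ a as → value (a ∷ as) ≋ pconst a ⊗ Q (length as) ⊕ value as
value-∷ a as = ⊕-cong (≋-trans (≋-sym (pconst-⊗ a (pmon (length as)))) (⊗-cong (≋-refl {pconst a}) (pmon≋pow (length as)))) (≋-refl {value as})

value-∷ʳ : ∀ as x → value (as ++ x ∷ []) ≋ (q· value as) ⊕ pconst x
value-∷ʳ [] x = coeffwise λ { zero → ≡.trans (ℤP.*-identityʳ x) (≡.sym (ℤP.+-identityˡ x)) ; (suc i) → ≡.refl }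
value-∷ʳ (a ∷ as) x = begin
  scale a (pmon (length (as ++ x ∷ []))) ⊕ value (as ++ x ∷ [])
    ≈⟨ ⊕-cong (≋-trans (PR.reflexive (≡.cong (λ k → scale a (pmon k)) (≡.trans (ListP.length-++ as) (ℕP.+-comm (length as) 1)))) (scale-q· a (pmon (length as)))) (value-∷ʳ as x) ⟩
  (q· scale a (pmon (length as))) ⊕ ((q· value as) ⊕ pconst x) ≈⟨ ⊕-assoc (q· scale a (pmon (length as))) (q· value as) (pconst x) ⟨
  ((q· scale a (pmon (length as))) ⊕ (q· value as)) ⊕ pconst x ≈⟨ ⊕-cong (q·-⊕ (scale a (pmon (length as))) (value as)) (≋-refl {pconst x}) ⟨
  (q· value (a ∷ as)) ⊕ pconst x ∎
  where open ≋-Reasoning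

value-reverse : ∀ f → value (reverse f) ≋ f
value-reverse [] = ≋-refl
value-reverse (x ∷ f) = begin
  value (reverse (x ∷ f)) ≡⟨ ≡.cong value (ListP.unfold-reverse x f) ⟩
  value (reverse f ++ x ∷ []) ≈⟨ value-∷ʳ (reverse f) x ⟩
  (q· value (reverse f)) ⊕ pconst x ≈⟨ ⊕-cong (q·-cong (value-reverse f)) (≋-refl {pconst x}) ⟩
  (q· f) ⊕ pconst x ≈⟨ ∷-cong (ℤP.+-identityˡ x) (⊕-identityʳ f) ⟩
  x ∷ f ∎
  where open ≋-Reasoning

reverse≋value : ∀ as → reverse as ≋ value as
reverse≋value as = ≋-trans (≋-sym (value-reverse (reverse as))) (PR.reflexive (≡.cong value (ListP.reverse-involutive as)))

value-highFirst : ∀ f → value (highFirst f) ≋ f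
value-highFirst f = ≋-trans (drop (reverse f)) (value-reverse f)
  where
  drop : ∀ as → value (dropWhile (λ x → x ℤP.≟ + 0) as) ≋ value as
  drop [] = ≋-refl
  drop (a ∷ as) with a ℤP.≟ + 0
  ... | yes ≡.refl = ≋-trans (drop as) (≋-sym (⊕-cong (scale-0 (pmon (length as))) (≋-refl {value as})))
  ... | no _ = ≋-refl

highFirst-head : ∀ f {a as} → highFirst f ≡ a ∷ as → a ≢ + 0
highFirst-head f = go (reverse f)
  where
  go : ∀ bs {a as} → dropWhile (λ x → x ℤP.≟ + 0) bs ≡ a ∷ as → a ≢ + 0
  go (b ∷ bs) e with b ℤP.≟ + 0
  ... | yes _ = go bs e
  go (b ∷ bs) ≡.refl | no b≢0 = b≢0

record Degree (f : Poly) (d : ℕ) (a : ℤ) : Set where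
  constructor degree
  field
    leading : coeff f d ≡ a
    above : ∀ i → d ℕ.< i → coeff f i ≡ + 0
open Degree

degree-resp : ∀ {f g d a} → f ≋ g → Degree f d a → Degree g d a
degree-resp e (degree l r) = degree (≡.trans (≡.sym (coeffs e _)) l) (λ i lt → ≡.trans (≡.sym (coeffs e i)) (r i lt))

degree-pmon : ∀ k → Degree (pmon k) k (+ 1)
degree-pmon zero = degree ≡.refl λ { (suc i) _ → ≡.refl }
degree-pmon (suc k) with degree-pmon k
... | degree l r = degree l λ { (suc i) (ℕ.s≤s lt) → r i lt }

degree-scale : ∀ {f d a} c → Degree f d a → Degree (scale c f) d (c ℤ.* a)
degree-scale {f} c (degree l r) = degree (≡.trans (coeff-scale c f _) (≡.cong (c ℤ.*_) l))
  (λ i lt → ≡.trans (coeff-scale c f i) (≡.trans (≡.cong (c ℤ.*_) (r i lt)) (ℤP.*-zeroʳ c)))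

value-above : ∀ as i → length as ℕ.≤ i → coeff (value as) i ≡ + 0
value-above [] i _ = ≡.refl
value-above (a ∷ as) i lt = ≡.trans (coeff-⊕ (scale a (pmon (length as))) (value as) i)
  (≡.cong₂ ℤ._+_ (above (degree-scale a (degree-pmon (length as))) i lt) (value-above as i (ℕP.<⇒≤ lt)))

degree-value : ∀ a as → Degree (value (a ∷ as)) (length as) a
degree-value a as = degree
  (≡.trans (coeff-⊕ (scale a (pmon (length as))) (value as) (length as))
    (≡.trans (≡.cong₂ ℤ._+_ (leading (degree-scale a (degree-pmon (length as)))) (value-above as (length as) ℕP.≤-refl))
      (≡.trans (ℤP.+-identityʳ _) (ℤP.*-identityʳ a))))
  (value-above (a ∷ as))

degree-⊗ : ∀ f g {d e a b} → Degree f d a → Degree g e b → Degree (f ⊗ g) (d ℕ.+ e) (a ℤ.* b)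
degree-⊗ [] g {b = b} (degree ≡.refl _) _ = degree (≡.sym (ℤP.*-zeroˡ b)) (λ _ _ → ≡.refl)
degree-⊗ (x ∷ f) g {zero} {e} (degree ≡.refl r) Dg = degree-resp (≋-sym (≋-trans (⊕-cong (≋-refl {scale x g}) f⊗g≋[]) (⊕-identityʳ (scale x g)))) (degree-scale x Dg)
  where
  f⊗g≋[] : q· (f ⊗ g) ≋ []
  f⊗g≋[] = ≋-trans (q·-cong (⊗-cong {f} {[]} (coeffwise λ i → r (suc i) (ℕ.s≤s ℕ.z≤n)) (≋-refl {g}))) q·[]≋[]
degree-⊗ (x ∷ f) g {suc d} {e} {a} {b} (degree l r) Dg = degree
  (≡.trans (coeff-⊕ (scale x g) (q· (f ⊗ g)) (suc d ℕ.+ e))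
    (≡.trans (≡.cong₂ ℤ._+_ (low (suc d ℕ.+ e) (ℕ.s≤s (ℕP.m≤n+m e d))) (leading rec)) (ℤP.+-identityˡ _)))
  (λ { (suc i) (ℕ.s≤s lt) → ≡.trans (coeff-⊕ (scale x g) (q· (f ⊗ g)) (suc i))
    (≡.cong₂ ℤ._+_ (low (suc i) (ℕ.s≤s (ℕP.≤-trans (ℕP.m≤n+m e d) (ℕP.<⇒≤ lt)))) (above rec i lt)) })
  where
  rec : Degree (f ⊗ g) (d ℕ.+ e) (a ℤ.* b)
  rec = degree-⊗ f g (degree l (λ i lt → r (suc i) (ℕ.s≤s lt))) Dg
  low : ∀ i → e ℕ.< i → coeff (scale x g) i ≡ + 0
  low i lt = ≡.trans (coeff-scale x g i) (≡.trans (≡.cong (x ℤ.*_) (above Dg i lt)) (ℤP.*-zeroʳ x))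

degree-unique : ∀ {f d e a b} → Degree f d a → Degree f e b → a ≢ + 0 → b ≢ + 0 → a ≡ b
degree-unique {d = d} {e} (degree l r) (degree l′ r′) a≢0 b≢0 with ℕP.<-cmp d e
... | tri< d<e _ _ = ⊥-elim (b≢0 (≡.trans (≡.sym l′) (r e d<e)))
... | tri≈ _ ≡.refl _ = ≡.trans (≡.sym l) l′
... | tri> _ _ e<d = ⊥-elim (a≢0 (≡.trans (≡.sym l) (r′ d e<d)))

degree? : ∀ f → (f ≋ []) ⊎ Σ ℕ λ d → Σ ℤ λ a → Degree f d a × a ≢ + 0
degree? f with highFirst f in e | value-highFirst f
... | [] | v = inj₁ (≋-sym v)
... | a ∷ as | v = inj₂ (length as , a , degree-resp v (degree-value a as) , highFirst-head f e)

Monic : Poly → Set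
Monic f = Σ ℕ λ d → Degree f d (+ 1)

monic-⊗ : ∀ f g → Monic f → Monic g → Monic (f ⊗ g)
monic-⊗ f g (d , p) (e , r) = d ℕ.+ e , degree-⊗ f g p r

monic-one : Monic pone
monic-one = 0 , degree-pmon 0

monic-quotient : ∀ {f g h} → Monic f → Monic h → f ⊗ g ≋ h → Monic g
monic-quotient {f} {g} {h} (d , p) (e , r) eq with degree? g
... | inj₁ g≋[] with ≡.trans (≡.sym (leading r)) (≡.trans (≡.sym (coeffs eq e)) (coeffs (≋-trans (⊗-cong (≋-refl {f}) g≋[]) (⊗-zeroʳ f)) e))
...   | ()
monic-quotient {f} {g} {h} (d , p) (e , r) eq | inj₂ (k , a , s , a≢0) = k , ≡.subst (Degree g k) a≡1 s
  where
  a≡1 : a ≡ + 1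
  a≡1 = ≡.trans (≡.sym (ℤP.*-identityˡ a)) (degree-unique (degree-resp eq (degree-⊗ f g p s)) r (λ z → a≢0 (≡.trans (≡.sym (ℤP.*-identityˡ a)) z)) (λ ()))

highFirst-monic : ∀ {g} → Monic g → Σ (List ℤ) λ bs → highFirst g ≡ + 1 ∷ bs
highFirst-monic {g} (d , p) with highFirst g in e | value-highFirst g
... | [] | v with ≡.trans (≡.sym (leading p)) (≡.sym (coeffs v d))
...   | ()
highFirst-monic {g} (d , p) | b ∷ bs | v = bs , ≡.cong (_∷ bs) (degree-unique (degree-resp v (degree-value b bs)) p (highFirst-head g e) (λ ()))

length-subtract : ∀ xs ys → length ys ℕ.≤ length xs → length (subtract xs ys) ≡ length xs
length-subtract xs [] _ = ≡.refl
length-subtract (x ∷ xs) (y ∷ ys) (ℕ.s≤s le) = ≡.cong suc (length-subtract xs ys le)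

value-subtract : ∀ xs ys → length ys ℕ.≤ length xs → value (subtract xs ys) ≋ value xs ⊖ Q (length xs ℕ.∸ length ys) ⊗ value ys
value-subtract xs [] _ = ≋-sym (≋-trans (⊕-cong (≋-refl {value xs}) (pneg-cong (⊗-zeroʳ (Q (length xs))))) (⊕-identityʳ (value xs)))
value-subtract (x ∷ xs) (y ∷ ys) (ℕ.s≤s le) = begin
  value (x ℤ.- y ∷ subtract xs ys) ≈⟨ value-∷ (x ℤ.- y) (subtract xs ys) ⟩
  (pconst x ⊖ pconst y) ⊗ Q (length (subtract xs ys)) ⊕ value (subtract xs ys)
    ≈⟨ ⊕-cong (⊗-cong (≋-refl {pconst x ⊖ pconst y}) (PR.pow≡ pq (length-subtract xs ys le))) (value-subtract xs ys le) ⟩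
  (pconst x ⊖ pconst y) ⊗ Q (length xs) ⊕ (value xs ⊖ s ⊗ value ys)
    ≈⟨ solveᴾ 6 (λ x y m v s w → (x :- y) :* m :+ (v :- s :* w) := x :* m :+ v :- (y :* m :+ s :* w)) ≋-refl (pconst x) (pconst y) (Q (length xs)) (value xs) s (value ys) ⟩
  (pconst x ⊗ Q (length xs) ⊕ value xs) ⊖ (pconst y ⊗ Q (length xs) ⊕ s ⊗ value ys)
    ≈⟨ ⊕-cong (≋-sym (value-∷ x xs)) (pneg-cong (⊕-cong (⊗-cong (≋-refl {pconst y}) (≋-trans (PR.pow≡ pq (≡.sym (ℕP.m∸n+n≡m le))) (PR.pow-+ pq (length xs ℕ.∸ length ys) (length ys)))) (≋-refl {s ⊗ value ys}))) ⟩
  value (x ∷ xs) ⊖ (pconst y ⊗ (s ⊗ Q (length ys)) ⊕ s ⊗ value ys)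
    ≈⟨ solveᴾ 5 (λ v y s m w → v :- (y :* (s :* m) :+ s :* w) := v :- s :* (y :* m :+ w)) ≋-refl (value (x ∷ xs)) (pconst y) s (Q (length ys)) (value ys) ⟩
  value (x ∷ xs) ⊖ s ⊗ (pconst y ⊗ Q (length ys) ⊕ value ys) ≈⟨ ⊕-cong (≋-refl {value (x ∷ xs)}) (pneg-cong (⊗-cong (≋-refl {s}) (value-∷ y ys))) ⟨
  value (x ∷ xs) ⊖ s ⊗ value (y ∷ ys) ∎
  where
  open ≋-Reasoning
  s = Q (length xs ℕ.∸ length ys)

value-scale : ∀ a bs → value (scale a bs) ≋ pconst a ⊗ value bs
value-scale a [] = ≋-sym (⊗-zeroʳ (pconst a))
value-scale a (b ∷ bs) = begin
  scale (a ℤ.* b) (pmon (length (scale a bs))) ⊕ value (scale a bs)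
    ≈⟨ ⊕-cong (≋-trans (PR.reflexive (≡.cong (λ k → scale (a ℤ.* b) (pmon k)) (ListP.length-map (a ℤ.*_) bs))) (≋-sym (scale-scale a b _))) (value-scale a bs) ⟩
  scale a (scale b (pmon (length bs))) ⊕ pconst a ⊗ value bs ≈⟨ ⊕-cong (pconst-⊗ a (scale b (pmon (length bs)))) (≋-refl {pconst a ⊗ value bs}) ⟨
  pconst a ⊗ scale b (pmon (length bs)) ⊕ pconst a ⊗ value bs ≈⟨ ⊗-distribˡ (pconst a) (scale b (pmon (length bs))) (value bs) ⟨
  pconst a ⊗ value (b ∷ bs) ∎
  where open ≋-Reasoning

-- Lengths bound degrees, so `small` puts the remainder below the degree of the divisor.
-- `quotient-length` fixes the degree at which `value` places the leading quotient coefficient.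
record Division (k : ℕ) (as bs : List ℤ) : Set where
  field
    remainder : List ℤ
    small : length remainder ℕ.≤ length bs
    quotient-length : length (divide k as bs) ≡ length as ℕ.∸ length bs
    division : value as ≋ value (+ 1 ∷ bs) ⊗ value (divide k as bs) ⊕ value remainder

divide-spec : ∀ k as bs → length as ℕ.≤ k → Division k as bs
divide-spec zero [] bs _ = record
  { remainder = [] ; small = ℕ.z≤n ; quotient-length = ≡.sym (ℕP.0∸n≡0 (length bs))
  ; division = ≋-sym (≋-trans (⊕-identityʳ (value (+ 1 ∷ bs) ⊗ [])) (⊗-zeroʳ (value (+ 1 ∷ bs)))) }
divide-spec (suc k) [] bs _ = record
  { remainder = [] ; small = ℕ.z≤n ; quotient-length = ≡.sym (ℕP.0∸n≡0 (length bs))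
  ; division = ≋-sym (≋-trans (⊕-identityʳ (value (+ 1 ∷ bs) ⊗ [])) (⊗-zeroʳ (value (+ 1 ∷ bs)))) }
divide-spec (suc k) (a ∷ as) bs (ℕ.s≤s le) = by-cases (length as <? length bs)
  where
  by-cases : Dec (length as ℕ.< length bs) → Division (suc k) (a ∷ as) bs
  by-cases (yes lt) = record
    { remainder = a ∷ as ; small = lt
    ; quotient-length = ≡.trans (≡.cong length stop) (≡.sym (ℕP.m≤n⇒m∸n≡0 lt))
    ; division = ≋-sym (⊕-cong (≋-trans (⊗-cong (≋-refl {value (+ 1 ∷ bs)}) (PR.reflexive (≡.cong value stop))) (⊗-zeroʳ (value (+ 1 ∷ bs)))) (≋-refl {value (a ∷ as)})) }
    where stop = divide-stop k a as bs lt
  by-cases (no nlt) = record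
    { remainder = remainder ; small = small
    ; quotient-length = ≡.trans (≡.cong length step) (≡.trans (≡.cong suc (≡.trans quotient-length (≡.cong (ℕ._∸ length bs) len))) (≡.sym (ℕP.+-∸-assoc 1 bs≤as)))
    ; division = begin
        value (a ∷ as) ≈⟨ value-∷ a as ⟩
        pconst a ⊗ Q (length as) ⊕ value as
          ≈⟨ ⊕-cong (⊗-cong (≋-refl {pconst a}) (≋-trans (PR.pow≡ pq (≡.sym (ℕP.m∸n+n≡m bs≤as))) (PR.pow-+ pq (length as ℕ.∸ length bs) (length bs)))) (≋-refl {value as}) ⟩
        pconst a ⊗ (s ⊗ Q (length bs)) ⊕ value as
          ≈⟨ solveᴾ 5 (λ a s m v b → a :* (s :* m) :+ v := (one :* m :+ b) :* (a :* s) :+ (v :- s :* (a :* b))) ≋-refl (pconst a) s (Q (length bs)) (value as) (value bs) ⟩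
        (pone ⊗ Q (length bs) ⊕ value bs) ⊗ (pconst a ⊗ s) ⊕ (value as ⊖ s ⊗ (pconst a ⊗ value bs))
          ≈⟨ ⊕-cong (⊗-cong (≋-sym (value-∷ (+ 1) bs)) (≋-refl {pconst a ⊗ s}))
               (≋-sym (≋-trans (value-subtract as (scale a bs) sbs≤as) (⊕-cong (≋-refl {value as}) (pneg-cong (⊗-cong (PR.pow≡ pq (≡.cong (length as ℕ.∸_) slen)) (value-scale a bs)))))) ⟩
        g ⊗ (pconst a ⊗ s) ⊕ value sub ≈⟨ ⊕-cong (≋-refl {g ⊗ (pconst a ⊗ s)}) division ⟩
        g ⊗ (pconst a ⊗ s) ⊕ (g ⊗ value (divide k sub bs) ⊕ value remainder)
          ≈⟨ solveᴾ 4 (λ g x y r → g :* x :+ (g :* y :+ r) := g :* (x :+ y) :+ r) ≋-refl g (pconst a ⊗ s) (value (divide k sub bs)) (value remainder) ⟩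
        g ⊗ (pconst a ⊗ s ⊕ value (divide k sub bs)) ⊕ value remainder
          ≈⟨ ⊕-cong (⊗-cong (≋-refl {g}) (≋-sym (≋-trans (PR.reflexive (≡.cong value step)) (≋-trans (value-∷ a (divide k sub bs))
               (⊕-cong (⊗-cong (≋-refl {pconst a}) (PR.pow≡ pq (≡.trans quotient-length (≡.cong (ℕ._∸ length bs) len)))) (≋-refl {value (divide k sub bs)})))))) (≋-refl {value remainder}) ⟩
        g ⊗ value (divide (suc k) (a ∷ as) bs) ⊕ value remainder ∎ }
    where
    open ≋-Reasoning
    g = value (+ 1 ∷ bs)
    s = Q (length as ℕ.∸ length bs)
    sub = subtract as (scale a bs)
    step = divide-step k a as bs nlt
    bs≤as : length bs ℕ.≤ length as
    bs≤as = ℕP.≮⇒≥ nlt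
    slen : length (scale a bs) ≡ length bs
    slen = ListP.length-map (a ℤ.*_) bs
    sbs≤as : length (scale a bs) ℕ.≤ length as
    sbs≤as = ≡.subst (ℕ._≤ length as) (≡.sym slen) bs≤as
    len : length sub ≡ length as
    len = length-subtract as (scale a bs) sbs≤as
    open Division (divide-spec k sub bs (≡.subst (ℕ._≤ k) (≡.sym len) le))

-- If c differed from the computed quotient, g times the difference would have at least the degree
-- of g, yet it equals the remainder.
monicQuot-exact : ∀ {f g c} → Monic g → g ⊗ c ≋ f → monicQuot f g ≋ c
monicQuot-exact {f} {g} {c} mg e with highFirst-monic mg
... | bs , hg = ≋-trans (≋-trans (PR.reflexive (monicQuot-divide f g (+ 1) bs hg)) (reverse≋value D)) (≋-sym c≋)
  where
  open ≋-Reasoning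
  D = divide (length (highFirst f)) (highFirst f) bs
  open Division (divide-spec (length (highFirst f)) (highFirst f) bs ℕP.≤-refl)
  G = value (+ 1 ∷ bs)
  G≋g : G ≋ g
  G≋g = ≋-trans (PR.reflexive (≡.cong value (≡.sym hg))) (value-highFirst g)
  difference≋remainder : G ⊗ (c ⊖ value D) ≋ value remainder
  difference≋remainder = begin
    G ⊗ (c ⊖ value D) ≈⟨ solveᴾ 3 (λ g c d → g :* (c :- d) := g :* c :- g :* d) ≋-refl G c (value D) ⟩
    G ⊗ c ⊖ G ⊗ value D ≈⟨ ⊕-cong (≋-trans (⊗-cong G≋g (≋-refl {c})) (≋-trans e (≋-trans (≋-sym (value-highFirst f)) division))) (≋-refl {pneg (G ⊗ value D)}) ⟩
    (G ⊗ value D ⊕ value remainder) ⊖ G ⊗ value D ≈⟨ solveᴾ 2 (λ x r → x :+ r :- x := r) ≋-refl (G ⊗ value D) (value remainder) ⟩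
    value remainder ∎
  c≋ : c ≋ value D
  c≋ with degree? (c ⊖ value D)
  ... | inj₁ z = begin
    c ≈⟨ solveᴾ 2 (λ c d → c := (c :- d) :+ d) ≋-refl c (value D) ⟩
    (c ⊖ value D) ⊕ value D ≈⟨ ⊕-cong z (≋-refl {value D}) ⟩
    value D ∎
  ... | inj₂ (k , a , p , a≢0) = ⊥-elim (a≢0 (≡.trans (≡.sym (ℤP.*-identityˡ a)) (≡.trans
    (≡.sym (leading (degree-resp difference≋remainder (degree-⊗ G (c ⊖ value D) (degree-value (+ 1) bs) p))))
    (value-above remainder (length bs ℕ.+ k) (ℕP.≤-trans small (ℕP.m≤m+n (length bs) k))))))

-- Factorization and coprimality of cyclotomic polynomials

Xq : ℕ → Poly
Xq = X pq

only : ∀ {A : Set} → Dec A → Poly → Poly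
only (yes _) f = f
only (no _) f = pone

-- Index j stands for the number j + 1. Non-divisors contribute 1, so products run over a full
-- range.
factor : ℕ → ℕ → Poly
factor n j = only (suc j ∣? n) (Φ (suc j))

private
  cyclotomic-fuel : ∀ f f′ n → n ℕ.≤ f → n ℕ.≤ f′ → n ≢ 0 → cyclotomic f n ≡ cyclotomic f′ n
  cyclotomic-fuel f f′ zero _ _ n≢0 = ⊥-elim (n≢0 ≡.refl)
  cyclotomic-fuel (suc f) (suc f′) (suc n) (ℕ.s≤s le) (ℕ.s≤s le′) _ =
    ≡.cong (λ xs → monicQuot (pmon (suc n) ⊖ pone) (pprod xs)) (ListP.map-cong-local
      (AllP.filter⁺ (_∣? suc n) (AllP.map⁺ (All.map (λ {d} d<n → cyclotomic-fuel f f′ (suc d) (ℕP.≤-trans d<n le) (ℕP.≤-trans d<n le′) (λ ())) (AllP.all-upTo n)))))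

  Φ-recursion : ∀ n → Φ (suc n) ≡ monicQuot (pmon (suc n) ⊖ pone) (pprod (map Φ (properDivisors (suc n))))
  Φ-recursion n = ≡.cong (λ xs → monicQuot (pmon (suc n) ⊖ pone) (pprod xs)) (ListP.map-cong-local
    (AllP.filter⁺ (_∣? suc n) (AllP.map⁺ (All.map (λ {d} d<n → cyclotomic-fuel n (suc d) (suc d) d<n ℕP.≤-refl (λ ())) (AllP.all-upTo n)))))

  pprod-filter : ∀ {P : ℕ → Set} (P? : ∀ k → Dec (P k)) (F : ℕ → Poly) m h →
    pprod (map F (filter P? (map suc (applyUpTo h m)))) ≋ PR.prod (λ j → only (P? (suc (h j))) (F (suc (h j)))) m
  pprod-filter P? F zero h = ≋-refl
  pprod-filter P? F (suc m) h = ≋-trans head (≋-sym (PR.prod-head (λ j → only (P? (suc (h j))) (F (suc (h j)))) m))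
    where
    rest = PR.prod (λ j → only (P? (suc (h (suc j)))) (F (suc (h (suc j))))) m
    head : pprod (map F (filter P? (suc (h 0) ∷ map suc (applyUpTo (λ j → h (suc j)) m)))) ≋ only (P? (suc (h 0))) (F (suc (h 0))) ⊗ rest
    head with P? (suc (h 0))
    ... | yes _ = ⊗-cong (≋-refl {F (suc (h 0))}) (pprod-filter P? F m (λ j → h (suc j)))
    ... | no _ = ≋-trans (pprod-filter P? F m (λ j → h (suc j))) (≋-sym (⊗-identityˡ rest))

X-head≢0 : ∀ n → coeff (Xq (suc n)) 0 ≡ -[1+ 0 ]
X-head≢0 n = ≡.trans (coeff-⊕ (PR.pow pq (suc n)) (pneg pone) 0) (≡.cong (ℤ._+ -[1+ 0 ]) (coeffs (pq-⊗ (PR.pow pq n)) 0))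

X-unitHead : ∀ n → UnitHead (Xq (suc n))
X-unitHead n = unitHead (≡.cong ℤ.∣_∣ (X-head≢0 n))

record CyclotomicFacts (n : ℕ) : Set where
  field
    factorization : PR.prod (factor n) (n ℕ.∸ 1) ⊗ Φ n ≋ Xq n
    monic : Monic (Φ n)

  Φ∣X : Φ n ∣ Xq n
  Φ∣X = PR.prod (factor n) (n ℕ.∸ 1) , ≋-trans (⊗-comm (Φ n) _) factorization

open CyclotomicFacts

private
  -- The induction has to be a strong one: factoring qⁿ - 1 uses coprimality of the smaller Φ's,
  -- which in turn uses their factorizations.
  FactsUpTo : ℕ → Set
  FactsUpTo n = ∀ k → suc k ℕ.≤ n → CyclotomicFacts (suc k)

  ∣suc⇒≢0 : ∀ {g n} → g ℕD.∣ suc n → g ≢ 0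
  ∣suc⇒≢0 d ≡.refl with ℕD.0∣⇒≡0 d
  ... | ()

  -- The Φ's that make up the smaller binomial occur among the proper factors of the larger, so its
  -- product with Φ (suc d) divides the larger one and `factor-coprime` applies.
  coprime-X-divisor : ∀ d g → FactsUpTo (suc d) → suc g ℕD.∣ suc d → g ℕ.< d → Coprime (Φ (suc d)) (Xq (suc g))
  coprime-X-divisor d g facts g∣d g<d = factor-coprime pq g∣d (λ ()) (UnitHead⇒cancellable (X-unitHead g)) (∣-resp (factorization Fd) (∣-resp (⊗-comm (Φ (suc d)) (PR.prod (factor (suc d)) d)) (*-mono-∣ (∣-refl {Φ (suc d)}) X∣prod)))
    where
    Fd = facts d ℕP.≤-refl
    Fg = facts g (ℕ.s≤s (ℕP.<⇒≤ g<d))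
    mono : ∀ j → factor (suc g) j ∣ factor (suc d) j
    mono j with suc j ∣? suc g | suc j ∣? suc d
    ... | yes _ | yes _ = ∣-refl
    ... | no _ | yes _ = 1∣ (Φ (suc j))
    ... | no _ | no _ = ∣-refl
    ... | yes j∣g | no j∤d = contradiction (ℕD.∣-trans j∣g g∣d) j∤d
    factor-g : factor (suc d) g ≡ Φ (suc g)
    factor-g with suc g ∣? suc d
    ... | yes _ = ≡.refl
    ... | no ∤ = contradiction g∣d ∤
    X∣prod : Xq (suc g) ∣ PR.prod (factor (suc d)) d
    X∣prod = ∣-trans (∣-respˡ (factorization Fg) (*-mono-∣ (prod-mono-∣ (factor (suc g)) (factor (suc d)) g mono) (∣-resp (PR.reflexive (≡.sym factor-g)) ∣-refl)))
      (prod-prefix-∣ (factor (suc d)) {suc g} {d} g<d)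

  coprime-X-below : ∀ d e → FactsUpTo (suc d) → ¬ (suc d ℕD.∣ e) → Coprime (Φ (suc d)) (Xq e)
  coprime-X-below d e facts d∤e = coprime-gcd pq (suc d) e (Φ∣X (facts d ℕP.≤-refl)) (go (GCD.gcd (suc d) e) ≡.refl)
    where
    go : ∀ g → GCD.gcd (suc d) e ≡ g → Coprime (Φ (suc d)) (Xq g)
    go zero eq = contradiction eq (∣suc⇒≢0 (GCD.gcd[m,n]∣m (suc d) e))
    go (suc g) eq = coprime-X-divisor d g facts g∣d (ℕP.≤∧≢⇒< (ℕ.s≤s⁻¹ (ℕD.∣⇒≤ g∣d)) λ { ≡.refl → d∤e (≡.subst (ℕD._∣ e) eq (GCD.gcd[m,n]∣n (suc d) e)) })
      where
      g∣d : suc g ℕD.∣ suc d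
      g∣d = ≡.subst (ℕD._∣ suc d) eq (GCD.gcd[m,n]∣m (suc d) e)

  -- Distinct numbers cannot divide each other both ways. Where divisibility fails, one Φ is coprime
  -- to a whole binomial qᵏ - 1 that the other divides.
  coprime-Φ-below : ∀ d e → FactsUpTo (suc d) → FactsUpTo (suc e) → d ≢ e → Coprime (Φ (suc d)) (Φ (suc e))
  coprime-Φ-below d e fd fe d≢e with suc d ∣? suc e
  ... | no d∤e = coprime-divisor (Φ∣X (fe e ℕP.≤-refl)) (coprime-X-below d (suc e) fd d∤e)
  ... | yes d∣e = coprime-sym (coprime-divisor (Φ∣X (fd d ℕP.≤-refl)) (coprime-X-below e (suc d) fe
    (λ e∣d → d≢e (ℕP.suc-injective (ℕD.∣-antisym d∣e e∣d)))))

  FactsUpTo-≤ : ∀ {m n} → m ℕ.≤ n → FactsUpTo n → FactsUpTo m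
  FactsUpTo-≤ le facts k k≤ = facts k (ℕP.≤-trans k≤ le)

  coprime-factor : ∀ n j k → FactsUpTo (suc k) → j ℕ.< k → Coprime (Φ (suc k)) (factor n j)
  coprime-factor n j k facts j<k with suc j ∣? n
  ... | yes _ = coprime-Φ-below k j facts (FactsUpTo-≤ (ℕ.s≤s (ℕP.<⇒≤ j<k)) facts) (λ { ≡.refl → ℕP.<-irrefl ≡.refl j<k })
  ... | no _ = coprime-1

  Φ-unitHead′ : ∀ {k} → CyclotomicFacts (suc k) → UnitHead (Φ (suc k))
  Φ-unitHead′ {k} F = UnitHead-divisor (Φ∣X F) (X-unitHead k)

  -- The factors are pairwise coprime, primitive divisors. This makes the division that defines Φ
  -- exact.
  prod-factor-∣ : ∀ n m → FactsUpTo m → PR.prod (factor n) m ∣ Xq n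
  prod-factor-∣ n zero facts = 1∣ (Xq n)
  prod-factor-∣ n (suc m) facts with suc m ∣? n
  ... | no _ = ∣-respˡ (≋-sym (≋-trans (⊗-comm (PR.prod (factor n) m) pone) (⊗-identityˡ _))) (prod-factor-∣ n m (FactsUpTo-≤ (ℕP.n≤1+n m) facts))
  ... | yes m∣n = coprime-product-∣ (UnitHead⇒primitive (Φ-unitHead′ F))
    (coprime-sym (coprime-prod (factor n) m (λ j j<m → coprime-factor n j m facts j<m)))
    (prod-factor-∣ n m (FactsUpTo-≤ (ℕP.n≤1+n m) facts)) (∣-trans (Φ∣X F) (X-∣ pq m∣n))
    where F = facts m ℕP.≤-refl

  monic-prod-factor : ∀ n m → FactsUpTo m → Monic (PR.prod (factor n) m)
  monic-prod-factor n zero facts = monic-one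
  monic-prod-factor n (suc m) facts = monic-⊗ (PR.prod (factor n) m) (factor n m) (monic-prod-factor n m (FactsUpTo-≤ (ℕP.n≤1+n m) facts)) monic-factor
    where
    monic-factor : Monic (factor n m)
    monic-factor with suc m ∣? n
    ... | yes _ = monic (facts m ℕP.≤-refl)
    ... | no _ = monic-one

  monic-resp : ∀ {f g} → f ≋ g → Monic f → Monic g
  monic-resp e (d , p) = d , degree-resp e p

  monic-X : ∀ n → Monic (Xq (suc n))
  monic-X n = suc n , degree-resp (⊕-cong (pmon≋pow (suc n)) (≋-refl {pneg pone})) (top (degree-pmon n))
    where
    top : Degree (pmon n) n (+ 1) → Degree (pmon (suc n) ⊖ pone) (suc n) (+ 1)
    top p = degree (≡.trans (coeffs (⊕-identityʳ (pmon n)) n) (leading p)) λ { (suc i) (ℕ.s≤s lt) → ≡.trans (coeffs (⊕-identityʳ (pmon n)) i) (above p i lt) }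

  facts-step : ∀ n → FactsUpTo n → CyclotomicFacts (suc n)
  facts-step n facts = record
    { factorization = ≋-trans (⊗-cong (≋-refl {PR.prod (factor (suc n)) n}) Φ≋c) (equality d)
    ; monic = monic-resp (≋-sym Φ≋c) (monic-quotient mp (monic-X n) (equality d)) }
    where
    d = prod-factor-∣ (suc n) n facts
    mp = monic-prod-factor (suc n) n facts
    list≋prod : pprod (map Φ (properDivisors (suc n))) ≋ PR.prod (factor (suc n)) n
    list≋prod = pprod-filter (_∣? suc n) Φ n (λ j → j)
    Φ≋c : Φ (suc n) ≋ quotient d
    Φ≋c = ≋-trans (PR.reflexive (Φ-recursion n)) (monicQuot-exact (monic-resp (≋-sym list≋prod) mp)
      (≋-trans (⊗-cong list≋prod (≋-refl {quotient d})) (≋-trans (equality d) (⊕-cong (≋-sym (pmon≋pow (suc n))) (≋-refl {pneg pone})))))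

  factsUpTo : ∀ n → FactsUpTo n
  factsUpTo (suc n) k (ℕ.s≤s k≤n) with ℕP.m≤n⇒m<n∨m≡n k≤n
  ... | inj₁ k<n = factsUpTo n k k<n
  ... | inj₂ ≡.refl = facts-step n (factsUpTo n)

cyclotomicFacts : ∀ n → CyclotomicFacts (suc n)
cyclotomicFacts n = facts-step n (factsUpTo n)

Φ-unitHead : ∀ n → UnitHead (Φ (suc n))
Φ-unitHead n = Φ-unitHead′ (cyclotomicFacts n)

coprime-Φ-X : ∀ d e → ¬ (suc d ℕD.∣ e) → Coprime (Φ (suc d)) (Xq e)
coprime-Φ-X d e = coprime-X-below d e (factsUpTo (suc d))

coprime-Φ-factor : ∀ n j k → j ℕ.< k → Coprime (Φ (suc k)) (factor n j)
coprime-Φ-factor n j k = coprime-factor n j k (factsUpTo (suc k))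

-- Values of formal fractions in a localization of ℤ[q]

private
  MTU = MonomialTimesUnit

unit⇒MTU : ∀ {f} → UnitHead f → MTU f
unit⇒MTU {f} u = monomialTimes 0 f u (≋-sym (⊗-identityˡ f))

MTU-1 : MTU pone
MTU-1 = unit⇒MTU (unitHead ≡.refl)

MTU-pq : MTU pq
MTU-pq = monomialTimes 1 pone (unitHead ≡.refl) (coeffwise λ { 0 → ≡.refl ; 1 → ≡.refl ; (suc (suc i)) → ≡.refl })

MTU-⊗ : ∀ {f g} → MTU f → MTU g → MTU (f ⊗ g)
MTU-⊗ {f} {g} (monomialTimes a f′ u e) (monomialTimes b g′ v r) = monomialTimes (a ℕ.+ b) (f′ ⊗ g′) (UnitHead-⊗ u v) (begin
  f ⊗ g ≈⟨ ⊗-cong e r ⟩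
  (PR.pow pq a ⊗ f′) ⊗ (PR.pow pq b ⊗ g′) ≈⟨ solveᴾ 4 (λ a f b g → a :* f :* (b :* g) := a :* b :* (f :* g)) ≋-refl (PR.pow pq a) f′ (PR.pow pq b) g′ ⟩
  (PR.pow pq a ⊗ PR.pow pq b) ⊗ (f′ ⊗ g′) ≈⟨ ⊗-cong (PR.pow-+ pq a b) (≋-refl {f′ ⊗ g′}) ⟨
  PR.pow pq (a ℕ.+ b) ⊗ (f′ ⊗ g′) ∎)
  where open ≋-Reasoning

MTU-cancellable : ∀ {f} → MTU f → Cancellable f
MTU-cancellable (monomialTimes a f′ u e) h z = UnitHead⇒cancellable u h (pow-pq-cancellable a (f′ ⊗ h) (≋-trans (≋-sym (⊗-assoc (PR.pow pq a) f′ h)) (≋-trans (⊗-cong (≋-sym e) (≋-refl {h})) z)))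

abstract
  private
    module K = Localization polyRing pq MonomialTimesUnit MTU-cancellable MTU-1 MTU-⊗

  -- The localization of ℤ[q] at the polynomials ±qᵃ(1 + q …), opaque to keep terms small.
  fractionRing : CommutativeRing 0ℓ 0ℓ
  fractionRing = K.localRing

  embedHom : RingHoms.RingHom polyRing fractionRing
  embedHom = K.embedHom

  embed-cong : ∀ {f g} → f ≋ g → CommutativeRing._≈_ fractionRing (RingHoms.RingHom.φ embedHom f) (RingHoms.RingHom.φ embedHom g)
  embed-cong e = K.cross (⊗-cong e (≋-refl {pone}))

  embed-injective : ∀ {f g} → CommutativeRing._≈_ fractionRing (RingHoms.RingHom.φ embedHom f) (RingHoms.RingHom.φ embedHom g) → f ≋ g
  embed-injective = K.embed-injective

  recip : ∀ {s} → MTU s → CommutativeRing.Carrier fractionRing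
  recip = K.recip

  recip-inverse : ∀ {s} (p : MTU s) → let open CommutativeRing fractionRing in recip p * RingHoms.RingHom.φ embedHom s ≈ 1#
  recip-inverse = K.recip-inverse

  Represents : Frac → CommutativeRing.Carrier fractionRing → Set
  Represents x = K.Value (num x) (den x)

  rep-den : ∀ {x k} → Represents x k → MTU (den x)
  rep-den = K.d∈S

  rep-resp : ∀ {x k l} → CommutativeRing._≈_ fractionRing k l → Represents x k → Represents x l
  rep-resp = K.value-resp

  rep-poly : ∀ f → Represents (fromPoly f) (RingHoms.RingHom.φ embedHom f)
  rep-poly = K.value-embed

  rep-recip : ∀ {s} (p : MTU s) → Represents (frac pone s) (recip p)
  rep-recip = K.value-recip

  rep-fadd : ∀ {x y k l} → Represents x k → Represents y l → Represents (fadd x y) (CommutativeRing._+_ fractionRing k l)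
  rep-fadd = K.value-+

  rep-fneg : ∀ {x k} → Represents x k → Represents (fneg x) (CommutativeRing.-_ fractionRing k)
  rep-fneg = K.value-neg

  rep-fmul : ∀ {x y k l} → Represents x k → Represents y l → Represents (fmul x y) (CommutativeRing._*_ fractionRing k l)
  rep-fmul = K.value-*

  rep-finv : ∀ {x k l} → MTU (num x) → (let open CommutativeRing fractionRing in k * l ≈ 1#) → Represents x k → Represents (finv x) l
  rep-finv = K.value-flip

  rep-crossed : ∀ {x k s u} → Represents x k → (let open CommutativeRing fractionRing ; open RingHoms.RingHom embedHom in φ s * k ≈ φ u) → s ⊗ num x ≋ u ⊗ den x
  rep-crossed {k = k} {s} {u} = K.value-crossed {k = k} {s} {u}

module KR = RingOps fractionRing
open KR using () renaming (_≈_ to _≈ᶠ_; Carrier to Fraction)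
module embedHom = RingHoms.RingHom embedHom
open embedHom using () renaming (φ to embed)

rep-fpow : ∀ {x k} n → Represents x k → Represents (fpow x n) (KR.pow k n)
rep-fpow zero r = rep-resp embedHom.φ-1 (rep-poly pone)
rep-fpow (suc n) r = rep-fmul r (rep-fpow n r)

rep-fprod : ∀ {x k} n → (∀ j → Represents (x j) (k j)) → Represents (fprod n x) (KR.prod k n)
rep-fprod zero r = rep-resp embedHom.φ-1 (rep-poly pone)
rep-fprod (suc n) r = rep-fmul (rep-fprod n r) (r n)

rep-fsum : ∀ {x k} n → (∀ j → Represents (x j) (k j)) → Represents (fsum n x) (KR.sum k n)
rep-fsum zero r = r 0
rep-fsum (suc n) r = rep-fadd (rep-fsum n r) (r (suc n))

q q⁻¹ p : Fraction
q = embed pq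
q⁻¹ = recip MTU-pq
p = KR.pow q 2

qq⁻¹≈1 : q KR.* q⁻¹ ≈ᶠ KR.1#
qq⁻¹≈1 = KR.trans (KR.*-comm q q⁻¹) (recip-inverse MTU-pq)

1-q^ : ∀ k → MTU (pone ⊕ pneg (PR.pow pq (suc k)))
1-q^ k = unit⇒MTU (UnitHead-resp {pneg (Xq (suc k))} (solveᴾ 1 (λ x → :- (x :- one) := one :- x) ≋-refl (PR.pow pq (suc k)))
    (unitHead (≡.cong ℤ.∣_∣ (≡.trans (coeff-pneg (Xq (suc k)) 0) (≡.cong ℤ.-_ (X-head≢0 k))))))

ν : ℕ → Fraction
ν k = recip (1-q^ k)

ν-inv : ∀ k → ν k KR.* (KR.1# KR.+ KR.- KR.pow q (suc k)) ≈ᶠ KR.1#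
ν-inv k = KR.trans (KR.*-congˡ (KR.sym (embedHom.φ-sub {y = PR.pow pq (suc k)} embedHom.φ-1 (embedHom.φ-pow pq (suc k))))) (recip-inverse (1-q^ k))

ι : ℕ → Fraction
ι k = ν (suc (k ℕ.+ k))

ι-inv : ∀ k → ι k KR.* (KR.1# KR.+ KR.- KR.pow p (suc k)) ≈ᶠ KR.1#
ι-inv k = KR.trans (KR.*-congˡ (KR.+-congˡ (KR.-‿cong (KR.trans (KR.pow-pow q 2 (suc k)) (KR.pow≡ q (e k)))))) (ν-inv (suc (k ℕ.+ k)))
  where
  e : ∀ k → suc k ℕ.* 2 ≡ suc (suc (k ℕ.+ k))
  e = solve-∀

ppow≡pow : ∀ f k → ppow f k ≡ PR.pow f k
ppow≡pow f zero = ≡.refl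
ppow≡pow f (suc k) = ≡.cong (f ⊗_) (ppow≡pow f k)

embed-ppow : ∀ {f k} n → embed f ≈ᶠ k → embed (ppow f n) ≈ᶠ KR.pow k n
embed-ppow {f} n e = KR.trans (KR.reflexive (≡.cong embed (ppow≡pow f n))) (embedHom.φ-pow′ n e)

embed-pmon : ∀ n → embed (pmon n) ≈ᶠ KR.pow q n
embed-pmon n = KR.trans (embed-cong (pmon≋pow n)) (embedHom.φ-pow pq n)

rep-poch : ∀ {x k} n → Represents x k → Represents (poch x q² n) (KR.prod (λ i → KR.1# KR.+ KR.- (k KR.* KR.pow p i)) n)
rep-poch n r = rep-fprod n (λ j → rep-fadd (rep-resp embedHom.φ-1 (rep-poly pone)) (rep-fneg (rep-fmul r (rep-resp (embed-ppow j (embed-pmon 2)) (rep-poly (ppow q² j))))))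

private
  -- The terms divide by powers of (q²;q²)ₖ, so its numerator becomes a denominator and must be
  -- admissible as one.
  unit-num-poch : ∀ n → UnitHead (num (poch (fromPoly q²) q² n))
  unit-num-poch zero = unitHead ≡.refl
  unit-num-poch (suc n) = UnitHead-⊗ (unit-num-poch n) (UnitHead-resp (≋-sym factor≋) (unitHead (≡.cong ℤ.∣_∣ head)))
    where
    open ≋-Reasoning
    x = ppow q² n
    y = pq ⊗ (pq ⊗ x)
    factor≋ : pone ⊗ (pone ⊗ pone) ⊕ pneg (q² ⊗ x) ⊗ pone ≋ pone ⊖ y
    factor≋ = begin
      pone ⊗ (pone ⊗ pone) ⊕ pneg (q² ⊗ x) ⊗ pone
        ≈⟨ solveᴾ 1 (λ t → one :* (one :* one) :+ :- t :* one := one :- t) ≋-refl (q² ⊗ x) ⟩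
      pone ⊖ q² ⊗ x ≈⟨ ⊕-cong (≋-refl {pone}) (pneg-cong (⊗-cong (pmon≋pow 2) (≋-refl {x}))) ⟩
      pone ⊖ PR.pow pq 2 ⊗ x ≈⟨ solveᴾ 2 (λ q x → one :- (q :* (q :* one)) :* x := one :- q :* (q :* x)) ≋-refl pq x ⟩
      pone ⊖ y ∎
    head : coeff (pone ⊖ y) 0 ≡ + 1
    head = ≡.trans (coeff-⊕ pone (pneg y) 0) (≡.cong (λ c → + 1 ℤ.+ c) (≡.trans (coeff-pneg y 0) (≡.cong ℤ.-_ (coeffs (pq-⊗ (pq ⊗ x)) 0))))

  unit-num-fpow : ∀ {x} n → UnitHead (num x) → UnitHead (num (fpow x n))
  unit-num-fpow zero u = unitHead ≡.refl
  unit-num-fpow (suc n) u = UnitHead-⊗ u (unit-num-fpow n u)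

-- The q-integer [4k-1], with [-1] = -q⁻¹. The number k + 3(k + 1) is the form to which 4(k + 1) - 1
-- computes.
j : ℕ → Fraction
j zero = KR.- q⁻¹
j (suc k) = embed (qnat (k ℕ.+ 3 ℕ.* suc k))

rep-qint : ∀ k → Represents (qint (+ (4 ℕ.* k) ℤ.- + 1)) (j k)
rep-qint zero = rep-fneg (rep-recip MTU-pq)
rep-qint (suc k) = rep-poly (qnat (k ℕ.+ 3 ℕ.* suc k))

geometric : ∀ m → (pone ⊖ pq) ⊗ qnat m ≋ pone ⊖ PR.pow pq m
geometric zero = ≋-trans (⊗-zeroʳ (pone ⊖ pq)) (≋-sym (⊕-inverseʳ pone))
geometric (suc m) = begin
  (pone ⊖ pq) ⊗ qnat (suc m) ≈⟨ ⊗-cong (≋-refl {pone ⊖ pq}) (≋-sym (≋-trans (⊕-cong (≋-refl {pone}) (pq-⊗ (qnat m))) (∷-cong ≡.refl ≋-refl))) ⟩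
  (pone ⊖ pq) ⊗ (pone ⊕ pq ⊗ qnat m) ≈⟨ solveᴾ 2 (λ q x → (one :- q) :* (one :+ q :* x) := one :- q :+ q :* ((one :- q) :* x)) ≋-refl pq (qnat m) ⟩
  (pone ⊖ pq) ⊕ pq ⊗ ((pone ⊖ pq) ⊗ qnat m) ≈⟨ ⊕-cong (≋-refl {pone ⊖ pq}) (⊗-cong (≋-refl {pq}) (geometric m)) ⟩
  (pone ⊖ pq) ⊕ pq ⊗ (pone ⊖ PR.pow pq m) ≈⟨ solveᴾ 2 (λ q x → one :- q :+ q :* (one :- x) := one :- q :* x) ≋-refl pq (PR.pow pq m) ⟩
  pone ⊖ PR.pow pq (suc m) ∎
  where open ≋-Reasoning

j-spec : ∀ k → q KR.* (KR.1# KR.+ KR.- q) KR.* j k ≈ᶠ q KR.+ KR.- KR.pow q (4 ℕ.* k)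
j-spec zero = KR.begin
  q KR.* (KR.1# KR.+ KR.- q) KR.* KR.- q⁻¹
    KR.≈⟨ KR.solve 2 (λ q r → q :* (one :- q) :* :- r := (q :* r) :* (q :- one)) KR.refl q q⁻¹ ⟩
  q KR.* q⁻¹ KR.* (q KR.+ KR.- KR.1#) KR.≈⟨ KR.trans (KR.*-congʳ qq⁻¹≈1) (KR.*-identityˡ _) ⟩
  q KR.+ KR.- KR.1# KR.∎
j-spec (suc k) = KR.begin
  q KR.* (KR.1# KR.+ KR.- q) KR.* embed (qnat m) KR.≈⟨ KR.*-assoc q _ _ ⟩
  q KR.* ((KR.1# KR.+ KR.- q) KR.* embed (qnat m)) KR.≈⟨ KR.*-congˡ (KR.trans (KR.sym (embedHom.φ-mul {x = pone ⊖ pq} {qnat m} (embedHom.φ-sub {pone} {pq} embedHom.φ-1 KR.refl) KR.refl))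
      (KR.trans (embed-cong (geometric m)) (embedHom.φ-sub {pone} {PR.pow pq m} embedHom.φ-1 (embedHom.φ-pow pq m)))) ⟩
  q KR.* (KR.1# KR.+ KR.- KR.pow q m) KR.≈⟨ KR.solve 2 (λ q x → q :* (one :- x) := q :- q :* x) KR.refl q (KR.pow q m) ⟩
  q KR.+ KR.- KR.pow q (4 ℕ.* suc k) KR.∎
  where m = k ℕ.+ 3 ℕ.* suc k

module Sums (l : Fraction) = RationalSums fractionRing q q⁻¹ l

termˡ termʳ : ℕ → Fraction
termˡ = Sums.termˡ KR.1# qq⁻¹≈1 ι ι-inv j j-spec
termʳ = Sums.termʳ KR.1# qq⁻¹≈1 ι ι-inv j j-spec

private
  b-inverse : ∀ k n → KR.pow (KR.prod (λ i → KR.1# KR.+ KR.- (p KR.* KR.pow p i)) k) n KR.* KR.pow (KR.prod ι k) n ≈ᶠ KR.1#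
  b-inverse k n = KR.trans (KR.sym (KR.pow-* _ _ n)) (KR.trans (KR.pow-cong n (KR.trans (KR.sym (KR.prod-* _ ι k))
    (KR.trans (KR.prod-cong k (λ i _ → KR.trans (KR.*-comm _ (ι i)) (ι-inv i))) (KR.trans (KR.prod-const KR.1# k) (KR.pow-1# k))))) (KR.pow-1# n))

  rep-1/b : ∀ k n → Represents (finv (fpow (poch (fromPoly q²) q² k) n)) (KR.pow (KR.prod ι k) n)
  rep-1/b k n = rep-finv {fpow (poch (fromPoly q²) q² k) n} (unit⇒MTU (unit-num-fpow {poch (fromPoly q²) q² k} n (unit-num-poch k))) (b-inverse k n)
    (rep-fpow n (rep-poch k (rep-resp (embed-pmon 2) (rep-poly q²))))

  rep-a : ∀ k → Represents (poch qinv q² k) (KR.prod (λ i → KR.1# KR.+ KR.- (q⁻¹ KR.* KR.pow p i)) k)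
  rep-a k = rep-poch k (rep-recip MTU-pq)

rep-LHS : ∀ m → Represents (LHS m) (KR.sum termˡ m)
rep-LHS m = rep-fsum m (λ k → rep-fmul (rep-resp (embed-ppow k (KR.trans (embedHom.φ-neg pone) (KR.-‿cong embedHom.φ-1))) (rep-poly (ppow (pconst (ℤ.- (+ 1))) k)))
  (rep-fmul (rep-qint k) (rep-fmul (rep-fmul (rep-fpow 5 (rep-a k)) (rep-1/b k 5)) (rep-resp (embed-pmon (k ℕ.* k ℕ.+ 5 ℕ.* k)) (rep-poly (pmon (k ℕ.* k ℕ.+ 5 ℕ.* k)))))))

rep-rhsSum : ∀ N → Represents (fsum N rhsTerm) (KR.sum termʳ N)
rep-rhsSum N = rep-fsum N (λ k → rep-fmul
  (rep-fmul (rep-fmul (rep-fpow 2 (rep-a k)) (rep-poch k (rep-resp (embed-pmon 3) (rep-poly (pmon 3))))) (rep-1/b k 3))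
  (rep-resp (embed-pmon (3 ℕ.* k)) (rep-poly (pmon (3 ℕ.* k)))))

-- Clearing denominators in s(A - B) = u gives Ns = uD for a form N/D of A - B. So g divides Ns, and
-- it is coprime to s.
divides-numerator : ∀ {A B a b s u g N D} → Represents A a → Represents B b → embed s KR.* (a KR.+ KR.- b) ≈ᶠ embed u →
  UnitHead g → Coprime g s → g ∣ u →
  N ⊗ (den A ⊗ den B) ≋ (num A ⊗ den B ⊖ num B ⊗ den A) ⊗ D → g ∣ N
divides-numerator {A} {B} {s = s} {u} {g} {N} {D} rA rB e ug cop g∣u eq =
  coprime-∣ (UnitHead⇒primitive ug) cop (∣-resp (≋-trans (≋-sym Ns≋uD) (⊗-comm N s)) (∣-*ʳ D g∣u))
  where
  open ≋-Reasoning
  dd = den A ⊗ den B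
  nn = num A ⊗ den B ⊕ pneg (num B) ⊗ den A
  sn≋ud : s ⊗ nn ≋ u ⊗ dd
  sn≋ud = rep-crossed (rep-fadd rA (rep-fneg rB)) e
  Ns≋uD : N ⊗ s ≋ u ⊗ D
  Ns≋uD = cancel {dd} (MTU-cancellable (MTU-⊗ (rep-den rA) (rep-den rB))) (begin
    dd ⊗ (N ⊗ s) ≈⟨ solveᴾ 3 (λ d n s → d :* (n :* s) := s :* (n :* d)) ≋-refl dd N s ⟩
    s ⊗ (N ⊗ dd) ≈⟨ ⊗-cong (≋-refl {s}) eq ⟩
    s ⊗ ((num A ⊗ den B ⊖ num B ⊗ den A) ⊗ D)
      ≈⟨ solveᴾ 6 (λ s a b c d x → s :* ((a :* b :- c :* d) :* x) := s :* (a :* b :+ (:- c) :* d) :* x) ≋-refl s (num A) (den B) (num B) (den A) D ⟩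
    (s ⊗ nn) ⊗ D ≈⟨ ⊗-cong sn≋ud (≋-refl {D}) ⟩
    (u ⊗ dd) ⊗ D ≈⟨ solveᴾ 3 (λ u d x → u :* d :* x := d :* (u :* x)) ≋-refl u dd D ⟩
    dd ⊗ (u ⊗ D) ∎)

-- The two sides as polynomials, and their divisibility by Φₙ³ and Φ_d

module PS (l x : Poly) = SeriesOver polyRing pq l x
module KS (l x : Fraction) = SeriesOver fractionRing q l x

embed-0 : embed [] ≈ᶠ KR.0#
embed-0 = KR.trans (embed-cong (≋-sym (⊕-inverseʳ pone))) (KR.trans (embedHom.φ-sub {pone} {pone} embedHom.φ-1 embedHom.φ-1) (KR.-‿inverseʳ KR.1#))

q[1-q] : Poly
q[1-q] = pq ⊗ (pone ⊖ pq)

embed-q[1-q] : embed q[1-q] ≈ᶠ q KR.* (KR.1# KR.+ KR.- q)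
embed-q[1-q] = embedHom.φ-mul {pq} {pone ⊖ pq} KR.refl (embedHom.φ-sub {pone} {pq} embedHom.φ-1 KR.refl)

prefactor : ℕ → ℕ → Poly
prefactor n e = qnat n ⊗ ppow (pneg pq) e

κ : ℕ → ℕ → Poly
κ n e = (pone ⊖ PR.pow pq n) ⊗ (pq ⊗ PR.pow (pneg pq) e)

κ≈ : ∀ n e → embed (κ n e) ≈ᶠ q KR.* (KR.1# KR.+ KR.- q) KR.* embed (prefactor n e)
κ≈ n e = KR.trans (embed-cong (begin
  (pone ⊖ PR.pow pq n) ⊗ (pq ⊗ s) ≈⟨ ⊗-cong (geometric n) (≋-refl {pq ⊗ s}) ⟨
  ((pone ⊖ pq) ⊗ qnat n) ⊗ (pq ⊗ s) ≈⟨ solveᴾ 4 (λ w m q s → w :* m :* (q :* s) := q :* w :* (m :* s)) ≋-refl (pone ⊖ pq) (qnat n) pq s ⟩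
  q[1-q] ⊗ (qnat n ⊗ s) ≡⟨ ≡.cong (λ s → q[1-q] ⊗ (qnat n ⊗ s)) (≡.sym (ppow≡pow (pneg pq) e)) ⟩
  q[1-q] ⊗ prefactor n e ∎)) (embedHom.φ-mul {q[1-q]} {prefactor n e} embed-q[1-q] KR.refl)
  where
  open ≋-Reasoning
  s = PR.pow (pneg pq) e

-- The identity is proved where q and all 1 - qᵏ are invertible. Being polynomial, it descends to
-- ℤ[q], which embeds into the localization.
exact : ∀ M e k → suc e ≡ M ℕ.* M → let n = suc (M ℕ.+ M) ; l = PR.pow pq n in
  PS.difference l ((pone ⊖ l) ⊗ (pone ⊖ l)) (κ n e) (suc M ℕ.+ k) (suc M) ≋ []
exact M e k e+1≡M² = embed-injective (KR.trans (embedHom.φ-difference {q = pq} {l} {(pone ⊖ l) ⊗ (pone ⊖ l)} KR.refl (embedHom.φ-pow pq n) (embedHom.φ-mul {pone ⊖ l} {pone ⊖ l} φ1-l φ1-l)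
    {κ n e} (embedHom.φ-mul {pone ⊖ l} {pq ⊗ PR.pow (pneg pq) e} φ1-l (embedHom.φ-mul {pq} {PR.pow (pneg pq) e} KR.refl (embedHom.φ-pow′ {pneg pq} e (embedHom.φ-neg pq)))) (suc M ℕ.+ k) (suc M))
  (KR.trans (ExactIdentity.exact-identity fractionRing q q⁻¹ qq⁻¹≈1 ν ν-inv M e e+1≡M² k) (KR.sym embed-0)))
  where
  n = suc (M ℕ.+ M)
  l = PR.pow pq n
  φ1-l : embed (pone ⊖ l) ≈ᶠ KR.1# KR.+ KR.- KR.pow q n
  φ1-l = embedHom.φ-sub {pone} {l} embedHom.φ-1 (embedHom.φ-pow pq n)

private
  p² : Poly
  p² = PR.pow pq 2

  1-p : ℕ → Poly
  1-p k = pone ⊖ PR.pow p² (suc k)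

  1-p∣X : ∀ k → 1-p k ∣ Xq (suc k ℕ.* 2)
  1-p∣X k = pneg pone , ≋-trans (solveᴾ 1 (λ y → (one :- y) :* :- one := y :- one) ≋-refl (PR.pow p² (suc k))) (⊕-cong (PR.pow-pow pq 2 (suc k)) (≋-refl {pneg pone}))

-- d divides 2jM = jd + j.
odd-divides-double : ∀ {d M} j → suc d ≡ M ℕ.+ M → d ℕD.∣ j ℕ.* 2 → d ℕD.∣ j
odd-divides-double {d} {M} j d+1≡2M d∣2j = ℕD.∣m+n∣m⇒∣n (≡.subst (d ℕD.∣_) (begin
  j ℕ.* 2 ℕ.* M ≡⟨ e₁ j M ⟩
  j ℕ.* (M ℕ.+ M) ≡⟨ ≡.cong (j ℕ.*_) (≡.sym d+1≡2M) ⟩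
  j ℕ.* suc d ≡⟨ e₂ j d ⟩
  j ℕ.* d ℕ.+ j ∎) (ℕD.∣m⇒∣m*n M d∣2j)) (ℕD.n∣m*n j)
  where
  open ≡.≡-Reasoning
  e₁ : ∀ j M → j ℕ.* 2 ℕ.* M ≡ j ℕ.* (M ℕ.+ M)
  e₁ = solve-∀
  e₂ : ∀ j d → j ℕ.* suc d ≡ j ℕ.* d ℕ.+ j
  e₂ = solve-∀

module OddCyclotomic (d′ M : ℕ) (d+1≡2M : suc (suc d′) ≡ M ℕ.+ M) (1<d : 1 ℕ.< suc d′) where
  d : ℕ
  d = suc d′

  g : Poly
  g = Φ d

  g-unit : UnitHead g
  g-unit = Φ-unitHead d′

  g-primitive : Primitive g
  g-primitive = UnitHead⇒primitive g-unit

  g∣X : ∀ {n} → d ℕD.∣ n → g ∣ Xq n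
  g∣X d∣n = ∣-trans (CyclotomicFacts.Φ∣X (cyclotomicFacts d′)) (X-∣ pq d∣n)

  g∣1-q^ : ∀ {n} → d ℕD.∣ n → g ∣ pone ⊖ PR.pow pq n
  g∣1-q^ {n} d∣n = ∣-resp (solveᴾ 1 (λ y → :- (y :- one) := one :- y) ≋-refl (PR.pow pq n)) (∣-neg (g∣X d∣n))

  coprime-1-p′ : ∀ k → ¬ (d ℕD.∣ suc k) → Coprime g (1-p k)
  coprime-1-p′ k d∤ = coprime-divisor (1-p∣X k) (coprime-Φ-X d′ (suc k ℕ.* 2) (λ div → d∤ (odd-divides-double {d} {M} (suc k) d+1≡2M div)))

  coprime-1-p : ∀ k → suc k ℕ.< d → Coprime g (1-p k)
  coprime-1-p k k<d = coprime-1-p′ k (λ div → ℕP.<-irrefl ≡.refl (ℕP.≤-trans k<d (ℕD.∣⇒≤ div)))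

  coprime-pow-pq : ∀ n → d ℕD.∣ n → Coprime g (PR.pow pq n)
  coprime-pow-pq n d∣n = coprime-shift (g∣1-q^ d∣n) coprime-1

  coprime-q[1-q] : Coprime g q[1-q]
  coprime-q[1-q] = coprime-* {g} {pq} {pone ⊖ pq}
    (coprime-divisor {g} {PR.pow pq d} {pq} (PR.pow pq d′ , ≋-refl) (coprime-pow-pq d ℕD.∣-refl))
    (coprime-divisor {g} {Xq 1} {pone ⊖ pq} (pneg pone , solveᴾ 1 (λ y → (one :- y) :* :- one := y :* one :- one) ≋-refl pq)
      (coprime-Φ-X d′ 1 (λ div → ℕP.<-irrefl ≡.refl (ℕP.≤-trans 1<d (ℕD.∣⇒≤ div)))))

  -- Let y = q^(k+1). If d does not divide k + 1, then 1 + y divides 1 - y², which is coprime to Φ_d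
  -- because d is odd. Otherwise 1 + y ≡ 2, and a non-zero integer counts as coprime.
  coprime-1+q^ : ∀ k → Coprime g (pone ⊕ PR.pow pq (suc k))
  coprime-1+q^ k with d ∣? suc k
  ... | no d∤ = coprime-divisor (pone ⊖ PR.pow pq (suc k) , ≋-trans (solveᴾ 1 (λ y → (one :+ y) :* (one :- y) := one :- y :* y) ≋-refl (PR.pow pq (suc k)))
          (⊕-cong (≋-refl {pone}) (pneg-cong (≋-trans (≋-sym (PR.pow-+ pq (suc k) (suc k))) (≋-trans (PR.pow≡ pq (e k)) (≋-sym (PR.pow-pow pq 2 (suc k)))))))) (coprime-1-p′ k d∤)
    where
    e : ∀ k → suc k ℕ.+ suc k ≡ suc k ℕ.* 2
    e = solve-∀
  ... | yes d∣ = coprime-shift {g} {PR.fromℤ (+ 2)} (∣-resp (solveᴾ 1 (λ y → one :- y := (one :+ one) :- (one :+ y)) ≋-refl (PR.pow pq (suc k))) (g∣1-q^ d∣))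
    (coprime [] pone (+ 2) (λ ()) (≋-trans (⊕-cong (⊗-zeroʳ g) (≋-refl {PR.fromℤ (+ 2) ⊗ pone})) (≋-trans (⊗-comm (PR.fromℤ (+ 2)) pone) (⊗-identityˡ _))))

  coprime-γ : ∀ l k → Coprime g l → suc k ℕ.< d → Coprime g (PS.γ l [] k)
  coprime-γ l k cl k<d = coprime-resp (solveᴾ 3 (λ y l z → y :* (l :* (z :* z)) := y :* (l :* (z :* z) :- zeroᵉ)) ≋-refl (PR.pow (1-p k) 3) l (1-p k))
    (coprime-* (coprime-pow 3 (coprime-1-p k k<d)) (coprime-* cl (coprime-* (coprime-1-p k k<d) (coprime-1-p k k<d))))

-- A certificate that g divides the numerator of a: multiplication by something coprime to g turns a
-- into a polynomial multiple of g.
record Relation (g : Poly) (a : Fraction) : Set where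
  constructor relation
  field
    multiplier multiple : Poly
    multiplier-coprime : Coprime g multiplier
    divides-multiple : g ∣ multiple
    equation : embed multiplier KR.* a ≈ᶠ embed multiple

discrepancy : ℕ → ℕ → ℕ → ℕ → Fraction
discrepancy n e m N = KR.sum termˡ m KR.+ KR.- (embed (prefactor n e) KR.* KR.sum termʳ N)

-- Here n = 2M + 3 and the upper limit is (n+1)/2 + k; the theorem needs k = 0 and k = M. All
-- factors of the multiplier have index below n, so they are coprime to Φₙ.
cube-relation : ∀ M e k → suc e ≡ suc M ℕ.* suc M → suc (suc M) ℕ.+ k ℕ.< suc (suc M ℕ.+ suc M) →
  let n = suc (suc M ℕ.+ suc M) in Relation (Φ n ⊗ (Φ n ⊗ Φ n)) (discrepancy n e (suc (suc M) ℕ.+ k) (suc (suc M)))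
cube-relation M e k e+1≡ N+k<n = relation s (PS.difference l [] (κ n e) m N)
  (coprime-sym (coprime-* cop (coprime-* cop cop)))
  (Cube.cube∣difference polyRing pq (Φ n) (κ n e) n N n+1≡2N N<n O.g-primitive g∣1-l (∣-*ʳ _ g∣1-l) O.coprime-1-p k N+k<n (exact (suc M) e k e+1≡))
  (KR.sym (KR.trans (embedHom.φ-difference {q = pq} {l} {[]} KR.refl (embedHom.φ-pow pq n) embed-0 {κ n e} KR.refl m N)
    (KR.trans (Sums.difference-cleared (KR.pow q n) qq⁻¹≈1 ι ι-inv j j-spec (embed (κ n e)) (embed (prefactor n e)) m N (κ≈ n e))
      (KR.*-congʳ (KR.sym embed-s)))))
  where
  N n m : ℕ
  N = suc (suc M)
  n = suc (suc M ℕ.+ suc M)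
  m = N ℕ.+ k
  l = PR.pow pq n
  n+1≡2N : suc n ≡ N ℕ.+ N
  n+1≡2N = ≡.cong suc (≡.sym (ℕP.+-suc (suc M) (suc M)))
  N<n : N ℕ.< n
  N<n = ℕP.≤-<-trans (ℕP.m≤m+n N k) N+k<n
  module O = OddCyclotomic (suc M ℕ.+ suc M) N n+1≡2N (ℕ.s≤s (ℕ.s≤s ℕ.z≤n))
  g∣1-l : Φ n ∣ pone ⊖ l
  g∣1-l = O.g∣1-q^ ℕD.∣-refl
  s : Poly
  s = (PR.prod (PS.γ′ l []) N ⊗ PR.prod (PS.γ l []) m) ⊗ q[1-q]
  l-coprime : Coprime (Φ n) l
  l-coprime = O.coprime-pow-pq n ℕD.∣-refl
  cop : Coprime s (Φ n)
  cop = coprime-sym (coprime-* (coprime-*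
    (coprime-prod (PS.γ′ l []) N (λ k k<N → coprime-* (coprime-pow 3 (O.coprime-1-p k (ℕP.≤-<-trans k<N N<n))) l-coprime))
    (coprime-prod (PS.γ l []) m (λ k k<m → O.coprime-γ l k l-coprime (ℕP.≤-<-trans k<m N+k<n)))) O.coprime-q[1-q])
  embed-s : embed s ≈ᶠ KR.prod (KS.γ′ (KR.pow q n) KR.0#) N KR.* KR.prod (KS.γ (KR.pow q n) KR.0#) m KR.* (q KR.* (KR.1# KR.+ KR.- q))
  embed-s = embedHom.φ-mul {PR.prod (PS.γ′ l []) N ⊗ PR.prod (PS.γ l []) m} {q[1-q]}
    (embedHom.φ-mul {PR.prod (PS.γ′ l []) N} {PR.prod (PS.γ l []) m}
      (embedHom.φ-prod {PS.γ′ l []} (embedHom.φ-γ′ {q = pq} {l} {[]} KR.refl (embedHom.φ-pow pq n) embed-0) N)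
      (embedHom.φ-prod {PS.γ l []} (embedHom.φ-γ {q = pq} {l} {[]} KR.refl (embedHom.φ-pow pq n) embed-0) m)) embed-q[1-q]

private
  MTU-1-p : ∀ k → MonomialTimesUnit (1-p k)
  MTU-1-p k = unit⇒MTU (UnitHead-divisor (1-p∣X k) (X-unitHead (suc (k ℕ.* 2))))

  MTU-pow : ∀ {f} n → MonomialTimesUnit f → MonomialTimesUnit (PR.pow f n)
  MTU-pow zero m = MTU-1
  MTU-pow (suc n) m = MTU-⊗ m (MTU-pow n m)

  MTU-prod : ∀ {f} n → (∀ k → MonomialTimesUnit (f k)) → MonomialTimesUnit (PR.prod f n)
  MTU-prod zero m = MTU-1
  MTU-prod (suc n) m = MTU-⊗ (MTU-prod n m) (m n)

  MTU-resp : ∀ {f g} → f ≋ g → MonomialTimesUnit f → MonomialTimesUnit g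
  MTU-resp e (monomialTimes a f′ u e′) = monomialTimes a f′ u (≋-trans (≋-sym e) e′)

  MTU-γ : ∀ k → MonomialTimesUnit (PS.γ pone [] k)
  MTU-γ k = MTU-resp (solveᴾ 1 (λ z → z :^ 3 :* (z :* z) := z :^ 3 :* (one :* (z :* z) :- zeroᵉ)) ≋-refl (1-p k))
    (MTU-⊗ (MTU-pow 3 (MTU-1-p k)) (MTU-⊗ (MTU-1-p k) (MTU-1-p k)))

  embed-cancel : ∀ {s x y} → MonomialTimesUnit s → x KR.* embed s ≈ᶠ y KR.* embed s → x ≈ᶠ y
  embed-cancel {s} {x} {y} m e = KR.trans (expand x) (KR.trans (KR.*-congˡ e) (KR.sym (expand y)))
    where
    expand : ∀ x → x ≈ᶠ recip m KR.* (x KR.* embed s)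
    expand x = KR.begin
      x KR.≈⟨ KR.*-identityˡ x ⟨
      KR.1# KR.* x KR.≈⟨ KR.*-congʳ (recip-inverse m) ⟨
      recip m KR.* embed s KR.* x KR.≈⟨ KR.solve 3 (λ r s x → r :* s :* x := r :* (x :* s)) KR.refl (recip m) (embed s) x ⟩
      recip m KR.* (x KR.* embed s) KR.∎

  module QB = QBinomial polyRing pq
  module C where
    cancellable : ∀ k → Cancellable (pone ⊖ PR.pow pq (suc k))
    cancellable k = MTU-cancellable (1-q^ k)
    V V′ : ℕ → ℕ → Poly
    V = QB.V cancellable
    V′ = QB.V′ cancellable

  sumˡ sumʳ : ℕ → Poly
  sumˡ m = PR.sum (λ k → PS.c pone [] k ⊗ C.V m k) m
  sumʳ N = PR.sum (λ k → PS.c′ pone [] k ⊗ C.V′ N k) N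

  -- Both sums come from the same recurrence at l = 1, x = 0, so they have the same cleared form up
  -- to the initial value `C.V m 0`, a power of (-q;q)ₘ.
  left-sum : ∀ m → embed (C.V m 0) KR.* (q KR.* (KR.1# KR.+ KR.- q) KR.* KR.sum termˡ m) ≈ᶠ embed (sumˡ m)
  left-sum m = embed-cancel (MTU-prod m MTU-γ) (KR.begin
    embed (C.V m 0) KR.* (q KR.* (KR.1# KR.+ KR.- q) KR.* KR.sum termˡ m) KR.* embed Pγ KR.≈⟨ KR.*-assoc _ _ _ ⟩
    embed (C.V m 0) KR.* (q KR.* (KR.1# KR.+ KR.- q) KR.* KR.sum termˡ m KR.* embed Pγ)
      KR.≈⟨ KR.*-congˡ (KR.trans (KR.*-congˡ (embedHom.φ-prod {PS.γ pone []} (embedHom.φ-γ {q = pq} {pone} {[]} KR.refl embedHom.φ-1 embed-0) m))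
        (KR.trans (Sums.left-cleared KR.1# qq⁻¹≈1 ι ι-inv j j-spec m) (KR.sym cleared))) ⟩
    embed (C.V m 0) KR.* embed cl KR.≈⟨ embedHom.φ-* (C.V m 0) cl ⟨
    embed (C.V m 0 ⊗ cl) KR.≈⟨ embed-cong (PS.clearedSum-recurrent pone [] (PS.c pone []) (PS.α pone []) (PS.γ pone []) (C.V m) m (QB.V-recurrent C.cancellable m)) ⟩
    embed (sumˡ m ⊗ Pγ) KR.≈⟨ embedHom.φ-* (sumˡ m) Pγ ⟩
    embed (sumˡ m) KR.* embed Pγ KR.∎)
    where
    Pγ cl : Poly
    Pγ = PR.prod (PS.γ pone []) m
    cl = PS.clearedSum pone [] (PS.c pone []) (PS.α pone []) (PS.γ pone []) m
    cleared : embed cl ≈ᶠ KS.clearedSum KR.1# KR.0# (KS.c KR.1# KR.0#) (KS.α KR.1# KR.0#) (KS.γ KR.1# KR.0#) m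
    cleared = embedHom.φ-clearedSum {q = pq} {pone} {[]} KR.refl embedHom.φ-1 embed-0 {PS.c pone []} {PS.α pone []} {PS.γ pone []}
      (embedHom.φ-c {q = pq} {pone} {[]} KR.refl embedHom.φ-1 embed-0) (embedHom.φ-α {q = pq} {pone} {[]} KR.refl embedHom.φ-1 embed-0) (embedHom.φ-γ {q = pq} {pone} {[]} KR.refl embedHom.φ-1 embed-0) m

  right-sum : ∀ N → embed (C.V′ N 0) KR.* KR.sum termʳ N ≈ᶠ embed (sumʳ N)
  right-sum N = embed-cancel (MTU-prod N (λ k → MTU-⊗ (MTU-pow 3 (MTU-1-p k)) MTU-1)) (KR.begin
    embed (C.V′ N 0) KR.* KR.sum termʳ N KR.* embed Pγ KR.≈⟨ KR.*-assoc _ _ _ ⟩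
    embed (C.V′ N 0) KR.* (KR.sum termʳ N KR.* embed Pγ)
      KR.≈⟨ KR.*-congˡ (KR.trans (KR.*-congˡ (embedHom.φ-prod {PS.γ′ pone []} (embedHom.φ-γ′ {q = pq} {pone} {[]} KR.refl embedHom.φ-1 embed-0) N))
        (KR.trans (Sums.right-cleared KR.1# qq⁻¹≈1 ι ι-inv j j-spec N) (KR.sym cleared))) ⟩
    embed (C.V′ N 0) KR.* embed cl KR.≈⟨ embedHom.φ-* (C.V′ N 0) cl ⟨
    embed (C.V′ N 0 ⊗ cl) KR.≈⟨ embed-cong (PS.clearedSum-recurrent pone [] (PS.c′ pone []) (PS.α′ pone []) (PS.γ′ pone []) (C.V′ N) N (QB.V′-recurrent C.cancellable N)) ⟩
    embed (sumʳ N ⊗ Pγ) KR.≈⟨ embedHom.φ-* (sumʳ N) Pγ ⟩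
    embed (sumʳ N) KR.* embed Pγ KR.∎)
    where
    Pγ cl : Poly
    Pγ = PR.prod (PS.γ′ pone []) N
    cl = PS.clearedSum pone [] (PS.c′ pone []) (PS.α′ pone []) (PS.γ′ pone []) N
    cleared : embed cl ≈ᶠ KS.clearedSum KR.1# KR.0# (KS.c′ KR.1# KR.0#) (KS.α′ KR.1# KR.0#) (KS.γ′ KR.1# KR.0#) N
    cleared = embedHom.φ-clearedSum {q = pq} {pone} {[]} KR.refl embedHom.φ-1 embed-0 {PS.c′ pone []} {PS.α′ pone []} {PS.γ′ pone []}
      (embedHom.φ-pow pq) (embedHom.φ-α′ {q = pq} {pone} {[]} KR.refl embedHom.φ-1 embed-0) (embedHom.φ-γ′ {q = pq} {pone} {[]} KR.refl embedHom.φ-1 embed-0) N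

-- Modulo Φ_d, d consecutive terms cancel, and so do the first (d+3)/2 of them.
divisor-relation : ∀ n e N d′ M t k → (d+1≡2M : suc (suc d′) ≡ M ℕ.+ M) (1<d : 1 ℕ.< suc d′) → suc d′ ℕD.∣ n → M ℕ.+ k ℕ.< suc d′ →
  Relation (Φ (suc d′)) (discrepancy n e (t ℕ.* suc d′ ℕ.+ (M ℕ.+ k)) N)
divisor-relation n e N d′ M t k d+1≡2M 1<d d∣n M+k<d = relation s u coprime-s g∣u (KR.begin
  embed s KR.* discrepancy n e m N
    KR.≈⟨ KR.*-congʳ (embedHom.φ-mul {v ⊗ v′} {q[1-q]} (embedHom.φ-* v v′) embed-q[1-q]) ⟩
  embed v KR.* embed v′ KR.* (q KR.* (KR.1# KR.+ KR.- q)) KR.* (L KR.+ KR.- (embed (prefactor n e) KR.* R))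
    KR.≈⟨ KR.solve 6 (λ v w x l r y → v :* w :* x :* (l :- r :* y) := w :* (v :* (x :* l)) :- v :* (x :* r) :* (w :* y)) KR.refl (embed v) (embed v′) (q KR.* (KR.1# KR.+ KR.- q)) L (embed (prefactor n e)) R ⟩
  embed v′ KR.* (embed v KR.* (q KR.* (KR.1# KR.+ KR.- q) KR.* L)) KR.+ KR.- (embed v KR.* (q KR.* (KR.1# KR.+ KR.- q) KR.* embed (prefactor n e)) KR.* (embed v′ KR.* R))
    KR.≈⟨ KR.+-cong (KR.*-congˡ (left-sum m)) (KR.-‿cong (KR.*-cong (KR.*-congˡ (KR.sym (κ≈ n e))) (right-sum N))) ⟩
  embed v′ KR.* embed (sumˡ m) KR.+ KR.- (embed v KR.* embed (κ n e) KR.* embed (sumʳ N))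
    KR.≈⟨ embedHom.φ-sub {v′ ⊗ sumˡ m} {(v ⊗ κ n e) ⊗ sumʳ N} (embedHom.φ-* v′ (sumˡ m)) (embedHom.φ-mul {v ⊗ κ n e} {sumʳ N} (embedHom.φ-* v (κ n e)) KR.refl) ⟨
  embed u KR.∎)
  where
  module O = OddCyclotomic d′ M d+1≡2M 1<d
  open O using (d; g)
  m : ℕ
  m = t ℕ.* d ℕ.+ (M ℕ.+ k)
  L R : Fraction
  L = KR.sum termˡ m
  R = KR.sum termʳ N
  v v′ s u : Poly
  v = C.V m 0
  v′ = C.V′ N 0
  s = (v ⊗ v′) ⊗ q[1-q]
  u = (v′ ⊗ sumˡ m) ⊖ (v ⊗ κ n e) ⊗ sumʳ N

  coprime-tail : ∀ m → Coprime g (QB.tail C.cancellable 0 m)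
  coprime-tail m = coprime-prod _ m (λ k _ → coprime-* (O.coprime-1+q^ k) (O.coprime-1+q^ k))

  coprime-s : Coprime g s
  coprime-s = coprime-* (coprime-* {g} {v} {v′} (coprime-pow 5 (coprime-tail m)) (coprime-* (coprime-pow 2 (coprime-tail N))
    (coprime-resp (solveᴾ 2 (λ q t → t := (one :+ q :* zeroᵉ) :* one :* t) ≋-refl pq (QB.tail C.cancellable 0 N)) (coprime-tail N)))) O.coprime-q[1-q]

  module Q = QuotientRing polyRing g

  g∣sumˡ : g ∣ sumˡ m
  -- The recurrence for `C.V` is the reduction of one in ℤ[q]; it thus continues across block ends,
  -- where γ vanishes modulo Φ_d.
  g∣sumˡ = Q.≡ₘ0⇒∣ (SeriesVanishing.blocks Q.quotientRing pq pone [] d M d+1≡2M (ℕP.≤-<-trans (ℕP.m≤m+n M k) M+k<d)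
    (Q.congruent (O.g∣X ℕD.∣-refl)) (Modulo.two-cancellable polyRing pq g O.g-primitive)
    (λ k k<d → Modulo.coprime⇒cancellable polyRing pq g O.g-primitive (O.coprime-γ pone k coprime-1 k<d))
    t k (C.V m) M+k<d (λ i i<m → Q.lift (QB.V-recurrent C.cancellable m i i<m)))

  g∣u : g ∣ u
  -- The right sum is multiplied by κ, which contains 1 - qⁿ.
  g∣u = ∣-+ (∣-*ˡ v′ g∣sumˡ) (∣-neg (∣-*ʳ (sumʳ N) (∣-*ˡ v (∣-*ʳ (pq ⊗ PR.pow (pneg pq) e) (O.g∣1-q^ d∣n)))))

divides-by-relation : ∀ {A B a b g N D} → Represents A a → Represents B b → UnitHead g → Relation g (a KR.+ KR.- b) →
  N ⊗ (den A ⊗ den B) ≋ (num A ⊗ den B ⊖ num B ⊗ den A) ⊗ D → g ∣ N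
divides-by-relation rA rB ug (relation s u cop g∣u e) = divides-numerator rA rB e ug cop g∣u

-- Assembling the modulus from coprime factors, for both upper limits

open import Data.Nat using (_<_; _+_; _∸_; _/_; _%_)

parity : ∀ n → Σ ℕ λ k → (n ≡ k ℕ.+ k) ⊎ (n ≡ suc (k ℕ.+ k))
parity zero = 0 , inj₁ ≡.refl
parity (suc n) with parity n
... | k , inj₁ e = k , inj₂ (≡.cong suc e)
... | k , inj₂ e = suc k , inj₁ (≡.cong suc (≡.trans e (≡.sym (ℕP.+-suc k k))))

even≢odd : ∀ k l → k ℕ.+ k ≢ suc (l ℕ.+ l)
even≢odd (suc k) zero e with ≡.trans (≡.sym (ℕP.+-suc k k)) (ℕP.suc-injective e)
... | ()
even≢odd (suc k) (suc l) e = even≢odd k l (ℕP.suc-injective (≡.trans (≡.sym (ℕP.+-suc k k)) (≡.trans (ℕP.suc-injective e) (≡.cong suc (ℕP.+-suc l l)))))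

odd-factor : ∀ {M} t d → suc (M ℕ.+ M) ≡ t ℕ.* d → Σ ℕ λ k → d ≡ suc (k ℕ.+ k)
odd-factor {M} t d e with parity d
... | k , inj₂ eq = k , eq
... | k , inj₁ ≡.refl = ⊥-elim (even≢odd (t ℕ.* k) M (≡.trans (≡.sym (ℕP.*-distribˡ-+ t k k)) (≡.sym e)))

only-yes : ∀ {A : Set} (A? : Dec A) f → A → only A? f ≡ f
only-yes (yes _) f a = ≡.refl
only-yes (no ¬a) f a = contradiction a ¬a

only-∣ : ∀ {A : Set} (A? : Dec A) {f g} → (A → f ∣ g) → only A? f ∣ g
only-∣ (yes a) d = d a
only-∣ (no _) {g = g} d = 1∣ g

only-unitHead : ∀ {A : Set} (A? : Dec A) {f} → UnitHead f → UnitHead (only A? f)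
only-unitHead (yes _) u = u
only-unitHead (no _) u = unitHead ≡.refl

only-coprime : ∀ {A : Set} (A? : Dec A) {f g} → Coprime g f → Coprime g (only A? f)
only-coprime (yes _) c = c
only-coprime (no _) c = coprime-1

Xq-1 : Xq 1 ≋ pq ⊖ pone
Xq-1 = ⊕-cong (≋-trans (⊗-comm pq pone) (⊗-identityˡ pq)) (≋-refl {pneg pone})

nontrivialFactors : ℕ → Poly
nontrivialFactors n = PR.prod (λ i → factor (suc (suc n)) (suc i)) n

-- The factor Φ₁ = q - 1 is cancelled from the factorization of the binomial.
qnat-factorization : ∀ n → qnat (suc (suc n)) ≋ nontrivialFactors n ⊗ Φ (suc (suc n))
qnat-factorization n′ = cancel {Xq 1} (UnitHead⇒cancellable (X-unitHead 0)) (begin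
  Xq 1 ⊗ qnat n ≈⟨ ⊗-cong (≋-trans Xq-1 (solveᴾ 1 (λ q → q :- one := :- (one :- q)) ≋-refl pq)) (≋-refl {qnat n}) ⟩
  pneg (pone ⊖ pq) ⊗ qnat n ≈⟨ solveᴾ 2 (λ x y → :- x :* y := :- (x :* y)) ≋-refl (pone ⊖ pq) (qnat n) ⟩
  pneg ((pone ⊖ pq) ⊗ qnat n) ≈⟨ pneg-cong (geometric n) ⟩
  pneg (pone ⊖ PR.pow pq n) ≈⟨ solveᴾ 1 (λ y → :- (one :- y) := y :- one) ≋-refl (PR.pow pq n) ⟩
  Xq n ≈⟨ CyclotomicFacts.factorization (cyclotomicFacts (suc n′)) ⟨
  PR.prod (factor n) (suc n′) ⊗ Φ n ≈⟨ ⊗-cong (≋-trans (PR.prod-head (factor n) n′) (⊗-cong factor-0 (≋-refl {nontrivialFactors n′}))) (≋-refl {Φ n}) ⟩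
  (Xq 1 ⊗ nontrivialFactors n′) ⊗ Φ n ≈⟨ ⊗-assoc (Xq 1) (nontrivialFactors n′) (Φ n) ⟩
  Xq 1 ⊗ (nontrivialFactors n′ ⊗ Φ n) ∎)
  where
  open ≋-Reasoning
  n = suc (suc n′)
  factor-0 : factor n 0 ≋ Xq 1
  factor-0 = ≋-trans (PR.reflexive (only-yes (1 ∣? n) (Φ 1) (ℕD.1∣ n)))
    (≋-trans (≋-sym (⊗-identityˡ (Φ 1))) (CyclotomicFacts.factorization (cyclotomicFacts 0)))

factor-unitHead : ∀ n i → UnitHead (factor n i)
factor-unitHead n i = only-unitHead (suc i ∣? n) (Φ-unitHead i)

coprime-factors : ∀ n i k → i ℕ.< k → Coprime (factor n i) (factor n k)
coprime-factors n i k i<k = only-coprime (suc k ∣? n) (coprime-sym (coprime-Φ-factor n i k i<k))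

-- [m]Φₘ² is Φₘ³ times the Φ_d with d | m and 1 < d < m, and these are pairwise coprime.
modulus-divides : ∀ n N → let m = suc (suc n) in
  Φ m ⊗ (Φ m ⊗ Φ m) ∣ N → (∀ i → suc i ℕ.< suc n → factor m (suc i) ∣ N) → modulus m ∣ N
modulus-divides n N cube∣ factor∣ = ∣-respˡ (begin
  nontrivialFactors n ⊗ (Φ m ⊗ (Φ m ⊗ Φ m)) ≈⟨ solveᴾ 2 (λ f g → f :* (g :* (g :* g)) := f :* g :* g :* g) ≋-refl (nontrivialFactors n) (Φ m) ⟩
  ((nontrivialFactors n ⊗ Φ m) ⊗ Φ m) ⊗ Φ m ≈⟨ ⊗-cong (⊗-cong (qnat-factorization n) (≋-refl {Φ m})) (≋-refl {Φ m}) ⟨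
  modulus m ∎)
  (coprime-product-∣ (UnitHead⇒primitive (UnitHead-⊗ u (UnitHead-⊗ u u))) (coprime-* cop (coprime-* cop cop)) (prefix n ℕP.≤-refl) cube∣)
  where
  open ≋-Reasoning
  m = suc (suc n)
  u : UnitHead (Φ m)
  u = Φ-unitHead (suc n)
  cop : Coprime (nontrivialFactors n) (Φ m)
  cop = coprime-sym (coprime-prod (λ i → factor m (suc i)) n (λ i i<n → coprime-Φ-factor m (suc i) (suc n) (ℕ.s≤s i<n)))
  prefix : ∀ k → k ℕ.≤ n → PR.prod (λ i → factor m (suc i)) k ∣ N
  prefix zero _ = 1∣ N
  prefix (suc k) k<n = coprime-product-∣ (UnitHead⇒primitive (factor-unitHead m (suc k)))
    (coprime-sym (coprime-prod (λ i → factor m (suc i)) k (λ i i<k → coprime-sym (coprime-factors m (suc i) (suc k) (ℕ.s≤s i<k)))))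
    (prefix k (ℕP.<⇒≤ k<n)) (factor∣ k (ℕ.s≤s k<n))

cong-from-divisibility : ∀ {A B a b P} → Represents A a → Represents B b →
  (∀ N D → N ⊗ (den A ⊗ den B) ≋ (num A ⊗ den B ⊖ num B ⊗ den A) ⊗ D → P ∣ N) → Cong A B P
cong-from-divisibility {A} {B} {P = P} rA rB divides = finish (reducedForm (num A ⊗ den B ⊖ num B ⊗ den A) (den A ⊗ den B) (MTU-⊗ (rep-den rA) (rep-den rB)))
  where
  toP : ∀ {f g} → f ∣ g → f ∣P g
  toP (h , e) = h , coeffs e
  fromP : ∀ {f g} → f ∣P g → f ∣ g
  fromP (h , e) = h , coeffwise e
  finish : Reduced (num A ⊗ den B ⊖ num B ⊗ den A) (den A ⊗ den B) → Cong A B P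
  finish (N , D , D≢0 , N⊥D , eq) =
    N , D , (λ z → D≢0 (coeffwise z)) , (λ f x y → toP (N⊥D f (fromP x) (fromP y))) , coeffs eq , toP (divides N D eq)

module _ (M : ℕ) where
  private
    N n e : ℕ
    N = suc (suc M)
    n = suc (suc M ℕ.+ suc M)
    e = ((n ℕ.+ 1) ℕ.* (n ℕ.∸ 3)) ℕ./ 4

    half : (n ℕ.+ 1) ℕ./ 2 ≡ N
    half = ≡.trans (≡.cong (ℕ._/ 2) (eq M)) (DivMod.m*n/n≡m N 2)
      where
      eq : ∀ M → suc (suc M ℕ.+ suc M) ℕ.+ 1 ≡ suc (suc M) ℕ.* 2
      eq = solve-∀

    e≡ : e ≡ N ℕ.* M
    e≡ = ≡.trans (≡.cong (ℕ._/ 4) (≡.trans (≡.cong (λ k → (n ℕ.+ 1) ℕ.* (k ℕ.∸ 2)) (≡.cong suc (ℕP.+-suc M M))) (eq M))) (DivMod.m*n/n≡m (N ℕ.* M) 4)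
      where
      eq : ∀ M → (suc (suc M ℕ.+ suc M) ℕ.+ 1) ℕ.* (M ℕ.+ M) ≡ suc (suc M) ℕ.* M ℕ.* 4
      eq = solve-∀

    -- With n = 2M + 3, (n+1)(n-3)/4 = (M+2)M. Adding 1 gives the square demanded by the exact
    -- identity.
    e+1≡ : suc e ≡ suc M ℕ.* suc M
    e+1≡ = ≡.trans (≡.cong suc e≡) (eq M)
      where
      eq : ∀ M → suc (suc (suc M) ℕ.* M) ≡ suc M ℕ.* suc M
      eq = solve-∀

    rep-RHS : Represents (RHS n) (embed (prefactor n e) KR.* KR.sum termʳ N)
    rep-RHS = rep-fmul (rep-poly (prefactor n e)) (≡.subst (λ k → Represents (fsum k rhsTerm) (KR.sum termʳ N)) (≡.sym half) (rep-rhsSum N))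

    data Length (m : ℕ) : Set where
      full : m ≡ suc M ℕ.+ suc M → Length m
      short : m ≡ N → Length m

    cube : ∀ m → Length m → Relation (Φ n ⊗ (Φ n ⊗ Φ n)) (discrepancy n e m N)
    cube m (full eq) = ≡.subst (λ m → Relation (Φ n ⊗ (Φ n ⊗ Φ n)) (discrepancy n e m N)) (≡.trans N+M≡ (≡.sym eq)) (cube-relation M e M e+1≡ (ℕP.≤-reflexive (≡.cong suc N+M≡)))
      where
      N+M≡ : N ℕ.+ M ≡ suc M ℕ.+ suc M
      N+M≡ = ≡.cong suc (≡.sym (ℕP.+-suc M M))
    cube m (short eq) = ≡.subst (λ m → Relation (Φ n ⊗ (Φ n ⊗ Φ n)) (discrepancy n e m N)) (≡.trans (ℕP.+-identityʳ N) (≡.sym eq)) (cube-relation M e 0 e+1≡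
      (≡.subst (ℕ._< n) (≡.sym (ℕP.+-identityʳ N)) (ℕ.s≤s (ℕ.s≤s (ℕP.m≤n+m (suc M) M)))))

    -- n = t d with t and d odd; the summation range consists of whole blocks of length d
    -- and, for the short sum, of (d+3)/2 further terms.
    divisor-blocks : ∀ m → Length m → ∀ i t k s → suc (suc i) ℕD.∣ n → n ≡ t ℕ.* suc (suc i) → suc (suc i) ≡ suc (suc k ℕ.+ suc k) → t ≡ suc (s ℕ.+ s) →
      Relation (Φ (suc (suc i))) (discrepancy n e m N)
    divisor-blocks m len i t k s d∣n n≡td d≡ t≡ = by-length len
      where
      d K : ℕ
      d = suc (suc i)
      K = suc (suc k)
      d+1≡ : suc d ≡ K ℕ.+ K
      d+1≡ = ≡.trans (≡.cong suc d≡) (≡.cong suc (≡.sym (ℕP.+-suc (suc k) (suc k))))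
      K+k≡ : suc (K ℕ.+ k) ≡ d
      K+k≡ = ≡.trans (≡.cong suc (≡.cong suc (≡.sym (ℕP.+-suc k k)))) (≡.sym d≡)
      by-length : Length m → Relation (Φ d) (discrepancy n e m N)
      by-length (full eq) = ≡.subst (λ m → Relation (Φ d) (discrepancy n e m N)) (≡.sym m≡)
        (divisor-relation n e N (suc i) K (s ℕ.+ s) k d+1≡ (ℕ.s≤s (ℕ.s≤s ℕ.z≤n)) d∣n (ℕP.≤-reflexive K+k≡))
        where
        m≡ : m ≡ (s ℕ.+ s) ℕ.* d ℕ.+ (K ℕ.+ k)
        m≡ = ℕP.suc-injective (≡.trans (≡.cong suc eq) (≡.trans n≡td (≡.trans (≡.cong (ℕ._* d) t≡) (≡.trans (ℕP.+-comm d ((s ℕ.+ s) ℕ.* d))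
          (≡.trans (≡.cong ((s ℕ.+ s) ℕ.* d ℕ.+_) (≡.sym K+k≡)) (ℕP.+-suc ((s ℕ.+ s) ℕ.* d) (K ℕ.+ k)))))))
      by-length (short eq) = ≡.subst (λ m → Relation (Φ d) (discrepancy n e m N)) (≡.sym m≡)
        (divisor-relation n e N (suc i) K s 0 d+1≡ (ℕ.s≤s (ℕ.s≤s ℕ.z≤n)) d∣n (≡.subst (ℕ._< d) (≡.sym (ℕP.+-identityʳ K)) (ℕP.≤-trans (ℕ.s≤s (ℕP.m≤m+n K k)) (ℕP.≤-reflexive K+k≡))))
        where
        double : N ℕ.* 2 ≡ (s ℕ.* d ℕ.+ K) ℕ.* 2
        double = begin
          N ℕ.* 2 ≡⟨ eq₁ M ⟩
          suc n ≡⟨ ≡.cong suc (≡.trans n≡td (≡.cong (ℕ._* d) t≡)) ⟩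
          suc (suc (s ℕ.+ s) ℕ.* d) ≡⟨ eq₂ s d ⟩
          s ℕ.* d ℕ.* 2 ℕ.+ suc d ≡⟨ ≡.cong (s ℕ.* d ℕ.* 2 ℕ.+_) d+1≡ ⟩
          s ℕ.* d ℕ.* 2 ℕ.+ (K ℕ.+ K) ≡⟨ eq₃ (s ℕ.* d) K ⟩
          (s ℕ.* d ℕ.+ K) ℕ.* 2 ∎
          where
          open ≡.≡-Reasoning
          eq₁ : ∀ M → suc (suc M) ℕ.* 2 ≡ suc (suc (suc M ℕ.+ suc M))
          eq₁ = solve-∀
          eq₂ : ∀ s d → suc (suc (s ℕ.+ s) ℕ.* d) ≡ s ℕ.* d ℕ.* 2 ℕ.+ suc d
          eq₂ = solve-∀
          eq₃ : ∀ x K → x ℕ.* 2 ℕ.+ (K ℕ.+ K) ≡ (x ℕ.+ K) ℕ.* 2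
          eq₃ = solve-∀
        m≡ : m ≡ s ℕ.* d ℕ.+ (K ℕ.+ 0)
        m≡ = ≡.trans eq (≡.trans (ℕP.*-cancelʳ-≡ N (s ℕ.* d ℕ.+ K) 2 double) (≡.cong (s ℕ.* d ℕ.+_) (≡.sym (ℕP.+-identityʳ K))))

    divisor : ∀ m → Length m → ∀ i → suc (suc i) ℕD.∣ n → Relation (Φ (suc (suc i))) (discrepancy n e m N)
    divisor m len i d∣n@(ℕD.divides t n≡td) = go (odd-factor {suc M} t (suc (suc i)) n≡td) (odd-factor {suc M} (suc (suc i)) t (≡.trans n≡td (ℕP.*-comm t (suc (suc i)))))
      where
      go : Σ ℕ (λ k → suc (suc i) ≡ suc (k ℕ.+ k)) → Σ ℕ (λ s → t ≡ suc (s ℕ.+ s)) → Relation (Φ (suc (suc i))) (discrepancy n e m N)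
      -- Half of an odd divisor greater than 1 is positive, so the case 0 is absent.
      go (suc k , d≡) (s , t≡) = divisor-blocks m len i t k s d∣n n≡td d≡ t≡

    congruence : ∀ m → Length m → Cong (LHS m) (RHS n) (modulus n)
    congruence m len = cong-from-divisibility (rep-LHS m) rep-RHS (λ A B eq → modulus-divides _ A
      (divides-by-relation (rep-LHS m) rep-RHS (UnitHead-⊗ u (UnitHead-⊗ u u)) (cube m len) eq)
      (λ i _ → factor∣ A B eq i))
      where
      u : UnitHead (Φ n)
      u = Φ-unitHead (suc M ℕ.+ suc M)
      factor∣ : ∀ A B → A ⊗ (den (LHS m) ⊗ den (RHS n)) ≋ (num (LHS m) ⊗ den (RHS n) ⊖ num (RHS n) ⊗ den (LHS m)) ⊗ B → ∀ i → factor n (suc i) ∣ A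
      factor∣ A B eq i = only-∣ (suc (suc i) ∣? n) (λ d∣n → divides-by-relation (rep-LHS m) rep-RHS (Φ-unitHead (suc i)) (divisor m len i d∣n) eq)

  odd-case : ∀ m → (m ≡ n ℕ.∸ 1 ⊎ m ≡ (n ℕ.+ 1) ℕ./ 2) → Cong (LHS m) (RHS n) (modulus n)
  odd-case m (inj₁ eq) = congruence m (full eq)
  odd-case m (inj₂ eq) = congruence m (short (≡.trans eq half))

theorem5p1 : (n : ℕ) → 1 < n → n % 2 ≡ 1 →
    (m : ℕ) → (m ≡ n ∸ 1 ⊎ m ≡ (n + 1) / 2) →
    Cong (LHS m) (RHS n) (modulus n)
theorem5p1 n 1<n odd = by-half (odd-half n 1<n odd)
  where
  odd-half : ∀ n → 1 < n → n % 2 ≡ 1 → Σ ℕ λ M → n ≡ suc (suc M + suc M)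
  odd-half n 1<n odd with n / 2 | ≡.trans (DivMod.m≡m%n+[m/n]*n n 2) (≡.cong (_+ n / 2 ℕ.* 2) odd)
  ... | zero | ≡.refl = contradiction 1<n (ℕP.<-irrefl ≡.refl)
  ... | suc M | e = M , ≡.trans e (double M)
    where
    double : ∀ M → 1 + suc M ℕ.* 2 ≡ suc (suc M + suc M)
    double = solve-∀
  by-half : ∀ {n} → (Σ ℕ λ M → n ≡ suc (suc M + suc M)) →
    ∀ m → (m ≡ n ∸ 1 ⊎ m ≡ (n + 1) / 2) → Cong (LHS m) (RHS n) (modulus n)
  by-half (M , ≡.refl) = odd-case M
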